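{- Let $P\in\mathbb{P}\cup\{\infty\}$. Then the set $\{\alpha\in\mathbb{K}: v_P(\alpha)\ge 0\}$ is Diophantine over $\mathbb{K}$ (definable by an existential formula in the language of rings with parameters from $\mathbb{K}$), and it is defined using $9$ existential quantifiers.
   Context: Let $S$ be an infinite set, $\mathcal{D}$ a nonprincipal ultrafilter on $S$, $q_s$ prime powers unbounded along $\mathcal{D}$, $\mathrm{GF}(\kappa)=\prod_s\mathbb{F}_{q_s}/\mathcal{D}$, $\mathbb{A}=\mathrm{GF}(\kappa)[t]$, $\mathbb{K}=\mathrm{GF}(\kappa)(t)$. $\mathbb{P}$ is the set of monic irreducible polynomials of positive degree in $\mathbb{A}$, $\infty=1/t$ the infinite prime with valuation $v_\infty=-\deg$, and $v_P$ the $P$-adic valuation of $\mathbb{K}$. -}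

module Defs where

open import Level using (0ℓ)
open import Data.Nat as ℕ using (ℕ; zero; suc; _<_; _≤_)
open import Data.Nat.Primality using (Prime)
open import Data.Integer as ℤ using (ℤ; +_)
open import Data.Fin using (Fin)
open import Data.List using (List; []; _∷_)
open import Data.Vec using (Vec; lookup)
import Data.Vec
import Data.Unit
import Relation.Binary.PropositionalEquality
open import Data.Product using (Σ; ∃; ∃-syntax; _×_; _,_)
open import Data.Sum using (_⊎_)
open import Data.Empty using (⊥)
open import Relation.Nullary using (¬_)
open import Relation.Binary.PropositionalEquality using (_≡_; _≢_)
open import Algebra.Structures using (IsCommutativeRing)
open import Function using (_⇔_)

record Ultrafilter (S : Set) : Set₁ where
  field
    U        : (S → Set) → Set
    full     : U (λ _ → Data.Unit.⊤)
    empty    : ¬ U (λ _ → ⊥)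
    upward   : ∀ {A B : S → Set} → (∀ s → A s → B s) → U A → U B
    inter    : ∀ {A B : S → Set} → U A → U B → U (λ s → A s × B s)
    ultra    : ∀ (A : S → Set) → U A ⊎ U (λ s → ¬ A s)

NonPrincipal : {S : Set} → Ultrafilter S → Set
NonPrincipal {S} D = ∀ (s : S) → ¬ Ultrafilter.U D (λ x → x ≡ s)

Infinite : Set → Set
Infinite S = ∀ (n : ℕ) → ¬ (Σ (S → Fin n) λ f → ∀ x y → f x ≡ f y → x ≡ y)

IsPrimePower : ℕ → Set
IsPrimePower q = ∃[ p ] ∃[ k ] (Prime p × 1 ≤ k × q ≡ p ℕ.^ k)

-- A finite field with q elements: a field structure on Fin q
-- (unique up to isomorphism, so this is F_q)

record FiniteField (q : ℕ) : Set where
  field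
    _+_ _*_  : Fin q → Fin q → Fin q
    -_       : Fin q → Fin q
    0# 1#    : Fin q
    isCommutativeRing : IsCommutativeRing _≡_ _+_ _*_ -_ 0# 1#
    1≢0      : 1# ≢ 0#
    inverse  : ∀ x → x ≢ 0# → ∃[ y ] (x * y ≡ 1#)

module Setting {S : Set} (D : Ultrafilter S) (q : S → ℕ)
               (F : ∀ s → FiniteField (q s)) where

  open Ultrafilter D using (U)
  module F s = FiniteField (F s)

  -- GF(κ) = ∏ F_{q_s} / D   (as a setoid)
  GF : Set
  GF = (s : S) → Fin (q s)

  infix 4 _≈_
  _≈_ : GF → GF → Set
  x ≈ y = U (λ s → x s ≡ y s)

  infixl 6 _+ᴳ_
  infixl 7 _*ᴳ_
  _+ᴳ_ _*ᴳ_ : GF → GF → GF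
  (x +ᴳ y) s = F._+_ s (x s) (y s)
  (x *ᴳ y) s = F._*_ s (x s) (y s)
  -ᴳ_ : GF → GF
  (-ᴳ x) s = F.-_ s (x s)
  0ᴳ 1ᴳ : GF
  0ᴳ s = F.0# s
  1ᴳ s = F.1# s

  -- A = GF(κ)[t]: coefficient lists (constant term first), compared
  -- coefficientwise (trailing zeros allowed)
  Poly : Set
  Poly = List GF

  coeff : Poly → ℕ → GF
  coeff []       _       = 0ᴳ
  coeff (a ∷ _)  zero    = a
  coeff (_ ∷ p)  (suc n) = coeff p n

  infix 4 _≈ₚ_
  _≈ₚ_ : Poly → Poly → Set
  p ≈ₚ r = ∀ n → coeff p n ≈ coeff r n

  infixl 6 _+ₚ_
  _+ₚ_ : Poly → Poly → Poly
  []      +ₚ r       = r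
  (a ∷ p) +ₚ []      = a ∷ p
  (a ∷ p) +ₚ (b ∷ r) = (a +ᴳ b) ∷ (p +ₚ r)

  -ₚ_ : Poly → Poly
  -ₚ []      = []
  -ₚ (a ∷ p) = (-ᴳ a) ∷ (-ₚ p)

  scale : GF → Poly → Poly
  scale c []      = []
  scale c (a ∷ p) = (c *ᴳ a) ∷ scale c p

  infixl 7 _*ₚ_
  _*ₚ_ : Poly → Poly → Poly
  []      *ₚ r = []
  (a ∷ p) *ₚ r = scale a r +ₚ (0ᴳ ∷ (p *ₚ r))

  0ₚ 1ₚ : Poly
  0ₚ = []
  1ₚ = 1ᴳ ∷ []

  _^ₚ_ : Poly → ℕ → Poly
  p ^ₚ zero  = 1ₚ
  p ^ₚ suc n = p *ₚ (p ^ₚ n)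

  HasDegree : Poly → ℕ → Set
  HasDegree p n = ¬ (coeff p n ≈ 0ᴳ) × (∀ m → n < m → coeff p m ≈ 0ᴳ)

  Monic : Poly → Set
  Monic p = ∃[ n ] (HasDegree p n × coeff p n ≈ 1ᴳ)

  IsUnit : Poly → Set
  IsUnit p = ∃[ r ] (p *ₚ r ≈ₚ 1ₚ)

  _∣ₚ_ : Poly → Poly → Set
  p ∣ₚ r = ∃[ c ] (p *ₚ c ≈ₚ r)

  Irreducible : Poly → Set
  Irreducible p = ¬ (p ≈ₚ 0ₚ) × ¬ IsUnit p
                × (∀ a b → p ≈ₚ a *ₚ b → IsUnit a ⊎ IsUnit b)

  IsInℙ : Poly → Set
  IsInℙ P = Monic P × Irreducible P × ¬ HasDegree P zero

  record 𝕂 : Set where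
    constructor _/_∶_
    field
      num den : Poly
      den≢0   : ¬ (den ≈ₚ 0ₚ)

  -- raw fractions (denominators arising as products of nonzero
  -- denominators; nonzero since A is a domain)
  RawFrac : Set
  RawFrac = Poly × Poly

  toRaw : 𝕂 → RawFrac
  toRaw (a / b ∶ _) = a , b

  infix 4 _≃_
  _≃_ : RawFrac → RawFrac → Set
  (a , b) ≃ (c , d) = a *ₚ d ≈ₚ c *ₚ b

  _≈𝕂_ : 𝕂 → 𝕂 → Set
  x ≈𝕂 y = toRaw x ≃ toRaw y

  _+ᶠ_ _*ᶠ_ : RawFrac → RawFrac → RawFrac
  (a , b) +ᶠ (c , d) = (a *ₚ d +ₚ c *ₚ b) , (b *ₚ d)
  (a , b) *ᶠ (c , d) = (a *ₚ c) , (b *ₚ d)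
  -ᶠ_ : RawFrac → RawFrac
  -ᶠ (a , b) = (-ₚ a) , b

  ValP : Poly → 𝕂 → ℤ → Set
  ValP P α n = ∃[ a' ] ∃[ b' ] ∃[ i ] ∃[ j ]
      ( ¬ (P ∣ₚ a') × ¬ (P ∣ₚ b')
      × (toRaw α ≃ ((P ^ₚ i) *ₚ a' , (P ^ₚ j) *ₚ b'))
      × n ≡ (+ i) ℤ.- (+ j) )

  Val∞ : 𝕂 → ℤ → Set
  Val∞ α n = ∃[ a ] ∃[ b ] ∃[ i ] ∃[ j ]
      ( HasDegree a i × HasDegree b j
      × (toRaw α ≃ (a , b))
      × n ≡ (+ j) ℤ.- (+ i) )

  data Place : Set where
    fin : (P : Poly) → IsInℙ P → Place
    ∞   : Place

  Val : Place → 𝕂 → ℤ → Set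
  Val (fin P _) = ValP P
  Val ∞         = Val∞

  -- v_P(α) ≥ 0   (v_P(0) = +∞)
  NonNegVal : Place → 𝕂 → Set
  NonNegVal P α = (α ≈𝕂 (0ₚ / 1ₚ ∶ λ h → nz (h zero))) ⊎ (∃[ n ] (Val P α n × + 0 ℤ.≤ n))
    where
      nz : ¬ (1ᴳ ≈ 0ᴳ)
      nz h = Ultrafilter.empty D (Ultrafilter.upward D (λ s e → F.1≢0 s e) h)

  data Term (n : ℕ) : Set where
    var   : Fin n → Term n
    par   : 𝕂 → Term n
    _⊕_   : Term n → Term n → Term n
    _⊗_   : Term n → Term n → Term n
    ⊖_    : Term n → Term n

  data QFFormula (n : ℕ) : Set where
    _≐_  : Term n → Term n → QFFormula n
    _∧ᶠ_ : QFFormula n → QFFormula n → QFFormula n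
    _∨ᶠ_ : QFFormula n → QFFormula n → QFFormula n

  evalT : ∀ {n} → Term n → Vec 𝕂 n → RawFrac
  evalT (var i) ρ = toRaw (lookup ρ i)
  evalT (par c) ρ = toRaw c
  evalT (t ⊕ u) ρ = evalT t ρ +ᶠ evalT u ρ
  evalT (t ⊗ u) ρ = evalT t ρ *ᶠ evalT u ρ
  evalT (⊖ t)   ρ = -ᶠ evalT t ρ

  Sat : ∀ {n} → QFFormula n → Vec 𝕂 n → Set
  Sat (t ≐ u)  ρ = evalT t ρ ≃ evalT u ρ
  Sat (φ ∧ᶠ ψ) ρ = Sat φ ρ × Sat ψ ρ
  Sat (φ ∨ᶠ ψ) ρ = Sat φ ρ ⊎ Sat ψ ρ

  DiophantineWith : ℕ → (𝕂 → Set) → Set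
  DiophantineWith k X = Σ (QFFormula (suc k)) λ φ →
    ∀ (α : 𝕂) → X α ⇔ (Σ (Vec 𝕂 k) λ ys → Sat φ (α Data.Vec.∷ ys))

-- Let P be a finite prime.  In odd characteristic choose a constant a with P(a) a non-square.
-- Then P is inert in the extension by the square root of -(t - a), and a descent at P shows
-- that z² + (t - a)(x² - P y²) = κ (1 + P (α + j)²) with κ ≡ 1 mod P forces v_P(α) ≥ 0.
-- Conversely, over F_q with q large, Stepanov's bound yields a second constant b at which P is a
-- square and every prime factor Q of the numerator c of the right-hand side has the same
-- quadratic character as at a.  Then -(t - b) is a square mod P and (t - a)(t - b) is a square
-- mod each Q, and Minkowski's argument for lattices over F_q[t] represents P and c by the
-- corresponding binary forms, hence c by the ternary form.  The degrees are bounded, so the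
-- solutions pass to the ultraproduct.  In characteristic two the form is
-- (t - a)(z² + z w) + β w², where a and β are themselves quantified; they are forced to be
-- constants because the curves y² + y = e x³ have no non-constant rational points, and for each
-- constant x one of e = 1, ε, 1 + ε makes the curve soluble in y.  The automorphism t ↦ 1/t
-- reduces the infinite prime to the prime t.

module Submission where

open import Defs
open import Data.Nat using (ℕ; _<_)
open import Level using (0ℓ)
open import Algebra using (CommutativeRing)
import Algebra.Solver.Ring
open import Algebra.Structures using (IsCommutativeRing)
open import Data.Bool as Bool using (Bool; true; false; not; _∧_)
open import Data.Bool.Properties using (T?; T-not-≡; T-≡)
open import Data.Empty using (⊥; ⊥-elim; ⊥-elim-irr)
open import Data.Fin as Fin using (Fin; zero; suc; remQuot; punchIn; punchOut)
import Data.Fin.Permutation as Perm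
import Data.Fin.Properties as Finₚ
import Data.Integer as ℤ
import Data.Integer.Properties as ℤₚ
open import Data.List as List using (List; []; _∷_; length; applyUpTo; filterᵇ; allFin)
open import Data.List.Membership.Propositional using (_∈_)
import Data.List.Properties as Listₚ
open import Data.List.Relation.Unary.All as All using (All; []; _∷_)
import Data.List.Relation.Unary.All.Properties as Allₚ
open import Data.List.Relation.Unary.AllPairs using (AllPairs; []; _∷_)
import Data.List.Relation.Unary.AllPairs.Properties as AllPairsₚ
open import Data.Nat as ℕ using (zero; suc; _≤_; z≤n; s≤s; ⌊_/2⌋; ⌈_/2⌉)
import Data.Nat.Properties as ℕₚ
open ℕₚ using (≤-trans; ≤-reflexive; m≤m+n; m≤n+m; n≤1+n; +-suc; +-monoʳ-≤; ≤-pred; ≤-refl; <⇒≤; <-≤-trans; <-irrefl; *-monoˡ-≤; ≰⇒>; ≤-<-trans; m+[n∸m]≡n; +-mono-≤; *-monoʳ-≤)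
open import Data.Nat.Solver using (module +-*-Solver)
open import Data.Product using (Σ; ∃; ∃₂; _×_; _,_; proj₁; proj₂)
open import Data.Sum using (_⊎_; inj₁; inj₂; [_,_]′)
open import Data.Vec as Vec using (Vec; []; _∷_; lookup; toList; take; drop)
open import Data.Vec.Functional using (removeAt; replicate)
import Data.Vec.Properties as Vecₚ
open import Function using (_∘_; _⇔_; mk⇔; Equivalence)
open import Relation.Nullary using (¬_; Dec; yes; no; does; ¬?)
open import Relation.Nullary.Decidable using (map′; _×-dec_)
import Relation.Binary.PropositionalEquality as ≡
open ≡ using (_≡_; _≢_; cong; cong₂; subst; subst₂)
private module N = +-*-Solver

-- The left-hand sides are norm forms of quaternion algebras. In odd characteristic (-(t - a), P)
-- ramifies exactly at P and at t - a, so the right-hand side is constrained at t = a as well: a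
-- nonzero square there is what makes the equation soluble. The shift j, one of 0, 1, -1, keeps it
-- nonzero at a, and κ, either 1 or a fixed κ₀ that is 1 mod P but takes the non-square value P(a)
-- at a, corrects its class without disturbing the descent at P. In characteristic two [β / (t - a),
-- P) ramifies at P exactly when β P'(a) / P(a) is not of the form r² + r; one fixed u outside the
-- image of r ↦ r² + r turns this negative condition into the existential r² + r + u = β P'(a) /
-- P(a). There β may depend on α, so every prime factor of the right-hand side can be made to split
-- and a binary form is enough. Finite fields are where prime factors are found by search and where
-- counting gives squares index two; only polynomials of bounded degree are carried back.

infix 4 _:=_
infixl 6 _:+_ _:-_
infixl 7 _:*_
infix 9 :-_

-- The expressions do not mention the ring, which keeps the terms produced by calls of solve small.
data Expr (n : ℕ) : Set where
  :var : Fin n → Expr n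
  :0 :1 : Expr n
  _:+_ _:*_ _:-_ : Expr n → Expr n → Expr n
  :-_ : Expr n → Expr n

record Identity (n : ℕ) : Set where
  constructor _:=_
  field lhs rhs : Expr n
open Identity

-- A ring solver with integer coefficients, and ring homomorphisms.

module SolverOver (R : CommutativeRing 0ℓ 0ℓ) where
  open CommutativeRing R
  open ℤ using (ℤ; +_; -[1+_]; _⊖_; _◃_; sign; ∣_∣)
  open import Data.Sign as Sign using (Sign)
  open import Data.Maybe using (Maybe; just; nothing; is-just)
  open import Data.Vec.N-ary using (N-ary; _$ⁿ_; Eq; curryⁿ; curryⁿ-cong)
  open import Algebra.Properties.Ring ring using (-0#≈0#; -‿involutive; -‿distribˡ-*; -‿distribʳ-*)
  open import Algebra.Properties.AbelianGroup +-abelianGroup using (⁻¹-∙-comm)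
  open import Algebra.Properties.Semiring.Mult.TCOptimised semiring using (×-homo-+; ×1-homo-*; 1+×) renaming (_×_ to _·_)
  open import Algebra.Properties.CommutativeSemigroup +-commutativeSemigroup using (interchange)
  open import Algebra.Solver.Ring.AlmostCommutativeRing using (_-Raw-AlmostCommutative⟶_; fromCommutativeRing)
  open import Relation.Binary.Reasoning.Setoid setoid

  private
    ⟦_⟧ℤ : ℤ → Carrier
    ⟦ + n ⟧ℤ = n · 1#
    ⟦ -[1+ n ] ⟧ℤ = - (suc n · 1#)

    signed : Sign → Carrier → Carrier
    signed Sign.+ x = x
    signed Sign.- x = - x

    ⊖-homo : ∀ m n → ⟦ m ⊖ n ⟧ℤ ≈ m · 1# + - (n · 1#)
    ⊖-homo zero zero = sym (trans (+-identityˡ _) -0#≈0#)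
    ⊖-homo (suc m) zero = sym (trans (+-congˡ -0#≈0#) (+-identityʳ _))
    ⊖-homo zero (suc n) = sym (+-identityˡ _)
    ⊖-homo (suc m) (suc n) = begin
      ⟦ suc m ⊖ suc n ⟧ℤ ≡⟨ cong ⟦_⟧ℤ (ℤₚ.[1+m]⊖[1+n]≡m⊖n m n) ⟩
      ⟦ m ⊖ n ⟧ℤ ≈⟨ ⊖-homo m n ⟩
      m · 1# + - (n · 1#) ≈⟨ +-identityˡ _ ⟨
      0# + (m · 1# + - (n · 1#)) ≈⟨ +-congʳ (-‿inverseʳ 1#) ⟨
      (1# + - 1#) + (m · 1# + - (n · 1#)) ≈⟨ interchange _ _ _ _ ⟩
      (1# + m · 1#) + (- 1# + - (n · 1#)) ≈⟨ +-cong (1+× m 1#) (trans (-‿cong (1+× n 1#)) (sym (⁻¹-∙-comm _ _))) ⟨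
      suc m · 1# + - (suc n · 1#) ∎

    ⟦⟧-+ : ∀ i j → ⟦ i ℤ.+ j ⟧ℤ ≈ ⟦ i ⟧ℤ + ⟦ j ⟧ℤ
    ⟦⟧-+ (+ m) (+ n) = ×-homo-+ 1# m n
    ⟦⟧-+ (+ m) -[1+ n ] = ⊖-homo m (suc n)
    ⟦⟧-+ -[1+ m ] (+ n) = trans (⊖-homo n (suc m)) (+-comm _ _)
    ⟦⟧-+ -[1+ m ] -[1+ n ] = begin
      - (suc (suc (m ℕ.+ n)) · 1#) ≡⟨ cong (λ k → - (suc k · 1#)) (+-suc m n) ⟨
      - ((suc m ℕ.+ suc n) · 1#) ≈⟨ -‿cong (×-homo-+ 1# (suc m) (suc n)) ⟩
      - (suc m · 1# + suc n · 1#) ≈⟨ ⁻¹-∙-comm _ _ ⟨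
      - (suc m · 1#) + - (suc n · 1#) ∎

    ◃-homo : ∀ s n → ⟦ s ◃ n ⟧ℤ ≈ signed s (n · 1#)
    ◃-homo Sign.+ zero = refl
    ◃-homo Sign.+ (suc n) = refl
    ◃-homo Sign.- zero = sym -0#≈0#
    ◃-homo Sign.- (suc n) = refl

    signed-* : ∀ s t x y → signed (s Sign.* t) (x * y) ≈ signed s x * signed t y
    signed-* Sign.+ Sign.+ x y = refl
    signed-* Sign.+ Sign.- x y = -‿distribʳ-* x y
    signed-* Sign.- Sign.+ x y = -‿distribˡ-* x y
    signed-* Sign.- Sign.- x y = begin
      x * y ≈⟨ -‿involutive _ ⟨
      - - (x * y) ≈⟨ -‿cong (-‿distribʳ-* x y) ⟩
      - (x * - y) ≈⟨ -‿distribˡ-* x (- y) ⟩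
      - x * - y ∎

    signed-cong : ∀ s {x y} → x ≈ y → signed s x ≈ signed s y
    signed-cong Sign.+ e = e
    signed-cong Sign.- e = -‿cong e

    ⟦⟧-sign : ∀ i → ⟦ i ⟧ℤ ≈ signed (sign i) (∣ i ∣ · 1#)
    ⟦⟧-sign (+ n) = refl
    ⟦⟧-sign -[1+ n ] = refl

    ⟦⟧-* : ∀ i j → ⟦ i ℤ.* j ⟧ℤ ≈ ⟦ i ⟧ℤ * ⟦ j ⟧ℤ
    ⟦⟧-* i j = begin
      ⟦ i ℤ.* j ⟧ℤ ≈⟨ ◃-homo (sign i Sign.* sign j) (∣ i ∣ ℕ.* ∣ j ∣) ⟩
      signed s ((∣ i ∣ ℕ.* ∣ j ∣) · 1#) ≈⟨ signed-cong s (×1-homo-* ∣ i ∣ ∣ j ∣) ⟩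
      signed s ((∣ i ∣ · 1#) * (∣ j ∣ · 1#)) ≈⟨ signed-* (sign i) (sign j) _ _ ⟩
      signed (sign i) (∣ i ∣ · 1#) * signed (sign j) (∣ j ∣ · 1#) ≈⟨ *-cong (⟦⟧-sign i) (⟦⟧-sign j) ⟨
      ⟦ i ⟧ℤ * ⟦ j ⟧ℤ ∎
      where s = sign i Sign.* sign j

    ⟦⟧-neg : ∀ i → ⟦ ℤ.- i ⟧ℤ ≈ - ⟦ i ⟧ℤ
    ⟦⟧-neg (+ zero) = sym -0#≈0#
    ⟦⟧-neg (+ suc n) = refl
    ⟦⟧-neg -[1+ n ] = sym (-‿involutive _)

    ℤ⟶R : ℤ.+-*-rawRing -Raw-AlmostCommutative⟶ fromCommutativeRing R
    ℤ⟶R = record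
      { ⟦_⟧ = ⟦_⟧ℤ ; +-homo = ⟦⟧-+ ; *-homo = ⟦⟧-* ; -‿homo = ⟦⟧-neg
      ; 0-homo = refl ; 1-homo = refl }

    _≟ℤ_ : ∀ i j → Maybe (⟦ i ⟧ℤ ≈ ⟦ j ⟧ℤ)
    i ≟ℤ j with i ℤ.≟ j
    ... | yes e = just (reflexive (cong ⟦_⟧ℤ e))
    ... | no _ = nothing

    module Ring = Algebra.Solver.Ring ℤ.+-*-rawRing (fromCommutativeRing R) ℤ⟶R _≟ℤ_
    open Ring using (⟦_⟧N; _≈N_; ⟦_⟧N-cong; _≟N_; normalise)

    compile : ∀ {n} → Expr n → Ring.Polynomial n
    compile (:var i) = Ring.var i
    compile :0 = Ring.con (+ 0)
    compile :1 = Ring.con (+ 1)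
    compile (p :+ r) = compile p Ring.:+ compile r
    compile (p :* r) = compile p Ring.:* compile r
    compile (p :- r) = compile p Ring.:- compile r
    compile (:- p) = Ring.:- compile p

    ⟦_⟧ : ∀ {n} → Expr n → Vec Carrier n → Carrier
    ⟦ :var i ⟧ ρ = lookup ρ i
    ⟦ :0 ⟧ ρ = 0#
    ⟦ :1 ⟧ ρ = 1#
    ⟦ p :+ r ⟧ ρ = ⟦ p ⟧ ρ + ⟦ r ⟧ ρ
    ⟦ p :* r ⟧ ρ = ⟦ p ⟧ ρ * ⟦ r ⟧ ρ
    ⟦ p :- r ⟧ ρ = ⟦ p ⟧ ρ - ⟦ r ⟧ ρ
    ⟦ :- p ⟧ ρ = - ⟦ p ⟧ ρ

    compile-sound : ∀ {n} (p : Expr n) ρ → Ring.⟦ compile p ⟧ ρ ≈ ⟦ p ⟧ ρ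
    compile-sound (:var i) ρ = refl
    compile-sound :0 ρ = refl
    compile-sound :1 ρ = refl
    compile-sound (p :+ r) ρ = +-cong (compile-sound p ρ) (compile-sound r ρ)
    compile-sound (p :* r) ρ = *-cong (compile-sound p ρ) (compile-sound r ρ)
    compile-sound (p :- r) ρ = +-cong (compile-sound p ρ) (-‿cong (compile-sound r ρ))
    compile-sound (:- p) ρ = -‿cong (compile-sound p ρ)

    normal-≈ : ∀ {n} {p r : Ring.Normal n} (d : Maybe (p ≈N r)) → Bool.T (is-just d) → ∀ ρ → ⟦ p ⟧N ρ ≈ ⟦ r ⟧N ρ
    normal-≈ (just e) _ = ⟦ e ⟧N-cong

    close : ∀ n → N-ary n (Expr n) (Identity n) → Identity n
    close n f = f $ⁿ Vec.map :var (Vec.allFin n)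

  -- The normal forms are computed over the integers, whose equality is decidable whatever the ring
  -- is. The implicit argument is the outcome of that computation and is filled in by evaluation;
  -- the homomorphism from ℤ transports the result to the ring.
  solve : ∀ n (f : N-ary n (Expr n) (Identity n)) →
    {Bool.T (is-just (normalise (compile (lhs (close n f))) ≟N normalise (compile (rhs (close n f)))))} →
    Eq n _≈_ (curryⁿ ⟦ lhs (close n f) ⟧) (curryⁿ ⟦ rhs (close n f) ⟧)
  solve n f {e} = curryⁿ-cong _≈_ ⟦ l ⟧ ⟦ r ⟧ λ ρ → trans (sym (compile-sound l ρ))
    (trans (Ring.prove ρ (compile l) (compile r) (normal-≈ (normalise (compile l) ≟N normalise (compile r)) e ρ)) (compile-sound r ρ))
    where
    l r : Expr n
    l = lhs (close n f)
    r = rhs (close n f)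

record RingHom (R S : CommutativeRing 0ℓ 0ℓ) : Set where
  private
    module R = CommutativeRing R
    module S = CommutativeRing S
  field
    to : R.Carrier → S.Carrier
    to-cong : ∀ {x y} → x R.≈ y → to x S.≈ to y
    to-+ : ∀ x y → to (x R.+ y) S.≈ to x S.+ to y
    to-* : ∀ x y → to (x R.* y) S.≈ to x S.* to y
    to-1 : to R.1# S.≈ S.1#

  to-0 : to R.0# S.≈ S.0#
  to-0 = begin
    to R.0# ≈⟨ solve 2 (λ z x → z := (z :+ x) :- x) (to R.0#) (to R.0#) ⟩
    (to R.0# S.+ to R.0#) S.- to R.0# ≈⟨ S.+-congʳ (to-+ R.0# R.0#) ⟨
    to (R.0# R.+ R.0#) S.- to R.0# ≈⟨ S.+-congʳ (to-cong (R.+-identityˡ R.0#)) ⟩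
    to R.0# S.- to R.0# ≈⟨ S.-‿inverseʳ _ ⟩
    S.0# ∎
    where
    open SolverOver S
    open import Relation.Binary.Reasoning.Setoid S.setoid

  to-neg : ∀ x → to (R.- x) S.≈ S.- to x
  to-neg x = begin
    to (R.- x) ≈⟨ solve 2 (λ a b → b := (a :+ b) :- a) (to x) (to (R.- x)) ⟩
    (to x S.+ to (R.- x)) S.- to x ≈⟨ S.+-congʳ (to-+ x (R.- x)) ⟨
    to (x R.+ R.- x) S.- to x ≈⟨ S.+-congʳ (S.trans (to-cong (R.-‿inverseʳ x)) to-0) ⟩
    S.0# S.- to x ≈⟨ S.+-identityˡ _ ⟩
    S.- to x ∎
    where
    open SolverOver S
    open import Relation.Binary.Reasoning.Setoid S.setoid

compHom : ∀ {R S T : CommutativeRing 0ℓ 0ℓ} → RingHom R S → RingHom S T → RingHom R T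
compHom {T = T} φ ψ = record
  { to = λ x → ψ.to (φ.to x) ; to-cong = λ e → ψ.to-cong (φ.to-cong e)
  ; to-+ = λ x y → trans (ψ.to-cong (φ.to-+ x y)) (ψ.to-+ _ _)
  ; to-* = λ x y → trans (ψ.to-cong (φ.to-* x y)) (ψ.to-* _ _)
  ; to-1 = trans (ψ.to-cong φ.to-1) ψ.to-1 }
  where
  module φ = RingHom φ
  module ψ = RingHom ψ
  open CommutativeRing T using (trans)

idHom : (R : CommutativeRing 0ℓ 0ℓ) → RingHom R R
idHom R = record
  { to = λ x → x ; to-cong = λ e → e ; to-+ = λ _ _ → refl ; to-* = λ _ _ → refl ; to-1 = refl }
  where open CommutativeRing R

-- Polynomials as coefficient lists, their derivatives and their evaluation.

module PolyOver (R : CommutativeRing 0ℓ 0ℓ) where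
  private module R = CommutativeRing R
  open import Relation.Binary.Reasoning.Setoid R.setoid

  Poly : Set
  Poly = List R.Carrier

  coeff : Poly → ℕ → R.Carrier
  coeff [] _ = R.0#
  coeff (a ∷ _) zero = a
  coeff (_ ∷ p) (suc n) = coeff p n

  infix 4 _≈ₚ_
  -- A record instead of a bare function type, so that unification can recover `p` and `r` from an
  -- equation.
  record _≈ₚ_ (p r : Poly) : Set where
    constructor mk≈
    field at : ∀ n → coeff p n R.≈ coeff r n
  open _≈ₚ_ public

  open import Algebra.Properties.Ring R.ring using (-0#≈0#)

  infixl 6 _+ₚ_
  infixl 7 _*ₚ_

  opaque
    -- The same recursions as in `Setting`, so that the two versions can later be identified by
    -- propositional equality. They are opaque to keep terms in the shape in which the solver states
    -- its identities.
    _+ₚ_ : Poly → Poly → Poly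
    [] +ₚ r = r
    (a ∷ p) +ₚ [] = a ∷ p
    (a ∷ p) +ₚ (b ∷ r) = (a R.+ b) ∷ (p +ₚ r)

    -ₚ_ : Poly → Poly
    -ₚ [] = []
    -ₚ (a ∷ p) = (R.- a) ∷ (-ₚ p)

    scale : R.Carrier → Poly → Poly
    scale c [] = []
    scale c (a ∷ p) = (c R.* a) ∷ scale c p

    _*ₚ_ : Poly → Poly → Poly
    [] *ₚ r = []
    (a ∷ p) *ₚ r = scale a r +ₚ (R.0# ∷ (p *ₚ r))

    coeff-+ : ∀ p r n → coeff (p +ₚ r) n R.≈ coeff p n R.+ coeff r n
    coeff-+ [] r n = R.sym (R.+-identityˡ _)
    coeff-+ (a ∷ p) [] n = R.sym (R.+-identityʳ _)
    coeff-+ (a ∷ p) (b ∷ r) zero = R.refl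
    coeff-+ (a ∷ p) (b ∷ r) (suc n) = coeff-+ p r n

    coeff-neg : ∀ p n → coeff (-ₚ p) n R.≈ R.- coeff p n
    coeff-neg [] n = R.sym -0#≈0#
    coeff-neg (a ∷ p) zero = R.refl
    coeff-neg (a ∷ p) (suc n) = coeff-neg p n

    coeff-scale : ∀ c p n → coeff (scale c p) n R.≈ c R.* coeff p n
    coeff-scale c [] n = R.sym (R.zeroʳ c)
    coeff-scale c (a ∷ p) zero = R.refl
    coeff-scale c (a ∷ p) (suc n) = coeff-scale c p n

    private
      refl′ : ∀ {p} → p ≈ₚ p
      refl′ = mk≈ λ _ → R.refl
      sym′ : ∀ {p r} → p ≈ₚ r → r ≈ₚ p
      sym′ e = mk≈ λ n → R.sym (at e n)
      trans′ : ∀ {p r s} → p ≈ₚ r → r ≈ₚ s → p ≈ₚ s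
      trans′ e f = mk≈ λ n → R.trans (at e n) (at f n)

      +-cong′ : ∀ {p p′ r r′} → p ≈ₚ p′ → r ≈ₚ r′ → p +ₚ r ≈ₚ p′ +ₚ r′
      +-cong′ {p} {p′} {r} {r′} e f = mk≈ λ n →
        R.trans (coeff-+ p r n) (R.trans (R.+-cong (at e n) (at f n)) (R.sym (coeff-+ p′ r′ n)))

      neg-cong′ : ∀ {p r} → p ≈ₚ r → -ₚ p ≈ₚ -ₚ r
      neg-cong′ {p} {r} e = mk≈ λ n →
        R.trans (coeff-neg p n) (R.trans (R.-‿cong (at e n)) (R.sym (coeff-neg r n)))

      +-assoc′ : ∀ p r s → (p +ₚ r) +ₚ s ≈ₚ p +ₚ (r +ₚ s)
      +-assoc′ p r s = mk≈ λ n → begin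
        coeff ((p +ₚ r) +ₚ s) n ≈⟨ R.trans (coeff-+ (p +ₚ r) s n) (R.+-congʳ (coeff-+ p r n)) ⟩
        (coeff p n R.+ coeff r n) R.+ coeff s n ≈⟨ R.+-assoc _ _ _ ⟩
        coeff p n R.+ (coeff r n R.+ coeff s n) ≈⟨ R.trans (coeff-+ p (r +ₚ s) n) (R.+-congˡ (coeff-+ r s n)) ⟨
        coeff (p +ₚ (r +ₚ s)) n ∎

      +-comm′ : ∀ p r → p +ₚ r ≈ₚ r +ₚ p
      +-comm′ p r = mk≈ λ n →
        R.trans (coeff-+ p r n) (R.trans (R.+-comm _ _) (R.sym (coeff-+ r p n)))

      +-identityʳ′ : ∀ p → p +ₚ [] ≈ₚ p
      +-identityʳ′ p = +-comm′ p []

      +-inverseʳ′ : ∀ p → p +ₚ -ₚ p ≈ₚ []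
      +-inverseʳ′ p = mk≈ λ n →
        R.trans (coeff-+ p (-ₚ p) n) (R.trans (R.+-congˡ (coeff-neg p n)) (R.-‿inverseʳ _))

      interchange′ : ∀ p r s u → (p +ₚ r) +ₚ (s +ₚ u) ≈ₚ (p +ₚ s) +ₚ (r +ₚ u)
      interchange′ p r s u = mk≈ λ n → begin
        coeff ((p +ₚ r) +ₚ (s +ₚ u)) n
          ≈⟨ R.trans (coeff-+ (p +ₚ r) (s +ₚ u) n) (R.+-cong (coeff-+ p r n) (coeff-+ s u n)) ⟩
        (coeff p n R.+ coeff r n) R.+ (coeff s n R.+ coeff u n) ≈⟨ interchange _ _ _ _ ⟩
        (coeff p n R.+ coeff s n) R.+ (coeff r n R.+ coeff u n)
          ≈⟨ R.trans (coeff-+ (p +ₚ s) (r +ₚ u) n) (R.+-cong (coeff-+ p s n) (coeff-+ r u n)) ⟨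
        coeff ((p +ₚ s) +ₚ (r +ₚ u)) n ∎
        where open import Algebra.Properties.CommutativeSemigroup R.+-commutativeSemigroup using (interchange)

      swap′ : ∀ p r s → p +ₚ (r +ₚ s) ≈ₚ r +ₚ (p +ₚ s)
      swap′ p r s = trans′ (sym′ (+-assoc′ p r s)) (trans′ (+-cong′ (+-comm′ p r) refl′) (+-assoc′ r p s))

    ∷-cong : ∀ {a b p r} → a R.≈ b → p ≈ₚ r → (a ∷ p) ≈ₚ (b ∷ r)
    ∷-cong e f = mk≈ λ { zero → e ; (suc n) → at f n }

    ∷-tail : ∀ {a b p r} → (a ∷ p) ≈ₚ (b ∷ r) → p ≈ₚ r
    ∷-tail e = mk≈ λ n → at e (suc n)

    []-tail : ∀ {a p} → (a ∷ p) ≈ₚ [] → p ≈ₚ []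
    []-tail e = mk≈ λ n → at e (suc n)

    0∷[] : ∀ {p} → p ≈ₚ [] → (R.0# ∷ p) ≈ₚ []
    0∷[] e = mk≈ λ { zero → R.refl ; (suc n) → at e n }

    scale-cong : ∀ {a b p r} → a R.≈ b → p ≈ₚ r → scale a p ≈ₚ scale b r
    scale-cong {a} {b} {p} {r} e f = mk≈ λ n →
      R.trans (coeff-scale a p n) (R.trans (R.*-cong e (at f n)) (R.sym (coeff-scale b r n)))

    scale-+ : ∀ c p r → scale c (p +ₚ r) ≈ₚ scale c p +ₚ scale c r
    scale-+ c p r = mk≈ λ n → begin
      coeff (scale c (p +ₚ r)) n ≈⟨ R.trans (coeff-scale c (p +ₚ r) n) (R.*-congˡ (coeff-+ p r n)) ⟩
      c R.* (coeff p n R.+ coeff r n) ≈⟨ R.distribˡ _ _ _ ⟩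
      c R.* coeff p n R.+ c R.* coeff r n
        ≈⟨ R.trans (coeff-+ (scale c p) (scale c r) n) (R.+-cong (coeff-scale c p n) (coeff-scale c r n)) ⟨
      coeff (scale c p +ₚ scale c r) n ∎

    scale-+ˡ : ∀ c d p → scale (c R.+ d) p ≈ₚ scale c p +ₚ scale d p
    scale-+ˡ c d p = mk≈ λ n → begin
      coeff (scale (c R.+ d) p) n ≈⟨ coeff-scale _ p n ⟩
      (c R.+ d) R.* coeff p n ≈⟨ R.distribʳ _ _ _ ⟩
      c R.* coeff p n R.+ d R.* coeff p n
        ≈⟨ R.trans (coeff-+ (scale c p) (scale d p) n) (R.+-cong (coeff-scale c p n) (coeff-scale d p n)) ⟨
      coeff (scale c p +ₚ scale d p) n ∎

    scale-scale : ∀ c d p → scale c (scale d p) ≈ₚ scale (c R.* d) p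
    scale-scale c d p = mk≈ λ n → begin
      coeff (scale c (scale d p)) n ≈⟨ R.trans (coeff-scale c (scale d p) n) (R.*-congˡ (coeff-scale d p n)) ⟩
      c R.* (d R.* coeff p n) ≈⟨ R.*-assoc _ _ _ ⟨
      (c R.* d) R.* coeff p n ≈⟨ coeff-scale _ p n ⟨
      coeff (scale (c R.* d) p) n ∎

    scale-0 : ∀ p → scale R.0# p ≈ₚ []
    scale-0 p = mk≈ λ n → R.trans (coeff-scale R.0# p n) (R.zeroˡ _)

    scale-1 : ∀ p → scale R.1# p ≈ₚ p
    scale-1 p = mk≈ λ n → R.trans (coeff-scale R.1# p n) (R.*-identityˡ _)

    private
      *-zeroʳ′ : ∀ p → p *ₚ [] ≈ₚ []
      *-zeroʳ′ [] = refl′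
      *-zeroʳ′ (a ∷ p) = 0∷[] (*-zeroʳ′ p)

      *-congˡ′ : ∀ p {r s} → r ≈ₚ s → p *ₚ r ≈ₚ p *ₚ s
      *-congˡ′ [] e = refl′
      *-congˡ′ (a ∷ p) e = +-cong′ (scale-cong R.refl e) (∷-cong R.refl (*-congˡ′ p e))

      *-∷ʳ : ∀ p b r → p *ₚ (b ∷ r) ≈ₚ scale b p +ₚ (R.0# ∷ (p *ₚ r))
      *-∷ʳ [] b r = sym′ (0∷[] refl′)
      *-∷ʳ (a ∷ p) b r = ∷-cong (R.+-congʳ (R.*-comm a b))
        (trans′ (+-cong′ refl′ (*-∷ʳ p b r)) (swap′ (scale a r) (scale b p) _))

      *-comm′ : ∀ p r → p *ₚ r ≈ₚ r *ₚ p
      *-comm′ [] r = sym′ (*-zeroʳ′ r)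
      *-comm′ (a ∷ p) r = trans′ (+-cong′ refl′ (∷-cong R.refl (*-comm′ p r))) (sym′ (*-∷ʳ r a p))

      *-cong′ : ∀ {p p′ r r′} → p ≈ₚ p′ → r ≈ₚ r′ → p *ₚ r ≈ₚ p′ *ₚ r′
      *-cong′ {p} {p′} {r} {r′} e f = trans′ (*-congˡ′ p f)
        (trans′ (*-comm′ p r′) (trans′ (*-congˡ′ r′ e) (*-comm′ r′ p′)))

      distribʳ′ : ∀ r p s → (p +ₚ s) *ₚ r ≈ₚ p *ₚ r +ₚ s *ₚ r
      distribʳ′ r [] s = refl′
      distribʳ′ r (a ∷ p) [] = sym′ (+-identityʳ′ _)
      distribʳ′ r (a ∷ p) (b ∷ s) = trans′
        (+-cong′ (scale-+ˡ a b r) (trans′ (∷-cong (R.sym (R.+-identityˡ R.0#)) (distribʳ′ r p s)) refl′))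
        (interchange′ (scale a r) (scale b r) (R.0# ∷ (p *ₚ r)) (R.0# ∷ (s *ₚ r)))

    scale-* : ∀ c p r → scale c (p *ₚ r) ≈ₚ scale c p *ₚ r
    scale-* c [] r = refl′
    scale-* c (a ∷ p) r = trans′ (scale-+ c (scale a r) (R.0# ∷ (p *ₚ r)))
      (+-cong′ (scale-scale c a r) (∷-cong (R.zeroʳ c) (scale-* c p r)))

    shift-* : ∀ p r → (R.0# ∷ p) *ₚ r ≈ₚ (R.0# ∷ (p *ₚ r))
    shift-* p r = +-cong′ (scale-0 r) refl′

    private
      *-assoc′ : ∀ p r s → (p *ₚ r) *ₚ s ≈ₚ p *ₚ (r *ₚ s)
      *-assoc′ [] r s = refl′
      *-assoc′ (a ∷ p) r s = trans′ (distribʳ′ s (scale a r) (R.0# ∷ (p *ₚ r)))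
        (+-cong′ (sym′ (scale-* a r s)) (trans′ (shift-* (p *ₚ r) s) (∷-cong R.refl (*-assoc′ p r s))))

      *-identityˡ′ : ∀ p → (R.1# ∷ []) *ₚ p ≈ₚ p
      *-identityˡ′ p = trans′ (+-cong′ (scale-1 p) (0∷[] refl′)) (+-identityʳ′ p)

      +-identityˡ′ : ∀ p → [] +ₚ p ≈ₚ p
      +-identityˡ′ p = refl′

  polyRing : CommutativeRing 0ℓ 0ℓ
  polyRing = record
    { Carrier = Poly ; _≈_ = _≈ₚ_ ; _+_ = _+ₚ_ ; _*_ = _*ₚ_ ; -_ = -ₚ_ ; 0# = [] ; 1# = R.1# ∷ []
    ; isCommutativeRing = record
      { isRing = record
        { +-isAbelianGroup = record
          { isGroup = record
            { isMonoid = record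
              { isSemigroup = record
                { isMagma = record
                  { isEquivalence = record { refl = refl′ ; sym = sym′ ; trans = trans′ }
                  ; ∙-cong = +-cong′ }
                ; assoc = +-assoc′ }
              ; identity = +-identityˡ′ , +-identityʳ′ }
            ; inverse = (λ p → trans′ (+-comm′ (-ₚ p) p) (+-inverseʳ′ p)) , +-inverseʳ′
            ; ⁻¹-cong = neg-cong′ }
          ; comm = +-comm′ }
        ; *-cong = *-cong′
        ; *-assoc = *-assoc′
        ; *-identity = *-identityˡ′ , λ p → trans′ (*-comm′ p _) (*-identityˡ′ p)
        ; distrib = (λ p r s → trans′ (*-comm′ p _) (trans′ (distribʳ′ p r s) (+-cong′ (*-comm′ r p) (*-comm′ s p))))
                  , distribʳ′ }
      ; *-comm = *-comm′ } }

  opaque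
    unfolding _+ₚ_

    const : R.Carrier → Poly
    const a = a ∷ []

    X : Poly
    X = R.0# ∷ R.1# ∷ []

    const-* : ∀ a p → const a *ₚ p ≈ₚ scale a p
    const-* a p = trans′ (+-cong′ {scale a p} refl′ (0∷[] refl′)) (+-identityʳ′ _)

    X-* : ∀ p → X *ₚ p ≈ₚ (R.0# ∷ p)
    X-* p = trans′ (shift-* (R.1# ∷ []) p) (∷-cong R.refl (*-identityˡ′ p))

    ∷-split : ∀ a p → (a ∷ p) ≈ₚ const a +ₚ X *ₚ p
    ∷-split a p = sym′ (trans′ (+-cong′ {const a} refl′ (X-* p)) (∷-cong (R.+-identityʳ a) refl′))

    const-0 : const R.0# ≈ₚ []
    const-0 = 0∷[] refl′

    const-∷ : ∀ a → const a ≈ₚ (a ∷ [])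
    const-∷ a = refl′

    X-∷ : X ≈ₚ (R.0# ∷ R.1# ∷ [])
    X-∷ = refl′

    *-∷ : ∀ a p r → (a ∷ p) *ₚ r ≈ₚ scale a r +ₚ (R.0# ∷ (p *ₚ r))
    *-∷ a p r = refl′

    const-cong : ∀ {a b} → a R.≈ b → const a ≈ₚ const b
    const-cong e = ∷-cong e refl′

    const-*-const : ∀ a b → const (a R.* b) ≈ₚ const a *ₚ const b
    const-*-const a b = sym′ (const-* a (const b))

    const-+ : ∀ a b → const (a R.+ b) ≈ₚ const a +ₚ const b
    const-+ a b = refl′

    const-1 : const R.1# ≈ₚ R.1# ∷ []
    const-1 = refl′

    -- The product rule applied to a + X p. No integer multiples of coefficients occur, so the
    -- definition is uniform in the characteristic.
    derivative : Poly → Poly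
    derivative [] = []
    derivative (a ∷ p) = p +ₚ (R.0# ∷ derivative p)

    private
      derivative-0 : ∀ {p} → p ≈ₚ [] → derivative p ≈ₚ []
      derivative-0 {[]} e = refl′
      derivative-0 {a ∷ p} e = +-cong′ ([]-tail e) (0∷[] (derivative-0 ([]-tail e)))

    derivative-cong : ∀ {p r} → p ≈ₚ r → derivative p ≈ₚ derivative r
    derivative-cong {[]} {r} e = sym′ (derivative-0 (sym′ e))
    derivative-cong {a ∷ p} {[]} e = derivative-0 e
    derivative-cong {a ∷ p} {b ∷ r} e = +-cong′ (∷-tail e) (∷-cong R.refl (derivative-cong (∷-tail e)))

    derivative-+ : ∀ p r → derivative (p +ₚ r) ≈ₚ derivative p +ₚ derivative r
    derivative-+ [] r = refl′
    derivative-+ (a ∷ p) [] = sym′ (+-identityʳ′ _)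
    derivative-+ (a ∷ p) (b ∷ r) = trans′
      (+-cong′ refl′ (∷-cong (R.sym (R.+-identityˡ _)) (derivative-+ p r)))
      (interchange′ p r (R.0# ∷ derivative p) (R.0# ∷ derivative r))

    derivative-scale : ∀ c p → derivative (scale c p) ≈ₚ scale c (derivative p)
    derivative-scale c [] = refl′
    derivative-scale c (a ∷ p) = trans′
      (+-cong′ refl′ (∷-cong (R.sym (R.zeroʳ c)) (derivative-scale c p)))
      (sym′ (scale-+ c p (R.0# ∷ derivative p)))

    derivative-* : ∀ p r → derivative (p *ₚ r) ≈ₚ derivative p *ₚ r +ₚ p *ₚ derivative r
    derivative-* [] r = refl′
    derivative-* (a ∷ p) r = begin′
      where
      open CommutativeRing polyRing using (trans; sym; +-cong; +-congˡ; +-congʳ; refl; distribʳ)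
      dp dr : Poly
      dp = derivative p
      dr = derivative r
      begin′ : derivative ((a ∷ p) *ₚ r) ≈ₚ derivative (a ∷ p) *ₚ r +ₚ (a ∷ p) *ₚ dr
      begin′ = trans (derivative-+ (scale a r) (R.0# ∷ (p *ₚ r)))
        (trans (+-cong (derivative-scale a r) (+-congˡ {p *ₚ r} (∷-cong (R.sym (R.+-identityˡ _)) (derivative-* p r))))
        (trans (+-congˡ {scale a dr} (sym (+-assoc′ (p *ₚ r) (R.0# ∷ (dp *ₚ r)) (R.0# ∷ (p *ₚ dr)))))
        (trans (swap′ (scale a dr) (p *ₚ r +ₚ (R.0# ∷ (dp *ₚ r))) (R.0# ∷ (p *ₚ dr)))
        (+-congʳ {scale a dr +ₚ (R.0# ∷ (p *ₚ dr))} (sym (trans (distribʳ r p (R.0# ∷ dp)) (+-congˡ {p *ₚ r} (shift-* dp r))))))))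

  constHom : RingHom R polyRing
  constHom = record
    { to = const ; to-cong = const-cong ; to-+ = const-+
    ; to-* = const-*-const ; to-1 = const-1 }

module EvalOver {R S : CommutativeRing 0ℓ 0ℓ} (φ : RingHom R S) where
  private module R = CommutativeRing R
  open PolyOver R
  private module S = CommutativeRing S
  open RingHom φ
  open SolverOver S
  open import Relation.Binary.Reasoning.Setoid S.setoid

  -- Horner's scheme along a homomorphism of coefficients. The choices of `φ` give evaluation at a
  -- constant, composition, Taylor shift, specialization of bivariate polynomials and substitution
  -- of 1/t.
  ev : S.Carrier → Poly → S.Carrier
  ev x [] = S.0#
  ev x (a ∷ p) = to a S.+ x S.* ev x p

  ev-≈[] : ∀ x {p} → p ≈ₚ [] → ev x p S.≈ S.0#
  ev-≈[] x {[]} e = S.refl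
  ev-≈[] x {a ∷ p} e = begin
    to a S.+ x S.* ev x p ≈⟨ S.+-cong (S.trans (to-cong (at e zero)) to-0) (S.*-congˡ (ev-≈[] x ([]-tail e))) ⟩
    S.0# S.+ x S.* S.0# ≈⟨ S.trans (S.+-identityˡ _) (S.zeroʳ x) ⟩
    S.0# ∎

  ev-cong : ∀ x {p r} → p ≈ₚ r → ev x p S.≈ ev x r
  ev-cong x {[]} {r} e = S.sym (ev-≈[] x (CommutativeRing.sym polyRing e))
  ev-cong x {a ∷ p} {[]} e = ev-≈[] x e
  ev-cong x {a ∷ p} {b ∷ r} e = S.+-cong (to-cong (at e zero)) (S.*-congˡ (ev-cong x (∷-tail e)))

  ev-congˣ : ∀ {x y} p → x S.≈ y → ev x p S.≈ ev y p
  ev-congˣ [] e = S.refl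
  ev-congˣ (a ∷ p) e = S.+-congˡ (S.*-cong e (ev-congˣ p e))

  opaque
    unfolding const

    ev-+ : ∀ x p r → ev x (p +ₚ r) S.≈ ev x p S.+ ev x r
    ev-+ x [] r = S.sym (S.+-identityˡ _)
    ev-+ x (a ∷ p) [] = S.sym (S.+-identityʳ _)
    ev-+ x (a ∷ p) (b ∷ r) = begin
      to (a R.+ b) S.+ x S.* ev x (p +ₚ r) ≈⟨ S.+-cong (to-+ a b) (S.*-congˡ (ev-+ x p r)) ⟩
      (to a S.+ to b) S.+ x S.* (ev x p S.+ ev x r)
        ≈⟨ solve 5 (λ a b x p r → (a :+ b) :+ x :* (p :+ r) := (a :+ x :* p) :+ (b :+ x :* r)) (to a) (to b) x (ev x p) (ev x r) ⟩
      (to a S.+ x S.* ev x p) S.+ (to b S.+ x S.* ev x r) ∎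

    ev-scale : ∀ x c p → ev x (scale c p) S.≈ to c S.* ev x p
    ev-scale x c [] = S.sym (S.zeroʳ _)
    ev-scale x c (a ∷ p) = begin
      to (c R.* a) S.+ x S.* ev x (scale c p) ≈⟨ S.+-cong (to-* c a) (S.*-congˡ (ev-scale x c p)) ⟩
      to c S.* to a S.+ x S.* (to c S.* ev x p)
        ≈⟨ solve 4 (λ c a x p → c :* a :+ x :* (c :* p) := c :* (a :+ x :* p)) (to c) (to a) x (ev x p) ⟩
      to c S.* (to a S.+ x S.* ev x p) ∎

    ev-* : ∀ x p r → ev x (p *ₚ r) S.≈ ev x p S.* ev x r
    ev-* x [] r = S.sym (S.zeroˡ _)
    ev-* x (a ∷ p) r = begin
      ev x (scale a r +ₚ (R.0# ∷ (p *ₚ r))) ≈⟨ ev-+ x (scale a r) (R.0# ∷ (p *ₚ r)) ⟩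
      ev x (scale a r) S.+ (to R.0# S.+ x S.* ev x (p *ₚ r)) ≈⟨ S.+-cong (ev-scale x a r) (S.+-cong to-0 (S.*-congˡ (ev-* x p r))) ⟩
      to a S.* ev x r S.+ (S.0# S.+ x S.* (ev x p S.* ev x r))
        ≈⟨ solve 4 (λ a r x p → a :* r :+ (:0 :+ x :* (p :* r)) := (a :+ x :* p) :* r) (to a) (ev x r) x (ev x p) ⟩
      (to a S.+ x S.* ev x p) S.* ev x r ∎

    ev-const : ∀ x a → ev x (const a) S.≈ to a
    ev-const x a = S.trans (S.+-congˡ (S.zeroʳ x)) (S.+-identityʳ _)

    ev-X : ∀ x → ev x X S.≈ x
    ev-X x = begin
      to R.0# S.+ x S.* (to R.1# S.+ x S.* S.0#) ≈⟨ S.+-cong to-0 (S.*-congˡ (S.+-congʳ to-1)) ⟩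
      S.0# S.+ x S.* (S.1# S.+ x S.* S.0#)
        ≈⟨ solve 1 (λ x → :0 :+ x :* (:1 :+ x :* :0) := x) x ⟩
      x ∎

  evHom : S.Carrier → RingHom polyRing S
  evHom x = record
    { to = ev x ; to-cong = ev-cong x ; to-+ = ev-+ x ; to-* = ev-* x
    ; to-1 = S.trans (ev-cong x (CommutativeRing.sym polyRing const-1)) (S.trans (ev-const x R.1#) to-1) }

-- Polynomial arithmetic over a field: degrees, division, Bezout, primes.

record DecField : Set₁ where
  field commRing : CommutativeRing 0ℓ 0ℓ
  open CommutativeRing commRing public
  field
    _≟_ : ∀ x y → Dec (x ≈ y)
    1≉0 : ¬ (1# ≈ 0#)
    invert : ∀ x → ¬ (x ≈ 0#) → ∃ λ y → x * y ≈ 1#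

module FieldLemmas (F : DecField) where
  open DecField F
  open SolverOver commRing
  open import Relation.Binary.Reasoning.Setoid setoid

  cancelˡ : ∀ {x y z} → ¬ (x ≈ 0#) → x * y ≈ x * z → y ≈ z
  cancelˡ {x} {y} {z} x≉0 e with invert x x≉0
  ... | i , xi≈1 = begin
    y ≈⟨ *-identityˡ y ⟨
    1# * y ≈⟨ *-congʳ xi≈1 ⟨
    (x * i) * y ≈⟨ solve 3 (λ x i y → x :* i :* y := i :* (x :* y)) x i y ⟩
    i * (x * y) ≈⟨ *-congˡ e ⟩
    i * (x * z) ≈⟨ solve 3 (λ x i y → i :* (x :* y) := x :* i :* y) x i z ⟩
    (x * i) * z ≈⟨ *-congʳ xi≈1 ⟩
    1# * z ≈⟨ *-identityˡ z ⟩
    z ∎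

  *≈0 : ∀ {x y} → x * y ≈ 0# → x ≈ 0# ⊎ y ≈ 0#
  *≈0 {x} {y} e with x ≟ 0#
  ... | yes x≈0 = inj₁ x≈0
  ... | no x≉0 = inj₂ (cancelˡ x≉0 (trans e (sym (zeroʳ x))))

  *≉0 : ∀ {x y} → ¬ (x ≈ 0#) → ¬ (y ≈ 0#) → ¬ (x * y ≈ 0#)
  *≉0 x≉0 y≉0 e with *≈0 e
  ... | inj₁ x≈0 = x≉0 x≈0
  ... | inj₂ y≈0 = y≉0 y≈0

  divide : ∀ x y → ¬ (y ≈ 0#) → ∃ λ z → z * y ≈ x
  divide x y y≉0 with invert y y≉0
  ... | i , e = x * i , trans (*-assoc x i y) (trans (*-congˡ (trans (*-comm i y) e)) (*-identityʳ x))

  x-y≈0⇒x≈y : ∀ {x y} → x - y ≈ 0# → x ≈ y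
  x-y≈0⇒x≈y {x} {y} e = begin
    x ≈⟨ solve 2 (λ x y → x := (x :- y) :+ y) x y ⟩
    (x - y) + y ≈⟨ +-congʳ e ⟩
    0# + y ≈⟨ +-identityˡ y ⟩
    y ∎

  x≈y⇒x-y≈0 : ∀ {x y} → x ≈ y → x - y ≈ 0#
  x≈y⇒x-y≈0 {x} {y} e = trans (+-congʳ e) (-‿inverseʳ y)

module FieldPoly (F : DecField) where
  module K = DecField F
  module Kₗ = FieldLemmas F
  open PolyOver K.commRing public
  open CommutativeRing polyRing public hiding (Carrier; zero)
  open SolverOver polyRing public
  private module KS = SolverOver K.commRing
  open import Relation.Binary.Reasoning.Setoid setoid

  -- Lists may end in zeros, so the length is only an upper bound for the degree. This form is
  -- stable under `_≈_`, and the zero polynomial satisfies every bound, including 0.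
  record Deg< (n : ℕ) (p : Poly) : Set where
    constructor deg<
    field vanish : ∀ i → n ≤ i → coeff p i K.≈ K.0#
  open Deg< public

  record Degree (p : Poly) (n : ℕ) : Set where
    constructor degree
    field
      lead≉0 : ¬ (coeff p n K.≈ K.0#)
      bound : Deg< (suc n) p
  open Degree public

  Deg<-cong : ∀ {n p r} → p ≈ r → Deg< n p → Deg< n r
  Deg<-cong e d = deg< λ i l → K.trans (K.sym (at e i)) (vanish d i l)

  Deg<-mono : ∀ {m n p} → m ≤ n → Deg< m p → Deg< n p
  Deg<-mono l d = deg< λ i k → vanish d i (≤-trans l k)

  Deg<-0 : ∀ {n} → Deg< n 0#
  Deg<-0 = deg< λ _ _ → K.refl

  Deg<-+ : ∀ {n p r} → Deg< n p → Deg< n r → Deg< n (p + r)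
  Deg<-+ {n} {p} {r} d e = deg< λ i l →
    K.trans (coeff-+ p r i) (K.trans (K.+-cong (vanish d i l) (vanish e i l)) (K.+-identityˡ _))

  Deg<-scale : ∀ {n p} c → Deg< n p → Deg< n (scale c p)
  Deg<-scale {n} {p} c d = deg< λ i l →
    K.trans (coeff-scale c p i) (K.trans (K.*-congˡ (vanish d i l)) (K.zeroʳ c))

  Deg<-neg : ∀ {n p} → Deg< n p → Deg< n (- p)
  Deg<-neg {n} {p} d = deg< λ i l →
    K.trans (coeff-neg p i) (K.trans (K.-‿cong (vanish d i l)) -0#≈0#)
    where open import Algebra.Properties.Ring K.ring using (-0#≈0#)

  Deg<-∷ : ∀ {n a p} → Deg< n p → Deg< (suc n) (a ∷ p)
  Deg<-∷ d = deg< λ { (suc i) (s≤s l) → vanish d i l }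

  Deg<-tail : ∀ {n a p} → Deg< (suc n) (a ∷ p) → Deg< n p
  Deg<-tail d = deg< λ i l → vanish d (suc i) (s≤s l)

  Deg<-length : ∀ p → Deg< (length p) p
  Deg<-length [] = Deg<-0
  Deg<-length (a ∷ p) = Deg<-∷ (Deg<-length p)

  Deg<0⇒≈0 : ∀ {p} → Deg< 0 p → p ≈ 0#
  Deg<0⇒≈0 d = mk≈ λ n → vanish d n z≤n

  ≈0⇒Deg< : ∀ {n p} → p ≈ 0# → Deg< n p
  ≈0⇒Deg< e = deg< λ i _ → at e i

  opaque
    unfolding _+ₚ_ const
    Deg<-const : ∀ a → Deg< 1 (const a)
    Deg<-const a = deg< λ { (suc i) (s≤s l) → K.refl }

    coeff-const : ∀ a → coeff (const a) 0 K.≈ a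
    coeff-const a = K.refl

    Degree-X : Degree X 1
    Degree-X = degree K.1≉0 (deg< λ { (suc (suc i)) (s≤s (s≤s l)) → K.refl })

  Deg<1⇒const : ∀ {p} → Deg< 1 p → p ≈ const (coeff p 0)
  Deg<1⇒const {p} d = mk≈ λ
    { zero → K.sym (coeff-const _)
    ; (suc i) → K.trans (vanish d (suc i) (s≤s z≤n)) (K.sym (vanish (Deg<-const (coeff p 0)) (suc i) (s≤s z≤n))) }

  -- The successor is demanded of one factor only; the other may carry the bound 0, which happens
  -- for the zero polynomial in the estimates below.
  Deg<-* : ∀ {m n} p {r} → Deg< m p → Deg< (suc n) r → Deg< (m ℕ.+ n) (p * r)
  Deg<-* {m} {n} [] {r} d e = ≈0⇒Deg< (zeroˡ r)
  Deg<-* {zero} {n} p@(_ ∷ _) {r} d e = ≈0⇒Deg< (trans (*-congʳ (Deg<0⇒≈0 d)) (zeroˡ r))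
  Deg<-* {suc m} {n} (a ∷ p) {r} d e = Deg<-cong (sym (*-∷ a p r))
    (Deg<-+ (Deg<-mono (s≤s (m≤n+m n m)) (Deg<-scale a e)) (Deg<-∷ (Deg<-* p (Deg<-tail d) e)))

  coeff-*-top : ∀ m n p r → Deg< (suc m) p → Deg< (suc n) r →
                coeff (p * r) (m ℕ.+ n) K.≈ coeff p m K.* coeff r n
  coeff-*-top m n [] r d e = K.trans (at (zeroˡ r) (m ℕ.+ n)) (K.sym (K.zeroˡ _))
  coeff-*-top zero n (a ∷ p) r d e = K.trans (at (trans (*-∷ a p r) (+-congˡ (0∷[] pr≈0))) n)
    (K.trans (at (+-identityʳ (scale a r)) n) (coeff-scale a r n))
    where
    pr≈0 : p * r ≈ 0#
    pr≈0 = trans (*-congʳ (Deg<0⇒≈0 (Deg<-tail d))) (zeroˡ r)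
  coeff-*-top (suc m) n (a ∷ p) r d e = K.trans (at (*-∷ a p r) (suc m ℕ.+ n))
    (K.trans (coeff-+ (scale a r) _ (suc m ℕ.+ n))
    (K.trans (K.+-cong (vanish (Deg<-scale a e) (suc m ℕ.+ n) (s≤s (m≤n+m n m))) (coeff-*-top m n p r (Deg<-tail d) e))
    (K.+-identityˡ _)))

  degree? : ∀ p → p ≈ 0# ⊎ ∃ (Degree p)
  degree? [] = inj₁ refl
  degree? (a ∷ p) with degree? p
  ... | inj₂ (n , degree l b) = inj₂ (suc n , degree l (Deg<-∷ b))
  ... | inj₁ p≈0 with a K.≟ K.0#
  ...   | yes a≈0 = inj₁ (mk≈ λ { zero → a≈0 ; (suc n) → at p≈0 n })
  ...   | no a≉0 = inj₂ (0 , degree a≉0 (Deg<-∷ (≈0⇒Deg< p≈0)))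

  Degree⇒≉0 : ∀ {p n} → Degree p n → ¬ (p ≈ 0#)
  Degree⇒≉0 {n = n} d e = lead≉0 d (at e n)

  ≉0⇒Degree : ∀ {p} → ¬ (p ≈ 0#) → ∃ (Degree p)
  ≉0⇒Degree {p} p≉0 with degree? p
  ... | inj₁ e = ⊥-elim (p≉0 e)
  ... | inj₂ d = d

  Degree-cong : ∀ {p r n} → p ≈ r → Degree p n → Degree r n
  Degree-cong {n = n} e d = degree (λ z → lead≉0 d (K.trans (at e n) z)) (Deg<-cong e (bound d))

  Degree-Deg< : ∀ {p n m} → Degree p n → Deg< m p → n < m
  Degree-Deg< {p} {n} {m} d e with n ℕₚ.<? m
  ... | yes l = l
  ... | no ¬l = ⊥-elim (lead≉0 d (vanish e n (ℕₚ.≮⇒≥ ¬l)))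

  Degree-unique : ∀ {p m n} → Degree p m → Degree p n → m ≡ n
  Degree-unique d e = ℕₚ.≤-antisym (≤-pred (Degree-Deg< d (bound e))) (≤-pred (Degree-Deg< e (bound d)))

  Degree-* : ∀ {p r m n} → Degree p m → Degree r n → Degree (p * r) (m ℕ.+ n)
  Degree-* {p} {r} {m} {n} d e = degree
    (λ z → Kₗ.*≉0 (lead≉0 d) (lead≉0 e) (K.trans (K.sym (coeff-*-top m n p r (bound d) (bound e))) z))
    (Deg<-* p (bound d) (bound e))

  ≈0? : ∀ p → Dec (p ≈ 0#)
  ≈0? p with degree? p
  ... | inj₁ e = yes e
  ... | inj₂ (_ , d) = no (Degree⇒≉0 d)

  *≈0 : ∀ {p r} → p * r ≈ 0# → p ≈ 0# ⊎ r ≈ 0#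
  *≈0 {p} {r} e with degree? p | degree? r
  ... | inj₁ z | _ = inj₁ z
  ... | inj₂ _ | inj₁ z = inj₂ z
  ... | inj₂ (m , d) | inj₂ (n , f) = ⊥-elim (Degree⇒≉0 (Degree-* d f) e)

  *≉0 : ∀ {p r} → ¬ (p ≈ 0#) → ¬ (r ≈ 0#) → ¬ (p * r ≈ 0#)
  *≉0 p≉0 r≉0 e with *≈0 e
  ... | inj₁ z = p≉0 z
  ... | inj₂ z = r≉0 z

  p-r≈0⇒p≈r : ∀ {p r} → p - r ≈ 0# → p ≈ r
  p-r≈0⇒p≈r {p} {r} e = begin
    p ≈⟨ solve 2 (λ x y → x := (x :- y) :+ y) p r ⟩
    (p - r) + r ≈⟨ +-congʳ e ⟩
    0# + r ≈⟨ +-identityˡ r ⟩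
    r ∎

  p≈r⇒p-r≈0 : ∀ {p r} → p ≈ r → p - r ≈ 0#
  p≈r⇒p-r≈0 {p} {r} e = trans (+-congʳ e) (-‿inverseʳ r)

  _≟ₚ_ : ∀ p r → Dec (p ≈ r)
  p ≟ₚ r with ≈0? (p - r)
  ... | yes e = yes (p-r≈0⇒p≈r e)
  ... | no n = no λ e → n (p≈r⇒p-r≈0 e)

  cancelˡ : ∀ {p r s} → ¬ (p ≈ 0#) → p * r ≈ p * s → r ≈ s
  cancelˡ {p} {r} {s} p≉0 e = p-r≈0⇒p≈r ([ (λ z → ⊥-elim (p≉0 z)) , (λ z → z) ]′ (*≈0
    (trans (solve 3 (λ p r s → p :* (r :- s) := p :* r :- p :* s) p r s) (p≈r⇒p-r≈0 e))))

  const≉0 : ∀ {a} → ¬ (a K.≈ K.0#) → ¬ (const a ≈ 0#)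
  const≉0 {a} a≉0 e = a≉0 (K.trans (K.sym (coeff-const a)) (at e 0))

  const-inverse : ∀ {a b} → a K.* b K.≈ K.1# → const a * const b ≈ 1#
  const-inverse {a} {b} e = trans (sym (const-*-const a b)) (trans (const-cong e) const-1)

  1≉0ₚ : ¬ (1# ≈ 0#)
  1≉0ₚ e = K.1≉0 (at e 0)

  infix 4 _∣_
  _∣_ : Poly → Poly → Set
  p ∣ r = ∃ λ c → r ≈ p * c

  ∣-cong : ∀ {p r s} → r ≈ s → p ∣ r → p ∣ s
  ∣-cong e (c , f) = c , trans (sym e) f

  ∣-+ : ∀ {p r s} → p ∣ r → p ∣ s → p ∣ r + s
  ∣-+ {p} (c , e) (d , f) = c + d , trans (+-cong e f) (sym (distribˡ p c d))

  ∣-neg : ∀ {p r} → p ∣ r → p ∣ - r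
  ∣-neg {p} (c , e) = - c , trans (-‿cong e) (solve 2 (λ p c → :- (p :* c) := p :* :- c) p c)

  ∣-*ʳ : ∀ {p r} s → p ∣ r → p ∣ r * s
  ∣-*ʳ {p} s (c , e) = c * s , trans (*-congʳ e) (*-assoc p c s)

  ∣-*ˡ : ∀ {p r} s → p ∣ r → p ∣ s * r
  ∣-*ˡ {p} {r} s d = ∣-cong (*-comm r s) (∣-*ʳ s d)

  ∣-trans : ∀ {p r s} → p ∣ r → r ∣ s → p ∣ s
  ∣-trans {p} (c , e) (d , f) = c * d , trans f (trans (*-congʳ e) (*-assoc p c d))

  ∣-refl : ∀ {p} → p ∣ p
  ∣-refl {p} = 1# , sym (*-identityʳ p)

  -- Division in Horner order: once the tail is divided, a + X r has degree at most n, and a single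
  -- constant multiple of f removes its coefficient of index n.
  divMod : ∀ {f n} → Degree f n → ∀ p → ∃₂ λ q r → p ≈ f * q + r × Deg< n r
  divMod {f} {n} d [] = 0# , 0# , sym (trans (+-identityʳ _) (zeroʳ f)) , Deg<-0
  divMod {f} {n} d (a ∷ p) with divMod d p
  ... | q , r , e , l with Kₗ.divide (coeff (a ∷ r) n) (coeff f n) (lead≉0 d)
  ...   | k , ke = X * q + const k , (a ∷ r) - const k * f , eq , deg< low
    where
    eq : (a ∷ p) ≈ f * (X * q + const k) + ((a ∷ r) - const k * f)
    eq = begin
      a ∷ p ≈⟨ trans (∷-cong K.refl e) (∷-split a (f * q + r)) ⟩
      const a + X * (f * q + r)
        ≈⟨ solve 6 (λ a x f q r k → a :+ x :* (f :* q :+ r) := f :* (x :* q :+ k) :+ ((a :+ x :* r) :- k :* f)) (const a) X f q r (const k) ⟩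
      f * (X * q + const k) + ((const a + X * r) - const k * f) ≈⟨ +-congˡ (+-congʳ (∷-split a r)) ⟨
      f * (X * q + const k) + ((a ∷ r) - const k * f) ∎
    rest : Deg< (suc n) ((a ∷ r) - const k * f)
    rest = Deg<-+ (Deg<-∷ l) (Deg<-neg (Deg<-cong (sym (const-* k f)) (Deg<-scale k (bound d))))
    top : coeff ((a ∷ r) - const k * f) n K.≈ K.0#
    top = K.trans (coeff-+ (a ∷ r) _ n) (K.trans (K.+-congˡ (K.trans (coeff-neg (const k * f) n)
      (K.-‿cong (K.trans (at (const-* k f) n) (K.trans (coeff-scale k f n) ke))))) (K.-‿inverseʳ _))
    low : ∀ i → n ≤ i → coeff ((a ∷ r) - const k * f) i K.≈ K.0#
    low i l′ with ℕₚ.m≤n⇒m<n∨m≡n l′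
    ... | inj₁ lt = vanish rest i lt
    ... | inj₂ ≡.refl = top

  Bezout : Poly → Poly → Set
  Bezout a b = ∃ λ d → d ∣ a × d ∣ b × ∃₂ λ u v → d ≈ u * a + v * b

  gcd : ∀ n a b → Deg< n b → Bezout a b
  gcd n a b l with degree? b
  ... | inj₁ b≈0 = a , ∣-refl , (0# , trans b≈0 (sym (zeroʳ a))) , 1# , 0# ,
                   solve 2 (λ a b → a := :1 :* a :+ :0 :* b) a b
  gcd zero a b l | inj₂ (m , d) = ⊥-elim (Degree⇒≉0 d (Deg<0⇒≈0 l))
  gcd (suc n) a b l | inj₂ (m , d) with divMod d a
  ... | q , r , e , lr with gcd n b r (Deg<-mono (≤-pred (Degree-Deg< d l)) lr)
  ...   | g , g∣b , g∣r , u , v , f = g , ∣-cong (sym e) (∣-+ (∣-*ʳ q g∣b) g∣r) , g∣b , v , u - v * q , (begin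
      g ≈⟨ f ⟩
      u * b + v * r ≈⟨ solve 5 (λ u b v r q → u :* b :+ v :* r := v :* (b :* q :+ r) :+ (u :- v :* q) :* b) u b v r q ⟩
      v * (b * q + r) + (u - v * q) * b ≈⟨ +-congʳ (*-congˡ e) ⟨
      v * a + (u - v * q) * b ∎)

  bezout : ∀ a b → Bezout a b
  bezout a b = gcd _ a b (Deg<-length b)

  Coprime : Poly → Poly → Set
  Coprime a b = ∃₂ λ u v → u * a + v * b ≈ 1#

  Coprime-sym : ∀ {a b} → Coprime a b → Coprime b a
  Coprime-sym (u , v , e) = v , u , trans (+-comm _ _) e

  Coprime-∣ : ∀ {a b c} → Coprime a b → a ∣ b * c → a ∣ c
  Coprime-∣ {a} {b} {c} (u , v , e) (d , f) = u * c + v * d , (begin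
    c ≈⟨ *-identityˡ c ⟨
    1# * c ≈⟨ *-congʳ e ⟨
    (u * a + v * b) * c ≈⟨ solve 5 (λ u a v b c → (u :* a :+ v :* b) :* c := a :* (u :* c) :+ v :* (b :* c)) u a v b c ⟩
    a * (u * c) + v * (b * c) ≈⟨ +-congˡ (*-congˡ f) ⟩
    a * (u * c) + v * (a * d) ≈⟨ solve 5 (λ u a v d c → a :* (u :* c) :+ v :* (a :* d) := a :* (u :* c :+ v :* d)) u a v d c ⟩
    a * (u * c + v * d) ∎)

  Coprime-* : ∀ {a b c} → Coprime a b → Coprime a c → Coprime a (b * c)
  Coprime-* {a} {b} {c} (u , v , e) (u′ , v′ , e′) = u * (u′ * a + v′ * c) + v * b * u′ , v * v′ , (begin
    (u * (u′ * a + v′ * c) + v * b * u′) * a + v * v′ * (b * c)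
      ≈⟨ solve 7 (λ u a v b c u′ v′ → (u :* (u′ :* a :+ v′ :* c) :+ v :* b :* u′) :* a :+ v :* v′ :* (b :* c) := (u :* a :+ v :* b) :* (u′ :* a :+ v′ :* c)) u a v b c u′ v′ ⟩
    (u * a + v * b) * (u′ * a + v′ * c) ≈⟨ *-cong e e′ ⟩
    1# * 1# ≈⟨ *-identityˡ 1# ⟩
    1# ∎)

  Coprime-cong : ∀ {a b b′} → b ≈ b′ → Coprime a b → Coprime a b′
  Coprime-cong e (u , v , f) = u , v , trans (+-congˡ (*-congˡ (sym e))) f

  lowest-terms : ∀ a b → ¬ (b ≈ 0#) → ∃ λ d → ∃₂ λ a₁ b₁ → a ≈ d * a₁ × b ≈ d * b₁ × Coprime a₁ b₁
  lowest-terms a b b≉0 = go (bezout a b)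
    where
    go : Bezout a b → ∃ λ d → ∃₂ λ a₁ b₁ → a ≈ d * a₁ × b ≈ d * b₁ × Coprime a₁ b₁
    go (d , (a₁ , ea) , (b₁ , eb) , u , v , f) = d , a₁ , b₁ , ea , eb , u , v , cancelˡ d≉0 (begin
      d * (u * a₁ + v * b₁) ≈⟨ solve 5 (λ d u a v b → d :* (u :* a :+ v :* b) := u :* (d :* a) :+ v :* (d :* b)) d u a₁ v b₁ ⟩
      u * (d * a₁) + v * (d * b₁) ≈⟨ +-cong (*-congˡ ea) (*-congˡ eb) ⟨
      u * a + v * b ≈⟨ f ⟨
      d ≈⟨ *-identityʳ d ⟨
      d * 1# ∎)
      where
      d≉0 : ¬ (d ≈ 0#)
      d≉0 z = b≉0 (trans eb (trans (*-congʳ z) (zeroˡ b₁)))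

  Degree-0 : ∀ {p} → Degree p 0 → ∃ λ r → p * r ≈ 1#
  Degree-0 {p} d with K.invert (coeff p 0) (lead≉0 d)
  ... | i , e = const i , trans (*-congʳ (Deg<1⇒const (bound d))) (const-inverse e)

  -- Primality is stored as a Bezout dichotomy, since nearly every use needs an explicit inverse
  -- modulo Q.
  record Prime (Q : Poly) : Set where
    constructor prime
    field
      {deg-1} : ℕ
      nonconstant : Degree Q (suc deg-1)
      dichotomy : ∀ x → Q ∣ x ⊎ Coprime Q x
  open Prime public

  Prime-≉0 : ∀ {Q} → Prime Q → ¬ (Q ≈ 0#)
  Prime-≉0 π = Degree⇒≉0 (nonconstant π)

  Prime-∤1 : ∀ {Q} → Prime Q → ¬ (Q ∣ 1#)
  Prime-∤1 {Q} π (c , e) with degree? c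
  ... | inj₁ c≈0 = 1≉0ₚ (trans e (trans (*-congˡ c≈0) (zeroʳ Q)))
  ... | inj₂ (m , d) with Degree-Deg< (Degree-cong (sym e) (Degree-* (nonconstant π) d)) (Deg<-cong const-1 (Deg<-const K.1#))
  ...   | s≤s ()

  Coprime⇒∤ : ∀ {Q x} → Prime Q → Coprime Q x → ¬ (Q ∣ x)
  Coprime⇒∤ {Q} {x} π (u , v , e) d = Prime-∤1 π (∣-cong e (∣-+ (∣-*ˡ u ∣-refl) (∣-*ˡ v d)))

  ∤⇒Coprime : ∀ {Q x} → Prime Q → ¬ (Q ∣ x) → Coprime Q x
  ∤⇒Coprime {x = x} π n with dichotomy π x
  ... | inj₁ d = ⊥-elim (n d)
  ... | inj₂ c = c

  Prime-∣* : ∀ {Q x y} → Prime Q → Q ∣ x * y → Q ∣ x ⊎ Q ∣ y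
  Prime-∣* {x = x} π d with dichotomy π x
  ... | inj₁ q = inj₁ q
  ... | inj₂ c = inj₂ (Coprime-∣ c d)

  Prime-∤* : ∀ {Q x y} → Prime Q → ¬ (Q ∣ x) → ¬ (Q ∣ y) → ¬ (Q ∣ x * y)
  Prime-∤* π a b d with Prime-∣* π d
  ... | inj₁ q = a q
  ... | inj₂ q = b q

  Prime-∣² : ∀ {Q x} → Prime Q → Q ∣ x * x → Q ∣ x
  Prime-∣² π d with Prime-∣* π d
  ... | inj₁ q = q
  ... | inj₂ q = q

  Prime-∤∣² : ∀ {Q v x} → Prime Q → ¬ (Q ∣ v) → Q ∣ v * (x * x) → Q ∣ x
  Prime-∤∣² π n d = Prime-∣² π (Coprime-∣ (∤⇒Coprime π n) d)

  -- Irreducibility as a statement about factors of bounded degree: this form can be decided by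
  -- search over a finite field and passes through the ultraproduct.
  NoFactor : Poly → ℕ → Set
  NoFactor Q n = ∀ a b → Deg< n a → Deg< n b → ¬ (Q ≈ a * b)

  -- Write Q = d e with d the greatest common divisor of Q and x. One of d, e has degree zero: if it
  -- is d, then Q and x are coprime; if it is e, then Q divides x.
  NoFactor⇒Prime : ∀ {Q n} → Degree Q (suc n) → NoFactor Q (suc n) → Prime Q
  NoFactor⇒Prime {Q} {n} dQ nf = prime dQ dich
    where
    dich : ∀ x → Q ∣ x ⊎ Coprime Q x
    dich x with bezout Q x
    ... | d , (e , Q≈de) , (x′ , x≈dx′) , u , v , eq with degree? d | degree? e
    ...   | inj₁ z | _ = ⊥-elim (Degree⇒≉0 dQ (trans Q≈de (trans (*-congʳ z) (zeroˡ e))))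
    ...   | inj₂ _ | inj₁ z = ⊥-elim (Degree⇒≉0 dQ (trans Q≈de (trans (*-congˡ z) (zeroʳ d))))
    ...   | inj₂ (zero , dd) | inj₂ _ with Degree-0 dd
    ...     | i , di = inj₂ (i * u , i * v , (begin
              i * u * Q + i * v * x ≈⟨ solve 5 (λ i u q v x → i :* u :* q :+ i :* v :* x := (u :* q :+ v :* x) :* i) i u Q v x ⟩
              (u * Q + v * x) * i ≈⟨ *-congʳ eq ⟨
              d * i ≈⟨ di ⟩
              1# ∎))
    dich x | d , (e , Q≈de) , (x′ , x≈dx′) , u , v , eq | inj₂ (suc m , dd) | inj₂ (zero , de) with Degree-0 de
    ...     | i , ei = inj₁ (i * x′ , (begin
              x ≈⟨ trans x≈dx′ (sym (*-identityˡ _)) ⟩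
              1# * (d * x′) ≈⟨ *-congʳ ei ⟨
              e * i * (d * x′) ≈⟨ solve 4 (λ e i d x → e :* i :* (d :* x) := d :* e :* (i :* x)) e i d x′ ⟩
              d * e * (i * x′) ≈⟨ *-congʳ Q≈de ⟨
              Q * (i * x′) ∎))
    dich x | d , (e , Q≈de) , (x′ , x≈dx′) , u , v , eq | inj₂ (suc m , dd) | inj₂ (suc k , de) =
      ⊥-elim (nf d e (Deg<-mono (s≤s m<n) (bound dd)) (Deg<-mono (s≤s k<n) (bound de)) Q≈de)
      where
      sum≡ : suc (m ℕ.+ suc k) ≡ suc n
      sum≡ = Degree-unique (Degree-* dd de) (Degree-cong Q≈de dQ)
      m<n : suc m ≤ n
      m<n = subst (suc m ≤_) (≡.trans (≡.sym (+-suc m k)) (ℕₚ.suc-injective sum≡)) (s≤s (m≤m+n m k))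
      k<n : suc k ≤ n
      k<n = subst (suc k ≤_) (ℕₚ.suc-injective sum≡) (m≤n+m (suc k) m)

  Deg<-quotient : ∀ {Q k n A} → Degree Q k → Deg< (k ℕ.+ n) (Q * A) → Deg< n A
  Deg<-quotient {Q} {k} {n} {A} dQ l with degree? A
  ... | inj₁ z = ≈0⇒Deg< z
  ... | inj₂ (m , d) = Deg<-mono (ℕₚ.+-cancelˡ-≤ k (suc m) n
          (subst (_≤ k ℕ.+ n) (≡.sym (+-suc k m)) (Degree-Deg< (Degree-* dQ d) l))) (bound d)

  Deg<-quotient-prime : ∀ {Q n A} → Prime Q → Deg< (suc n) (Q * A) → Deg< n A
  Deg<-quotient-prime {n = n} π l = Deg<-quotient (nonconstant π) (Deg<-mono (s≤s (m≤n+m n _)) l)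

  -- Infinite descent: both variables of an Eisenstein form are divisible by ϖ.
  eisenstein : ∀ {ϖ} → Prime ϖ → ∀ v b e → ¬ (ϖ ∣ v) → ¬ (ϖ ∣ e) → ∀ B A →
    v * (B * B) + ϖ * (b * (A * B) + e * (A * A)) ≈ 0# → B ≈ 0# × A ≈ 0#
  eisenstein {ϖ} π v b e ϖ∤v ϖ∤e B A = go (ℕ._⊔_ (length B) (length A)) B A
    (Deg<-mono (ℕₚ.m≤m⊔n _ _) (Deg<-length B)) (Deg<-mono (ℕₚ.m≤n⊔m _ _) (Deg<-length A))
    where
    go : ∀ n B A → Deg< n B → Deg< n A →
      v * (B * B) + ϖ * (b * (A * B) + e * (A * A)) ≈ 0# → B ≈ 0# × A ≈ 0#
    go zero B A dB dA _ = Deg<0⇒≈0 dB , Deg<0⇒≈0 dA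
    go (suc n) B A dB dA eq = conclude
      where
      ϖ∣vBB : ϖ ∣ v * (B * B)
      ϖ∣vBB = - (b * (A * B) + e * (A * A)) , (begin
        v * (B * B) ≈⟨ solve 2 (λ x y → x := (x :+ y) :- y) (v * (B * B)) (ϖ * (b * (A * B) + e * (A * A))) ⟩
        (v * (B * B) + ϖ * (b * (A * B) + e * (A * A))) - ϖ * (b * (A * B) + e * (A * A)) ≈⟨ +-congʳ eq ⟩
        0# - ϖ * (b * (A * B) + e * (A * A)) ≈⟨ solve 2 (λ p x → :0 :- p :* x := p :* :- x) ϖ (b * (A * B) + e * (A * A)) ⟩
        ϖ * - (b * (A * B) + e * (A * A)) ∎)
      ϖ∣B : ϖ ∣ B
      ϖ∣B = Prime-∤∣² π ϖ∤v ϖ∣vBB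
      B′ : Poly
      B′ = proj₁ ϖ∣B
      eq₁ : v * (ϖ * (B′ * B′)) + (b * (A * (ϖ * B′)) + e * (A * A)) ≈ 0#
      eq₁ = cancelˡ (Prime-≉0 π) (begin
        ϖ * (v * (ϖ * (B′ * B′)) + (b * (A * (ϖ * B′)) + e * (A * A)))
          ≈⟨ solve 6 (λ w v c b a e → w :* (v :* (w :* (c :* c)) :+ (b :* (a :* (w :* c)) :+ e :* (a :* a))) := v :* ((w :* c) :* (w :* c)) :+ w :* (b :* (a :* (w :* c)) :+ e :* (a :* a))) ϖ v B′ b A e ⟩
        v * ((ϖ * B′) * (ϖ * B′)) + ϖ * (b * (A * (ϖ * B′)) + e * (A * A))
          ≈⟨ +-cong (*-congˡ (*-cong (proj₂ ϖ∣B) (proj₂ ϖ∣B))) (*-congˡ (+-congʳ (*-congˡ (*-congˡ (proj₂ ϖ∣B))))) ⟨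
        v * (B * B) + ϖ * (b * (A * B) + e * (A * A)) ≈⟨ trans eq (sym (zeroʳ ϖ)) ⟩
        ϖ * 0# ∎)
      ϖ∣eAA : ϖ ∣ e * (A * A)
      ϖ∣eAA = - (v * (B′ * B′) + b * (A * B′)) , (begin
        e * (A * A) ≈⟨ solve 6 (λ w v c b a e → e :* (a :* a) := (v :* (w :* (c :* c)) :+ (b :* (a :* (w :* c)) :+ e :* (a :* a))) :+ w :* :- (v :* (c :* c) :+ b :* (a :* c))) ϖ v B′ b A e ⟩
        (v * (ϖ * (B′ * B′)) + (b * (A * (ϖ * B′)) + e * (A * A))) + ϖ * - (v * (B′ * B′) + b * (A * B′)) ≈⟨ trans (+-congʳ eq₁) (+-identityˡ _) ⟩
        ϖ * - (v * (B′ * B′) + b * (A * B′)) ∎)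
      ϖ∣A : ϖ ∣ A
      ϖ∣A = Prime-∤∣² π ϖ∤e ϖ∣eAA
      A′ : Poly
      A′ = proj₁ ϖ∣A
      eq₂ : v * (B′ * B′) + ϖ * (b * (A′ * B′) + e * (A′ * A′)) ≈ 0#
      eq₂ = cancelˡ (Prime-≉0 π) (begin
        ϖ * (v * (B′ * B′) + ϖ * (b * (A′ * B′) + e * (A′ * A′)))
          ≈⟨ solve 6 (λ w v c b a e → w :* (v :* (c :* c) :+ w :* (b :* (a :* c) :+ e :* (a :* a))) := v :* (w :* (c :* c)) :+ (b :* ((w :* a) :* (w :* c)) :+ e :* ((w :* a) :* (w :* a)))) ϖ v B′ b A′ e ⟩
        v * (ϖ * (B′ * B′)) + (b * ((ϖ * A′) * (ϖ * B′)) + e * ((ϖ * A′) * (ϖ * A′)))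
          ≈⟨ +-congˡ (+-cong (*-congˡ (*-congʳ (proj₂ ϖ∣A))) (*-congˡ (*-cong (proj₂ ϖ∣A) (proj₂ ϖ∣A)))) ⟨
        v * (ϖ * (B′ * B′)) + (b * (A * (ϖ * B′)) + e * (A * A)) ≈⟨ trans eq₁ (sym (zeroʳ ϖ)) ⟩
        ϖ * 0# ∎)
      smaller : B′ ≈ 0# × A′ ≈ 0#
      smaller = go n B′ A′ (Deg<-quotient-prime π (Deg<-cong (proj₂ ϖ∣B) dB)) (Deg<-quotient-prime π (Deg<-cong (proj₂ ϖ∣A) dA)) eq₂
      conclude : B ≈ 0# × A ≈ 0#
      conclude = trans (proj₂ ϖ∣B) (trans (*-congˡ (proj₁ smaller)) (zeroʳ ϖ))
               , trans (proj₂ ϖ∣A) (trans (*-congˡ (proj₂ smaller)) (zeroʳ ϖ))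

  open EvalOver (idHom K.commRing) public renaming (ev to eval; ev-cong to eval-cong; ev-+ to eval-+; ev-* to eval-*; ev-const to eval-const; ev-X to eval-X; evHom to evalHom; ev-scale to eval-scale)

  eval-neg : ∀ a p → eval a (- p) K.≈ K.- eval a p
  eval-neg a p = RingHom.to-neg (evalHom a) p

  eval-1 : ∀ a → eval a 1# K.≈ K.1#
  eval-1 a = RingHom.to-1 (evalHom a)

  t- : K.Carrier → Poly
  t- a = X - const a

  Degree-t- : ∀ a → Degree (t- a) 1
  Degree-t- a = degree
    (λ e → lead≉0 Degree-X (K.trans (K.sym (K.trans (coeff-+ X (- const a) 1) (K.trans (K.+-congˡ c) (K.+-identityʳ _)))) e))
    (Deg<-+ (bound Degree-X) (Deg<-neg (Deg<-mono (s≤s z≤n) (Deg<-const a))))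
    where
    c : coeff (- const a) 1 K.≈ K.0#
    c = vanish (Deg<-neg (Deg<-const a)) 1 (s≤s z≤n)

  eval-t- : ∀ x a → eval x (t- a) K.≈ x K.- a
  eval-t- x a = K.trans (eval-+ x X (- const a)) (K.+-cong (eval-X x) (K.trans (eval-neg x (const a)) (K.-‿cong (eval-const x a))))

  eval-root : ∀ a → eval a (t- a) K.≈ K.0#
  eval-root a = K.trans (eval-t- a a) (K.-‿inverseʳ a)

  opaque
    remainder : ∀ a p → ∃ λ q → p ≈ t- a * q + const (eval a p)
    remainder a p with divMod (Degree-t- a) p
    ... | q , r , e , l = q , trans e (+-congˡ (trans (Deg<1⇒const l) (const-cong (K.sym value))))
      where
      value : eval a p K.≈ coeff r 0
      value = K.trans (eval-cong a e) (K.trans (eval-+ a (t- a * q) r) (K.trans (K.+-cong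
        (K.trans (eval-* a (t- a) q) (K.trans (K.*-congʳ (eval-root a)) (K.zeroˡ _)))
        (K.trans (eval-cong a (Deg<1⇒const l)) (eval-const a (coeff r 0)))) (K.+-identityˡ _)))

  root⇒∣ : ∀ {a p} → eval a p K.≈ K.0# → t- a ∣ p
  root⇒∣ {a} {p} e with remainder a p
  ... | q , f = q , trans f (trans (+-congˡ (trans (const-cong e) const-0)) (+-identityʳ _))

  ∣⇒root : ∀ {a p} → t- a ∣ p → eval a p K.≈ K.0#
  ∣⇒root {a} (q , e) = K.trans (eval-cong a e) (K.trans (eval-* a (t- a) q) (K.trans (K.*-congʳ (eval-root a)) (K.zeroˡ _)))

  Prime-t- : ∀ a → Prime (t- a)
  Prime-t- a = prime (Degree-t- a) dich
    where
    dich : ∀ x → t- a ∣ x ⊎ Coprime (t- a) x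
    dich x with eval a x K.≟ K.0#
    ... | yes e = inj₁ (root⇒∣ e)
    ... | no n with remainder a x | K.invert (eval a x) n
    ...   | q , f | i , g = inj₂ (- (const i * q) , const i , (begin
            - (const i * q) * t- a + const i * x ≈⟨ +-congˡ (*-congˡ f) ⟩
            - (const i * q) * t- a + const i * (t- a * q + const (eval a x))
              ≈⟨ solve 4 (λ i q t c → :- (i :* q) :* t :+ i :* (t :* q :+ c) := c :* i) (const i) q (t- a) (const (eval a x)) ⟩
            const (eval a x) * const i ≈⟨ const-inverse g ⟩
            1# ∎))

-- Homogeneous linear systems with more unknowns than equations.

module LinearRelations (F : DecField) where
  private module K = DecField F
  open SolverOver K.commRing
  open import Relation.Binary.Reasoning.Setoid K.setoid

  Row : ℕ → Set
  Row n = Vec K.Carrier n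

  _∙_ : ∀ {n} → Row n → Row n → K.Carrier
  [] ∙ [] = K.0#
  (a ∷ r) ∙ (b ∷ v) = a K.* b K.+ r ∙ v

  data NonZero : ∀ {n} → Row n → Set where
    here : ∀ {n a} {v : Row n} → ¬ (a K.≈ K.0#) → NonZero (a ∷ v)
    there : ∀ {n a} {v : Row n} → NonZero v → NonZero (a ∷ v)

  private
    zeros : ∀ {n} → Row n
    zeros {zero} = []
    zeros {suc n} = K.0# ∷ zeros

    ∙-zeros : ∀ {n} (r : Row n) → r ∙ zeros K.≈ K.0#
    ∙-zeros [] = K.refl
    ∙-zeros (a ∷ r) = K.trans (K.+-cong (K.zeroʳ a) (∙-zeros r)) (K.+-identityˡ _)

    combine : ∀ {n} → K.Carrier → Row n → Row n → Row n
    combine c [] [] = []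
    combine c (a ∷ r) (b ∷ s) = (b K.- c K.* a) ∷ combine c r s

    ∙-combine : ∀ {n} c (r s v : Row n) → combine c r s ∙ v K.≈ s ∙ v K.- c K.* (r ∙ v)
    ∙-combine c [] [] [] = solve 1 (λ c → :0 := :0 :- c :* :0) c
    ∙-combine c (a ∷ r) (b ∷ s) (x ∷ v) = begin
      (b K.- c K.* a) K.* x K.+ combine c r s ∙ v ≈⟨ K.+-congˡ (∙-combine c r s v) ⟩
      (b K.- c K.* a) K.* x K.+ (s ∙ v K.- c K.* (r ∙ v))
        ≈⟨ solve 6 (λ a b c x r s → (b :- c :* a) :* x :+ (s :- c :* r) := (b :* x :+ s) :- c :* (a :* x :+ r)) a b c x (r ∙ v) (s ∙ v) ⟩
      (b K.* x K.+ s ∙ v) K.- c K.* (a K.* x K.+ r ∙ v) ∎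

    Kills : ∀ {n} → Row n → Row n → Set
    Kills v r = r ∙ v K.≈ K.0#

    record Pivot {n} (rows : List (Row (suc n))) : Set where
      constructor mkPivot
      field
        row : Row (suc n)
        head≉0 : ¬ (Vec.head row K.≈ K.0#)
        rest : List (Row n)
        shorter : suc (length rest) ≡ length rows
        enough : ∀ v → Kills v row → All (Kills (Vec.tail v)) rest → All (Kills v) rows

    noHead : ∀ {n} (r : Row (suc n)) → Vec.head r K.≈ K.0# → r ∙ (K.1# ∷ zeros) K.≈ K.0#
    noHead (a ∷ r) e = K.trans (K.+-cong (K.trans (K.*-congʳ e) (K.zeroˡ _)) (∙-zeros r)) (K.+-identityˡ _)

    eliminate : ∀ {n} (row : Row (suc n)) → ¬ (Vec.head row K.≈ K.0#) → (s : Row (suc n)) →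
      Σ (Row n) λ s′ → ∀ v → Kills v row → Kills (Vec.tail v) s′ → Kills v s
    eliminate (a ∷ r) a≉0 (b ∷ s) with FieldLemmas.divide F b a a≉0
    ... | c , ca≈b = combine c r s , λ { (x ∷ v) kr ks → begin
      b K.* x K.+ s ∙ v ≈⟨ K.+-congʳ (K.*-congʳ ca≈b) ⟨
      c K.* a K.* x K.+ s ∙ v ≈⟨ solve 5 (λ a c x r s → c :* a :* x :+ s := (s :- c :* r) :+ c :* (a :* x :+ r)) a c x (r ∙ v) (s ∙ v) ⟩
      (s ∙ v K.- c K.* (r ∙ v)) K.+ c K.* (a K.* x K.+ r ∙ v) ≈⟨ K.+-cong (K.trans (K.sym (∙-combine c r s v)) ks) (K.*-congˡ kr) ⟩
      K.0# K.+ c K.* K.0# ≈⟨ K.trans (K.+-identityˡ _) (K.zeroʳ c) ⟩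
      K.0# ∎ }

    eliminateAll : ∀ {n} (row : Row (suc n)) → ¬ (Vec.head row K.≈ K.0#) → (rows : List (Row (suc n))) →
      Σ (List (Row n)) λ rest → (length rest ≡ length rows) ×
        (∀ v → Kills v row → All (Kills (Vec.tail v)) rest → All (Kills v) rows)
    eliminateAll row h [] = [] , ≡.refl , λ _ _ _ → []
    eliminateAll row h (s ∷ rows) with eliminate row h s | eliminateAll row h rows
    ... | s′ , f | rest , e , g = s′ ∷ rest , cong suc e , λ { v k (k₁ ∷ ks) → f v k k₁ ∷ g v k ks }

    findPivot : ∀ {n} (rows : List (Row (suc n))) → All (Kills (K.1# ∷ zeros)) rows ⊎ Pivot rows
    findPivot [] = inj₁ []
    findPivot (r ∷ rows) with Vec.head r K.≟ K.0#
    ... | no h with eliminateAll r h rows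
    ...   | rest , e , g = inj₂ (mkPivot r h rest (cong suc e) λ v k ks → k ∷ g v k ks)
    findPivot (r ∷ rows) | yes z with findPivot rows
    ...   | inj₁ all = inj₁ (noHead r z ∷ all)
    ...   | inj₂ (mkPivot row h rest e g) with eliminate row h r
    ...     | r′ , f = inj₂ (mkPivot row h (r′ ∷ rest) (cong suc e) λ { v k (k₁ ∷ ks) → f v k k₁ ∷ g v k ks })

  -- Gaussian elimination: a pivot in the first column removes one row together with one unknown,
  -- and a column without pivot makes the first unit vector a solution.
  kernel : ∀ {n} (rows : List (Row n)) → length rows < n → ∃ λ v → NonZero v × All (λ r → r ∙ v K.≈ K.0#) rows
  kernel {suc n} rows l with findPivot rows
  ... | inj₁ all = K.1# ∷ zeros , here K.1≉0 , all
  ... | inj₂ (mkPivot (a ∷ r) h rest e g) with kernel rest (≤-pred (subst (_< suc n) (≡.sym e) l))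
  ...   | w , nz , ks with FieldLemmas.divide F (K.- (r ∙ w)) a h
  ...     | x , xa = x ∷ w , there nz , g (x ∷ w) (begin
        a K.* x K.+ r ∙ w ≈⟨ K.+-congʳ (K.trans (K.*-comm a x) xa) ⟩
        K.- (r ∙ w) K.+ r ∙ w ≈⟨ K.-‿inverseˡ _ ⟩
        K.0# ∎) ks

module PolynomialRelations (F : DecField) where
  open FieldPoly F
  open LinearRelations F public

  lincomb : ∀ {n} → Row n → Vec Poly n → Poly
  lincomb [] [] = 0#
  lincomb (a ∷ v) (p ∷ ps) = scale a p + lincomb v ps

  column : ∀ {n} → ℕ → Vec Poly n → Row n
  column i = Vec.map (λ p → coeff p i)

  columns : ∀ {n} → ℕ → Vec Poly n → List (Row n)
  columns zero ps = []
  columns (suc m) ps = column m ps ∷ columns m ps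

  private
    length-columns : ∀ {n} m (ps : Vec Poly n) → length (columns m ps) ≡ m
    length-columns zero ps = ≡.refl
    length-columns (suc m) ps = cong suc (length-columns m ps)

    coeff-lincomb : ∀ {n} i v (ps : Vec Poly n) → coeff (lincomb v ps) i K.≈ column i ps ∙ v
    coeff-lincomb i [] [] = K.refl
    coeff-lincomb i (a ∷ v) (p ∷ ps) = K.trans (coeff-+ (scale a p) _ i)
      (K.+-cong (K.trans (coeff-scale a p i) (K.*-comm _ _)) (coeff-lincomb i v ps))

    killed : ∀ {n} m v (ps : Vec Poly n) → All (λ r → r ∙ v K.≈ K.0#) (columns m ps) → ∀ i → i < m → coeff (lincomb v ps) i K.≈ K.0#
    killed (suc m) v ps (k ∷ ks) i (s≤s i≤m) with ℕₚ.m≤n⇒m<n∨m≡n i≤m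
    ... | inj₁ i<m = killed m v ps ks i i<m
    ... | inj₂ ≡.refl = K.trans (coeff-lincomb i v ps) k

  relation : ∀ {m n} (ps : Vec Poly n) → m < n → ∃ λ v → NonZero v × (∀ i → i < m → coeff (lincomb v ps) i K.≈ K.0#)
  relation {m} {n} ps l with kernel (columns m ps) (subst (_< n) (≡.sym (length-columns m ps)) l)
  ... | v , nz , ks = v , nz , killed m v ps ks

-- Minkowski's argument and binary norm forms.

halve : ∀ n → (∃ λ g → n ≡ g ℕ.+ g) ⊎ (∃ λ g → n ≡ suc (g ℕ.+ g))
halve zero = inj₁ (0 , ≡.refl)
halve (suc n) with halve n
... | inj₁ (g , e) = inj₂ (g , cong suc e)
... | inj₂ (g , e) = inj₁ (suc g , cong suc (≡.trans e (≡.sym (+-suc g g))))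

module NormForms (F : DecField) where
  open FieldPoly F
  open PolynomialRelations F
  open import Relation.Binary.Reasoning.Setoid setoid

  NonZero⇒≉0 : ∀ {n} {v : Row n} → NonZero v → ¬ (toList v ≈ 0#)
  NonZero⇒≉0 (here a≉0) e = a≉0 (at e 0)
  NonZero⇒≉0 (there nz) e = NonZero⇒≉0 nz ([]-tail e)

  NonZero-++ : ∀ {m n} (v : Row m) {w : Row n} → NonZero (v Vec.++ w) → NonZero v ⊎ NonZero w
  NonZero-++ [] nz = inj₂ nz
  NonZero-++ (a ∷ v) (here a≉0) = inj₁ (here a≉0)
  NonZero-++ (a ∷ v) (there nz) with NonZero-++ v nz
  ... | inj₁ l = inj₁ (there l)
  ... | inj₂ r = inj₂ r

  private
    powers : (n : ℕ) → Poly → Vec Poly n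
    powers zero p = []
    powers (suc n) p = p ∷ powers n (X * p)

    lincomb-powers : ∀ {n} (v : Row n) p → lincomb v (powers n p) ≈ toList v * p
    lincomb-powers [] p = sym (zeroˡ p)
    lincomb-powers (a ∷ v) p = begin
      scale a p + lincomb v (powers _ (X * p)) ≈⟨ +-cong (sym (const-* a p)) (lincomb-powers v (X * p)) ⟩
      const a * p + toList v * (X * p) ≈⟨ solve 4 (λ a p v x → a :* p :+ v :* (x :* p) := (a :+ x :* v) :* p) (const a) p (toList v) X ⟩
      (const a + X * toList v) * p ≈⟨ *-congʳ (∷-split a (toList v)) ⟨
      (a ∷ toList v) * p ∎

    lincomb-++ : ∀ {m n} (v : Row m) (w : Row n) ps qs → lincomb (v Vec.++ w) (ps Vec.++ qs) ≈ lincomb v ps + lincomb w qs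
    lincomb-++ [] w [] qs = sym (+-identityˡ _)
    lincomb-++ (a ∷ v) w (p ∷ ps) qs = trans (+-congˡ (lincomb-++ v w ps qs)) (sym (+-assoc _ _ _))

    Deg<-toList : ∀ {n} (v : Row n) → Deg< n (toList v)
    Deg<-toList [] = Deg<-0
    Deg<-toList (a ∷ v) = Deg<-∷ (Deg<-toList v)

    module _ {c m} (dc : Degree c m) where
      reduce : Poly → Poly
      reduce p = proj₁ (proj₂ (divMod dc p))

      Deg<-reduce : ∀ {n} v (ps : Vec Poly n) → Deg< m (lincomb v (Vec.map reduce ps))
      Deg<-reduce [] [] = Deg<-0
      Deg<-reduce (a ∷ v) (p ∷ ps) = Deg<-+ (Deg<-scale a (proj₂ (proj₂ (proj₂ (divMod dc p))))) (Deg<-reduce v ps)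

      ∣-reduce : ∀ {n} v (ps : Vec Poly n) → c ∣ lincomb v ps - lincomb v (Vec.map reduce ps)
      ∣-reduce [] [] = 0# , trans (-‿inverseʳ 0#) (sym (zeroʳ c))
      ∣-reduce (a ∷ v) (p ∷ ps) = const a * q + s , (begin
        (scale a p + L) - (scale a r + L′) ≈⟨ +-cong (+-congʳ (const-* a p)) (-‿cong (+-congʳ (const-* a r))) ⟨
        (const a * p + L) - (const a * r + L′) ≈⟨ +-congʳ (+-congʳ (*-congˡ e)) ⟩
        (const a * (c * q + r) + L) - (const a * r + L′)
          ≈⟨ solve 6 (λ a c q r l k → (a :* (c :* q :+ r) :+ l) :- (a :* r :+ k) := c :* (a :* q) :+ (l :- k)) (const a) c q r L L′ ⟩
        c * (const a * q) + (L - L′) ≈⟨ +-congˡ f ⟩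
        c * (const a * q) + c * s ≈⟨ distribˡ c _ _ ⟨
        c * (const a * q + s) ∎)
        where
        q r s L L′ : Poly
        q = proj₁ (divMod dc p)
        r = reduce p
        L = lincomb v ps
        L′ = lincomb v (Vec.map reduce ps)
        s = proj₁ (∣-reduce v ps)
        e : p ≈ c * q + r
        e = proj₁ (proj₂ (proj₂ (divMod dc p)))
        f : L - L′ ≈ c * s
        f = proj₂ (∣-reduce v ps)

  -- Minkowski's theorem for the lattice { (y , w) : y ≡ θ w mod c }.
  short-vector : ∀ {c m} → Degree c m → ∀ θ n₁ n₂ → m < n₁ ℕ.+ n₂ →
    ∃₂ λ y w → Deg< n₁ y × Deg< n₂ w × ¬ (y ≈ 0# × w ≈ 0#) × c ∣ y - θ * w
  -- The unknowns are the n₁ + n₂ coefficients of y and w, and the m equations say that the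
  -- remainder of y - θ w modulo c vanishes.
  short-vector {c} {m} dc θ n₁ n₂ l with relation {m} (Vec.map (reduce dc) (powers n₁ 1# Vec.++ powers n₂ (- θ))) l
  ... | v , nz , zero< with Vec.splitAt n₁ v
  ...   | v₁ , v₂ , ≡.refl = toList v₁ , toList v₂ , Deg<-toList v₁ , Deg<-toList v₂ , nontrivial , ∣-cong eq (∣-reduce dc (v₁ Vec.++ v₂) qs)
    where
    qs : Vec Poly (n₁ ℕ.+ n₂)
    qs = powers n₁ 1# Vec.++ powers n₂ (- θ)
    nontrivial : ¬ (toList v₁ ≈ 0# × toList v₂ ≈ 0#)
    nontrivial (e₁ , e₂) with NonZero-++ v₁ nz
    ... | inj₁ z = NonZero⇒≉0 z e₁
    ... | inj₂ z = NonZero⇒≉0 z e₂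
    rest≈0 : lincomb (v₁ Vec.++ v₂) (Vec.map (reduce dc) qs) ≈ 0#
    rest≈0 = mk≈ low
      where
      low : ∀ i → coeff (lincomb (v₁ Vec.++ v₂) (Vec.map (reduce dc) qs)) i K.≈ K.0#
      low i with i ℕₚ.<? m
      ... | yes i<m = zero< i i<m
      ... | no i≮m = vanish (Deg<-reduce dc (v₁ Vec.++ v₂) qs) i (ℕₚ.≮⇒≥ i≮m)
    eq : lincomb (v₁ Vec.++ v₂) qs - lincomb (v₁ Vec.++ v₂) (Vec.map (reduce dc) qs) ≈ toList v₁ - θ * toList v₂
    eq = begin
      lincomb (v₁ Vec.++ v₂) qs - lincomb (v₁ Vec.++ v₂) (Vec.map (reduce dc) qs) ≈⟨ +-cong (lincomb-++ v₁ v₂ _ _) (-‿cong rest≈0) ⟩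
      (lincomb v₁ (powers n₁ 1#) + lincomb v₂ (powers n₂ (- θ))) - 0# ≈⟨ +-congʳ (+-cong (lincomb-powers v₁ 1#) (lincomb-powers v₂ (- θ))) ⟩
      (toList v₁ * 1# + toList v₂ * - θ) - 0#
        ≈⟨ solve 3 (λ y w t → (y :* :1 :+ w :* :- t) :- :0 := y :- t :* w) (toList v₁) (toList v₂) θ ⟩
      toList v₁ - θ * toList v₂ ∎

  private
    ⌈/2⌉≤ : ∀ m → ⌈ m /2⌉ ≤ suc ⌊ m /2⌋
    ⌈/2⌉≤ zero = z≤n
    ⌈/2⌉≤ (suc zero) = s≤s z≤n
    ⌈/2⌉≤ (suc (suc m)) = s≤s (⌈/2⌉≤ m)

  record Represents (B E c : Poly) (m : ℕ) : Set where
    field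
      y w : Poly
      κ : K.Carrier
      represents : y * y + B * (y * w) + E * (w * w) ≈ const κ * c
      nontrivial : ¬ (y ≈ 0# × w ≈ 0#)
      Deg<-y : Deg< (suc ⌊ m /2⌋) y
      Deg<-w : Deg< ⌈ m /2⌉ w

  -- A box with ⌊m/2⌋ + 1 coefficients for y and ⌈m/2⌉ for w has m + 1 unknowns, one more than the
  -- equations. As B and E are at most linear, the form has degree at most m on this box; it is
  -- divisible by c of degree m, so the quotient is a constant.
  representation : ∀ {c m} → Degree c m → ∀ B E → Deg< 2 B → Deg< 2 E → ∀ θ → c ∣ θ * θ + B * θ + E → Represents B E c m
  representation {c} {m} dc B E dB dE θ (g , ge) = build (short-vector dc θ (suc h) h′ (s≤s (≤-reflexive (≡.sym (ℕₚ.⌊n/2⌋+⌈n/2⌉≡n m)))))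
    where
    h h′ : ℕ
    h = ⌊ m /2⌋
    h′ = ⌈ m /2⌉
    build : (∃₂ λ y w → Deg< (suc h) y × Deg< h′ w × ¬ (y ≈ 0# × w ≈ 0#) × c ∣ y - θ * w) → Represents B E c m
    build (y , w , dy , dw , nt , s , e) = record
      { y = y ; w = w ; κ = coeff κ 0
      ; represents = trans N≈cκ (trans (*-comm c κ) (*-congʳ (Deg<1⇒const κ-const)))
      ; nontrivial = nt
      ; Deg<-y = dy
      ; Deg<-w = dw }
      where
      κ N : Poly
      -- The quotient of the form by c, read off from θ² + B θ + E = c g and y - θ w = c s.
      κ = g * (w * w) + s * (y + θ * w + B * w)
      N = y * y + B * (y * w) + E * (w * w)
      N≈cκ : N ≈ c * κ
      N≈cκ = begin
        y * y + B * (y * w) + E * (w * w)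
          ≈⟨ solve 5 (λ y w b e t → y :* y :+ b :* (y :* w) :+ e :* (w :* w) := (t :* t :+ b :* t :+ e) :* (w :* w) :+ (y :- t :* w) :* (y :+ t :* w :+ b :* w)) y w B E θ ⟩
        (θ * θ + B * θ + E) * (w * w) + (y - θ * w) * (y + θ * w + B * w) ≈⟨ +-cong (*-congʳ ge) (*-congʳ e) ⟩
        c * g * (w * w) + c * s * (y + θ * w + B * w) ≈⟨ +-cong (*-assoc c g _) (*-assoc c s _) ⟩
        c * (g * (w * w)) + c * (s * (y + θ * w + B * w)) ≈⟨ distribˡ c _ _ ⟨
        c * κ ∎
      h+h′ : h ℕ.+ h′ ≡ m
      h+h′ = ℕₚ.⌊n/2⌋+⌈n/2⌉≡n m
      dyy : Deg< (suc m) (y * y)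
      dyy = Deg<-mono (s≤s (subst (h ℕ.+ h ≤_) h+h′ (+-monoʳ-≤ h (ℕₚ.⌊n/2⌋≤⌈n/2⌉ m)))) (Deg<-* y dy dy)
      dyw : Deg< (suc m) (B * (y * w))
      dyw = Deg<-cong (solve 3 (λ w y b → w :* y :* b := b :* (y :* w)) w y B)
        (Deg<-mono (≤-reflexive (≡.trans (ℕₚ.+-comm (h′ ℕ.+ h) 1) (cong suc (≡.trans (ℕₚ.+-comm h′ h) h+h′))))
          (Deg<-* (w * y) (Deg<-* w dw dy) dB))
      ww : ∀ k → k ≡ h′ → Deg< k w → Deg< (suc m) (w * w * E)
      ww zero _ d = ≈0⇒Deg< (trans (*-congʳ (trans (*-congʳ (Deg<0⇒≈0 d)) (zeroˡ w))) (zeroˡ E))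
      ww (suc k) p d = Deg<-mono (subst₂ _≤_ (ℕₚ.+-comm 1 (suc k ℕ.+ k)) (cong suc h+h′)
          (subst (λ z → z ≤ suc (h ℕ.+ h′)) (cong suc (+-suc k k)) (subst (λ z → suc k ℕ.+ suc k ≤ suc (h ℕ.+ z)) p
            (ℕₚ.+-monoˡ-≤ (suc k) (subst (_≤ suc h) (≡.sym p) (⌈/2⌉≤ m))))))
        (Deg<-* (w * w) (Deg<-* w d d) dE)
      dww : Deg< (suc m) (E * (w * w))
      dww = Deg<-cong (*-comm (w * w) E) (ww h′ ≡.refl dw)
      κ-const : Deg< 1 κ
      κ-const = Deg<-quotient dc (subst (λ k → Deg< k (c * κ)) (ℕₚ.+-comm 1 m) (Deg<-cong N≈cκ (Deg<-+ (Deg<-+ dyy dyw) dww)))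

  const-*-t-≤ : ∀ a b → Deg< 2 (const b * t- a)
  const-*-t-≤ a b = Deg<-* (const b) (Deg<-const b) (bound (Degree-t- a))

  ∤const : ∀ {Q e} → Prime Q → ¬ (e K.≈ K.0#) → ¬ (Q ∣ const e)
  ∤const {Q} {e} π e≉0 d with K.invert e e≉0
  ... | i , ei = Prime-∤1 π (∣-cong (const-inverse ei) (∣-*ʳ (const i) d))

  ∤t- : ∀ {a b} → ¬ (a K.≈ b) → ¬ (t- a ∣ t- b)
  ∤t- {a} {b} a≉b d = a≉b (Kₗ.x-y≈0⇒x≈y (K.trans (K.sym (eval-t- a b)) (∣⇒root d)))

  -- Norm form of θ² + (t - a)(b θ + e). With b = 0, e = 1 this is the extension by the square root
  -- of -(t - a); with b = 1, e = β it is the Artin-Schreier extension of β / (t - a), as the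
  -- substitution θ = (t - a) η shows.
  record Norm₁ (a b e : K.Carrier) (c : Poly) (m : ℕ) : Set where
    field
      y w : Poly
      κ : K.Carrier
      κ≉0 : ¬ (κ K.≈ K.0#)
      norm : y * y + t- a * (const b * (w * y) + const e * (w * w)) ≈ const κ * c
      Deg<-y : Deg< (suc ⌊ m /2⌋) y
      Deg<-w : Deg< ⌈ m /2⌉ w

  norm₁ : ∀ {c m} → Degree c m → ∀ a b e → ¬ (e K.≈ K.0#) → ∀ θ →
    c ∣ θ * θ + t- a * (const b * θ + const e) → Norm₁ a b e c m
  norm₁ {c} {m} dc a b e e≉0 θ d = build (representation dc (const b * t- a) (const e * t- a) (const-*-t-≤ a b) (const-*-t-≤ a e) θ
      (∣-cong (solve 4 (λ θ b t e → θ :* θ :+ t :* (b :* θ :+ e) := θ :* θ :+ b :* t :* θ :+ e :* t) θ (const b) (t- a) (const e)) d))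
    where
    build : Represents (const b * t- a) (const e * t- a) c m → Norm₁ a b e c m
    build r = record { y = y ; w = w ; κ = κ ; κ≉0 = κ≉0 ; norm = norm ; Deg<-y = Deg<-y ; Deg<-w = Deg<-w }
      where
      open Represents r
      norm : y * y + t- a * (const b * (w * y) + const e * (w * w)) ≈ const κ * c
      norm = trans (solve 5 (λ y w b t e → y :* y :+ t :* (b :* (w :* y) :+ e :* (w :* w)) := y :* y :+ b :* t :* (y :* w) :+ e :* t :* (w :* w)) y w (const b) (t- a) (const e)) represents
      κ≉0 : ¬ (κ K.≈ K.0#)
      -- The form is Eisenstein at t - a, hence anisotropic, and the short vector is nontrivial.
      κ≉0 κ≈0 = nontrivial (eisenstein (Prime-t- a) 1# (const b) (const e) (Prime-∤1 (Prime-t- a)) (∤const (Prime-t- a) e≉0) y w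
        (trans (+-congʳ (*-identityˡ _)) (trans norm (trans (*-congʳ (trans (const-cong κ≈0) const-0)) (zeroˡ c)))))

  record Norm₂ (a b : K.Carrier) (c : Poly) (m : ℕ) : Set where
    field
      z w : Poly
      κ : K.Carrier
      κ≉0 : ¬ (κ K.≈ K.0#)
      norm : z * z - t- a * t- b * (w * w) ≈ const κ * c
      Deg<-z : Deg< (2 ℕ.+ m) z
      Deg<-w : Deg< (suc m) w

  -- The coefficient (t - a)(t - b) is quadratic, too large for `representation`. The substitution z
  -- = y + X w cancels the X² and leaves coefficients 2 X and (a + b) X - a b. The form is
  -- anisotropic because it is Eisenstein at t - a when a and b differ.
  norm₂ : ∀ {c m} → Degree c m → ∀ a b → ¬ (a K.≈ b) → ∀ θ → c ∣ θ * θ - t- a * t- b → Norm₂ a b c m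
  norm₂ {c} {m} dc a b a≉b θ d = build (representation dc (X + X) E (Deg<-+ (bound Degree-X) (bound Degree-X)) dE (θ - X)
      (∣-cong (solve 4 (λ θ x a b → θ :* θ :- (x :- a) :* (x :- b) := (θ :- x) :* (θ :- x) :+ (x :+ x) :* (θ :- x) :+ (a :* x :+ b :* x :- a :* b)) θ X (const a) (const b)) d))
    where
    E : Poly
    E = const a * X + const b * X - const a * const b
    dE : Deg< 2 E
    dE = Deg<-+ (Deg<-+ (Deg<-* (const a) (Deg<-const a) (bound Degree-X)) (Deg<-* (const b) (Deg<-const b) (bound Degree-X)))
      (Deg<-neg (Deg<-mono (s≤s z≤n) (Deg<-* (const a) (Deg<-const a) (Deg<-const b))))
    build : Represents (X + X) E c m → Norm₂ a b c m
    build r = record { z = z ; w = w ; κ = κ ; κ≉0 = κ≉0 ; norm = norm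
      ; Deg<-z = Deg<-+ (Deg<-mono (s≤s (≤-trans (ℕₚ.⌊n/2⌋≤n m) (n≤1+n m))) Deg<-y) (Deg<-cong (*-comm w X) (subst (λ k → Deg< k (w * X)) (ℕₚ.+-comm (suc m) 1) (Deg<-* w Deg<-w′ (bound Degree-X)))) ; Deg<-w = Deg<-w′ }
      where
      open Represents r
      Deg<-w′ : Deg< (suc m) w
      Deg<-w′ = Deg<-mono (≤-trans (ℕₚ.⌈n/2⌉≤n m) (n≤1+n m)) Deg<-w
      z : Poly
      z = y + X * w
      norm : z * z - t- a * t- b * (w * w) ≈ const κ * c
      norm = trans (solve 5 (λ y x w a b → (y :+ x :* w) :* (y :+ x :* w) :- (x :- a) :* (x :- b) :* (w :* w) := y :* y :+ (x :+ x) :* (y :* w) :+ (a :* x :+ b :* x :- a :* b) :* (w :* w)) y X w (const a) (const b)) represents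
      κ≉0 : ¬ (κ K.≈ K.0#)
      κ≉0 κ≈0 = nontrivial (y≈0 , proj₂ zw)
        where
        zw : z ≈ 0# × w ≈ 0#
        zw = eisenstein (Prime-t- a) 1# 0# (- t- b) (Prime-∤1 (Prime-t- a)) (λ d → ∤t- a≉b (∣-cong (solve 1 (λ x → :- (:- x) := x) (t- b)) (∣-neg d))) z w
          (trans (solve 4 (λ z t s w → :1 :* (z :* z) :+ t :* (:0 :* (w :* z) :+ :- s :* (w :* w)) := z :* z :- t :* s :* (w :* w)) z (t- a) (t- b) w)
            (trans norm (trans (*-congʳ (trans (const-cong κ≈0) const-0)) (zeroˡ c))))
        y≈0 : y ≈ 0#
        y≈0 = begin
          y ≈⟨ solve 3 (λ y x w → y := (y :+ x :* w) :- x :* w) y X w ⟩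
          z - X * w ≈⟨ +-cong (proj₁ zw) (-‿cong (trans (*-congˡ (proj₂ zw)) (zeroʳ X))) ⟩
          0# - 0# ≈⟨ -‿inverseʳ 0# ⟩
          0# ∎

  eval-norm₁ : ∀ {a b e c m} (N : Norm₁ a b e c m) → eval a (Norm₁.y N) K.* eval a (Norm₁.y N) K.≈ Norm₁.κ N K.* eval a c
  eval-norm₁ {a} {b} {e} {c} N = K.trans (K.sym (K.trans (eval-+ a _ _) (K.trans (K.+-cong (eval-* a y y) (vanishes _)) (K.+-identityʳ _))))
    (K.trans (eval-cong a norm) (K.trans (eval-* a (const κ) c) (K.*-congʳ (eval-const a κ))))
    where
    open Norm₁ N
    vanishes : ∀ p → eval a (t- a * p) K.≈ K.0#
    vanishes p = ∣⇒root (∣-*ʳ p ∣-refl)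

  -- Available at x = a and at x = b with the same κ, so it links the quadratic characters of c at
  -- the two points.
  eval-norm₂ : ∀ {a b c m} (N : Norm₂ a b c m) → ∀ x → t- x ∣ t- a * t- b → eval x (Norm₂.z N) K.* eval x (Norm₂.z N) K.≈ Norm₂.κ N K.* eval x c
  eval-norm₂ {a} {b} {c} N x d = K.trans (K.sym (K.trans (eval-+ x _ _) (K.trans (K.+-cong (eval-* x z z) vanishes) (K.+-identityʳ _))))
    (K.trans (eval-cong x norm) (K.trans (eval-* x (const κ) c) (K.*-congʳ (eval-const x κ))))
    where
    open Norm₂ N
    vanishes : eval x (- (t- a * t- b * (w * w))) K.≈ K.0#
    vanishes = ∣⇒root (∣-neg (∣-*ʳ (w * w) d))

-- Symbols at linear primes: quadratic and Artin-Schreier reciprocity.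

module LinearSymbols (F : DecField) where
  open FieldPoly F
  open NormForms F
  private module S = SolverOver K.commRing
  open S using () renaming (solve to solveᴷ)

  opaque
    unfolding const
    lead-t- : ∀ a → coeff (t- a) 1 K.≈ K.1#
    lead-t- a = K.trans (coeff-+ X (- const a) 1) (K.trans (K.+-congˡ (vanish (Deg<-neg (Deg<-const a)) 1 (s≤s z≤n))) (K.+-identityʳ _))

  -- The leading term of y² + (t - a) w² comes from y or from w according to the parity of the degree.
  κ-square : ∀ {a c m} → coeff c m K.≈ K.1# → (N : Norm₁ a K.0# K.1# c m) → ∃ λ s → s K.* s K.≈ Norm₁.κ N
  κ-square {a} {c} {m} monic N = cases (halve m)
    where
    open Norm₁ N
    norm′ : y * y + t- a * (w * w) ≈ const κ * c
    norm′ = trans (+-congˡ (*-congˡ (sym (trans (+-cong (trans (*-congʳ const-0) (zeroˡ _)) (trans (*-congʳ const-1) (*-identityˡ _))) (+-identityˡ _))))) norm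
    top : coeff (y * y) m K.+ coeff (t- a * (w * w)) m K.≈ κ
    top = K.trans (K.sym (coeff-+ (y * y) (t- a * (w * w)) m)) (K.trans (at norm′ m) (K.trans (at (const-* κ c) m) (K.trans (coeff-scale κ c m) (K.trans (K.*-congˡ monic) (K.*-identityʳ κ)))))
    cases : (∃ λ g → m ≡ g ℕ.+ g) ⊎ (∃ λ g → m ≡ suc (g ℕ.+ g)) → ∃ λ s → s K.* s K.≈ κ
    cases (inj₁ (g , ≡.refl)) = coeff y g , K.trans (K.sym (K.trans (K.+-cong (coeff-*-top g g y y dy dy) (vanish small (g ℕ.+ g) ≤-refl)) (K.+-identityʳ _))) top
      where
      dy : Deg< (suc g) y
      dy = subst (λ k → Deg< (suc k) y) (≡.sym (ℕₚ.n≡⌊n+n/2⌋ g)) Deg<-y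
      dw : Deg< g w
      dw = subst (λ k → Deg< k w) (≡.sym (ℕₚ.n≡⌈n+n/2⌉ g)) Deg<-w
      small′ : ∀ k → Deg< k w → Deg< (k ℕ.+ k) (t- a * (w * w))
      small′ zero d = ≈0⇒Deg< (trans (*-congˡ (trans (*-congʳ (Deg<0⇒≈0 d)) (zeroˡ w))) (zeroʳ _))
      small′ (suc k) d = Deg<-cong (*-comm (w * w) (t- a)) (Deg<-mono (≤-reflexive (≡.trans (ℕₚ.+-comm (suc k ℕ.+ k) 1) (cong suc (≡.sym (+-suc k k))))) (Deg<-* (w * w) (Deg<-* w d d) (bound (Degree-t- a))))
      small : Deg< (g ℕ.+ g) (t- a * (w * w))
      small = small′ g dw
    cases (inj₂ (g , ≡.refl)) = coeff w g , K.trans (K.sym (K.trans (K.+-cong (vanish (Deg<-* y dy dy) (suc (g ℕ.+ g)) ≤-refl)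
        (K.trans (coeff-*-top 1 (g ℕ.+ g) (t- a) (w * w) (bound (Degree-t- a)) (Deg<-* w dw dw)) (K.trans (K.*-congʳ (lead-t- a)) (K.trans (K.*-identityˡ _) (coeff-*-top g g w w dw dw))))) (K.+-identityˡ _))) top
      where
      dy : Deg< (suc g) y
      dy = subst (λ k → Deg< (suc k) y) (≡.sym (ℕₚ.n≡⌈n+n/2⌉ g)) Deg<-y
      dw : Deg< (suc g) w
      dw = subst (λ k → Deg< (suc k) w) (≡.sym (ℕₚ.n≡⌊n+n/2⌋ g)) Deg<-w

  square-quotient : ∀ {x s y} → ¬ (s K.≈ K.0#) → x K.* x K.≈ s K.* s K.* y → ∃ λ r → r K.* r K.≈ y
  square-quotient {x} {s} {y} s≉0 e = go (K.invert s s≉0)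
    where
    go : (∃ λ i → s K.* i K.≈ K.1#) → ∃ λ r → r K.* r K.≈ y
    go (i , si) = x K.* i , K.trans (solveᴷ 2 (λ x i → x :* i :* (x :* i) := x :* x :* (i :* i)) x i)
      (K.trans (K.*-congʳ e) (K.trans (solveᴷ 3 (λ s y i → s :* s :* y :* (i :* i) := s :* i :* (s :* i) :* y) s y i)
        (K.trans (K.*-congʳ (K.trans (K.*-cong si si) (K.*-identityˡ _))) (K.*-identityˡ y))))

  split-norm₁ : ∀ {P m} → Degree P m → ∀ a θ → P ∣ θ * θ + t- a → Norm₁ a K.0# K.1# P m
  split-norm₁ dP a θ d = norm₁ dP a K.0# K.1# K.1≉0 θ (∣-cong (+-congˡ (sym (trans (*-congˡ (trans (+-cong (trans (*-congʳ const-0) (zeroˡ _)) const-1) (+-identityˡ _))) (*-identityʳ _)))) d)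

  -- One half of quadratic reciprocity for P and t - a. Minkowski represents κ P by y² + (t - a) w²;
  -- κ is a square because P is monic, and at a only y(a)² remains.
  split⇒square : ∀ {P m} → Degree P m → coeff P m K.≈ K.1# → ∀ a θ → P ∣ θ * θ + t- a → ∃ λ s → s K.* s K.≈ eval a P
  split⇒square {P} {m} dP monic a θ d = go (split-norm₁ dP a θ d)
    where
    go : Norm₁ a K.0# K.1# P m → ∃ λ s → s K.* s K.≈ eval a P
    go N = finish (κ-square monic N)
      where
      finish : (∃ λ s → s K.* s K.≈ Norm₁.κ N) → ∃ λ s → s K.* s K.≈ eval a P
      finish (s , e) = square-quotient {s = s} (λ s≈0 → Norm₁.κ≉0 N (K.trans (K.sym e) (K.trans (K.*-congʳ s≈0) (K.zeroˡ s)))) (K.trans (eval-norm₁ N) (K.*-congʳ (K.sym e)))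

  -- Comparing values and derivatives at a of y² + (t - a)(w y + β w²) = κ Q gives r = β w(a) / y(a).
  artinSchreier-split : K.1# K.+ K.1# K.≈ K.0# → ∀ {Q m} → Degree Q m → ∀ a β → ¬ (β K.≈ K.0#) → ¬ (eval a Q K.≈ K.0#) → ∀ θ →
    Q ∣ θ * θ + t- a * (θ + const β) → ∃ λ r → (r K.* r K.+ r) K.* eval a Q K.≈ β K.* eval a (derivative Q)
  artinSchreier-split 2≈0 {Q} {m} dQ a β β≉0 Qa≉0 θ d = go (norm₁ dQ a K.1# β β≉0 θ (∣-cong (+-congˡ (*-congˡ (+-congʳ (sym (trans (*-congʳ const-1) (*-identityˡ θ)))))) d))
    where
    go : Norm₁ a K.1# β Q m → ∃ λ r → (r K.* r K.+ r) K.* eval a Q K.≈ β K.* eval a (derivative Q)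
    go N = finish (K.invert y₀ y₀≉0)
      where
      open Norm₁ N
      y₀ w₀ : K.Carrier
      y₀ = eval a y
      w₀ = eval a w
      G : Poly
      G = const K.1# * (w * y) + const β * (w * w)
      value : y₀ K.* y₀ K.≈ κ K.* eval a Q
      value = eval-norm₁ N
      y₀≉0 : ¬ (y₀ K.≈ K.0#)
      y₀≉0 e = Kₗ.*≉0 κ≉0 Qa≉0 (K.trans (K.sym value) (K.trans (K.*-congʳ e) (K.zeroˡ _)))
      opaque
        unfolding const
        derivative-t- : derivative (t- a) ≈ 1#
        derivative-t- = mk≈ λ { zero → K.trans (K.+-congˡ K.refl) (K.+-identityʳ _) ; (suc zero) → K.refl ; (suc (suc n)) → K.refl }
        derivative-const : ∀ c → derivative (const c) ≈ 0#
        derivative-const c = 0∷[] refl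
      G₀ : eval a G K.≈ w₀ K.* y₀ K.+ β K.* (w₀ K.* w₀)
      G₀ = K.trans (eval-+ a (const K.1# * (w * y)) (const β * (w * w))) (K.+-cong
        (K.trans (eval-* a (const K.1#) (w * y)) (K.trans (K.*-cong (eval-const a K.1#) (eval-* a w y)) (K.*-identityˡ _)))
        (K.trans (eval-* a (const β) (w * w)) (K.*-cong (eval-const a β) (eval-* a w w))))
      derived : derivative y * y + y * derivative y + (G + t- a * derivative G) ≈ const κ * derivative Q
      derived = trans (sym (trans (derivative-+ (y * y) (t- a * G)) (+-cong (derivative-* y y) (trans (derivative-* (t- a) G) (+-congʳ (trans (*-congʳ derivative-t-) (*-identityˡ G)))))))
        (trans (derivative-cong norm) (trans (derivative-* (const κ) Q) (trans (+-congʳ (trans (*-congʳ (derivative-const κ)) (zeroˡ Q))) (+-identityˡ _))))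
      slope : eval a G K.≈ κ K.* eval a (derivative Q)
      slope = K.trans (K.sym (K.trans (eval-+ a (derivative y * y + y * derivative y) (G + t- a * derivative G)) (K.trans (K.+-cong twice (K.trans (eval-+ a G (t- a * derivative G)) (K.trans (K.+-congˡ (∣⇒root (∣-*ʳ (derivative G) ∣-refl))) (K.+-identityʳ _)))) (K.+-identityˡ _))))
        (K.trans (eval-cong a derived) (K.trans (eval-* a (const κ) (derivative Q)) (K.*-congʳ (eval-const a κ))))
        where
        twice : eval a (derivative y * y + y * derivative y) K.≈ K.0#
        twice = K.trans (eval-+ a (derivative y * y) (y * derivative y)) (K.trans (K.+-cong (eval-* a (derivative y) y) (eval-* a y (derivative y)))
          (K.trans (solveᴷ 2 (λ d y → d :* y :+ y :* d := (:1 :+ :1) :* (y :* d)) (eval a (derivative y)) y₀) (K.trans (K.*-congʳ 2≈0) (K.zeroˡ _))))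
      finish : (∃ λ i → y₀ K.* i K.≈ K.1#) → ∃ λ r → (r K.* r K.+ r) K.* eval a Q K.≈ β K.* eval a (derivative Q)
      finish (i , yi) = r , Kₗ.cancelˡ κ≉0 (begin
        κ K.* ((r K.* r K.+ r) K.* eval a Q) ≈⟨ solveᴷ 3 (λ k r q → k :* (r :* q) := r :* (k :* q)) κ (r K.* r K.+ r) (eval a Q) ⟩
        (r K.* r K.+ r) K.* (κ K.* eval a Q) ≈⟨ K.*-congˡ (K.sym value) ⟩
        (r K.* r K.+ r) K.* (y₀ K.* y₀)
          ≈⟨ solveᴷ 4 (λ b w i y → (b :* w :* i :* (b :* w :* i) :+ b :* w :* i) :* (y :* y) := b :* (b :* (w :* w) :* (y :* i :* (y :* i)) :+ w :* y :* (y :* i))) β w₀ i y₀ ⟩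
        β K.* (β K.* (w₀ K.* w₀) K.* (y₀ K.* i K.* (y₀ K.* i)) K.+ w₀ K.* y₀ K.* (y₀ K.* i)) ≈⟨ K.*-congˡ (K.+-cong (K.*-congˡ (K.trans (K.*-cong yi yi) (K.*-identityˡ _))) (K.*-congˡ yi)) ⟩
        β K.* (β K.* (w₀ K.* w₀) K.* K.1# K.+ w₀ K.* y₀ K.* K.1#)
          ≈⟨ solveᴷ 3 (λ b w y → b :* (b :* (w :* w) :* :1 :+ w :* y :* :1) := b :* (w :* y :+ b :* (w :* w))) β w₀ y₀ ⟩
        β K.* (w₀ K.* y₀ K.+ β K.* (w₀ K.* w₀)) ≈⟨ K.*-congˡ (K.trans (K.sym G₀) slope) ⟩
        β K.* (κ K.* eval a (derivative Q)) ≈⟨ solveᴷ 3 (λ b k d → b :* (k :* d) := k :* (b :* d)) β κ (eval a (derivative Q)) ⟩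
        κ K.* (β K.* eval a (derivative Q)) ∎)
        where
        open import Relation.Binary.Reasoning.Setoid K.setoid
        r : K.Carrier
        r = β K.* w₀ K.* i

-- Counting arguments on finite sets.

injective⇒surjective : ∀ {n} (f : Fin n → Fin n) → (∀ i j → f i ≡ f j → i ≡ j) → ∀ b → ∃ λ i → f i ≡ b
injective⇒surjective {suc n} f inj b with Finₚ.any? (λ i → f i Finₚ.≟ b)
... | yes found = found
... | no none = ⊥-elim (ℕₚ.1+n≰n (Finₚ.injective⇒≤ {f = λ i → punchOut (missed i)}
        λ {i} {j} e → inj i j (Finₚ.punchOut-injective (missed i) (missed j) e)))
  where
  missed : ∀ i → b ≢ f i
  missed i e = none (i , ≡.sym e)

record FiniteSetoid : Set₁ where
  field
    Carrier : Set
    _~_ : Carrier → Carrier → Set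
    ~-sym : ∀ {x y} → x ~ y → y ~ x
    ~-trans : ∀ {x y z} → x ~ y → y ~ z → x ~ z
    size : ℕ
    element : Fin size → Carrier
    code : Carrier → Fin size
    element-code : ∀ x → element (code x) ~ x
    element-injective : ∀ i j → element i ~ element j → i ≡ j

-- If f is two-to-one, with fibres the orbits of τ, and the images of f and g ∘ f
-- overlap only trivially, then together they exhaust the set: send the smaller
-- element x of each orbit to f x and the larger one to g (f x).
module TwoToOne (A : FiniteSetoid) where
  open FiniteSetoid A

  exhaust : (f g τ : Carrier → Carrier) → (∀ {x y} → x ~ y → τ x ~ τ y) → (∀ x → τ (τ x) ~ x) →
    (∀ {x y} → g x ~ g y → x ~ y) →
    (∀ x y → f x ~ f y → (x ~ y) ⊎ (x ~ τ y)) → (∀ x y → f x ~ g (f y) → x ~ y) →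
    ∀ b → ∃ λ x → (b ~ f x) ⊎ (b ~ g (f x))
  exhaust f g τ τ-cong ττ g-inj f-fibre f-g b = conclude (injective⇒surjective h h-injective (code b))
    where
    partner : Fin size → Fin size
    partner i = code (τ (element i))
    value : ∀ i → Dec (i Fin.≤ partner i) → Carrier
    value i (yes _) = f (element i)
    value i (no _) = g (f (element i))
    small? : ∀ i → Dec (i Fin.≤ partner i)
    small? i = i Finₚ.≤? partner i
    h : Fin size → Fin size
    h i = code (value i (small? i))
    code-injective : ∀ {x y} → code x ≡ code y → x ~ y
    code-injective {x} {y} e = ~-trans (~-sym (element-code x)) (subst (λ i → element i ~ y) (≡.sym e) (element-code y))
    partner-of : ∀ i j → element i ~ τ (element j) → i ≡ partner j
    partner-of i j e = element-injective i (partner j) (~-trans e (~-sym (element-code _)))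
    swap : ∀ i j → element i ~ τ (element j) → element j ~ τ (element i)
    swap i j e = ~-sym (~-trans (τ-cong e) (ττ _))
    inj′ : ∀ i j (di : Dec (i Fin.≤ partner i)) (dj : Dec (j Fin.≤ partner j)) → value i di ~ value j dj → i ≡ j
    inj′ i j (yes si) (yes sj) e with f-fibre _ _ e
    ... | inj₁ same = element-injective i j same
    ... | inj₂ opp = Finₚ.≤-antisym (subst (i Fin.≤_) (≡.sym (partner-of j i (swap i j opp))) si)
                                    (subst (j Fin.≤_) (≡.sym (partner-of i j opp)) sj)
    inj′ i j (yes _) (no _) e = element-injective i j (f-g _ _ e)
    inj′ i j (no _) (yes _) e = element-injective i j (~-sym (f-g _ _ (~-sym e)))
    inj′ i j (no li) (no lj) e with f-fibre _ _ (g-inj e)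
    ... | inj₁ same = element-injective i j same
    ... | inj₂ opp = ⊥-elim (Finₚ.<-asym {x = i} {y = j}
            (subst (Fin._< j) (≡.sym (partner-of i j opp)) (≰⇒> lj))
            (subst (Fin._< i) (≡.sym (partner-of j i (swap i j opp))) (≰⇒> li)))
    h-injective : ∀ i j → h i ≡ h j → i ≡ j
    h-injective i j e = inj′ i j (small? i) (small? j) (code-injective e)
    conclude′ : ∀ i (di : Dec (i Fin.≤ partner i)) → code (value i di) ≡ code b → ∃ λ x → (b ~ f x) ⊎ (b ~ g (f x))
    conclude′ i (yes _) e = element i , inj₁ (~-sym (code-injective e))
    conclude′ i (no _) e = element i , inj₂ (~-sym (code-injective e))
    conclude : (∃ λ i → h i ≡ code b) → ∃ λ x → (b ~ f x) ⊎ (b ~ g (f x))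
    conclude (i , e) = conclude′ i (small? i) e

codeVec : ∀ {q m} → Vec (Fin q) m → Fin (q ℕ.^ m)
codeVec [] = zero
codeVec (x ∷ v) = Fin.combine x (codeVec v)

decodeVec : ∀ {q} m → Fin (q ℕ.^ m) → Vec (Fin q) m
decodeVec zero _ = []
decodeVec {q} (suc m) i = proj₁ (remQuot {q} (q ℕ.^ m) i) ∷ decodeVec m (proj₂ (remQuot {q} (q ℕ.^ m) i))

decode-code : ∀ {q m} (v : Vec (Fin q) m) → decodeVec m (codeVec v) ≡ v
decode-code [] = ≡.refl
decode-code {q} {suc m} (x ∷ v) = cong₂ _∷_
  (cong proj₁ (Finₚ.remQuot-combine {q} x (codeVec v)))
  (≡.trans (cong (decodeVec m) (cong proj₂ (Finₚ.remQuot-combine {q} x (codeVec v)))) (decode-code v))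

code-decode : ∀ {q} m (i : Fin (q ℕ.^ m)) → codeVec (decodeVec {q} m i) ≡ i
code-decode zero zero = ≡.refl
code-decode {q} (suc m) i = ≡.trans (cong (Fin.combine (proj₁ (remQuot {q} (q ℕ.^ m) i))) (code-decode {q} m _)) (Finₚ.combine-remQuot {q} (q ℕ.^ m) i)

anyVec? : ∀ {q} m {P : Vec (Fin q) m → Set} → (∀ v → Dec (P v)) → Dec (∃ P)
anyVec? {q} m {P} P? = map′ (λ { (i , p) → decodeVec m i , p }) (λ { (v , p) → codeVec v , subst P (≡.sym (decode-code v)) p })
  (Finₚ.any? (λ i → P? (decodeVec m i)))

-- Polynomials over a finite field: residue classes, index two, factorization.

finiteDecField : ∀ {q} → FiniteField q → DecField
finiteDecField F = record
  { commRing = record { isCommutativeRing = isCommutativeRing }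
  ; _≟_ = Finₚ._≟_ ; 1≉0 = 1≢0 ; invert = inverse }
  where open FiniteField F

module FiniteFieldPoly {q} (F : FiniteField q) where
  field′ : DecField
  field′ = finiteDecField F
  open FieldPoly field′ public
  open import Relation.Binary.Reasoning.Setoid setoid

  truncate : ∀ m → Poly → Vec (Fin q) m
  truncate zero p = []
  truncate (suc m) [] = K.0# ∷ truncate m []
  truncate (suc m) (a ∷ p) = a ∷ truncate m p

  truncate-≈ : ∀ m p → Deg< m p → toList (truncate m p) ≈ p
  truncate-≈ zero p d = sym (Deg<0⇒≈0 d)
  truncate-≈ (suc m) [] d = 0∷[] (truncate-≈ m [] Deg<-0)
  truncate-≈ (suc m) (a ∷ p) d = ∷-cong K.refl (truncate-≈ m p (Deg<-tail d))

  Deg<-toList : ∀ {m} (v : Vec (Fin q) m) → Deg< m (toList v)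
  Deg<-toList [] = Deg<-0
  Deg<-toList (a ∷ v) = Deg<-∷ (Deg<-toList v)

  toList-injective : ∀ {m} (u v : Vec (Fin q) m) → toList u ≈ toList v → u ≡ v
  toList-injective [] [] e = ≡.refl
  toList-injective (a ∷ u) (b ∷ v) e = cong₂ _∷_ (at e 0) (toList-injective u v (∷-tail e))

  module Residues {Q m} (dQ : Degree Q m) where
    infix 4 _~_
    _~_ : Poly → Poly → Set
    p ~ r = Q ∣ p - r

    ~-sym : ∀ {p r} → p ~ r → r ~ p
    ~-sym {p} {r} d = ∣-cong (solve 2 (λ p r → :- (p :- r) := r :- p) p r) (∣-neg d)

    ~-trans : ∀ {p r s} → p ~ r → r ~ s → p ~ s
    ~-trans {p} {r} {s} d e = ∣-cong (solve 3 (λ p r s → (p :- r) :+ (r :- s) := p :- s) p r s) (∣-+ d e)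

    reduced : ∀ p → ∃ λ r → Deg< m r × r ~ p
    reduced p with divMod dQ p
    ... | c , r , e , l = r , l , - c , (begin
      r - p ≈⟨ +-congˡ (-‿cong e) ⟩
      r - (Q * c + r) ≈⟨ solve 3 (λ r q c → r :- (q :* c :+ r) := q :* :- c) r Q c ⟩
      Q * - c ∎)

    ~⇒≈ : ∀ {p r} → Deg< m p → Deg< m r → p ~ r → p ≈ r
    ~⇒≈ {p} {r} dp dr (c , e) = p-r≈0⇒p≈r (trans e (trans (*-congˡ c≈0) (zeroʳ Q)))
      where
      c≈0 : c ≈ 0#
      c≈0 = Deg<0⇒≈0 (Deg<-quotient dQ (subst (λ k → Deg< k (Q * c)) (≡.sym (ℕₚ.+-identityʳ m)) (Deg<-cong e (Deg<-+ dp (Deg<-neg dr)))))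

    finiteSetoid : FiniteSetoid
    finiteSetoid = record
      { Carrier = Poly ; _~_ = _~_ ; ~-sym = ~-sym ; ~-trans = ~-trans
      ; size = q ℕ.^ m
      ; element = λ i → toList (decodeVec {q} m i)
      ; code = λ p → codeVec (truncate m (proj₁ (reduced p)))
      ; element-code = λ p → subst (λ v → toList v ~ p) (≡.sym (decode-code (truncate m (proj₁ (reduced p)))))
          (~-trans (≈⇒~ (truncate-≈ m (proj₁ (reduced p)) (proj₁ (proj₂ (reduced p))))) (proj₂ (proj₂ (reduced p))))
      ; element-injective = λ i j e → ≡.trans (≡.sym (code-decode {q} m i)) (≡.trans (cong codeVec
          (toList-injective (decodeVec m i) (decodeVec m j) (~⇒≈ (Deg<-toList (decodeVec m i)) (Deg<-toList (decodeVec m j)) e))) (code-decode {q} m j)) }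
      where
      ≈⇒~ : ∀ {p r} → p ≈ r → p ~ r
      ≈⇒~ e = 0# , trans (p≈r⇒p-r≈0 e) (sym (zeroʳ Q))

  open Residues using (~-sym; ~-trans)

  SquareMod : Poly → Poly → Set
  SquareMod Q x = ∃ λ θ → Q ∣ θ * θ - x

  -- The fibres of squaring are the pairs x, -x, and x² = a y² modulo Q forces both to vanish, as a
  -- is no square. By counting, the squares and a times the squares therefore exhaust the residue
  -- field.
  square-index : ∀ {Q} → Prime Q → ∀ {a} → ¬ SquareMod Q a → ∀ b → SquareMod Q b ⊎ SquareMod Q (a * b)
  square-index {Q} π {a} ¬a b = conclude (TwoToOne.exhaust finiteSetoid (λ x → x * x) (a *_) -_ τ-cong ττ g-inj f-fibre f-g b)
    where
    open Residues (nonconstant π)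
    conclude : (∃ λ x → (b ~ x * x) ⊎ (b ~ a * (x * x))) → SquareMod Q b ⊎ SquareMod Q (a * b)
    conclude (x , inj₁ e) = inj₁ (x , Residues.~-sym (nonconstant π) e)
    conclude (x , inj₂ e) = inj₂ (a * x , ∣-cong (solve 3 (λ a b x → a :* (a :* (x :* x) :- b) := (a :* x) :* (a :* x) :- a :* b) a b x) (∣-*ˡ a (Residues.~-sym (nonconstant π) e)))
    Q∤a : ¬ (Q ∣ a)
    Q∤a d = ¬a (0# , ∣-cong (solve 1 (λ a → :- a := :0 :* :0 :- a) a) (∣-neg d))
    τ-cong : ∀ {x y} → x ~ y → - x ~ - y
    τ-cong {x} {y} d = ∣-cong (solve 2 (λ x y → :- (x :- y) := :- x :- :- y) x y) (∣-neg d)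
    ττ : ∀ x → - (- x) ~ x
    ττ x = 0# , trans (solve 1 (λ x → :- (:- x) :- x := :0) x) (sym (zeroʳ Q))
    g-inj : ∀ {x y} → a * x ~ a * y → x ~ y
    g-inj {x} {y} d = Coprime-∣ (∤⇒Coprime π Q∤a) (∣-cong (solve 3 (λ a x y → a :* x :- a :* y := a :* (x :- y)) a x y) d)
    f-fibre : ∀ x y → x * x ~ y * y → (x ~ y) ⊎ (x ~ - y)
    f-fibre x y d = Prime-∣* {x = x - y} {y = x - - y} π (∣-cong (solve 2 (λ x y → x :* x :- y :* y := (x :- y) :* (x :- :- y)) x y) d)
    f-g : ∀ x y → x * x ~ a * (y * y) → x ~ y
    f-g x y d with dichotomy π y
    ... | inj₁ Q∣y = ∣-+ (Prime-∣² π (∣-cong (solve 3 (λ x a y → (x :* x :- a :* (y :* y)) :+ a :* y :* y := x :* x) x a y) (∣-+ d (∣-*ˡ (a * y) Q∣y)))) (∣-neg Q∣y)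
    ... | inj₂ (u , v , e) = ⊥-elim (¬a (v * x , ∣-cong eq (∣-+ (∣-*ˡ (v * v) d) (∣-*ʳ (- (a * u * (1# + v * y))) ∣-refl))))
      where
      eq : v * v * (x * x - a * (y * y)) + Q * - (a * u * (1# + v * y)) ≈ v * x * (v * x) - a
      eq = begin
        v * v * (x * x - a * (y * y)) + Q * - (a * u * (1# + v * y))
          ≈⟨ solve 6 (λ v x a y q u → v :* v :* (x :* x :- a :* (y :* y)) :+ q :* :- (a :* u :* (:1 :+ v :* y)) := v :* x :* (v :* x) :- a :* ((u :* q :+ v :* y) :* (:1 :+ v :* y) :- v :* y)) v x a y Q u ⟩
        v * x * (v * x) - a * ((u * Q + v * y) * (1# + v * y) - v * y) ≈⟨ +-congˡ (-‿cong (*-congˡ (+-congʳ (*-congʳ e)))) ⟩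
        v * x * (v * x) - a * (1# * (1# + v * y) - v * y)
          ≈⟨ solve 4 (λ v x a y → v :* x :* (v :* x) :- a :* (:1 :* (:1 :+ v :* y) :- v :* y) := v :* x :* (v :* x) :- a) v x a y ⟩
        v * x * (v * x) - a ∎

  ASMod : Poly → Poly → Set
  ASMod Q x = ∃ λ θ → Q ∣ θ * θ + θ - x

  -- The additive analogue: the fibres of x² + x are the orbits of x ↦ -1 - x, and the image is a
  -- subgroup that misses a.
  artinSchreier-index : ∀ {Q} → Prime Q → K.1# K.+ K.1# K.≈ K.0# → ∀ {a} → ¬ ASMod Q a → ∀ b → ASMod Q b ⊎ ASMod Q (b - a)
  artinSchreier-index {Q} π 2≈0 {a} ¬a b = conclude (TwoToOne.exhaust finiteSetoid (λ x → x * x + x) (a +_) (λ x → - 1# - x) τ-cong ττ g-inj f-fibre f-g b)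
    where
    open Residues (nonconstant π)
    conclude : (∃ λ x → (b ~ x * x + x) ⊎ (b ~ a + (x * x + x))) → ASMod Q b ⊎ ASMod Q (b - a)
    conclude (x , inj₁ e) = inj₁ (x , Residues.~-sym (nonconstant π) e)
    conclude (x , inj₂ e) = inj₂ (x , ∣-cong (solve 3 (λ a b x → :- (b :- (a :+ (x :* x :+ x))) := x :* x :+ x :- (b :- a)) a b x) (∣-neg e))
    τ-cong : ∀ {x y} → x ~ y → - 1# - x ~ - 1# - y
    τ-cong {x} {y} d = ∣-cong (solve 2 (λ x y → :- (x :- y) := (:- :1 :- x) :- (:- :1 :- y)) x y) (∣-neg d)
    ττ : ∀ x → - 1# - (- 1# - x) ~ x
    ττ x = 0# , trans (solve 1 (λ x → (:- :1 :- (:- :1 :- x)) :- x := :0) x) (sym (zeroʳ Q))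
    g-inj : ∀ {x y} → a + x ~ a + y → x ~ y
    g-inj {x} {y} d = ∣-cong (solve 3 (λ a x y → (a :+ x) :- (a :+ y) := x :- y) a x y) d
    f-fibre : ∀ x y → x * x + x ~ y * y + y → (x ~ y) ⊎ (x ~ - 1# - y)
    f-fibre x y d = Prime-∣* {x = x - y} {y = x - (- 1# - y)} π (∣-cong (solve 2 (λ x y → (x :* x :+ x) :- (y :* y :+ y) := (x :- y) :* (x :- (:- :1 :- y))) x y) d)
    f-g : ∀ x y → x * x + x ~ a + (y * y + y) → x ~ y
    f-g x y d = ⊥-elim (¬a (x - y , ∣-cong eq d))
      where
      two : 1# + 1# ≈ 0#
      two = trans (+-cong (sym const-1) (sym const-1)) (trans (sym (const-+ _ _)) (trans (const-cong 2≈0) const-0))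
      eq : (x * x + x) - (a + (y * y + y)) ≈ (x - y) * (x - y) + (x - y) - a
      eq = begin
        (x * x + x) - (a + (y * y + y))
          ≈⟨ solve 3 (λ x y a → (x :* x :+ x) :- (a :+ (y :* y :+ y)) := (x :- y) :* (x :- y) :+ (x :- y) :- a :+ (:1 :+ :1) :* (x :* y :- y :* y)) x y a ⟩
        (x - y) * (x - y) + (x - y) - a + (1# + 1#) * (x * y - y * y) ≈⟨ +-congˡ (trans (*-congʳ two) (zeroˡ _)) ⟩
        (x - y) * (x - y) + (x - y) - a + 0# ≈⟨ +-identityʳ _ ⟩
        (x - y) * (x - y) + (x - y) - a ∎

  product : List Poly → Poly
  product [] = 1#
  product (Q ∷ Qs) = Q * product Qs

  data SquareFree : List Poly → Set where
    [] : SquareFree []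
    cons : ∀ {Q Qs} → Prime Q → ¬ (Q ∣ product Qs) → SquareFree Qs → SquareFree (Q ∷ Qs)

  factor? : ∀ p n → Dec (∃₂ λ (u v : Vec (Fin q) n) → p ≈ toList u * toList v)
  factor? p n = anyVec? n (λ u → anyVec? n (λ v → p ≟ₚ (toList u * toList v)))

  ¬factor⇒NoFactor : ∀ {p n} → ¬ (∃₂ λ (u v : Vec (Fin q) n) → p ≈ toList u * toList v) → NoFactor p n
  ¬factor⇒NoFactor {p} {n} none a b da db e = none (truncate n a , truncate n b , trans e (sym (*-cong (truncate-≈ n a da) (truncate-≈ n b db))))

  -- Exhaustive search for a splitting into two smaller factors; if there is none, p is itself
  -- prime. The number m only bounds the recursion.
  primeFactor : ∀ m {p n} → n < m → Degree p (suc n) → ∃ λ Q → Prime Q × Q ∣ p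
  primeFactor (suc m) {p} {n} (s≤s n≤m) d with factor? p (suc n)
  ... | no none = p , NoFactor⇒Prime d (¬factor⇒NoFactor none) , ∣-refl
  ... | yes (u , v , e) with degree? (toList u) | degree? (toList v)
  ...   | inj₁ z | _ = ⊥-elim (Degree⇒≉0 d (trans e (trans (*-congʳ z) (zeroˡ _))))
  ...   | inj₂ _ | inj₁ z = ⊥-elim (Degree⇒≉0 d (trans e (trans (*-congˡ z) (zeroʳ _))))
  ...   | inj₂ (zero , du) | inj₂ (k , dv) = ⊥-elim (<-irrefl (Degree-unique (Degree-cong (sym e) (Degree-* du dv)) d) (Degree-Deg< dv (Deg<-toList v)))
  ...   | inj₂ (suc j , du) | inj₂ _ with primeFactor m (<-≤-trans (≤-pred (Degree-Deg< du (Deg<-toList u))) n≤m) du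
  ...     | Q , π , Q∣u = Q , π , ∣-cong (sym e) (∣-*ʳ _ Q∣u)

  -- A square factor of c is absorbed by scaling a solution with `root`, so only the square-free
  -- part has to be represented. The bounds on degrees and on the number of primes feed the point
  -- counts.
  record Factorization (c : Poly) (n : ℕ) : Set where
    field
      unit : K.Carrier
      root : Poly
      primes : List Poly
      squareFree : SquareFree primes
      factored : c ≈ const unit * (root * root * product primes)
      Deg<-root : Deg< (suc n) root
      Deg<-product : Deg< (suc n) (product primes)
      length≤ : List.length primes ≤ n

  private
    quotientDegree : ∀ {c Q c′ n} → Degree c n → Prime Q → c ≈ Q * c′ → ∃ λ k → Degree c′ k × k < n
    quotientDegree {c} {Q} {c′} {n} d π e with degree? c′
    ... | inj₁ z = ⊥-elim (Degree⇒≉0 d (trans e (trans (*-congˡ z) (zeroʳ Q))))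
    ... | inj₂ (k , dk) = k , dk , subst (k <_) (Degree-unique (Degree-cong (sym e) (Degree-* (nonconstant π) dk)) d) (s≤s (m≤n+m k _))

    Deg<-*-quotient : ∀ {Q c c′ r n k} → Degree c n → c ≈ Q * c′ → Prime Q → Degree c′ k → Deg< (suc k) r → Deg< (suc n) (r * Q)
    Deg<-*-quotient {Q} {r = r} {n} {k} d e π dk l = Deg<-mono (≤-reflexive (cong suc (≡.trans (ℕₚ.+-comm k _) (Degree-unique (Degree-cong (sym e) (Degree-* (nonconstant π) dk)) d)))) (Deg<-* r l (bound (nonconstant π)))

  -- A prime factor Q of c with cofactor c′ joins the list if Q does not divide c′, since the
  -- product of the primes of c′ divides c′. Otherwise Q² is split off and Q goes into the root.
  factorize : ∀ m {c n} → n < m → Degree c n → Factorization c n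
  factorize (suc m) {c} {zero} _ d = record
    { unit = coeff c 0 ; root = 1# ; primes = [] ; squareFree = []
    ; factored = trans (Deg<1⇒const (bound d)) (solve 1 (λ x → x := x :* (:1 :* :1 :* :1)) (const (coeff c 0)))
    ; Deg<-root = Deg<-cong const-1 (Deg<-const _) ; Deg<-product = Deg<-cong const-1 (Deg<-const _) ; length≤ = z≤n }
  factorize (suc m) {c} {suc n} (s≤s n<m) d with primeFactor (suc n) ≤-refl d
  ... | Q , π , c′ , e with quotientDegree d π e | dichotomy π c′
  ...   | k , dk , k<n | inj₂ cop = extend (factorize m (<-≤-trans k<n n<m) dk)
    where
    extend : Factorization c′ k → Factorization c (suc n)
    extend f = record
      { unit = unit ; root = root ; primes = Q ∷ primes
      ; squareFree = cons π (λ Q∣ → Coprime⇒∤ π cop (∣-cong (sym factored) (∣-*ˡ (const unit) (∣-*ˡ (root * root) Q∣)))) squareFree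
      ; factored = trans e (trans (*-congˡ factored) (solve 4 (λ q u r p → q :* (u :* (r :* r :* p)) := u :* (r :* r :* (q :* p))) Q (const unit) root (product primes)))
      ; Deg<-root = Deg<-mono (≤-trans k<n (n≤1+n _)) Deg<-root
      ; Deg<-product = Deg<-cong (*-comm _ Q) (Deg<-*-quotient d e π dk Deg<-product)
      ; length≤ = ≤-trans (s≤s length≤) k<n }
      where open Factorization f
  ...   | k , dk , k<n | inj₁ (c″ , e′) with quotientDegree dk π e′
  ...     | j , dj , j<k = extend (factorize m (<-≤-trans (ℕₚ.<-trans j<k k<n) n<m) dj)
    where
    extend : Factorization c″ j → Factorization c (suc n)
    extend f = record
      { unit = unit ; root = root * Q ; primes = primes ; squareFree = squareFree
      ; factored = trans e (trans (*-congˡ (trans e′ (*-congˡ factored))) (solve 4 (λ q u r p → q :* (q :* (u :* (r :* r :* p))) := u :* (r :* q :* (r :* q) :* p)) Q (const unit) root (product primes)))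
      ; Deg<-root = Deg<-*-quotient d e π dk (Deg<-mono (≤-trans j<k (n≤1+n _)) Deg<-root)
      ; Deg<-product = Deg<-mono (s≤s (<⇒≤ (ℕₚ.<-trans j<k k<n))) Deg<-product
      ; length≤ = ≤-trans length≤ (<⇒≤ (ℕₚ.<-trans j<k k<n)) }
      where open Factorization f

-- Powers, zeros with multiplicity, Fermat and Frobenius.

module Powers (R : CommutativeRing 0ℓ 0ℓ) where
  open import Algebra.Properties.Semiring.Exp (CommutativeRing.semiring R) public using (_^_; ^-congˡ; ^-homo-*; ^-assocʳ)
  open import Algebra.Properties.CommutativeSemiring.Exp (CommutativeRing.commutativeSemiring R) public using (^-distrib-*)

module _ {R S : CommutativeRing 0ℓ 0ℓ} (φ : RingHom R S) where
  private
    module R = CommutativeRing R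
    module S = CommutativeRing S
    module Rp = Powers R
    module Sp = Powers S
  open RingHom φ

  to-^ : ∀ x n → to (x Rp.^ n) S.≈ to x Sp.^ n
  to-^ x zero = to-1
  to-^ x (suc n) = S.trans (to-* x (x Rp.^ n)) (S.*-congˡ (to-^ x n))

module RootMultiplicities (F : DecField) where
  open FieldPoly F
  open Powers polyRing

  Coprime-1 : ∀ a → Coprime a 1#
  Coprime-1 a = 0# , 1# , trans (+-cong (zeroˡ a) (*-identityˡ 1#)) (+-identityˡ 1#)

  Coprime-^ : ∀ {a b} n → Coprime a b → Coprime a (b ^ n)
  Coprime-^ {a} zero c = Coprime-1 a
  Coprime-^ (suc n) c = Coprime-* c (Coprime-^ n c)

  t-Coprime : ∀ {a b} → ¬ (a K.≈ b) → Coprime (t- a) (t- b)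
  t-Coprime {a} {b} a≉b = ∤⇒Coprime (Prime-t- a) (λ d → a≉b (Kₗ.x-y≈0⇒x≈y (K.trans (K.sym (eval-t- a b)) (∣⇒root d))))

  Degree-t-^ : ∀ a n → Degree (t- a ^ n) n
  Degree-t-^ a zero = degree K.1≉0 (Deg<-cong const-1 (Deg<-const K.1#))
  Degree-t-^ a (suc n) = Degree-* (Degree-t- a) (Degree-t-^ a n)

  -- Powers of distinct linear polynomials are coprime, so dividing R by one of them keeps the
  -- divisibility by the others.
  roots≤degree : ∀ ℓ {R d} → Degree R d → ∀ xs → AllPairs (λ x y → ¬ (x K.≈ y)) xs → All (λ x → t- x ^ ℓ ∣ R) xs → length xs ℕ.* ℓ ≤ d
  roots≤degree ℓ dR [] _ _ = z≤n
  roots≤degree ℓ {R} {d} dR (x ∷ xs) (x∉ ∷ distinct) ((R′ , e) ∷ ds) with degree? R′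
  ... | inj₁ z = ⊥-elim (Degree⇒≉0 dR (trans e (trans (*-congˡ z) (zeroʳ _))))
  ... | inj₂ (d′ , dR′) = subst (ℓ ℕ.+ length xs ℕ.* ℓ ≤_) (Degree-unique (Degree-cong (sym e) (Degree-* (Degree-t-^ x ℓ) dR′)) dR)
      (+-monoʳ-≤ ℓ (roots≤degree ℓ dR′ xs distinct (others xs x∉ ds)))
    where
    others : ∀ ys → All (λ y → ¬ (x K.≈ y)) ys → All (λ y → t- y ^ ℓ ∣ R) ys → All (λ y → t- y ^ ℓ ∣ R′) ys
    others [] _ _ = []
    others (y ∷ ys) (x≉y ∷ ns) (dy ∷ dys) = Coprime-∣ (Coprime-^ ℓ (Coprime-sym (Coprime-^ ℓ (t-Coprime x≉y)))) (∣-cong e dy) ∷ others ys ns dys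

  degree-eval : ∀ {p n} → Deg< n p → ∀ xs → AllPairs (λ x y → ¬ (x K.≈ y)) xs → All (λ x → eval x p K.≈ K.0#) xs → n ≤ length xs → p ≈ 0#
  degree-eval {p} {n} d xs distinct roots n≤ with degree? p
  ... | inj₁ z = z
  ... | inj₂ (m , dm) = ⊥-elim (<-irrefl ≡.refl (<-≤-trans (Degree-Deg< dm d) (≤-trans n≤
      (subst (_≤ m) (ℕₚ.*-identityʳ (length xs)) (roots≤degree 1 dm xs distinct (All.map (λ e → ∣-trans′ (root⇒∣ e)) roots))))))
    where
    ∣-trans′ : ∀ {x} → t- x ∣ p → t- x ^ 1 ∣ p
    ∣-trans′ (c , e) = c , trans e (*-congʳ (sym (*-identityʳ _)))

module FiniteFieldPowers {q} (F : FiniteField q) where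
  open FiniteFieldPoly F
  open Powers K.commRing using () renaming (_^_ to _^ᴷ_; ^-congˡ to ^ᴷ-congˡ)
  open Powers polyRing
  open RootMultiplicities field′ public

  allFin-distinct : AllPairs (λ x y → ¬ (x ≡ y)) (List.allFin q)
  allFin-distinct = AllPairsₚ.tabulate⁺ {f = λ i → i} λ i≢j e → i≢j e

  vanishing-everywhere : ∀ {p} → Deg< q p → (∀ x → eval x p ≡ K.0#) → p ≈ 0#
  vanishing-everywhere d e = degree-eval d (List.allFin q) allFin-distinct (All.tabulate {xs = List.allFin q} (λ {x} _ → e x))
    (≤-reflexive (≡.sym (Listₚ.length-tabulate (λ (i : Fin q) → i))))

  module _ where
    open import Algebra.Properties.CommutativeMonoid.Sum K.*-commutativeMonoid
    open import Algebra.Properties.Monoid.Mult K.*-monoid using () renaming (_×_ to _×ᴷ_)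

    private
      nz : Fin q → Fin q
      nz y with y K.≟ K.0#
      ... | yes _ = K.1#
      ... | no _ = y

      nz-0 : ∀ {y} → y ≡ K.0# → nz y ≡ K.1#
      nz-0 {y} e with y K.≟ K.0#
      ... | yes _ = ≡.refl
      ... | no n = ⊥-elim (n e)

      nz-≢0 : ∀ {y} → ¬ (y ≡ K.0#) → nz y ≡ y
      nz-≢0 {y} n with y K.≟ K.0#
      ... | yes e = ⊥-elim (n e)
      ... | no _ = ≡.refl

      nz≢0 : ∀ y → ¬ (nz y ≡ K.0#)
      nz≢0 y with y K.≟ K.0#
      ... | yes _ = K.1≉0
      ... | no n = n

      sum≢0 : ∀ {n} (f : Fin n → Fin q) → (∀ i → ¬ (f i ≡ K.0#)) → ¬ (sum f ≡ K.0#)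
      sum≢0 {zero} f h = K.1≉0
      sum≢0 {suc n} f h = Kₗ.*≉0 (h zero) (sum≢0 (λ i → f (suc i)) (λ i → h (suc i)))

      replicate-sum : ∀ n x → sum {n} (λ _ → x) ≡ x ^ᴷ n
      replicate-sum zero x = ≡.refl
      replicate-sum (suc n) x = cong (x K.*_) (replicate-sum n x)

      differ-at : ∀ {n} i (f g : Fin n → Fin q) x → f i ≡ x K.* g i → (∀ j → ¬ (j ≡ i) → f j ≡ g j) → sum f ≡ x K.* sum g
      differ-at {suc n} i f g x e h = ≡.trans (sum-remove {i = i} f) (≡.trans
        (cong₂ K._*_ e (sum-cong-≗ {x = removeAt f i} {y = removeAt g i} (λ j → h (punchIn i j) (λ p → Finₚ.punchInᵢ≢i i j p))))
        (≡.trans (K.*-assoc x (g i) _) (cong (x K.*_) (≡.sym (sum-remove {i = i} g)))))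

    0^q : ∀ n → Fin n → K.0# ^ᴷ n ≡ K.0#
    0^q (suc n) _ = K.zeroˡ _

    -- Multiplication by x permutes the nonzero elements. The product, written `sum` because it is
    -- taken in the multiplicative monoid, runs over all of `Fin q` with `nz` replacing 0 by 1. At
    -- index 0 the factor x · nz 0 exceeds nz (x · 0) by x, which is why the exponent q comes out
    -- directly.
    fermat : ∀ x → x ^ᴷ q ≡ x
    fermat x with x K.≟ K.0#
    ... | yes ≡.refl = 0^q q x
    ... | no x≢0 = Kₗ.cancelˡ (sum≢0 nz nz≢0) (begin
        sum nz K.* x ^ᴷ q ≡⟨ K.*-comm (sum nz) _ ⟩
        x ^ᴷ q K.* sum nz ≡⟨ cong (K._* sum nz) (replicate-sum q x) ⟨
        sum {q} (λ _ → x) K.* sum nz ≡⟨ ∑-distrib-+ {q} (λ _ → x) nz ⟨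
        sum (λ y → x K.* nz y) ≡⟨ differ-at K.0# (λ y → x K.* nz y) (λ y → nz (x K.* y)) x at-0 off-0 ⟩
        x K.* sum (λ y → nz (x K.* y)) ≡⟨ cong (x K.*_) (sum-permute nz π) ⟨
        x K.* sum nz ≡⟨ K.*-comm x _ ⟩
        sum nz K.* x ∎)
      where
      open ≡.≡-Reasoning
      i : Fin q
      i = proj₁ (K.invert x x≢0)
      xi : x K.* i ≡ K.1#
      xi = proj₂ (K.invert x x≢0)
      π : Perm.Permutation q q
      π = Perm.permutation (x K.*_) (i K.*_)
        (λ y → ≡.trans (≡.sym (K.*-assoc x i y)) (≡.trans (cong (K._* y) xi) (K.*-identityˡ y)))
        (λ y → ≡.trans (≡.sym (K.*-assoc i x y)) (≡.trans (cong (K._* y) (≡.trans (K.*-comm i x) xi)) (K.*-identityˡ y)))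
      at-0 : x K.* nz K.0# ≡ x K.* nz (x K.* K.0#)
      at-0 = cong (x K.*_) (≡.trans (nz-0 ≡.refl) (≡.sym (nz-0 (K.zeroʳ x))))
      off-0 : ∀ y → ¬ (y ≡ K.0#) → x K.* nz y ≡ nz (x K.* y)
      off-0 y y≢0 = ≡.trans (cong (x K.*_) (nz-≢0 y≢0)) (≡.sym (nz-≢0 (Kₗ.*≉0 x≢0 y≢0)))

  private
    monic-^ : ∀ a n → coeff ((X + const a) ^ n) n ≡ K.1# × Deg< (suc n) ((X + const a) ^ n)
    monic-^ a zero = ≡.refl , Deg<-cong const-1 (Deg<-const K.1#)
    monic-^ a (suc n) with monic-^ a n
    ... | e , d = ≡.trans (coeff-*-top 1 n (X + const a) _ dX d) (≡.trans (cong₂ K._*_ lead e) (K.*-identityˡ _))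
                , Deg<-* (X + const a) dX d
      where
      dX : Deg< 2 (X + const a)
      dX = Deg<-+ (bound Degree-X) (Deg<-mono (s≤s z≤n) (Deg<-const a))
      opaque
        unfolding const
        leadX : coeff X 1 ≡ K.1#
        leadX = ≡.refl
      lead : coeff (X + const a) 1 ≡ K.1#
      lead = ≡.trans (coeff-+ X (const a) 1) (≡.trans (cong₂ K._+_ leadX (vanish (Deg<-const a) 1 (s≤s z≤n))) (K.+-identityʳ _))

    X+0 : X + const K.0# ≈ X
    X+0 = trans (+-congˡ const-0) (+-identityʳ X)

    1≤q : Fin q → 1 ≤ q
    1≤q x = ≤-trans (s≤s z≤n) (Finₚ.toℕ<n x)

    eval-^ : ∀ x p n → eval x (p ^ n) ≡ eval x p ^ᴷ n
    eval-^ x p n = to-^ (evalHom x) p n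

    -- No binomial coefficients: the leading terms cancel, which leaves degree below q, and Fermat's
    -- identity supplies q zeros.
    frobenius-X : ∀ a → (X + const a) ^ q ≈ X ^ q + const a
    frobenius-X a = p-r≈0⇒p≈r (vanishing-everywhere low zeros)
      where
      D : Poly
      D = (X + const a) ^ q - (X ^ q + const a)
      X^q : coeff (X ^ q) q ≡ K.1# × Deg< (suc q) (X ^ q)
      X^q = ≡.trans (≡.sym (at (^-congˡ q X+0) q)) (proj₁ (monic-^ K.0# q)) , Deg<-cong (^-congˡ q X+0) (proj₂ (monic-^ K.0# q))
      top : ∀ i → q ≤ i → coeff D i ≡ K.0#
      top i l with ℕₚ.m≤n⇒m<n∨m≡n l
      ... | inj₁ lt = vanish (Deg<-+ (proj₂ (monic-^ a q)) (Deg<-neg (Deg<-+ (proj₂ X^q) (Deg<-mono (s≤s z≤n) (Deg<-const a))))) i lt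
      ... | inj₂ ≡.refl = ≡.trans (coeff-+ ((X + const a) ^ q) _ q) (≡.trans (cong₂ K._+_ (proj₁ (monic-^ a q))
            (≡.trans (coeff-neg (X ^ q + const a) q) (cong K.-_ (≡.trans (coeff-+ (X ^ q) (const a) q) (≡.trans (cong₂ K._+_ (proj₁ X^q) (vanish (Deg<-const a) q (1≤q a))) (K.+-identityʳ _))))))
            (K.-‿inverseʳ _))
      low : Deg< q D
      low = deg< top
      zeros : ∀ x → eval x D ≡ K.0#
      zeros x = begin
        eval x D ≡⟨ ≡.trans (eval-+ x ((X + const a) ^ q) (- (X ^ q + const a))) (cong (eval x ((X + const a) ^ q) K.+_) (eval-neg x (X ^ q + const a))) ⟩
        eval x ((X + const a) ^ q) K.- eval x (X ^ q + const a)
          ≡⟨ cong₂ (λ u v → u K.- v)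
               (≡.trans (eval-^ x (X + const a) q) (≡.trans (fermat (eval x (X + const a))) (≡.trans (eval-+ x X (const a)) (cong₂ K._+_ (eval-X x) (eval-const x a)))))
               (≡.trans (eval-+ x (X ^ q) (const a)) (cong₂ K._+_ (≡.trans (eval-^ x X q) (≡.trans (fermat (eval x X)) (eval-X x))) (eval-const x a))) ⟩
        (x K.+ a) K.- (x K.+ a) ≡⟨ K.-‿inverseʳ _ ⟩
        K.0# ∎
        where open ≡.≡-Reasoning

  -- Both sides of the case h = X have the same value at each of the q points.
  frobenius : ∀ h a → (h + const a) ^ q ≈ h ^ q + const a
  frobenius h a = begin
    (h + const a) ^ q ≈⟨ ^-congˡ q (trans (+-cong (sym (E.ev-X h)) (sym (E.ev-const h a))) (sym (E.ev-+ h X (const a)))) ⟩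
    E.ev h (X + const a) ^ q ≈⟨ to-^ (E.evHom h) (X + const a) q ⟨
    E.ev h ((X + const a) ^ q) ≈⟨ E.ev-cong h (frobenius-X a) ⟩
    E.ev h (X ^ q + const a) ≈⟨ E.ev-+ h (X ^ q) (const a) ⟩
    E.ev h (X ^ q) + E.ev h (const a) ≈⟨ +-cong (trans (to-^ (E.evHom h) X q) (^-congˡ q (E.ev-X h))) (E.ev-const h a) ⟩
    h ^ q + const a ∎
    where
    module E = EvalOver constHom
    open import Relation.Binary.Reasoning.Setoid setoid

-- Taylor expansions as polynomials in two variables.

module Bivariate (F : DecField) where
  open FieldPoly F
  module BP = PolyOver polyRing
  module B = CommutativeRing BP.polyRing
  module BS = SolverOver BP.polyRing
  open Powers BP.polyRing using () renaming (_^_ to _^ᴮ_)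
  open Powers polyRing using (_^_)

  BPoly : Set
  BPoly = BP.Poly

  record XDeg< (D : ℕ) (P : BPoly) : Set where
    constructor xdeg<
    field coefficient : ∀ l → Deg< D (BP.coeff P l)
  open XDeg< public

  XDeg<-cong : ∀ {D P Q} → P B.≈ Q → XDeg< D P → XDeg< D Q
  XDeg<-cong e d = xdeg< λ l → Deg<-cong (BP.at e l) (coefficient d l)

  XDeg<-mono : ∀ {D E P} → D ≤ E → XDeg< D P → XDeg< E P
  XDeg<-mono l d = xdeg< λ i → Deg<-mono l (coefficient d i)

  XDeg<-0 : ∀ {D} → XDeg< D B.0#
  XDeg<-0 = xdeg< λ _ → Deg<-0

  XDeg<-+ : ∀ {D P Q} → XDeg< D P → XDeg< D Q → XDeg< D (P B.+ Q)
  XDeg<-+ {D} {P} {Q} d e = xdeg< λ l → Deg<-cong (sym (BP.coeff-+ P Q l)) (Deg<-+ (coefficient d l) (coefficient e l))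

  XDeg<-∷ : ∀ {D c P} → Deg< D c → XDeg< D P → XDeg< D (c ∷ P)
  XDeg<-∷ d e = xdeg< λ { zero → d ; (suc l) → coefficient e l }

  XDeg<-tail : ∀ {D c P} → XDeg< D (c ∷ P) → XDeg< D P
  XDeg<-tail d = xdeg< λ l → coefficient d (suc l)

  XDeg<-* : ∀ {a b} P {Q} → XDeg< a P → XDeg< (suc b) Q → XDeg< (a ℕ.+ b) (P B.* Q)
  XDeg<-* [] {Q} d e = XDeg<-cong (B.sym (B.zeroˡ Q)) XDeg<-0
  XDeg<-* (c ∷ P) {Q} d e = XDeg<-cong (B.sym (BP.*-∷ c P Q)) (XDeg<-+
    (xdeg< λ l → Deg<-cong (sym (BP.coeff-scale c Q l)) (Deg<-* c (coefficient d 0) (coefficient e l)))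
    (XDeg<-∷ Deg<-0 (XDeg<-* P (XDeg<-tail d) e)))

  XDeg<-const : ∀ {D c} → Deg< D c → XDeg< D (BP.const c)
  XDeg<-const {c = c} d = XDeg<-cong (B.sym (BP.const-∷ c)) (XDeg<-∷ d XDeg<-0)

  Y : BPoly
  Y = BP.X

  Deg<-1 : Deg< 1 1#
  Deg<-1 = Deg<-cong const-1 (Deg<-const K.1#)

  XDeg<-1 : XDeg< 1 B.1#
  XDeg<-1 = XDeg<-∷ Deg<-1 XDeg<-0

  XDeg<-Y : XDeg< 1 Y
  XDeg<-Y = XDeg<-cong (B.sym BP.X-∷) (XDeg<-∷ Deg<-0 (XDeg<-∷ Deg<-1 XDeg<-0))

  XDeg<-^ : ∀ {m P} → XDeg< (suc m) P → ∀ L → XDeg< (suc (L ℕ.* m)) (P ^ᴮ L)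
  XDeg<-^ d zero = XDeg<-1
  XDeg<-^ {m} {P} d (suc L) = XDeg<-* P d (XDeg<-^ d L)

  module Taylor = EvalOver (compHom constHom BP.constHom)

  X+Y : BPoly
  X+Y = BP.const X B.+ Y

  -- The Taylor expansion p(x + Y). Its Y-coefficients are the Hasse derivatives of p, which detect
  -- multiplicities in every characteristic, unlike iterated ordinary derivatives.
  τ : Poly → BPoly
  τ = Taylor.ev X+Y

  XDeg<-τ : ∀ p → XDeg< (length p) (τ p)
  XDeg<-τ [] = XDeg<-0
  XDeg<-τ (a ∷ p) = XDeg<-+ (XDeg<-mono (s≤s z≤n) (XDeg<-const (Deg<-const a)))
    (XDeg<-cong (B.*-comm (τ p) X+Y) (XDeg<-mono (≤-reflexive (ℕₚ.+-comm (length p) 1))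
      (XDeg<-* (τ p) (XDeg<-τ p) (XDeg<-+ (XDeg<-const (bound Degree-X)) (XDeg<-mono (s≤s z≤n) XDeg<-Y)))))

  module Specialize (x₀ : K.Carrier) = EvalOver (compHom (evalHom x₀) constHom)

  -- Sets x = x₀ in the coefficients and Y = t - x₀, so a Taylor expansion around x₀ is summed up
  -- again; this is `spec-τ`.
  spec : K.Carrier → BPoly → Poly
  spec x₀ = Specialize.ev x₀ (t- x₀)

  spec-const : ∀ x₀ p → spec x₀ (BP.const p) ≈ const (eval x₀ p)
  spec-const x₀ p = Specialize.ev-const x₀ (t- x₀) p

  spec-Y : ∀ x₀ → spec x₀ Y ≈ t- x₀
  spec-Y x₀ = Specialize.ev-X x₀ (t- x₀)

  spec-X+Y : ∀ x₀ → spec x₀ X+Y ≈ X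
  spec-X+Y x₀ = trans (Specialize.ev-+ x₀ (t- x₀) (BP.const X) Y) (trans (+-cong (trans (spec-const x₀ X) (const-cong (eval-X x₀))) (spec-Y x₀))
    (solve 2 (λ a x → a :+ (x :- a) := x) (const x₀) X))

  spec-τ : ∀ x₀ p → spec x₀ (τ p) ≈ p
  spec-τ x₀ [] = refl
  spec-τ x₀ (a ∷ p) = trans (Specialize.ev-+ x₀ (t- x₀) (BP.const (const a)) (X+Y B.* τ p))
    (trans (+-cong (trans (spec-const x₀ (const a)) (const-cong (eval-const x₀ a)))
      (trans (Specialize.ev-* x₀ (t- x₀) X+Y (τ p)) (*-cong (spec-X+Y x₀) (spec-τ x₀ p)))) (sym (∷-split a p)))

  private
    module AtZero = EvalOver (idHom polyRing)

    atZero-coeff : ∀ P → AtZero.ev 0# P ≈ BP.coeff P 0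
    atZero-coeff [] = refl
    atZero-coeff (c ∷ P) = trans (+-congˡ (zeroˡ _)) (+-identityʳ c)

    atZero-τ : ∀ p → AtZero.ev 0# (τ p) ≈ p
    atZero-τ [] = refl
    atZero-τ (a ∷ p) = trans (AtZero.ev-+ 0# (BP.const (const a)) (X+Y B.* τ p))
      (trans (+-cong (AtZero.ev-const 0# (const a)) (trans (AtZero.ev-* 0# X+Y (τ p))
        (*-cong (trans (AtZero.ev-+ 0# (BP.const X) Y) (trans (+-cong (AtZero.ev-const 0# X) (AtZero.ev-X 0#)) (+-identityʳ X))) (atZero-τ p))))
      (sym (∷-split a p)))

  increment : BPoly → BPoly
  increment [] = []
  increment (c ∷ P) = P

  τ-expand : ∀ p → τ p B.≈ BP.const p B.+ Y B.* increment (τ p)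
  τ-expand p = go (τ p) (trans (sym (atZero-coeff (τ p))) (atZero-τ p))
    where
    go : ∀ P → BP.coeff P 0 ≈ p → P B.≈ BP.const p B.+ Y B.* increment P
    go [] e = B.sym (B.trans (B.+-cong (B.trans (BP.const-cong (sym e)) BP.const-0) (B.zeroʳ Y)) (B.+-identityˡ B.0#))
    go (c ∷ P) e = B.trans (BP.∷-split c P) (B.+-congʳ (BP.const-cong e))

  XDeg<-increment : ∀ {D} P → XDeg< D P → XDeg< D (increment P)
  XDeg<-increment [] d = d
  XDeg<-increment (c ∷ P) d = XDeg<-tail d

  -- Connects the linear conditions on coefficients to multiple zeros: the conditions do not mention
  -- x₀, so one choice of unknowns works for all points at once.
  spec-vanish : ∀ x₀ ℓ P → (∀ l → l < ℓ → BP.coeff P l ≈ 0#) → t- x₀ ^ ℓ ∣ spec x₀ P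
  spec-vanish x₀ zero P h = spec x₀ P , sym (*-identityˡ _)
  spec-vanish x₀ (suc ℓ) [] h = 0# , sym (zeroʳ _)
  spec-vanish x₀ (suc ℓ) (c ∷ P) h with spec-vanish x₀ ℓ P (λ l l<ℓ → h (suc l) (s≤s l<ℓ))
  ... | s , e = s , trans (+-cong (trans (const-cong (K.trans (eval-cong x₀ (h 0 (s≤s z≤n))) K.refl)) const-0) (*-congˡ e))
        (trans (+-identityˡ _) (sym (*-assoc _ _ s)))

  -- t^L τ(T)^g = t^g W g L + O(Y^(L+1)), where the degree of W in x does not depend on g.
  module PowerExpansion (T : Poly) where
    t T₁ : BPoly
    t = BP.const T
    T₁ = increment (τ T)

    -- With τ(T) = t + Y T₁, each step multiplies by one more factor of the power. Expanding t^g (1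
    -- + Y T₁ / t)^g up to Y^L has denominators dividing t^L, and the factor t^L clears them. The
    -- bound L m on the x-degree matters because g is about q / 2.
    W : ℕ → ℕ → BPoly
    W zero L = t ^ᴮ L
    W (suc g) zero = W g zero
    W (suc g) (suc L) = W g (suc L) B.+ Y B.* (T₁ B.* W g L)

    private
      S = τ T

    W-expand : ∀ g L → ∃ λ c → t ^ᴮ L B.* S ^ᴮ g B.≈ t ^ᴮ g B.* W g L B.+ Y ^ᴮ suc L B.* c
    W-expand zero L = B.0# , BS.solve 2 (λ a b → a :* :1 := :1 :* a :+ b :* :0) (t ^ᴮ L) (Y ^ᴮ suc L)
    W-expand (suc g) zero = step (W-expand g zero)
      where
      step : (∃ λ c → t ^ᴮ 0 B.* S ^ᴮ g B.≈ t ^ᴮ g B.* W g 0 B.+ Y ^ᴮ 1 B.* c) →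
             ∃ λ c → t ^ᴮ 0 B.* S ^ᴮ suc g B.≈ t ^ᴮ suc g B.* W g 0 B.+ Y ^ᴮ 1 B.* c
      step (c , e) = t B.* c B.+ T₁ B.* S ^ᴮ g , (begin
        B.1# B.* (S B.* S ^ᴮ g) ≈⟨ B.*-congˡ (B.*-congʳ (τ-expand T)) ⟩
        B.1# B.* ((t B.+ Y B.* T₁) B.* S ^ᴮ g)
          ≈⟨ BS.solve 4 (λ t y u s → :1 :* ((t :+ y :* u) :* s) := t :* (:1 :* s) :+ y :* :1 :* (u :* s)) t Y T₁ (S ^ᴮ g) ⟩
        t B.* (B.1# B.* S ^ᴮ g) B.+ Y ^ᴮ 1 B.* (T₁ B.* S ^ᴮ g) ≈⟨ B.+-congʳ (B.*-congˡ e) ⟩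
        t B.* (t ^ᴮ g B.* W g 0 B.+ Y ^ᴮ 1 B.* c) B.+ Y ^ᴮ 1 B.* (T₁ B.* S ^ᴮ g)
          ≈⟨ BS.solve 6 (λ t p w y c u → t :* (p :* w :+ y :* c) :+ y :* u := t :* p :* w :+ y :* (t :* c :+ u)) t (t ^ᴮ g) (W g 0) (Y ^ᴮ 1) c (T₁ B.* S ^ᴮ g) ⟩
        t ^ᴮ suc g B.* W g 0 B.+ Y ^ᴮ 1 B.* (t B.* c B.+ T₁ B.* S ^ᴮ g) ∎)
        where open import Relation.Binary.Reasoning.Setoid B.setoid
    W-expand (suc g) (suc L) = step (W-expand g (suc L)) (W-expand g L)
      where
      step : (∃ λ c → t ^ᴮ suc L B.* S ^ᴮ g B.≈ t ^ᴮ g B.* W g (suc L) B.+ Y ^ᴮ suc (suc L) B.* c) →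
             (∃ λ c → t ^ᴮ L B.* S ^ᴮ g B.≈ t ^ᴮ g B.* W g L B.+ Y ^ᴮ suc L B.* c) →
             ∃ λ c → t ^ᴮ suc L B.* S ^ᴮ suc g B.≈ t ^ᴮ suc g B.* W (suc g) (suc L) B.+ Y ^ᴮ suc (suc L) B.* c
      step (c , e) (d , f) = t B.* c B.+ T₁ B.* (t B.* d) , (begin
        t ^ᴮ suc L B.* (S B.* S ^ᴮ g) ≈⟨ B.*-congˡ (B.*-congʳ (τ-expand T)) ⟩
        t ^ᴮ suc L B.* ((t B.+ Y B.* T₁) B.* S ^ᴮ g)
          ≈⟨ BS.solve 5 (λ t l y u s → t :* l :* ((t :+ y :* u) :* s) := t :* (t :* l :* s) :+ y :* (u :* (t :* (l :* s)))) t (t ^ᴮ L) Y T₁ (S ^ᴮ g) ⟩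
        t B.* (t ^ᴮ suc L B.* S ^ᴮ g) B.+ Y B.* (T₁ B.* (t B.* (t ^ᴮ L B.* S ^ᴮ g))) ≈⟨ B.+-cong (B.*-congˡ e) (B.*-congˡ (B.*-congˡ (B.*-congˡ f))) ⟩
        t B.* (t ^ᴮ g B.* W g (suc L) B.+ Y ^ᴮ suc (suc L) B.* c) B.+ Y B.* (T₁ B.* (t B.* (t ^ᴮ g B.* W g L B.+ Y ^ᴮ suc L B.* d)))
          ≈⟨ BS.solve 9 (λ t p w y z c u v d → t :* (p :* w :+ y :* z :* c) :+ y :* (u :* (t :* (p :* v :+ z :* d))) := t :* p :* (w :+ y :* (u :* v)) :+ y :* z :* (t :* c :+ u :* (t :* d))) t (t ^ᴮ g) (W g (suc L)) Y (Y ^ᴮ suc L) c T₁ (W g L) d ⟩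
        t ^ᴮ suc g B.* W (suc g) (suc L) B.+ Y ^ᴮ suc (suc L) B.* (t B.* c B.+ T₁ B.* (t B.* d)) ∎)
        where open import Relation.Binary.Reasoning.Setoid B.setoid

    XDeg<-W : ∀ {m} → length T ≤ suc m → ∀ g L → XDeg< (suc (L ℕ.* m)) (W g L)
    XDeg<-W {m} l zero L = XDeg<-^ (XDeg<-const (Deg<-mono l (Deg<-length T))) L
    XDeg<-W l (suc g) zero = XDeg<-W l g zero
    XDeg<-W {m} l (suc g) (suc L) = XDeg<-+ (XDeg<-W l g (suc L)) (XDeg<-* Y XDeg<-Y (XDeg<-* T₁ (XDeg<-increment (τ T) (XDeg<-mono l (XDeg<-τ T))) (XDeg<-W l g L)))

-- Stepanov's method.

grid : {A : Set} → ℕ → ℕ → (ℕ → ℕ → A) → List A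
grid zero D f = []
grid (suc ℓ) D f = applyUpTo (f ℓ) D List.++ grid ℓ D f

length-grid : ∀ {A : Set} ℓ D (f : ℕ → ℕ → A) → length (grid ℓ D f) ≡ ℓ ℕ.* D
length-grid zero D f = ≡.refl
length-grid (suc ℓ) D f = ≡.trans (Listₚ.length-++ (applyUpTo (f ℓ) D)) (cong₂ ℕ._+_ (Listₚ.length-applyUpTo (f ℓ) D) (length-grid ℓ D f))

grid⁻ : ∀ {A : Set} {P : A → Set} ℓ D (f : ℕ → ℕ → A) → All P (grid ℓ D f) → ∀ {l i} → l < ℓ → i < D → P (f l i)
grid⁻ (suc ℓ) D f all {l} {i} (s≤s l≤ℓ) i<D with ℕₚ.m≤n⇒m<n∨m≡n l≤ℓ
... | inj₁ l<ℓ = grid⁻ ℓ D f (Allₚ.++⁻ʳ (applyUpTo (f ℓ) D) all) l<ℓ i<D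
... | inj₂ ≡.refl = Allₚ.applyUpTo⁻ (f ℓ) D (Allₚ.++⁻ˡ (applyUpTo (f ℓ) D) all) i<D

private
  module StepanovArithmetic where
    split-conditions : ∀ l j n k → l ℕ.* (j ℕ.+ k) ℕ.+ l ℕ.* n ≡ l ℕ.* (j ℕ.+ (n ℕ.+ k))
    split-conditions = N.solve 4 (λ l j n k → l N.:* (j N.:+ k) N.:+ l N.:* n N.:= l N.:* (j N.:+ (n N.:+ k))) ≡.refl

    double : ∀ j n → (j ℕ.+ j) ℕ.* n ≡ j ℕ.* (n ℕ.+ n)
    double = N.solve 2 (λ j n → (j N.:+ j) N.:* n N.:= j N.:* (n N.:+ n)) ≡.refl

    regroup : ∀ j q n g m → (j ℕ.* q ℕ.+ (n ℕ.+ g ℕ.* m)) ℕ.+ (j ℕ.* q ℕ.+ (n ℕ.+ g ℕ.* m)) ≡ q ℕ.* (j ℕ.+ j) ℕ.+ ((n ℕ.+ n) ℕ.+ (g ℕ.+ g) ℕ.* m)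
    regroup = N.solve 5 (λ j q n g m → (j N.:* q N.:+ (n N.:+ g N.:* m)) N.:+ (j N.:* q N.:+ (n N.:+ g N.:* m)) N.:= q N.:* (j N.:+ j) N.:+ ((n N.:+ n) N.:+ (g N.:+ g) N.:* m)) ≡.refl

    collect : ∀ q l m → q ℕ.* suc (suc l) ℕ.+ (q ℕ.+ q ℕ.* m) ≡ q ℕ.* suc l ℕ.+ q ℕ.* suc (suc m)
    collect = N.solve 3 (λ q l m → q N.:* (N.con 1 N.:+ (N.con 1 N.:+ l)) N.:+ (q N.:+ q N.:* m) N.:= q N.:* (N.con 1 N.:+ l) N.:+ q N.:* (N.con 1 N.:+ (N.con 1 N.:+ m))) ≡.refl

module StepanovMethod {q} (F : FiniteField q) where
  open FiniteFieldPoly F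
  open FiniteFieldPowers F
  open LinearRelations field′
  open Bivariate field′
  open NormForms field′ using (NonZero⇒≉0; NonZero-++)
  open Powers K.commRing using () renaming (_^_ to _^ᴷ_; ^-congˡ to ^ᴷ-congˡ)
  open Powers polyRing
  open Powers BP.polyRing using () renaming (_^_ to _^ᴮ_)

  _⊕_ : ∀ {n} → Row n → Row n → Row n
  _⊕_ = Vec.zipWith K._+_

  _⊛_ : ∀ {n} → Fin q → Row n → Row n
  c ⊛ v = Vec.map (c K.*_) v

  private
    zeros : ∀ {n} → Row n
    zeros = Vec.replicate _ K.0#

    ⊕-zeros : ∀ {n} (v : Row n) → zeros ⊕ v ≡ v
    ⊕-zeros [] = ≡.refl
    ⊕-zeros (a ∷ v) = cong₂ _∷_ (K.+-identityˡ a) (⊕-zeros v)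

    ⊛-zeros : ∀ {n} c → c ⊛ zeros {n} ≡ zeros
    ⊛-zeros {zero} c = ≡.refl
    ⊛-zeros {suc n} c = cong₂ _∷_ (K.zeroʳ c) (⊛-zeros c)

  record Linear {n} (Λ : Row n → Fin q) : Set where
    field
      Λ-⊕ : ∀ u v → Λ (u ⊕ v) ≡ Λ u K.+ Λ v
      Λ-⊛ : ∀ c v → Λ (c ⊛ v) ≡ c K.* Λ v
  open Linear

  private
    Λ-zeros : ∀ {n} {Λ : Row n → Fin q} → Linear Λ → Λ zeros ≡ K.0#
    Λ-zeros {n} {Λ} lin = ≡.trans (cong Λ (≡.sym (⊛-zeros K.0#))) (≡.trans (Λ-⊛ lin K.0# zeros) (K.zeroˡ _))

    -- The conditions arise as linear functionals of the unknowns; their values on the unit vectors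
    -- are the rows that `kernel` expects.
    row : ∀ {n} → (Row n → Fin q) → Row n
    row {zero} Λ = []
    row {suc n} Λ = Λ (K.1# ∷ zeros) ∷ row (λ v → Λ (K.0# ∷ v))

    tail-linear : ∀ {n} {Λ : Row (suc n) → Fin q} → Linear Λ → Linear (λ v → Λ (K.0# ∷ v))
    tail-linear {Λ = Λ} lin = record
      { Λ-⊕ = λ u v → ≡.trans (cong (λ z → Λ (z ∷ (u ⊕ v))) (≡.sym (K.+-identityˡ K.0#))) (Λ-⊕ lin (K.0# ∷ u) (K.0# ∷ v))
      ; Λ-⊛ = λ c v → ≡.trans (cong (λ z → Λ (z ∷ (c ⊛ v))) (≡.sym (K.zeroʳ c))) (Λ-⊛ lin c (K.0# ∷ v)) }

    row-∙ : ∀ {n} {Λ : Row n → Fin q} → Linear Λ → ∀ v → row Λ ∙ v ≡ Λ v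
    row-∙ {Λ = Λ} lin [] = ≡.sym (Λ-zeros lin)
    row-∙ {Λ = Λ} lin (a ∷ v) = ≡.trans (cong₂ K._+_ (≡.trans (K.*-comm _ a) (≡.sym (Λ-⊛ lin a _))) (row-∙ (tail-linear lin) v))
      (≡.trans (≡.sym (Λ-⊕ lin _ _)) (cong Λ (cong₂ _∷_ (≡.trans (K.+-identityʳ _) (K.*-identityʳ a)) (≡.trans (cong (_⊕ v) (⊛-zeros a)) (⊕-zeros v)))))

  toList-⊕ : ∀ {n} (u v : Row n) → toList (u ⊕ v) ≈ toList u + toList v
  toList-⊕ [] [] = sym (+-identityˡ 0#)
  toList-⊕ (a ∷ u) (b ∷ v) = begin
    (a K.+ b) ∷ toList (u ⊕ v) ≈⟨ ∷-cong K.refl (toList-⊕ u v) ⟩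
    (a K.+ b) ∷ (toList u + toList v) ≈⟨ trans (∷-split (a K.+ b) (toList u + toList v)) (+-congʳ (const-+ a b)) ⟩
    (const a + const b) + X * (toList u + toList v)
      ≈⟨ solve 5 (λ a b x u v → (a :+ b) :+ x :* (u :+ v) := (a :+ x :* u) :+ (b :+ x :* v)) (const a) (const b) X (toList u) (toList v) ⟩
    (const a + X * toList u) + (const b + X * toList v) ≈⟨ +-cong (∷-split a (toList u)) (∷-split b (toList v)) ⟨
    (a ∷ toList u) + (b ∷ toList v) ∎
    where open import Relation.Binary.Reasoning.Setoid setoid

  toList-⊛ : ∀ {n} c (v : Row n) → toList (c ⊛ v) ≈ const c * toList v
  toList-⊛ c [] = sym (zeroʳ _)
  toList-⊛ c (a ∷ v) = begin
    (c K.* a) ∷ toList (c ⊛ v) ≈⟨ ∷-cong K.refl (toList-⊛ c v) ⟩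
    (c K.* a) ∷ (const c * toList v) ≈⟨ trans (∷-split (c K.* a) _) (+-congʳ (const-*-const c a)) ⟩
    const c * const a + X * (const c * toList v) ≈⟨ solve 4 (λ c a x v → c :* a :+ x :* (c :* v) := c :* (a :+ x :* v)) (const c) (const a) X (toList v) ⟩
    const c * (const a + X * toList v) ≈⟨ *-congˡ (∷-split a (toList v)) ⟨
    const c * (a ∷ toList v) ∎
    where open import Relation.Binary.Reasoning.Setoid setoid

  -- T is not a constant multiple of a square in the rational function field. Every nonzero δ is
  -- allowed because the argument meets the constant T(c₀), over which it has no control.
  NotSquare : Poly → Set
  NotSquare T = ∀ δ → ¬ (δ ≡ K.0#) → ∀ A B → T * (A * A) ≈ const δ * (B * B) → A ≈ 0# × B ≈ 0#

  private
    spec-block : ∀ x a b c d e f → spec x ((a B.* b B.+ c B.* d) B.+ e B.* f) ≈ (spec x a * spec x b + spec x c * spec x d) + spec x e * spec x f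
    spec-block x a b c d e f = trans (Sp.to-+ (a B.* b B.+ c B.* d) (e B.* f)) (+-cong (trans (Sp.to-+ (a B.* b) (c B.* d)) (+-cong (Sp.to-* a b) (Sp.to-* c d))) (Sp.to-* e f))
      where module Sp = RingHom (Specialize.evHom x (t- x))

    -- The ring identity behind the induction in `specialize`, with l = t₀^L, p = T^g, w its
    -- truncated expansion, o = (t - x₀)^(L+1) and h = x₀ - c₀. Both congruences modulo o are
    -- inserted at once.
    recombine : ∀ l a w b h R o s c p r Y → l * p ≈ w + o * c → Y ≈ o * r + h →
      (l * a + w * b) + h * (l * R + o * s) ≈ l * ((a + p * b) + Y * R) + o * (h * s - c * b - l * (r * R))
    recombine l a w b h R o s c p r Y e f = begin
      (l * a + w * b) + h * (l * R + o * s)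
        ≈⟨ solve 9 (λ l a w b h R o s c → (l :* a :+ w :* b) :+ h :* (l :* R :+ o :* s) := (l :* a :+ (w :+ o :* c) :* b) :+ l :* (h :* R) :+ o :* (h :* s :- c :* b)) l a w b h R o s c ⟩
      (l * a + (w + o * c) * b) + l * (h * R) + o * (h * s - c * b) ≈⟨ +-congʳ (+-congʳ (+-congˡ (*-congʳ e))) ⟨
      (l * a + l * p * b) + l * (h * R) + o * (h * s - c * b)
        ≈⟨ solve 9 (λ l a p b h R o r z → (l :* a :+ l :* p :* b) :+ l :* (h :* R) :+ o :* z := l :* ((a :+ p :* b) :+ (o :* r :+ h) :* R) :+ o :* (z :- l :* (r :* R))) l a p b h R o r (h * s - c * b) ⟩
      l * ((a + p * b) + (o * r + h) * R) + o * (h * s - c * b - l * (r * R)) ≈⟨ +-congʳ (*-congˡ (+-congˡ (*-congʳ f))) ⟨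
      l * ((a + p * b) + Y * R) + o * (h * s - c * b - l * (r * R)) ∎
      where open import Relation.Binary.Reasoning.Setoid setoid

  module Auxiliary (T : Poly) (m : ℕ) (T≤ : length T ≤ suc m) (c₀ : Fin q) (Tc≢0 : ¬ (eval c₀ T ≡ K.0#)) (T-ns : NotSquare T)
                   (g : ℕ) (q≡ : q ≡ suc (g ℕ.+ g)) (L n : ℕ) (n≤ : n ℕ.+ n ℕ.+ m ≤ q) where
    open PowerExpansion T

    private
      first second : ∀ {k} → Row ((n ℕ.+ n) ℕ.+ k) → Row n
      first v = take n (take (n ℕ.+ n) v)
      second v = drop n (take (n ℕ.+ n) v)

      rest : ∀ {k} → Row ((n ℕ.+ n) ℕ.+ k) → Row k
      rest v = drop (n ℕ.+ n) v

      x̂ : BPoly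
      x̂ = BP.const (t- c₀)

      Y₀ : Poly
      Y₀ = t- c₀ ^ q

    -- A substitute for t^L R of small degree in x: at a point with T^g = 1 the power T^g may be
    -- replaced by W and Y₀ by x - c₀, up to order L. Its coefficients give few enough linear
    -- conditions.
    E : ∀ J → Row (J ℕ.* (n ℕ.+ n)) → BPoly
    E zero v = B.0#
    E (suc J) v = (t ^ᴮ L B.* τ (toList (first v)) B.+ W g L B.* τ (toList (second v))) B.+ x̂ B.* E J (rest v)

    -- Stepanov's auxiliary polynomial, a combination of the powers Y₀^j and Y₀^j T^g with
    -- coefficients of degree below n, where Y₀ = (t - c₀)^q.
    R : ∀ J → Row (J ℕ.* (n ℕ.+ n)) → Poly
    R zero v = 0#
    R (suc J) v = (toList (first v) + T ^ g * toList (second v)) + Y₀ * R J (rest v)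

    private
      τ-⊕ : ∀ (u v : Row n) → τ (toList (u ⊕ v)) B.≈ τ (toList u) B.+ τ (toList v)
      τ-⊕ u v = B.trans (Taylor.ev-cong X+Y (toList-⊕ u v)) (Taylor.ev-+ X+Y (toList u) (toList v))

      τ-⊛ : ∀ c (v : Row n) → τ (toList (c ⊛ v)) B.≈ BP.const (const c) B.* τ (toList v)
      τ-⊛ c v = B.trans (Taylor.ev-cong X+Y (toList-⊛ c v)) (B.trans (Taylor.ev-* X+Y (const c) (toList v)) (B.*-congʳ (Taylor.ev-const X+Y c)))

      first-⊕ : ∀ {k} (u v : Row ((n ℕ.+ n) ℕ.+ k)) → first (u ⊕ v) ≡ first u ⊕ first v
      first-⊕ u v = ≡.trans (cong (take n) (Vecₚ.take-zipWith K._+_ u v)) (Vecₚ.take-zipWith K._+_ (take (n ℕ.+ n) u) (take (n ℕ.+ n) v))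

      second-⊕ : ∀ {k} (u v : Row ((n ℕ.+ n) ℕ.+ k)) → second (u ⊕ v) ≡ second u ⊕ second v
      second-⊕ u v = ≡.trans (cong (drop n) (Vecₚ.take-zipWith K._+_ u v)) (Vecₚ.drop-zipWith K._+_ (take (n ℕ.+ n) u) (take (n ℕ.+ n) v))

      first-⊛ : ∀ {k} c (v : Row ((n ℕ.+ n) ℕ.+ k)) → first (c ⊛ v) ≡ c ⊛ first v
      first-⊛ c v = ≡.trans (cong (take n) (Vecₚ.take-map (c K.*_) (n ℕ.+ n) v)) (Vecₚ.take-map (c K.*_) n (take (n ℕ.+ n) v))

      second-⊛ : ∀ {k} c (v : Row ((n ℕ.+ n) ℕ.+ k)) → second (c ⊛ v) ≡ c ⊛ second v
      second-⊛ c v = ≡.trans (cong (drop n) (Vecₚ.take-map (c K.*_) (n ℕ.+ n) v)) (Vecₚ.drop-map (c K.*_) n (take (n ℕ.+ n) v))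

      τ-≡ : ∀ {u v : Row n} {x} → u ≡ v → τ (toList v) B.≈ x → τ (toList u) B.≈ x
      τ-≡ ≡.refl e = e

      E-⊕ : ∀ J u v → E J (u ⊕ v) B.≈ E J u B.+ E J v
      E-⊕ zero u v = B.sym (B.+-identityˡ B.0#)
      E-⊕ (suc J) u v = B.trans
        (B.+-cong (B.+-cong (B.*-congˡ (τ-≡ (first-⊕ u v) (τ-⊕ (first u) (first v)))) (B.*-congˡ (τ-≡ (second-⊕ u v) (τ-⊕ (second u) (second v)))))
          (B.*-congˡ (B.trans (B.reflexive (cong (E J) (Vecₚ.drop-zipWith {m = n ℕ.+ n} K._+_ u v))) (E-⊕ J (rest u) (rest v)))))
        (BS.solve 9 (λ t a b w c d x e f → (t :* (a :+ b) :+ w :* (c :+ d)) :+ x :* (e :+ f) := ((t :* a :+ w :* c) :+ x :* e) :+ ((t :* b :+ w :* d) :+ x :* f))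
          (t ^ᴮ L) (τ (toList (first u))) (τ (toList (first v))) (W g L) (τ (toList (second u))) (τ (toList (second v))) x̂ (E J (rest u)) (E J (rest v)))

      E-⊛ : ∀ J c v → E J (c ⊛ v) B.≈ BP.const (const c) B.* E J v
      E-⊛ zero c v = B.sym (B.zeroʳ _)
      E-⊛ (suc J) c v = B.trans
        (B.+-cong (B.+-cong (B.*-congˡ (τ-≡ (first-⊛ c v) (τ-⊛ c (first v)))) (B.*-congˡ (τ-≡ (second-⊛ c v) (τ-⊛ c (second v)))))
          (B.*-congˡ (B.trans (B.reflexive (cong (E J) (Vecₚ.drop-map (c K.*_) (n ℕ.+ n) v))) (E-⊛ J c (rest v)))))
        (BS.solve 7 (λ t a k w b x e → (t :* (k :* a) :+ w :* (k :* b)) :+ x :* (k :* e) := k :* ((t :* a :+ w :* b) :+ x :* e))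
          (t ^ᴮ L) (τ (toList (first v))) (BP.const (const c)) (W g L) (τ (toList (second v))) x̂ (E J (rest v)))

      Λ : ∀ J → ℕ → ℕ → Row (J ℕ.* (n ℕ.+ n)) → Fin q
      Λ J l i v = coeff (BP.coeff (E J v) l) i

      Λ-linear : ∀ J l i → Linear (Λ J l i)
      Λ-linear J l i = record
        { Λ-⊕ = λ u v → ≡.trans (at (trans (BP.at (E-⊕ J u v) l) (BP.coeff-+ (E J u) (E J v) l)) i) (coeff-+ (BP.coeff (E J u) l) (BP.coeff (E J v) l) i)
        ; Λ-⊛ = λ c v → ≡.trans (at (trans (BP.at (B.trans (E-⊛ J c v) (BP.const-* (const c) (E J v))) l) (trans (BP.coeff-scale (const c) (E J v) l) (const-* c (BP.coeff (E J v) l)))) i)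
                  (coeff-scale c (BP.coeff (E J v) l) i) }

    degreeBound : ℕ → ℕ
    degreeBound J = J ℕ.+ (n ℕ.+ L ℕ.* m)

    private
      length-toList : ∀ {k} (v : Row k) → length (toList v) ≡ k
      length-toList [] = ≡.refl
      length-toList (a ∷ v) = cong suc (length-toList v)

      XDeg<-E : ∀ J v → XDeg< (degreeBound J) (E J v)
      XDeg<-E zero v = XDeg<-0
      XDeg<-E (suc J) v = XDeg<-+
        (XDeg<-+ (block (t ^ᴮ L) (XDeg<-^ (XDeg<-const (Deg<-mono T≤ (Deg<-length T))) L) (first v)) (block (W g L) (XDeg<-W T≤ g L) (second v)))
        (XDeg<-cong (B.*-comm (E J (rest v)) x̂) (XDeg<-mono (≤-reflexive (ℕₚ.+-comm (degreeBound J) 1)) (XDeg<-* (E J (rest v)) (XDeg<-E J (rest v)) (XDeg<-const (bound (Degree-t- c₀))))))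
        where
        block : ∀ P → XDeg< (suc (L ℕ.* m)) P → (u : Row n) → XDeg< (degreeBound (suc J)) (P B.* τ (toList u))
        block P d u = XDeg<-cong (B.*-comm (τ (toList u)) P) (XDeg<-mono (m≤n+m (n ℕ.+ L ℕ.* m) (suc J))
          (XDeg<-* (τ (toList u)) (subst (λ k → XDeg< k (τ (toList u))) (length-toList u) (XDeg<-τ (toList u))) d))

    solution : ∀ J ℓ → ℓ ℕ.* degreeBound J < J ℕ.* (n ℕ.+ n) → ∃ λ v → NonZero v × (∀ l → l < ℓ → BP.coeff (E J v) l ≈ 0#)
    solution J ℓ h with kernel (grid ℓ (degreeBound J) (λ l i → row (Λ J l i))) (subst (_< J ℕ.* (n ℕ.+ n)) (≡.sym (length-grid ℓ (degreeBound J) _)) h)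
    ... | v , nz , ks = v , nz , λ l l<ℓ → mk≈ (low l l<ℓ)
      where
      low : ∀ l → l < ℓ → ∀ i → coeff (BP.coeff (E J v) l) i ≡ K.0#
      low l l<ℓ i with i ℕₚ.<? degreeBound J
      ... | yes i< = ≡.trans (≡.sym (row-∙ (Λ-linear J l i) v)) (grid⁻ ℓ (degreeBound J) (λ l i → row (Λ J l i)) ks l<ℓ i<)
      ... | no i≮ = vanish (coefficient (XDeg<-E J v) l) i (ℕₚ.≮⇒≥ i≮)

    private
      g*2 : ∀ (p : Poly) → p * (p ^ g * p ^ g) ≈ p ^ q
      g*2 p = trans (*-congˡ (sym (^-homo-* p g g))) (reflexive (cong (p ^_) (≡.sym q≡)))

      -- Frobenius applied to T = (t - c₀) s + T(c₀), so modulo Y₀ the power T^q is a constant.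
      T^q : ∃ λ s → T ^ q ≈ Y₀ * s + const (eval c₀ T)
      T^q with remainder c₀ T
      ... | s , e = s ^ q , trans (^-congˡ q e) (trans (frobenius (t- c₀ * s) (eval c₀ T)) (+-congʳ (^-distrib-* (t- c₀) s q)))

      -- Multiplying A + T^g B by T (A - T^g B) gives T A² - T^q B², which is T A² - T(c₀) B² modulo
      -- Y₀. The degree of the latter is below q, so it vanishes outright, and T is not a square up
      -- to constants.
      block-zero : ∀ (a b : Row n) → Y₀ ∣ toList a + T ^ g * toList b → toList a ≈ 0# × toList b ≈ 0#
      block-zero a b (s , e) = T-ns (eval c₀ T) Tc≢0 A B (p-r≈0⇒p≈r (trans eq (trans (*-congˡ z≈0) (zeroʳ Y₀))))
        where
        A B z u : Poly
        A = toList a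
        B = toList b
        u = proj₁ T^q
        z = u * (B * B) + T * (s * (A - T ^ g * B))
        eq : T * (A * A) - const (eval c₀ T) * (B * B) ≈ Y₀ * z
        eq = begin
          T * (A * A) - const (eval c₀ T) * (B * B)
            ≈⟨ solve 5 (λ t a b p d → t :* (a :* a) :- d :* (b :* b) := (t :* (p :* p) :- d) :* (b :* b) :+ t :* ((a :+ p :* b) :* (a :- p :* b))) T A B (T ^ g) (const (eval c₀ T)) ⟩
          (T * (T ^ g * T ^ g) - const (eval c₀ T)) * (B * B) + T * ((A + T ^ g * B) * (A - T ^ g * B))
            ≈⟨ +-cong (*-congʳ (+-congʳ (trans (g*2 T) (proj₂ T^q)))) (*-congˡ (*-congʳ e)) ⟩
          ((Y₀ * u + const (eval c₀ T)) - const (eval c₀ T)) * (B * B) + T * (Y₀ * s * (A - T ^ g * B))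
            ≈⟨ solve 7 (λ y u d b t s w → ((y :* u :+ d) :- d) :* (b :* b) :+ t :* (y :* s :* w) := y :* (u :* (b :* b) :+ t :* (s :* w))) Y₀ u (const (eval c₀ T)) B T s (A - T ^ g * B) ⟩
          Y₀ * z ∎
          where open import Relation.Binary.Reasoning.Setoid setoid
        sq : ∀ (v : Row n) → Deg< (n ℕ.+ n) (toList v * toList v)
        sq v = Deg<-mono′ n (toList v) (Deg<-toList v)
          where
          Deg<-mono′ : ∀ k p → Deg< k p → Deg< (k ℕ.+ k) (p * p)
          Deg<-mono′ zero p d = ≈0⇒Deg< (trans (*-congʳ (Deg<0⇒≈0 d)) (zeroˡ p))
          Deg<-mono′ (suc k) p d = Deg<-mono (+-monoʳ-≤ (suc k) (n≤1+n k)) (Deg<-* p d d)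
        low : Deg< q (T * (A * A) - const (eval c₀ T) * (B * B))
        low = Deg<-+ (Deg<-cong (*-comm (A * A) T) (Deg<-mono n≤ (Deg<-* (A * A) (sq a) (Deg<-mono T≤ (Deg<-length T)))))
          (Deg<-neg (Deg<-cong (*-comm (B * B) _) (Deg<-mono (≤-trans (+-monoʳ-≤ (n ℕ.+ n) z≤n) n≤) (Deg<-* (B * B) (sq b) (Deg<-const (eval c₀ T))))))
        z≈0 : z ≈ 0#
        z≈0 = Deg<0⇒≈0 (Deg<-quotient (Degree-t-^ c₀ q) (subst (λ k → Deg< k (Y₀ * z)) (≡.sym (ℕₚ.+-identityʳ q)) (Deg<-cong eq low)))

    -- Expansion in powers of Y₀: the lowest block is divisible by Y₀ and hence zero, then one power
    -- of Y₀ cancels.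
    R-injective : ∀ J v → R J v ≈ 0# → ¬ NonZero v
    R-injective zero [] e ()
    R-injective (suc J) v e nz = contra
      where
      Y₀∣ : Y₀ ∣ toList (first v) + T ^ g * toList (second v)
      Y₀∣ = - R J (rest v) , trans (solve 3 (λ x y r → x := (x :+ y :* r) :+ y :* :- r) (toList (first v) + T ^ g * toList (second v)) Y₀ (R J (rest v))) (trans (+-congʳ e) (+-identityˡ _))
      zz : toList (first v) ≈ 0# × toList (second v) ≈ 0#
      zz = block-zero (first v) (second v) Y₀∣
      R′≈0 : R J (rest v) ≈ 0#
      R′≈0 = cancelˡ (Degree⇒≉0 (Degree-t-^ c₀ q)) (trans (trans (sym (trans (+-congʳ (trans (+-cong (proj₁ zz) (trans (*-congˡ (proj₂ zz)) (zeroʳ _))) (+-identityˡ 0#))) (+-identityˡ _))) e) (sym (zeroʳ Y₀)))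
      cases : NonZero (take (n ℕ.+ n) v) ⊎ NonZero (rest v) → ⊥
      cases (inj₂ r) = R-injective J (rest v) R′≈0 r
      cases (inj₁ l) with NonZero-++ (first v) (subst NonZero (≡.sym (Vecₚ.take++drop≡id n (take (n ℕ.+ n) v))) l)
      ... | inj₁ x = NonZero⇒≉0 x (proj₁ zz)
      ... | inj₂ x = NonZero⇒≉0 x (proj₂ zz)
      contra : ⊥
      contra = cases (NonZero-++ (take (n ℕ.+ n) v) (subst NonZero (≡.sym (Vecₚ.take++drop≡id (n ℕ.+ n) v)) nz))

    Deg<-R : ∀ J v → Deg< (J ℕ.* q ℕ.+ (n ℕ.+ g ℕ.* m)) (R J v)
    Deg<-R zero v = Deg<-0
    Deg<-R (suc J) v = Deg<-+ (Deg<-mono (m≤n+m _ (suc J ℕ.* q)) (Deg<-+ (Deg<-mono (m≤m+n n _) (Deg<-toList (first v)))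
        (Deg<-cong (*-comm (toList (second v)) (T ^ g)) (Deg<-* (toList (second v)) (Deg<-toList (second v)) (Deg<-^ g)))))
      (Deg<-cong (*-comm (R J (rest v)) Y₀) (Deg<-mono (≤-reflexive (≡.trans (ℕₚ.+-comm _ q) (≡.sym (ℕₚ.+-assoc q (J ℕ.* q) _)))) (Deg<-* (R J (rest v)) (Deg<-R J (rest v)) (bound (Degree-t-^ c₀ q)))))
      where
      Deg<-^ : ∀ k → Deg< (suc (k ℕ.* m)) (T ^ k)
      Deg<-^ zero = Deg<-1
      Deg<-^ (suc k) = Deg<-* T (Deg<-mono T≤ (Deg<-length T)) (Deg<-^ k)

    module AtPoint (x₀ : Fin q) (Tx^g : eval x₀ T ^ᴷ g ≡ K.1#) (ℓ≤q : suc L ≤ q) where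
      private
        ϖ t₀ h w : Poly
        ϖ = t- x₀
        t₀ = const (eval x₀ T)
        h = const (x₀ K.- c₀)
        w = spec x₀ (W g L)
        module Sp = RingHom (Specialize.evHom x₀ (t- x₀))

        spec-t : spec x₀ t ≈ t₀
        spec-t = spec-const x₀ T

        spec-x̂ : spec x₀ x̂ ≈ h
        spec-x̂ = trans (spec-const x₀ (t- c₀)) (const-cong (eval-t- x₀ c₀))

        spec-^ : ∀ P k → spec x₀ (P ^ᴮ k) ≈ spec x₀ P ^ k
        spec-^ P k = to-^ (Specialize.evHom x₀ (t- x₀)) P k

        t₀^g : t₀ ^ g ≈ 1#
        t₀^g = trans (sym (to-^ constHom (eval x₀ T) g)) (trans (const-cong Tx^g) const-1)

        power : ∃ λ c → t₀ ^ L * T ^ g ≈ w + ϖ ^ suc L * c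
        power = go (W-expand g L)
          where
          go : (∃ λ c → t ^ᴮ L B.* τ T ^ᴮ g B.≈ t ^ᴮ g B.* W g L B.+ Y ^ᴮ suc L B.* c) → ∃ λ c → t₀ ^ L * T ^ g ≈ w + ϖ ^ suc L * c
          go (c , e) = spec x₀ c , trans (sym (trans (Sp.to-* (t ^ᴮ L) (τ T ^ᴮ g)) (*-cong (trans (spec-^ t L) (^-congˡ L spec-t)) (trans (spec-^ (τ T) g) (^-congˡ g (spec-τ x₀ T))))))
            (trans (Sp.to-cong e) (trans (Sp.to-+ (t ^ᴮ g B.* W g L) (Y ^ᴮ suc L B.* c)) (+-cong
              (trans (Sp.to-* (t ^ᴮ g) (W g L)) (trans (*-congʳ (trans (spec-^ t g) (trans (^-congˡ g spec-t) t₀^g))) (*-identityˡ w)))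
              (trans (Sp.to-* (Y ^ᴮ suc L) c) (*-congʳ (trans (spec-^ Y (suc L)) (^-congˡ (suc L) (spec-Y x₀))))))))

        Y₀-expand : Y₀ ≈ ϖ ^ suc L * ϖ ^ (q ℕ.∸ suc L) + h
        Y₀-expand = begin
          -- Shifting the base point to x₀ and applying Frobenius shows that Y₀ is the constant x₀ -
          -- c₀ modulo (t - x₀)^q.
          t- c₀ ^ q ≈⟨ ^-congˡ q (trans (solve 3 (λ x a c → x :- c := (x :- a) :+ (a :- c)) X (const x₀) (const c₀)) (+-congˡ (sym (trans (RingHom.to-+ constHom x₀ (K.- c₀)) (+-congˡ (RingHom.to-neg constHom c₀)))))) ⟩
          (ϖ + h) ^ q ≈⟨ frobenius ϖ (x₀ K.- c₀) ⟩
          ϖ ^ q + h ≈⟨ +-congʳ (trans (reflexive (cong (ϖ ^_) (≡.sym (m+[n∸m]≡n ℓ≤q)))) (^-homo-* ϖ (suc L) (q ℕ.∸ suc L))) ⟩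
          ϖ ^ suc L * ϖ ^ (q ℕ.∸ suc L) + h ∎
          where open import Relation.Binary.Reasoning.Setoid setoid

        -- Term by term: Y₀ agrees with x₀ - c₀ and t₀^L T^g with the specialized W, both up to
        -- multiples of (t - x₀)^(L+1). The hypothesis T(x₀)^g = 1 removes the factor t^g in front
        -- of W.
        specialize : ∀ J v → ∃ λ s → spec x₀ (E J v) ≈ t₀ ^ L * R J v + ϖ ^ suc L * s
        specialize zero v = 0# , sym (trans (+-cong (zeroʳ _) (zeroʳ _)) (+-identityˡ 0#))
        specialize (suc J) v = go (specialize J (rest v)) power
          where
          go : (∃ λ s → spec x₀ (E J (rest v)) ≈ t₀ ^ L * R J (rest v) + ϖ ^ suc L * s) → (∃ λ c → t₀ ^ L * T ^ g ≈ w + ϖ ^ suc L * c) →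
            ∃ λ s → spec x₀ (E (suc J) v) ≈ t₀ ^ L * R (suc J) v + ϖ ^ suc L * s
          go (s , e) (c , f) = _ , trans (spec-block x₀ (t ^ᴮ L) (τ (toList (first v))) (W g L) (τ (toList (second v))) x̂ (E J (rest v)))
            (trans (+-cong (+-cong (*-cong (trans (spec-^ t L) (^-congˡ L spec-t)) (spec-τ x₀ (toList (first v)))) (*-congˡ (spec-τ x₀ (toList (second v))))) (*-cong spec-x̂ e))
              (recombine (t₀ ^ L) (toList (first v)) w (toList (second v)) h (R J (rest v)) (ϖ ^ suc L) s c (T ^ g) (ϖ ^ (q ℕ.∸ suc L)) Y₀ f Y₀-expand))

        Tx≢0 : 1 ≤ g → ¬ (eval x₀ T ≡ K.0#)
        Tx≢0 (s≤s _) e = K.1≉0 (≡.trans (≡.sym Tx^g) (≡.trans (cong (λ z → z ^ᴷ g) e) (K.zeroˡ _)))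

        t₀^L-inverse : 1 ≤ g → ∃ λ i → t₀ ^ L * i ≈ 1#
        t₀^L-inverse 1≤g with K.invert (eval x₀ T) (Tx≢0 1≤g)
        ... | i , e = const i ^ L , trans (sym (^-distrib-* t₀ (const i) L)) (trans (^-congˡ L (const-inverse e)) (1^ L))
          where
          1^ : ∀ k → 1# ^ k ≈ 1#
          1^ zero = refl
          1^ (suc k) = trans (*-identityˡ _) (1^ k)

      vanishes : 1 ≤ g → ∀ J v → (∀ l → l < suc L → BP.coeff (E J v) l ≈ 0#) → ϖ ^ suc L ∣ R J v
      vanishes 1≤g J v low with specialize J v | t₀^L-inverse 1≤g
      ... | s , e | i , f = ∣-cong (trans (solve 3 (λ l r i → l :* r :* i := l :* i :* r) (t₀ ^ L) (R J v) i) (trans (*-congʳ f) (*-identityˡ _)))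
          (∣-*ʳ i (∣-cong (trans (+-congʳ e) (solve 2 (λ x y → (x :+ y) :- y := x) (t₀ ^ L * R J v) (ϖ ^ suc L * s))) (∣-+ (spec-vanish x₀ (suc L) (E J v) low) (∣-neg (∣-*ʳ s ∣-refl)))))

  -- The nonzero R has a zero of order L + 1 at every listed point, and its degree is at most about
  -- J q + g m. With 2 J = L + 2 the count is q / 2 up to an error of relative size (m + 2) / (L +
  -- 1), which a large fixed L makes as small as required.
  stepanov : ∀ T m → length T ≤ suc m → ∀ c₀ → ¬ (eval c₀ T ≡ K.0#) → NotSquare T →
    ∀ g → q ≡ suc (g ℕ.+ g) → 1 ≤ g → ∀ L J n → suc (suc L) ≡ J ℕ.+ J → n ℕ.+ n ℕ.+ m ≤ q → suc L ℕ.* (J ℕ.+ L ℕ.* m) < n →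
    ∀ xs → AllPairs (λ x y → ¬ (x ≡ y)) xs → All (λ x → eval x T ^ᴷ g ≡ K.1#) xs →
    length xs ℕ.* suc L ℕ.+ length xs ℕ.* suc L ≤ q ℕ.* suc L ℕ.+ q ℕ.* suc (suc m)
  stepanov T m T≤ c₀ Tc≢0 T-ns g q≡ 1≤g L J n 2J≡ n≤ small xs distinct good = ≤-trans (+-mono-≤ bound₁ bound₁) bound₂
    where
    open Auxiliary T m T≤ c₀ Tc≢0 T-ns g q≡ L n n≤
    enough : suc L ℕ.* (J ℕ.+ (n ℕ.+ L ℕ.* m)) < J ℕ.* (n ℕ.+ n)
    enough = subst₂ _<_
      (StepanovArithmetic.split-conditions (suc L) J n (L ℕ.* m))
      (≡.trans (cong (ℕ._* n) 2J≡) (StepanovArithmetic.double J n))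
      (ℕₚ.+-monoˡ-< (suc L ℕ.* n) small)
    ℓ≤q : suc L ≤ q
    ℓ≤q = ≤-trans (≤-trans (≤-trans (≤-reflexive (≡.sym (ℕₚ.*-identityʳ (suc L)))) (*-monoʳ-≤ (suc L) (≤-trans (1≤J J 2J≡) (m≤m+n J _)))) (<⇒≤ small))
      (≤-trans (≤-trans (m≤m+n n n) (m≤m+n (n ℕ.+ n) m)) n≤)
      where
      1≤J : ∀ J → suc (suc L) ≡ J ℕ.+ J → 1 ≤ J
      1≤J (suc J) _ = s≤s z≤n
    bound₁ : length xs ℕ.* suc L ≤ J ℕ.* q ℕ.+ (n ℕ.+ g ℕ.* m)
    bound₁ = count (solution J (suc L) enough)
      where
      count : (∃ λ v → NonZero v × (∀ l → l < suc L → BP.coeff (E J v) l ≈ 0#)) → length xs ℕ.* suc L ≤ J ℕ.* q ℕ.+ (n ℕ.+ g ℕ.* m)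
      count (v , nz , low) = from-degree (degree? (R J v))
        where
        from-degree : R J v ≈ 0# ⊎ ∃ (Degree (R J v)) → length xs ℕ.* suc L ≤ J ℕ.* q ℕ.+ (n ℕ.+ g ℕ.* m)
        from-degree (inj₁ z) = ⊥-elim (R-injective J v z nz)
        from-degree (inj₂ (d , dR)) = ≤-trans (roots≤degree (suc L) dR xs distinct (All.map (λ {x} e → AtPoint.vanishes x e ℓ≤q 1≤g J v low) good)) (<⇒≤ (Degree-Deg< dR (Deg<-R J v)))
    2g≤q : g ℕ.+ g ≤ q
    2g≤q = subst (g ℕ.+ g ≤_) (≡.sym q≡) (n≤1+n _)
    bound₂ : (J ℕ.* q ℕ.+ (n ℕ.+ g ℕ.* m)) ℕ.+ (J ℕ.* q ℕ.+ (n ℕ.+ g ℕ.* m)) ≤ q ℕ.* suc L ℕ.+ q ℕ.* suc (suc m)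
    bound₂ = begin
      (J ℕ.* q ℕ.+ (n ℕ.+ g ℕ.* m)) ℕ.+ (J ℕ.* q ℕ.+ (n ℕ.+ g ℕ.* m))
        ≡⟨ StepanovArithmetic.regroup J q n g m ⟩
      q ℕ.* (J ℕ.+ J) ℕ.+ ((n ℕ.+ n) ℕ.+ (g ℕ.+ g) ℕ.* m) ≡⟨ cong (λ z → q ℕ.* z ℕ.+ ((n ℕ.+ n) ℕ.+ (g ℕ.+ g) ℕ.* m)) (≡.sym 2J≡) ⟩
      q ℕ.* suc (suc L) ℕ.+ ((n ℕ.+ n) ℕ.+ (g ℕ.+ g) ℕ.* m) ≤⟨ +-monoʳ-≤ (q ℕ.* suc (suc L)) (+-mono-≤ (≤-trans (m≤m+n (n ℕ.+ n) m) n≤) (*-monoˡ-≤ m 2g≤q)) ⟩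
      q ℕ.* suc (suc L) ℕ.+ (q ℕ.+ q ℕ.* m) ≡⟨ StepanovArithmetic.collect q L m ⟩
      q ℕ.* suc L ℕ.+ q ℕ.* suc (suc m) ∎
      where open ℕₚ.≤-Reasoning

-- From balanced signs to prescribed sign patterns.

_⇔ᵇ_ : Bool → Bool → Bool
true ⇔ᵇ b = b
false ⇔ᵇ b = not b

⇔ᵇ-cancelˡ : ∀ s b b′ → s ⇔ᵇ b ≡ true → s ⇔ᵇ b′ ≡ true → b ≡ b′
⇔ᵇ-cancelˡ true true true _ _ = ≡.refl
⇔ᵇ-cancelˡ false false false _ _ = ≡.refl

module Counting {A : Set} where
  open Data.Nat using (_+_; _*_; _^_)

  count : (A → Bool) → List A → ℕ
  count f ys = length (filterᵇ f ys)

  count-cong : ∀ {f g : A → Bool} → (∀ a → f a ≡ g a) → ∀ ys → count f ys ≡ count g ys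
  count-cong h [] = ≡.refl
  count-cong {f} {g} h (a ∷ ys) rewrite h a with g a
  ... | true = cong suc (count-cong h ys)
  ... | false = count-cong h ys

  count-split : ∀ (f g : A → Bool) ys → count f ys ≡ count (λ a → f a ∧ g a) ys + count (λ a → f a ∧ not (g a)) ys
  count-split f g [] = ≡.refl
  count-split f g (a ∷ ys) with f a | g a
  ... | true | true = cong suc (count-split f g ys)
  ... | true | false = ≡.trans (cong suc (count-split f g ys)) (≡.sym (+-suc _ _))
  ... | false | _ = count-split f g ys

  count-filter : ∀ (f g : A → Bool) ys → count f (filterᵇ g ys) ≡ count (λ a → f a ∧ g a) ys
  count-filter f g [] = ≡.refl
  count-filter f g (a ∷ ys) with g a
  count-filter f g (a ∷ ys) | true with f a
  ... | true = cong suc (count-filter f g ys)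
  ... | false = count-filter f g ys
  count-filter f g (a ∷ ys) | false with f a
  ... | true = count-filter f g ys
  ... | false = count-filter f g ys

  count-length : ∀ (f : A → Bool) ys → length ys ≡ count f ys + count (λ a → not (f a)) ys
  count-length f [] = ≡.refl
  count-length f (a ∷ ys) with f a
  ... | true = cong suc (count-length f ys)
  ... | false = ≡.trans (cong suc (count-length f ys)) (≡.sym (+-suc _ _))

  -- The two signs occur equally often up to δ / ℓ; multiplying by ℓ keeps the estimate within the
  -- natural numbers.
  record Balanced (ℓ δ : ℕ) (ys : List A) (f : A → Bool) : Set where
    constructor balanced
    field
      upper : ℓ * count f ys ≤ ℓ * count (λ a → not (f a)) ys + δ
      lower : ℓ * count (λ a → not (f a)) ys ≤ ℓ * count f ys + δ
  open Balanced public

  count-congᴬ : ∀ {f g : A → Bool} {ys} → All (λ a → f a ≡ g a) ys → count f ys ≡ count g ys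
  count-congᴬ [] = ≡.refl
  count-congᴬ {f} {g} {a ∷ ys} (e ∷ es) rewrite e with g a
  ... | true = cong suc (count-congᴬ es)
  ... | false = count-congᴬ es

  Balanced-cong : ∀ {ℓ δ ys} {f g : A → Bool} → All (λ a → f a ≡ g a) ys → Balanced ℓ δ ys f → Balanced ℓ δ ys g
  Balanced-cong {ℓ} {δ} {ys} h (balanced u l) = balanced
    (subst₂ (λ x y → ℓ * x ≤ ℓ * y + δ) (count-congᴬ h) (count-congᴬ (All.map (cong not) h)) u)
    (subst₂ (λ x y → ℓ * x ≤ ℓ * y + δ) (count-congᴬ (All.map (cong not) h)) (count-congᴬ h) l)

  private
    average : ∀ ℓ δ x y z w → ℓ * (x + y) ≤ ℓ * (z + w) + δ → ℓ * (x + w) ≤ ℓ * (y + z) + δ → ℓ * x ≤ ℓ * z + δ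
    average ℓ δ x y z w h k = ℕₚ.*-cancelˡ-≤ 2 (ℕₚ.+-cancelʳ-≤ (ℓ * y + ℓ * w) (2 * (ℓ * x)) (2 * (ℓ * z + δ)) (subst₂ _≤_
        (N.solve 4 (λ ℓ x y w → ℓ N.:* (x N.:+ y) N.:+ ℓ N.:* (x N.:+ w) N.:= N.con 2 N.:* (ℓ N.:* x) N.:+ (ℓ N.:* y N.:+ ℓ N.:* w)) ≡.refl ℓ x y w)
        (N.solve 5 (λ ℓ δ y z w → (ℓ N.:* (z N.:+ w) N.:+ δ) N.:+ (ℓ N.:* (y N.:+ z) N.:+ δ) N.:= N.con 2 N.:* (ℓ N.:* z N.:+ δ) N.:+ (ℓ N.:* y N.:+ ℓ N.:* w)) ≡.refl ℓ δ y z w)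
        (+-mono-≤ h k)))

    agree : (A → Bool) → (A → Bool) → A → Bool
    agree f g a = f a ⇔ᵇ g a

    count-agree : ∀ (f g : A → Bool) ys → count (agree f g) ys ≡ count (λ a → f a ∧ g a) ys + count (λ a → not (f a) ∧ not (g a)) ys
    count-agree f g [] = ≡.refl
    count-agree f g (a ∷ ys) with f a | g a
    ... | true | true = cong suc (count-agree f g ys)
    ... | true | false = count-agree f g ys
    ... | false | true = count-agree f g ys
    ... | false | false = ≡.trans (cong suc (count-agree f g ys)) (≡.sym (+-suc _ _))

    count-disagree : ∀ (f g : A → Bool) ys → count (λ a → not (agree f g a)) ys ≡ count (λ a → f a ∧ not (g a)) ys + count (λ a → not (f a) ∧ g a) ys
    count-disagree f g [] = ≡.refl
    count-disagree f g (a ∷ ys) with f a | g a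
    ... | true | true = count-disagree f g ys
    ... | true | false = cong suc (count-disagree f g ys)
    ... | false | true = ≡.trans (cong suc (count-disagree f g ys)) (≡.sym (+-suc _ _))
    ... | false | false = count-disagree f g ys

  -- Split the points into four classes by the signs of f and g. Adding the estimate for f to the
  -- one for the product of f and g cancels two of the classes and compares the other two, which
  -- make up the half where g has the sign ε.
  Balanced-filter : ∀ {ℓ δ ys} (f g : A → Bool) ε → Balanced ℓ δ ys f → Balanced ℓ δ ys (λ a → f a ⇔ᵇ g a) → Balanced ℓ δ (filterᵇ (λ a → g a ⇔ᵇ ε) ys) f
  Balanced-filter {ℓ} {δ} {ys} f g true (balanced u l) (balanced u′ l′) = balanced
    (subst₂ (λ x y → ℓ * x ≤ ℓ * y + δ) (e₁ f) (e₁ (λ a → not (f a)))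
      (average ℓ δ n₁₁ n₁₀ n₀₁ n₀₀ (subst₂ (λ x y → ℓ * x ≤ ℓ * y + δ) (count-split f g ys) (count-split (λ a → not (f a)) g ys) u)
        (subst₂ (λ x y → ℓ * x ≤ ℓ * y + δ) (count-agree f g ys) (count-disagree f g ys) u′)))
    (subst₂ (λ x y → ℓ * x ≤ ℓ * y + δ) (e₁ (λ a → not (f a))) (e₁ f)
      (average ℓ δ n₀₁ n₀₀ n₁₁ n₁₀ (subst₂ (λ x y → ℓ * x ≤ ℓ * y + δ) (count-split (λ a → not (f a)) g ys) (count-split f g ys) l)
        (subst₂ (λ x y → ℓ * x ≤ ℓ * y + δ) (≡.trans (count-disagree f g ys) (ℕₚ.+-comm n₁₀ n₀₁)) (≡.trans (count-agree f g ys) (ℕₚ.+-comm n₁₁ n₀₀)) l′)))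
    where
    n₁₁ n₁₀ n₀₁ n₀₀ : ℕ
    n₁₁ = count (λ a → f a ∧ g a) ys
    n₁₀ = count (λ a → f a ∧ not (g a)) ys
    n₀₁ = count (λ a → not (f a) ∧ g a) ys
    n₀₀ = count (λ a → not (f a) ∧ not (g a)) ys
    ⇔true : ∀ b → b ⇔ᵇ true ≡ b
    ⇔true true = ≡.refl
    ⇔true false = ≡.refl
    e₁ : ∀ h → count (λ a → h a ∧ g a) ys ≡ count h (filterᵇ (λ a → g a ⇔ᵇ true) ys)
    e₁ h = ≡.sym (≡.trans (count-filter h (λ a → g a ⇔ᵇ true) ys) (count-cong (λ a → cong (h a ∧_) (⇔true (g a))) ys))
  Balanced-filter {ℓ} {δ} {ys} f g false (balanced u l) (balanced u′ l′) = balanced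
    (subst₂ (λ x y → ℓ * x ≤ ℓ * y + δ) (e₁ f) (e₁ (λ a → not (f a)))
      (average ℓ δ n₁₀ n₁₁ n₀₀ n₀₁ (subst₂ (λ x y → ℓ * x ≤ ℓ * y + δ) (≡.trans (count-split f g ys) (ℕₚ.+-comm n₁₁ n₁₀)) (≡.trans (count-split (λ a → not (f a)) g ys) (ℕₚ.+-comm n₀₁ n₀₀)) u)
        (subst₂ (λ x y → ℓ * x ≤ ℓ * y + δ) (count-disagree f g ys) (count-agree f g ys) l′)))
    (subst₂ (λ x y → ℓ * x ≤ ℓ * y + δ) (e₁ (λ a → not (f a))) (e₁ f)
      (average ℓ δ n₀₀ n₀₁ n₁₀ n₁₁ (subst₂ (λ x y → ℓ * x ≤ ℓ * y + δ) (≡.trans (count-split (λ a → not (f a)) g ys) (ℕₚ.+-comm n₀₁ n₀₀)) (≡.trans (count-split f g ys) (ℕₚ.+-comm n₁₁ n₁₀)) l)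
        (subst₂ (λ x y → ℓ * x ≤ ℓ * y + δ) (≡.trans (count-agree f g ys) (ℕₚ.+-comm n₁₁ n₀₀)) (≡.trans (count-disagree f g ys) (ℕₚ.+-comm n₁₀ n₀₁)) u′)))
    where
    n₁₁ n₁₀ n₀₁ n₀₀ : ℕ
    n₁₁ = count (λ a → f a ∧ g a) ys
    n₁₀ = count (λ a → f a ∧ not (g a)) ys
    n₀₁ = count (λ a → not (f a) ∧ g a) ys
    n₀₀ = count (λ a → not (f a) ∧ not (g a)) ys
    ⇔false : ∀ b → b ⇔ᵇ false ≡ not b
    ⇔false true = ≡.refl
    ⇔false false = ≡.refl
    e₁ : ∀ h → count (λ a → h a ∧ not (g a)) ys ≡ count h (filterᵇ (λ a → g a ⇔ᵇ false) ys)
    e₁ h = ≡.sym (≡.trans (count-filter h (λ a → g a ⇔ᵇ false) ys) (count-cong (λ a → cong (h a ∧_) (⇔false (g a))) ys))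

  length-filter : ∀ {ℓ δ ys} (g : A → Bool) ε → Balanced ℓ δ ys g → ℓ * length ys ≤ 2 * (ℓ * length (filterᵇ (λ a → g a ⇔ᵇ ε) ys)) + δ
  length-filter {ℓ} {δ} {ys} g ε (balanced u l) = go ε
    where
    arith : ∀ x y → ℓ * y ≤ ℓ * x + δ → ℓ * (x + y) ≤ 2 * (ℓ * x) + δ
    arith x y h = subst₂ _≤_ (N.solve 3 (λ ℓ x y → ℓ N.:* x N.:+ ℓ N.:* y N.:= ℓ N.:* (x N.:+ y)) ≡.refl ℓ x y)
      (N.solve 3 (λ ℓ x d → ℓ N.:* x N.:+ (ℓ N.:* x N.:+ d) N.:= N.con 2 N.:* (ℓ N.:* x) N.:+ d) ≡.refl ℓ x δ) (+-monoʳ-≤ (ℓ * x) h)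
    ⇔true : ∀ b → b ≡ b ⇔ᵇ true
    ⇔true true = ≡.refl
    ⇔true false = ≡.refl
    ⇔false : ∀ b → not b ≡ b ⇔ᵇ false
    ⇔false true = ≡.refl
    ⇔false false = ≡.refl
    x₁ x₀ : ℕ
    x₁ = count g ys
    x₀ = count (λ a → not (g a)) ys
    go : ∀ ε → ℓ * length ys ≤ 2 * (ℓ * length (filterᵇ (λ a → g a ⇔ᵇ ε) ys)) + δ
    go true = subst₂ (λ s t → ℓ * s ≤ 2 * (ℓ * t) + δ) (≡.sym (count-length g ys)) (count-cong (λ a → ⇔true (g a)) ys) (arith x₁ x₀ l)
    go false = subst₂ (λ s t → ℓ * s ≤ 2 * (ℓ * t) + δ) (≡.trans (ℕₚ.+-comm x₀ x₁) (≡.sym (count-length g ys))) (count-cong (λ a → ⇔false (g a)) ys) (arith x₀ x₁ u)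

  -- Products of signs over nonempty sublists, where `_⇔ᵇ_` is multiplication of signs with `true`
  -- as +1. These are the nontrivial characters of the group of sign patterns.
  data Combination : List (A → Bool) → (A → Bool) → Set where
    only : ∀ {f fs} → Combination (f ∷ fs) f
    skip : ∀ {f fs h} → Combination fs h → Combination (f ∷ fs) h
    both : ∀ {f fs h} → Combination fs h → Combination (f ∷ fs) (λ a → h a ⇔ᵇ f a)

  data Matches (a : A) : List ((A → Bool) × Bool) → Set where
    [] : Matches a []
    _∷_ : ∀ {f ε fs} → f a ≡ ε → Matches a fs → Matches a ((f , ε) ∷ fs)

  open import Data.List.Relation.Unary.Any using (here; there)

  private
    -- Prescribing a sign keeps half of the points up to an error δ, so the requirement doubles and
    -- grows by δ with each sign.
    needed : ℕ → ℕ → ℕ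
    needed δ zero = 0
    needed δ (suc n) = 2 * needed δ n + δ

    filter-∈ : ∀ (g : A → Bool) ε ys {a} → a ∈ filterᵇ (λ a → g a ⇔ᵇ ε) ys → a ∈ ys × g a ≡ ε
    filter-∈ g ε (y ∷ ys) m with g y in eq | ε
    filter-∈ g ε (y ∷ ys) (here ≡.refl) | true | true = here ≡.refl , eq
    filter-∈ g ε (y ∷ ys) (there m) | true | true = there (proj₁ (filter-∈ g true ys m)) , proj₂ (filter-∈ g true ys m)
    filter-∈ g ε (y ∷ ys) m | true | false = there (proj₁ (filter-∈ g false ys m)) , proj₂ (filter-∈ g false ys m)
    filter-∈ g ε (y ∷ ys) m | false | true = there (proj₁ (filter-∈ g true ys m)) , proj₂ (filter-∈ g true ys m)
    filter-∈ g ε (y ∷ ys) (here ≡.refl) | false | false = here ≡.refl , eq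
    filter-∈ g ε (y ∷ ys) (there m) | false | false = there (proj₁ (filter-∈ g false ys m)) , proj₂ (filter-∈ g false ys m)

    find : ∀ ℓ δ fs ys → (∀ {h} → Combination (List.map proj₁ fs) h → Balanced ℓ δ ys h) → needed δ (length fs) < ℓ * length ys →
      ∃ λ a → a ∈ ys × Matches a fs
    find ℓ δ [] [] _ l = ⊥-elim (<-irrefl ≡.refl (subst (0 <_) (ℕₚ.*-zeroʳ ℓ) l))
    find ℓ δ [] (y ∷ ys) _ l = y , here ≡.refl , []
    find ℓ δ ((f , ε) ∷ fs) ys bal l with find ℓ δ fs (filterᵇ (λ a → f a ⇔ᵇ ε) ys)
        (λ c → Balanced-filter _ f ε (bal (skip c)) (bal (both c)))
        (ℕₚ.*-cancelˡ-< 2 _ _ (ℕₚ.+-cancelʳ-< δ _ _ (<-≤-trans l (length-filter f ε (bal only)))))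
    ... | a , m , matches with filter-∈ f ε ys m
    ...   | a∈ , e = a , a∈ , e ∷ matches

    needed-≤ : ∀ δ n → needed δ n + δ ≤ 2 ^ n * δ
    needed-≤ δ zero = ≤-reflexive (≡.sym (ℕₚ.+-identityʳ δ))
    needed-≤ δ (suc n) = subst₂ _≤_ (N.solve 2 (λ x d → N.con 2 N.:* (x N.:+ d) N.:= N.con 2 N.:* x N.:+ d N.:+ d) ≡.refl (needed δ n) δ) (≡.sym (ℕₚ.*-assoc 2 (2 ^ n) δ)) (*-monoʳ-≤ 2 (needed-≤ δ n))

  -- Filtering by one sign at a time keeps at least about half of the points, and the remaining
  -- products stay balanced on what is left. For that reason balance of all products is assumed, and
  -- not only of the single signs.
  matching : ∀ ℓ δ N fs ys → length fs ≤ N → (∀ {h} → Combination (List.map proj₁ fs) h → Balanced ℓ δ ys h) → 2 ^ N * δ < ℓ * length ys →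
    ∃ λ a → a ∈ ys × Matches a fs
  matching ℓ δ N fs ys n≤N bal l = find ℓ δ fs ys bal (≤-<-trans (≤-trans (m≤m+n _ δ) (≤-trans (needed-≤ δ (length fs)) (*-monoˡ-≤ δ (ℕₚ.^-monoʳ-≤ 2 n≤N)))) l)

private
  module SignArithmetic where
    balance : ∀ ℓ q M p s x → p ℕ.* ℓ ℕ.+ p ℕ.* ℓ ≤ q ℕ.* ℓ ℕ.+ q ℕ.* suc (suc M) → x ≡ p ℕ.+ s → q ≤ x ℕ.+ M →
      ℓ ℕ.* p ≤ ℓ ℕ.* s ℕ.+ (q ℕ.* suc (suc M) ℕ.+ ℓ ℕ.* M)
    balance ℓ q M p s x h ≡.refl k = ℕₚ.+-cancelˡ-≤ (p ℕ.* ℓ) _ _ (begin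
      p ℕ.* ℓ ℕ.+ ℓ ℕ.* p ≡⟨ cong (p ℕ.* ℓ ℕ.+_) (ℕₚ.*-comm ℓ p) ⟩
      p ℕ.* ℓ ℕ.+ p ℕ.* ℓ ≤⟨ h ⟩
      q ℕ.* ℓ ℕ.+ q ℕ.* suc (suc M) ≤⟨ ℕₚ.+-monoˡ-≤ _ (*-monoˡ-≤ ℓ k) ⟩
      (p ℕ.+ s ℕ.+ M) ℕ.* ℓ ℕ.+ q ℕ.* suc (suc M)
        ≡⟨ N.solve 5 (λ p s M ℓ z → (p N.:+ s N.:+ M) N.:* ℓ N.:+ z N.:= p N.:* ℓ N.:+ (ℓ N.:* s N.:+ (z N.:+ ℓ N.:* M))) ≡.refl p s M ℓ (q ℕ.* suc (suc M)) ⟩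
      p ℕ.* ℓ ℕ.+ (ℓ ℕ.* s ℕ.+ (q ℕ.* suc (suc M) ℕ.+ ℓ ℕ.* M)) ∎)
      where open ℕₚ.≤-Reasoning

    enough : ∀ N q M x A → A ≡ N ℕ.* suc (suc M) → suc (A ℕ.+ A) ℕ.* M ℕ.* suc N < q → q ≤ x ℕ.+ M →
      N ℕ.* (q ℕ.* suc (suc M) ℕ.+ suc (A ℕ.+ A) ℕ.* M) < suc (A ℕ.+ A) ℕ.* x
    enough N q M x _ ≡.refl h k = ℕₚ.+-cancelʳ-< (ℓ ℕ.* M) _ _ (begin-strict
      N ℕ.* (q ℕ.* suc (suc M) ℕ.+ ℓ ℕ.* M) ℕ.+ ℓ ℕ.* M
        ≡⟨ N.solve 4 (λ N q M z → N N.:* (q N.:* (N.con 2 N.:+ M) N.:+ z) N.:+ z N.:= N N.:* (N.con 2 N.:+ M) N.:* q N.:+ z N.:* (N.con 1 N.:+ N)) ≡.refl N q M (ℓ ℕ.* M) ⟩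
      A ℕ.* q ℕ.+ ℓ ℕ.* M ℕ.* suc N <⟨ ℕₚ.+-monoʳ-< (A ℕ.* q) h ⟩
      A ℕ.* q ℕ.+ q ≤⟨ m≤n+m _ (A ℕ.* q) ⟩
      A ℕ.* q ℕ.+ (A ℕ.* q ℕ.+ q) ≡⟨ N.solve 2 (λ A q → A N.:* q N.:+ (A N.:* q N.:+ q) N.:= (N.con 1 N.:+ (A N.:+ A)) N.:* q) ≡.refl A q ⟩
      ℓ ℕ.* q ≤⟨ *-monoʳ-≤ ℓ k ⟩
      ℓ ℕ.* (x ℕ.+ M) ≡⟨ ℕₚ.*-distribˡ-+ ℓ x M ⟩
      ℓ ℕ.* x ℕ.+ ℓ ℕ.* M ∎)
      where
      open ℕₚ.≤-Reasoning
      A ℓ : ℕ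
      A = N ℕ.* suc (suc M)
      ℓ = suc (A ℕ.+ A)

-- Half of the order L used in Stepanov's method. The relative error (M + 2) / (L + 1) then stays
-- below half of 2^-N, enough for N independent signs, and evenness of L permits L + 2 = 2 J.
signSteps : ℕ → ℕ → ℕ
signSteps M N = 2 ℕ.^ N ℕ.* suc (suc M)

-- The least block width n that meets the smallness condition of `stepanov` for these L and J.
signWidth : ℕ → ℕ → ℕ
signWidth M N = suc (suc (signSteps M N ℕ.+ signSteps M N) ℕ.* (suc (signSteps M N) ℕ.+ (signSteps M N ℕ.+ signSteps M N) ℕ.* M))

-- The first summand leaves room for the degree comparison modulo Y₀, the second compensates for up
-- to M points at which some polynomial vanishes.
signBound : ℕ → ℕ → ℕ
signBound M N = (signWidth M N ℕ.+ signWidth M N ℕ.+ M) ℕ.+ suc (signSteps M N ℕ.+ signSteps M N) ℕ.* M ℕ.* suc (2 ℕ.^ N)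

-- Quadratic characters at the points of a finite field.

module Squares {q} (F : FiniteField q) where
  open FiniteFieldPoly F public
  open FiniteFieldPowers F public
  open Powers K.commRing using () renaming (_^_ to _^ᴷ_; ^-homo-* to ^ᴷ-homo-*; ^-distrib-* to ^ᴷ-distrib-*; ^-congˡ to ^ᴷ-congˡ)
  private module S = SolverOver K.commRing
  open S using () renaming (solve to solveᴷ)

  IsSq : Fin q → Set
  IsSq x = ∃ λ s → s K.* s ≡ x

  opaque
    isSq? : ∀ x → Dec (IsSq x)
    isSq? x = Finₚ.any? (λ s → (s K.* s) K.≟ x)

  sq? : Fin q → Bool
  sq? x = does (isSq? x)

  sq?-true : ∀ {x} → IsSq x → sq? x ≡ true
  sq?-true {x} s with isSq? x
  ... | yes _ = ≡.refl
  ... | no n = ⊥-elim (n s)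

  sq?-false : ∀ {x} → ¬ IsSq x → sq? x ≡ false
  sq?-false {x} n with isSq? x
  ... | yes s = ⊥-elim (n s)
  ... | no _ = ≡.refl

  true-sq : ∀ {x} → sq? x ≡ true → IsSq x
  true-sq {x} e with isSq? x
  ... | yes s = s

  false-sq : ∀ {x} → sq? x ≡ false → ¬ IsSq x
  false-sq {x} e with isSq? x
  ... | no n = n

  IsSq-* : ∀ {x y} → IsSq x → IsSq y → IsSq (x K.* y)
  IsSq-* {x} {y} (s , e) (t , f) = s K.* t , ≡.trans (solveᴷ 2 (λ s t → s :* t :* (s :* t) := s :* s :* (t :* t)) s t) (cong₂ K._*_ e f)

  IsSq-cancel : ∀ {x y} → ¬ (x ≡ K.0#) → IsSq x → IsSq (x K.* y) → IsSq y
  IsSq-cancel {x} {y} x≢0 (s , e) (t , f) with K.invert s (λ s≡0 → x≢0 (≡.trans (≡.sym e) (≡.trans (cong (K._* s) s≡0) (K.zeroˡ s))))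
  ... | i , si = t K.* i , (begin
    t K.* i K.* (t K.* i) ≡⟨ solveᴷ 2 (λ t i → t :* i :* (t :* i) := t :* t :* (i :* i)) t i ⟩
    t K.* t K.* (i K.* i) ≡⟨ cong (K._* (i K.* i)) (≡.trans f (cong (K._* y) (≡.sym e))) ⟩
    s K.* s K.* y K.* (i K.* i) ≡⟨ solveᴷ 3 (λ s y i → s :* s :* y :* (i :* i) := s :* i :* (s :* i) :* y) s y i ⟩
    s K.* i K.* (s K.* i) K.* y ≡⟨ cong (K._* y) (≡.trans (cong₂ K._*_ si si) (K.*-identityˡ K.1#)) ⟩
    K.1# K.* y ≡⟨ K.*-identityˡ y ⟩
    y ∎)
    where open ≡.≡-Reasoning

  private
    setoidF : FiniteSetoid
    setoidF = record { Carrier = Fin q ; _~_ = _≡_ ; ~-sym = ≡.sym ; ~-trans = ≡.trans ; size = q ; element = λ x → x ; code = λ x → x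
      ; element-code = λ _ → ≡.refl ; element-injective = λ _ _ e → e }

  IsSq-index : ∀ {a} → ¬ IsSq a → ∀ b → IsSq b ⊎ IsSq (a K.* b)
  IsSq-index {a} ¬a b = conclude (TwoToOne.exhaust setoidF (λ x → x K.* x) (a K.*_) (λ x → K.- x) (cong (λ x → K.- x)) (λ x → solveᴷ 1 (λ x → :- (:- x) := x) x)
      (Kₗ.cancelˡ a≢0) fibre overlaps b)
    where
    conclude : (∃ λ x → (b ≡ x K.* x) ⊎ (b ≡ a K.* (x K.* x))) → IsSq b ⊎ IsSq (a K.* b)
    conclude (x , inj₁ e) = inj₁ (x , ≡.sym e)
    conclude (x , inj₂ e) = inj₂ (a K.* x , ≡.trans (solveᴷ 2 (λ a x → a :* x :* (a :* x) := a :* (a :* (x :* x))) a x) (cong (a K.*_) (≡.sym e)))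
    a≢0 : ¬ (a ≡ K.0#)
    a≢0 e = ¬a (K.0# , ≡.trans (K.zeroˡ _) (≡.sym e))
    either : ∀ {x y} → x K.- y ≡ K.0# ⊎ x K.- K.- y ≡ K.0# → (x ≡ y) ⊎ (x ≡ K.- y)
    either (inj₁ z) = inj₁ (Kₗ.x-y≈0⇒x≈y z)
    either (inj₂ z) = inj₂ (Kₗ.x-y≈0⇒x≈y z)
    fibre : ∀ x y → x K.* x ≡ y K.* y → (x ≡ y) ⊎ (x ≡ K.- y)
    fibre x y e = either (Kₗ.*≈0 (≡.trans (solveᴷ 2 (λ x y → (x :- y) :* (x :- :- y) := x :* x :- y :* y) x y) (Kₗ.x≈y⇒x-y≈0 e)))
    square-zero : ∀ {x} → x K.* x ≡ K.0# → x ≡ K.0#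
    square-zero e = [ (λ z → z) , (λ z → z) ]′ (Kₗ.*≈0 e)
    overlaps : ∀ x y → x K.* x ≡ a K.* (y K.* y) → x ≡ y
    overlaps x y e with y K.≟ K.0#
    ... | no y≢0 = ⊥-elim (¬a (IsSq-cancel {y K.* y} {a} (Kₗ.*≉0 y≢0 y≢0) (y , ≡.refl) (x , ≡.trans e (K.*-comm a _))))
    ... | yes y≡0 = ≡.trans (square-zero (≡.trans e (≡.trans (cong (λ y → a K.* (y K.* y)) y≡0) (≡.trans (cong (a K.*_) (K.zeroˡ _)) (K.zeroʳ a))))) (≡.sym y≡0)

  sq?-* : ∀ x y → ¬ (x ≡ K.0#) → ¬ (y ≡ K.0#) → sq? (x K.* y) ≡ sq? x ⇔ᵇ sq? y
  sq?-* x y x≢0 y≢0 with isSq? x | isSq? y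
  ... | yes s | yes t = sq?-true (IsSq-* s t)
  ... | yes s | no n = sq?-false λ p → n (IsSq-cancel x≢0 s p)
  ... | no n | yes t = sq?-false λ p → n (IsSq-cancel y≢0 t (subst IsSq (K.*-comm x y) p))
  ... | no n | no m = sq?-true ([ (λ s → ⊥-elim (m s)) , (λ s → s) ]′ (IsSq-index n y))

  module Odd (2≢0 : ¬ (K.1# K.+ K.1# ≡ K.0#)) where
    open StepanovMethod F
    open Counting {Fin q}

    private
      -- For even q the power (-1)^q would be 1, while Fermat's identity makes it -1, so 2 would
      -- vanish.
      odd : ∃ λ g → q ≡ suc (g ℕ.+ g)
      odd with halve q
      ... | inj₂ h = h
      ... | inj₁ (g , e) = ⊥-elim (2≢0 (≡.trans (cong (K._+ K.1#) (≡.trans (≡.sym one) (fermat (K.- K.1#)))) (K.-‿inverseˡ K.1#)))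
        where
        1^ : ∀ k → K.1# ^ᴷ k ≡ K.1#
        1^ zero = ≡.refl
        1^ (suc k) = ≡.trans (K.*-identityˡ _) (1^ k)
        one : (K.- K.1#) ^ᴷ q ≡ K.1#
        one = ≡.trans (cong ((K.- K.1#) ^ᴷ_) e) (≡.trans (^ᴷ-homo-* (K.- K.1#) g g) (≡.trans (≡.sym (^ᴷ-distrib-* (K.- K.1#) (K.- K.1#) g))
          (≡.trans (cong (_^ᴷ g) (≡.trans (solveᴷ 1 (λ x → :- x :* :- x := x :* x) K.1#) (K.*-identityˡ K.1#))) (1^ g))))

      g : ℕ
      g = proj₁ odd

      q≡ : q ≡ suc (g ℕ.+ g)
      q≡ = proj₂ odd

      1≤g : 1 ≤ g
      1≤g with g in eq
      ... | suc _ = s≤s z≤n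
      ... | zero = ⊥-elim (K.1≉0 (single q (≡.trans q≡ (cong (λ z → suc (z ℕ.+ z)) eq)) K.1# K.0#))
        where
        single : ∀ n → n ≡ 1 → (i j : Fin n) → i ≡ j
        single .1 ≡.refl zero zero = ≡.refl

      sq-power : ∀ {x} → ¬ (x ≡ K.0#) → IsSq x → x ^ᴷ g ≡ K.1#
      sq-power {x} x≢0 (s , e) = Kₗ.cancelˡ s≢0 (begin
        s K.* x ^ᴷ g ≡⟨ cong (λ y → s K.* y ^ᴷ g) e ⟨
        s K.* (s K.* s) ^ᴷ g ≡⟨ cong (s K.*_) (≡.trans (^ᴷ-distrib-* s s g) (≡.sym (^ᴷ-homo-* s g g))) ⟩
        s ^ᴷ suc (g ℕ.+ g) ≡⟨ cong (s ^ᴷ_) q≡ ⟨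
        s ^ᴷ q ≡⟨ fermat s ⟩
        s ≡⟨ K.*-identityʳ s ⟨
        s K.* K.1# ∎)
        where
        open ≡.≡-Reasoning
        s≢0 : ¬ (s ≡ K.0#)
        s≢0 s≡0 = x≢0 (≡.trans (≡.sym e) (≡.trans (cong (K._* s) s≡0) (K.zeroˡ s)))

      NotSquare-cong : ∀ {T U} → T ≈ U → NotSquare T → NotSquare U
      NotSquare-cong e ns δ δ≢0 A B f = ns δ δ≢0 A B (trans (*-congʳ e) f)

      NotSquare-scale : ∀ {T ν} → ¬ (ν ≡ K.0#) → NotSquare T → NotSquare (const ν * T)
      NotSquare-scale {T} {ν} ν≢0 ns δ δ≢0 A B f with K.invert ν ν≢0
      ... | i , e = ns (i K.* δ) (Kₗ.*≉0 i≢0 δ≢0) A B (begin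
        T * (A * A) ≈⟨ trans (sym (*-identityˡ _)) (*-congʳ (sym (const-inverse e))) ⟩
        const ν * const i * (T * (A * A)) ≈⟨ solve 4 (λ n i t a → n :* i :* (t :* a) := i :* (n :* t :* a)) (const ν) (const i) T (A * A) ⟩
        const i * (const ν * T * (A * A)) ≈⟨ *-congˡ f ⟩
        const i * (const δ * (B * B)) ≈⟨ sym (*-assoc _ _ _) ⟩
        const i * const δ * (B * B) ≈⟨ *-congʳ (const-*-const i δ) ⟨
        const (i K.* δ) * (B * B) ∎)
        where
        open import Relation.Binary.Reasoning.Setoid setoid
        i≢0 : ¬ (i ≡ K.0#)
        i≢0 i≡0 = K.1≉0 (≡.trans (≡.sym e) (≡.trans (cong (ν K.*_) i≡0) (K.zeroʳ ν)))

    -- The equation T A² = δ B² becomes an Eisenstein form at π, which divides T exactly once.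
    exact⇒NotSquare : ∀ {T π u} → Prime π → T ≈ π * u → ¬ (π ∣ u) → NotSquare T
    exact⇒NotSquare {T} {π} {u} pr e π∤u δ δ≢0 A B f = proj₂ zz , proj₁ zz
      where
      π∤δ : ¬ (π ∣ const δ)
      π∤δ d with K.invert δ δ≢0
      ... | i , δi = Prime-∤1 pr (∣-cong (const-inverse δi) (∣-*ʳ (const i) d))
      zz : B ≈ 0# × A ≈ 0#
      zz = eisenstein pr (const δ) 0# (- u) π∤δ (λ d → π∤u (∣-cong (solve 1 (λ x → :- (:- x) := x) u) (∣-neg d))) B A (begin
        const δ * (B * B) + π * (0# * (A * B) + - u * (A * A)) ≈⟨ solve 5 (λ d b p a u → d :* (b :* b) :+ p :* (:0 :* (a :* b) :+ :- u :* (a :* a)) := d :* (b :* b) :- p :* u :* (a :* a)) (const δ) B π A u ⟩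
        const δ * (B * B) - π * u * (A * A) ≈⟨ +-congˡ (-‿cong (trans (*-congʳ (sym e)) f)) ⟩
        const δ * (B * B) - const δ * (B * B) ≈⟨ -‿inverseʳ _ ⟩
        0# ∎)
        where open import Relation.Binary.Reasoning.Setoid setoid

    signOf : Poly → Fin q → Bool
    signOf Q a = sq? (eval a Q)

    module _ (M N : ℕ) (large : signBound M N < q) where
      private
        A L ℓ δ h : ℕ
        A = signSteps M N
        L = A ℕ.+ A
        ℓ = suc L
        δ = q ℕ.* suc (suc M) ℕ.+ ℓ ℕ.* M
        h = signWidth M N

        countBound : ∀ T → Deg< (suc M) T → NotSquare T → ∀ ys → AllPairs (λ x y → ¬ (x ≡ y)) ys → All (λ a → ¬ (eval a T ≡ K.0#) × IsSq (eval a T)) ys →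
          length ys ℕ.* ℓ ℕ.+ length ys ℕ.* ℓ ≤ q ℕ.* ℓ ℕ.+ q ℕ.* suc (suc M)
        countBound T d ns [] _ _ = z≤n
        -- The first listed point serves as base point c₀, since T does not vanish there. T is
        -- replaced by a list of length M + 1, as the bound is on the length.
        countBound T d ns (y ∷ ys) distinct (p ∷ ps) = stepanov T′ M (≤-reflexive (length-toList (truncate (suc M) T))) y
            (λ e → proj₁ p (≡.trans (≡.sym (eval-cong y T′≈T)) e)) (NotSquare-cong (sym T′≈T) ns) g q≡ 1≤g L (suc A) h
            (cong suc (≡.sym (+-suc A A))) (≤-trans (m≤m+n _ _) (<⇒≤ large)) (ℕₚ.n<1+n _) (y ∷ ys) distinct
            (All.map (λ {a} (nz , s) → ≡.trans (cong (_^ᴷ g) (eval-cong a T′≈T)) (sq-power nz s)) (p ∷ ps))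
          where
          open Vec.Vec renaming ([] to []ᵛ; _∷_ to _∷ᵛ_)
          length-toList : ∀ {k} (v : Vec (Fin q) k) → length (toList v) ≡ k
          length-toList []ᵛ = ≡.refl
          length-toList (a ∷ᵛ v) = cong suc (length-toList v)
          T′ : Poly
          T′ = toList (truncate (suc M) T)
          T′≈T : T′ ≈ T
          T′≈T = truncate-≈ (suc M) T d

        -- Stepanov's estimate bounds the points of either sign from above; since the two classes
        -- together make up all but M of the field, each upper bound also bounds the other class
        -- from below.
        balanced-squares : ∀ T → Deg< (suc M) T → NotSquare T → ∀ xs → AllPairs (λ x y → ¬ (x ≡ y)) xs → q ≤ length xs ℕ.+ M →
          All (λ a → ¬ (eval a T ≡ K.0#)) xs → Balanced ℓ δ xs (λ a → sq? (eval a T))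
        balanced-squares T d ns xs distinct q≤ nz = balanced
            (SignArithmetic.balance ℓ q M (length plus) (length minus) (length xs) plus≤ (count-length f xs) q≤)
            (SignArithmetic.balance ℓ q M (length minus) (length plus) (length xs) (minus≤ minus minus-distinct minus-all) (≡.trans (count-length f xs) (ℕₚ.+-comm (length plus) (length minus))) q≤)
          where
          f : Fin q → Bool
          f a = sq? (eval a T)
          plus minus : List (Fin q)
          plus = filterᵇ f xs
          minus = filterᵇ (λ a → not (f a)) xs
          minus-distinct : AllPairs (λ x y → ¬ (x ≡ y)) minus
          minus-distinct = AllPairsₚ.filter⁺ (T? ∘ (λ a → not (f a))) distinct
          minus-all : All (λ a → ¬ (eval a T ≡ K.0#) × ¬ IsSq (eval a T)) minus
          minus-all = All.zip (Allₚ.filter⁺ (T? ∘ (λ a → not (f a))) nz , All.map (λ {a} t → false-sq (Equivalence.to T-not-≡ t)) (Allₚ.all-filter (T? ∘ (λ a → not (f a))) xs))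
          plus≤ : length plus ℕ.* ℓ ℕ.+ length plus ℕ.* ℓ ≤ q ℕ.* ℓ ℕ.+ q ℕ.* suc (suc M)
          plus≤ = countBound T d ns plus (AllPairsₚ.filter⁺ (T? ∘ f) distinct)
            (All.zip (Allₚ.filter⁺ (T? ∘ f) nz , All.map (λ {a} t → true-sq (Equivalence.to T-≡ t)) (Allₚ.all-filter (T? ∘ f) xs)))
          minus≤ : ∀ ys → AllPairs (λ x y → ¬ (x ≡ y)) ys → All (λ a → ¬ (eval a T ≡ K.0#) × ¬ IsSq (eval a T)) ys →
            length ys ℕ.* ℓ ℕ.+ length ys ℕ.* ℓ ≤ q ℕ.* ℓ ℕ.+ q ℕ.* suc (suc M)
          minus≤ [] _ _ = z≤n
          minus≤ (y ∷ ys) ds (p ∷ ps) = countBound (const ν * T) (Deg<-* (const ν) (Deg<-const ν) d) (NotSquare-scale (proj₁ p) ns) (y ∷ ys) ds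
              (All.map (λ {a} (z , n) → value a z n) (p ∷ ps))
            where
            ν : Fin q
            -- Scaling T by one of its non-square values turns all non-square values into squares,
            -- so the same bound counts them.
            ν = eval y T
            ev : ∀ a → eval a (const ν * T) ≡ ν K.* eval a T
            ev a = ≡.trans (eval-* a (const ν) T) (cong (K._* eval a T) (eval-const a ν))
            value : ∀ a → ¬ (eval a T ≡ K.0#) → ¬ IsSq (eval a T) → ¬ (eval a (const ν * T) ≡ K.0#) × IsSq (eval a (const ν * T))
            value a z n = (λ e → Kₗ.*≉0 (proj₁ p) z (≡.trans (≡.sym (ev a)) e)) , sqr (IsSq-index (proj₂ p) (eval a T))
              where
              sqr : IsSq (eval a T) ⊎ IsSq (ν K.* eval a T) → IsSq (eval a (const ν * T))
              sqr (inj₁ s) = ⊥-elim (n s)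
              sqr (inj₂ s) = subst IsSq (≡.sym (ev a)) s

        -- A product of signs over a sublist is the sign of the product T of those primes. The exact
        -- prime factor π certifies that T is not a square.
        record Realized (Qs : List Poly) (xs : List (Fin q)) (h : Fin q → Bool) : Set where
          field
            T : Poly
            T∣ : T ∣ product Qs
            π u : Poly
            π-prime : Prime π
            T≈ : T ≈ π * u
            π∤u : ¬ (π ∣ u)
            agrees : All (λ a → h a ≡ signOf T a) xs

        ∣-nonzero : ∀ {P T xs} → T ∣ P → All (λ a → ¬ (eval a P ≡ K.0#)) xs → All (λ a → ¬ (eval a T ≡ K.0#)) xs
        ∣-nonzero {P} {T} (c , e) = All.map (λ {a} nz z → nz (≡.trans (eval-cong a e) (≡.trans (eval-* a T c) (≡.trans (cong (K._* eval a c) z) (K.zeroˡ _)))))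

        realize : ∀ {Qs h} xs → SquareFree Qs → All (λ a → ¬ (eval a (product Qs) ≡ K.0#)) xs → Combination (List.map signOf Qs) h → Realized Qs xs h
        realize {Q ∷ Qs} xs (cons pr n sf) nz only = record
          { T = Q ; T∣ = ∣-*ʳ (product Qs) ∣-refl ; π = Q ; u = 1# ; π-prime = pr ; T≈ = sym (*-identityʳ Q) ; π∤u = Prime-∤1 pr
          ; agrees = All.tabulate (λ _ → ≡.refl) }
        realize {Q ∷ Qs} xs (cons pr n sf) nz (skip c) = record
          { T = T ; T∣ = ∣-*ˡ Q T∣ ; π = π ; u = u ; π-prime = π-prime ; T≈ = T≈ ; π∤u = π∤u ; agrees = agrees }
          where open Realized (realize xs sf (∣-nonzero (∣-*ˡ Q ∣-refl) nz) c)
        realize {Q ∷ Qs} xs (cons pr n sf) nz (both {h = h} c) = record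
          { T = T * Q ; T∣ = ∣-cong (*-comm (product Qs) Q) (proj₁ T∣ , trans (*-congʳ (proj₂ T∣)) (solve 3 (λ t c q → t :* c :* q := t :* q :* c) T (proj₁ T∣) Q))
          ; π = Q ; u = T ; π-prime = pr ; T≈ = *-comm T Q ; π∤u = λ d → n (∣-trans d T∣)
          ; agrees = All.zipWith (λ {a} (e , nzT , nzQ) → ≡.trans (cong (_⇔ᵇ signOf Q a) e) (≡.trans (≡.sym (sq?-* (eval a T) (eval a Q) nzT nzQ)) (cong sq? (≡.sym (eval-* a T Q)))))
              (agrees , All.zip (∣-nonzero (∣-*ˡ Q T∣) nz , ∣-nonzero (∣-*ʳ (product Qs) ∣-refl) nz)) }
          where open Realized (realize xs sf (∣-nonzero (∣-*ˡ Q ∣-refl) nz) c)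

      SquareFree⇒≉0 : ∀ {Qs} → SquareFree Qs → ¬ (product Qs ≈ 0#)
      SquareFree⇒≉0 [] = 1≉0ₚ
      SquareFree⇒≉0 (cons pr _ sf) = *≉0 (Prime-≉0 pr) (SquareFree⇒≉0 sf)

      -- Every nonempty product of signs is the character of a non-square polynomial, hence
      -- balanced, and `matching` realizes any pattern. The at most M zeros of the product are
      -- removed from the points beforehand.
      prescribed-signs : ∀ {Qs} → SquareFree Qs → length Qs ≤ N → Deg< (suc M) (product Qs) → ∀ (εs : List Bool) → length εs ≡ length Qs →
        ∃ λ a → ¬ (eval a (product Qs) ≡ K.0#) × Matches a (List.zip (List.map signOf Qs) εs)
      prescribed-signs {Qs} sf n≤N d εs same = finish (matching ℓ δ N (List.zip (List.map signOf Qs) εs) xs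
          (≤-trans (≤-reflexive lengths) n≤N) (λ c → bal (subst (λ fs → Combination fs _) firsts c))
          (SignArithmetic.enough (2 ℕ.^ N) q M (length xs) A ≡.refl (≤-<-trans (m≤n+m _ _) large) q≤))
        where
        P : Poly
        P = product Qs
        nonzero : Fin q → Bool
        nonzero a = not (does (eval a P K.≟ K.0#))
        xs zs : List (Fin q)
        xs = filterᵇ nonzero (allFin q)
        zs = filterᵇ (λ a → not (nonzero a)) (allFin q)
        nonzero-sound : ∀ {a} → Bool.T (nonzero a) → ¬ (eval a P ≡ K.0#)
        nonzero-sound {a} t with eval a P K.≟ K.0#
        ... | no n = n
        zero-sound : ∀ {a} → Bool.T (not (nonzero a)) → eval a P ≡ K.0#
        zero-sound {a} t with eval a P K.≟ K.0#
        ... | yes e = e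
        xs-nonzero : All (λ a → ¬ (eval a P ≡ K.0#)) xs
        xs-nonzero = All.map nonzero-sound (Allₚ.all-filter (T? ∘ nonzero) (allFin q))
        zs≤ : length zs ≤ M
        zs≤ with ≉0⇒Degree (SquareFree⇒≉0 sf)
        ... | k , dk = ≤-trans (subst (_≤ k) (ℕₚ.*-identityʳ (length zs)) (roots≤degree 1 dk zs (AllPairsₚ.filter⁺ (T? ∘ (λ a → not (nonzero a))) allFin-distinct)
              (All.map (λ {a} t → let (c , e) = root⇒∣ (zero-sound {a} t) in c , trans e (*-congʳ (sym (*-identityʳ _)))) (Allₚ.all-filter (T? ∘ (λ a → not (nonzero a))) (allFin q)))))
            (≤-pred (Degree-Deg< dk d))
        q≤ : q ≤ length xs ℕ.+ M
        q≤ = subst (_≤ length xs ℕ.+ M) (≡.trans (≡.sym (count-length nonzero (allFin q))) (Listₚ.length-tabulate (λ (i : Fin q) → i))) (+-monoʳ-≤ (length xs) zs≤)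
        lengths : length (List.zip (List.map signOf Qs) εs) ≡ length Qs
        lengths = ≡.trans (Listₚ.length-zipWith _,_ (List.map signOf Qs) εs) (≡.trans (cong₂ ℕ._⊓_ (Listₚ.length-map signOf Qs) same) (ℕₚ.⊓-idem (length Qs)))
        zip-map : ∀ (fs : List (Fin q → Bool)) (bs : List Bool) → length bs ≡ length fs → List.map proj₁ (List.zip fs bs) ≡ fs
        zip-map [] [] _ = ≡.refl
        zip-map (f ∷ fs) (b ∷ bs) e = cong (f ∷_) (zip-map fs bs (ℕₚ.suc-injective e))
        firsts : List.map proj₁ (List.zip (List.map signOf Qs) εs) ≡ List.map signOf Qs
        firsts = zip-map (List.map signOf Qs) εs (≡.trans same (≡.sym (Listₚ.length-map signOf Qs)))
        Deg<-∣ : ∀ {T} → T ∣ P → Deg< (suc M) T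
        Deg<-∣ {T} (c , e) with degree? T | degree? c
        ... | inj₁ z | _ = ≈0⇒Deg< z
        ... | inj₂ _ | inj₁ z = ⊥-elim (SquareFree⇒≉0 sf (trans e (trans (*-congˡ z) (zeroʳ T))))
        ... | inj₂ (i , di) | inj₂ (j , dj) = Deg<-mono (≤-trans (s≤s (m≤m+n i j)) (Degree-Deg< (Degree-cong (sym e) (Degree-* di dj)) d)) (bound di)
        bal : ∀ {h} → Combination (List.map signOf Qs) h → Balanced ℓ δ xs h
        bal c = Balanced-cong (All.map ≡.sym agrees) (balanced-squares T (Deg<-∣ T∣) (exact⇒NotSquare π-prime T≈ π∤u) xs
            (AllPairsₚ.filter⁺ (T? ∘ nonzero) allFin-distinct) q≤ (∣-nonzero T∣ xs-nonzero))
          where open Realized (realize xs sf xs-nonzero c)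
        finish : (∃ λ a → a ∈ xs × Matches a (List.zip (List.map signOf Qs) εs)) → ∃ λ a → ¬ (eval a P ≡ K.0#) × Matches a (List.zip (List.map signOf Qs) εs)
        finish (a , a∈ , matches) = a , All.lookup xs-nonzero a∈ , matches

-- Chinese remainders for quadratic congruences.

module ChineseRemainder {q} (F : FiniteField q) where
  open FiniteFieldPoly F

  Coprime-∣∣ : ∀ {a b c} → Coprime a b → a ∣ c → b ∣ c → a * b ∣ c
  Coprime-∣∣ {a} {b} {c} cop (x , e) b∣c = go (Coprime-∣ (Coprime-sym cop) (∣-cong e b∣c))
    where
    go : b ∣ x → a * b ∣ c
    go (y , f) = y , trans e (trans (*-congˡ f) (sym (*-assoc a b y)))

  chinese : ∀ {a b} → Coprime a b → ∀ x y → ∃ λ z → a ∣ z - x × b ∣ z - y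
  chinese {a} {b} (u , v , e) x y = x * (v * b) + y * (u * a)
    , (u * (y - x) , (begin
        x * (v * b) + y * (u * a) - x ≈⟨ +-congˡ (-‿cong (trans (sym (*-identityʳ x)) (*-congˡ (sym e)))) ⟩
        x * (v * b) + y * (u * a) - x * (u * a + v * b) ≈⟨ solve 6 (λ x y u v a b → x :* (v :* b) :+ y :* (u :* a) :- x :* (u :* a :+ v :* b) := a :* (u :* (y :- x))) x y u v a b ⟩
        a * (u * (y - x)) ∎))
    , (v * (x - y) , (begin
        x * (v * b) + y * (u * a) - y ≈⟨ +-congˡ (-‿cong (trans (sym (*-identityʳ y)) (*-congˡ (sym e)))) ⟩
        x * (v * b) + y * (u * a) - y * (u * a + v * b) ≈⟨ solve 6 (λ x y u v a b → x :* (v :* b) :+ y :* (u :* a) :- y :* (u :* a :+ v :* b) := b :* (v :* (x :- y))) x y u v a b ⟩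
        b * (v * (x - y)) ∎))
    where open import Relation.Binary.Reasoning.Setoid setoid

  -- θ ↦ B θ + θ² + C modulo coprime moduli.
  quadratic-crt : ∀ B C {Qs} → SquareFree Qs → All (λ Q → ∃ λ θ → Q ∣ θ * θ + B * θ + C) Qs → ∃ λ θ → product Qs ∣ θ * θ + B * θ + C
  quadratic-crt B C [] [] = 0# , (0# * 0# + B * 0# + C , sym (*-identityˡ _))
  quadratic-crt B C {Q ∷ Qs} (cons π n sf) ((θ₁ , d₁) ∷ ds) = combine (quadratic-crt B C sf ds)
    where
    transfer : ∀ {M θ θ′} → M ∣ θ′ - θ → M ∣ θ * θ + B * θ + C → M ∣ θ′ * θ′ + B * θ′ + C
    transfer {M} {θ} {θ′} d e = ∣-cong (solve 4 (λ b c t s → (s :- t) :* (s :+ t :+ b) :+ (t :* t :+ b :* t :+ c) := s :* s :+ b :* s :+ c) B C θ θ′) (∣-+ (∣-*ʳ (θ′ + θ + B) d) e)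
    combine : (∃ λ θ → product Qs ∣ θ * θ + B * θ + C) → ∃ λ θ → Q * product Qs ∣ θ * θ + B * θ + C
    combine (θ₂ , d₂) = join (chinese (∤⇒Coprime π n) θ₁ θ₂)
      where
      join : (∃ λ z → Q ∣ z - θ₁ × product Qs ∣ z - θ₂) → ∃ λ θ → Q * product Qs ∣ θ * θ + B * θ + C
      join (z , z₁ , z₂) = z , Coprime-∣∣ (∤⇒Coprime π n) (transfer z₁ d₁) (transfer z₂ d₂)

-- The ternary form over a finite field of odd characteristic.

record OddSolution {q} (F : FiniteField q) (P c : List (Fin q)) (a₀ : Fin q) (b : ℕ) : Set where
  open FiniteFieldPoly F
  field
    z x y w : Poly
    equation : z * z + t- a₀ * (x * x - P * (y * y)) ≈ c * (w * w)
    w≉0 : ¬ (w ≈ 0#)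
    Deg<-z : Deg< b z
    Deg<-x : Deg< b x
    Deg<-y : Deg< b y
    Deg<-w : Deg< b w

module OddSolvability {q} (F : FiniteField q) where
  open Squares F
  open NormForms field′
  open LinearSymbols field′
  open ChineseRemainder F
  private module S = SolverOver K.commRing
  open S using () renaming (solve to solveᴷ)

  module _ (2≢0 : ¬ (K.1# K.+ K.1# ≡ K.0#)) {P p} (dP : Degree P (suc p)) (monic : coeff P (suc p) ≡ K.1#) (P-prime : Prime P)
           (a₀ : Fin q) (Pa₀-ns : ¬ IsSq (eval a₀ P)) {c n} (dc : Degree c n) (P∤c : ¬ (P ∣ c)) (ca₀≢0 : ¬ (eval a₀ c ≡ K.0#)) (ca₀-sq : IsSq (eval a₀ c))
           (large : signBound (n ℕ.+ suc p) (suc n) < q) where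
    open Odd 2≢0
    open Counting {Fin q}

    private
      opaque
        f : Factorization c n
        f = factorize (suc n) ≤-refl dc
      module f = Factorization f
      Qs : List Poly
      Qs = f.primes
      ρ Π : Poly
      ρ = f.root
      Π = product Qs
      λ₀ : Fin q
      λ₀ = f.unit

      Π∣c : Π ∣ c
      Π∣c = ∣-cong (sym f.factored) (∣-*ˡ (const λ₀) (∣-*ˡ (ρ * ρ) ∣-refl))

      eval-c : eval a₀ c ≡ λ₀ K.* (eval a₀ ρ K.* eval a₀ ρ K.* eval a₀ Π)
      eval-c = ≡.trans (eval-cong a₀ f.factored) (≡.trans (eval-* a₀ (const λ₀) (ρ * ρ * Π)) (cong₂ K._*_ (eval-const a₀ λ₀)
        (≡.trans (eval-* a₀ (ρ * ρ) Π) (cong (K._* eval a₀ Π) (eval-* a₀ ρ ρ)))))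

      ∣-eval≢0 : ∀ {Q R} a → Q ∣ R → ¬ (eval a R ≡ K.0#) → ¬ (eval a Q ≡ K.0#)
      ∣-eval≢0 {Q} a (r , e) n z = n (≡.trans (eval-cong a e) (≡.trans (eval-* a Q r) (≡.trans (cong (K._* eval a r) z) (K.zeroˡ _))))

      Πa₀≢0 : ¬ (eval a₀ Π ≡ K.0#)
      Πa₀≢0 = ∣-eval≢0 a₀ Π∣c ca₀≢0

      ρa₀≢0 : ¬ (eval a₀ ρ ≡ K.0#)
      ρa₀≢0 = ∣-eval≢0 a₀ (∣-cong (sym f.factored) (∣-*ˡ (const λ₀) (∣-*ʳ Π (∣-*ʳ ρ ∣-refl)))) ca₀≢0

      sf : SquareFree (P ∷ Qs)
      sf = cons P-prime (λ d → P∤c (∣-trans d Π∣c)) f.squareFree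

      opaque
        signs : ∃ λ a → ¬ (eval a (P * Π) ≡ K.0#) × Matches a (List.zip (List.map signOf (P ∷ Qs)) (true ∷ List.map (λ Q → sq? (eval a₀ Q)) Qs))
        signs = prescribed-signs (n ℕ.+ suc p) (suc n) large sf (s≤s f.length≤) (Deg<-cong (*-comm Π P) (Deg<-* Π f.Deg<-product (bound dP)))
          (true ∷ List.map (λ Q → sq? (eval a₀ Q)) Qs) (cong suc (Listₚ.length-map (λ Q → sq? (eval a₀ Q)) Qs))

      a : Fin q
      a = proj₁ signs

      first-match : ∀ {g ε fs} → Matches a ((g , ε) ∷ fs) → g a ≡ ε × Matches a fs
      first-match (e ∷ m) = e , m

      Pa-sq : IsSq (eval a P)
      Pa-sq = true-sq (proj₁ (first-match (proj₂ (proj₂ signs))))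

      Pa≢0 : ¬ (eval a P ≡ K.0#)
      Pa≢0 = ∣-eval≢0 a (∣-*ʳ Π ∣-refl) (proj₁ (proj₂ signs))

      Pa₀≢0 : ¬ (eval a₀ P ≡ K.0#)
      Pa₀≢0 e = Pa₀-ns (K.0# , ≡.trans (K.zeroˡ _) (≡.sym e))

      a₀≢a : ¬ (a₀ ≡ a)
      a₀≢a e = Pa₀-ns (subst (λ b → IsSq (eval b P)) (≡.sym e) Pa-sq)

      -- Minkowski represents κ Q by z² - (t - x)(t - y) w², and κ Q is then a square at both x and
      -- y; comparing the two eliminates κ.
      norm₂-signs : ∀ {Q m x y} → Degree Q m → ¬ (x ≡ y) → SquareMod Q (t- x * t- y) → ¬ (eval x Q ≡ K.0#) → ¬ (eval y Q ≡ K.0#) → sq? (eval x Q) ≡ sq? (eval y Q)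
      norm₂-signs {Q} {m} {x} {y} dQ x≢y (θ , d) Qx≢0 Qy≢0 = go (norm₂ dQ x y x≢y θ d)
        where
        go : Norm₂ x y Q m → sq? (eval x Q) ≡ sq? (eval y Q)
        go N = ⇔ᵇ-cancelˡ (sq? κ) _ _
          (≡.trans (≡.sym (sq?-* κ (eval x Q) κ≉0 Qx≢0)) (sq?-true (eval x z , eval-norm₂ N x (∣-*ʳ (t- y) ∣-refl))))
          (≡.trans (≡.sym (sq?-* κ (eval y Q) κ≉0 Qy≢0)) (sq?-true (eval y z , eval-norm₂ N y (∣-*ˡ (t- x) ∣-refl))))
          where open Norm₂ N

      ¬split-P : ¬ SquareMod P (- t- a₀)
      ¬split-P (θ , d) = Pa₀-ns (split⇒square dP monic a₀ θ (∣-cong (solve 2 (λ x y → x :- :- y := x :+ y) (θ * θ) (t- a₀)) d))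

      opaque
        -- Index two: if -(t - a) were no square mod P, its product with the non-square -(t - a₀)
        -- would be one, and P would have the same character at a₀ and at a.
        split-P : SquareMod P (- t- a)
        split-P = [ (λ s → s) , (λ s → ⊥-elim (contra s)) ]′ (square-index P-prime ¬split-P (- t- a))
          where
          contra : SquareMod P (- t- a₀ * - t- a) → ⊥
          contra (θ , d) = Pa₀-ns (true-sq (≡.trans (norm₂-signs dP a₀≢a (θ , ∣-cong (+-congˡ (-‿cong (solve 2 (λ x y → :- x :* :- y := x :* y) (t- a₀) (t- a)))) d) Pa₀≢0 Pa≢0) (sq?-true Pa-sq)))

      opaque
        NP : Norm₁ a K.0# K.1# P (suc p)
        NP = split-norm₁ dP a (proj₁ split-P) (∣-cong (solve 2 (λ x y → x :- :- y := x :+ y) (proj₁ split-P * proj₁ split-P) (t- a)) (proj₂ split-P))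
      module NP = Norm₁ NP

      opaque
        κP : ∃ λ s → s K.* s ≡ NP.κ
        κP = κ-square monic NP

      opaque
        sP-inverse : ∃ λ i → proj₁ κP K.* i ≡ K.1#
        sP-inverse = K.invert (proj₁ κP) (λ e → NP.κ≉0 (≡.trans (≡.sym (proj₂ κP)) (≡.trans (cong (K._* proj₁ κP) e) (K.zeroˡ _))))

      i yP wP : Poly
      i = const (proj₁ sP-inverse)
      yP = i * NP.y
      wP = i * NP.w

      opaque
        -- P is monic, so the constant in its representation is a square and is absorbed into yP and
        -- wP.
        P≈ : yP * yP + t- a * (wP * wP) ≈ P
        P≈ = begin
          i * NP.y * (i * NP.y) + t- a * (i * NP.w * (i * NP.w)) ≈⟨ solve 4 (λ i y t w → i :* y :* (i :* y) :+ t :* (i :* w :* (i :* w)) := i :* i :* (y :* y :+ t :* (w :* w))) i NP.y (t- a) NP.w ⟩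
          i * i * (NP.y * NP.y + t- a * (NP.w * NP.w)) ≈⟨ *-congˡ (trans (+-congˡ (*-congˡ (sym (trans (+-cong (trans (*-congʳ const-0) (zeroˡ _)) (trans (*-congʳ const-1) (*-identityˡ _))) (+-identityˡ _))))) NP.norm) ⟩
          i * i * (const NP.κ * P) ≈⟨ *-congˡ (*-congʳ (trans (const-cong (≡.sym (proj₂ κP))) (const-*-const (proj₁ κP) (proj₁ κP)))) ⟩
          i * i * (const (proj₁ κP) * const (proj₁ κP) * P) ≈⟨ solve 3 (λ i s p → i :* i :* (s :* s :* p) := s :* i :* (s :* i) :* p) i (const (proj₁ κP)) P ⟩
          const (proj₁ κP) * i * (const (proj₁ κP) * i) * P ≈⟨ *-congʳ (trans (*-cong (const-inverse (proj₂ sP-inverse)) (const-inverse (proj₂ sP-inverse))) (*-identityˡ _)) ⟩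
          1# * P ≈⟨ *-identityˡ P ⟩
          P ∎
          where open import Relation.Binary.Reasoning.Setoid setoid

      opaque
        -- Otherwise P = yP² would have a square value at a₀.
        wP≉0 : ¬ (wP ≈ 0#)
        wP≉0 z = Pa₀-ns (eval a₀ yP , ≡.trans (≡.sym (eval-* a₀ yP yP)) (eval-cong a₀ (trans (sym (trans (+-congˡ (trans (*-congˡ (trans (*-congʳ z) (zeroˡ wP))) (zeroʳ _))) (+-identityʳ _))) P≈)))

      opaque
        -- Supplies a reference point b for which (t - a₀)(t - b) is certainly not a square mod Q,
        -- as index-two arguments need one known non-square.
        other-sign : ∀ {Q} → Prime Q → Q ∣ c → ∃ λ b → ¬ (eval b Q ≡ K.0#) × sq? (eval b Q) ≡ not (sq? (eval a₀ Q))
        other-sign {Q} π Q∣c = go (prescribed-signs (n ℕ.+ suc p) (suc n) large {Q ∷ []} (cons π (Prime-∤1 π) []) (s≤s z≤n) (Deg<-cong (sym (*-identityʳ Q)) (Deg<-∣c Q∣c)) (not (sq? (eval a₀ Q)) ∷ []) ≡.refl)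
          where
          Deg<-∣c : Q ∣ c → Deg< (suc (n ℕ.+ suc p)) Q
          Deg<-∣c (r , e) with degree? r
          ... | inj₁ z = ⊥-elim (Degree⇒≉0 dc (trans e (trans (*-congˡ z) (zeroʳ Q))))
          ... | inj₂ (j , dj) = Deg<-mono (s≤s (≤-trans (subst (suc (deg-1 π) ≤_) (Degree-unique (Degree-cong (sym e) (Degree-* (nonconstant π) dj)) dc) (m≤m+n _ j)) (m≤m+n n _))) (bound (nonconstant π))
          go : (∃ λ b → ¬ (eval b (Q * 1#) ≡ K.0#) × Matches b ((signOf Q , not (sq? (eval a₀ Q))) ∷ [])) → ∃ λ b → ¬ (eval b Q ≡ K.0#) × sq? (eval b Q) ≡ not (sq? (eval a₀ Q))
          go (b , nz , e ∷ []) = b , ∣-eval≢0 b (∣-*ʳ 1# ∣-refl) nz , e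

      opaque
        -- The converse of `norm₂-signs`. With b from `other-sign`, if (t - a₀)(t - a) were no
        -- square mod Q, then its product with the non-square (t - a₀)(t - b) would be one; dividing
        -- by (t - a₀)² makes (t - a)(t - b) a square, against the opposite signs of Q at a and b.
        split-Q : ∀ {Q} → Prime Q → Q ∣ c → ¬ (eval a Q ≡ K.0#) → sq? (eval a Q) ≡ sq? (eval a₀ Q) → SquareMod Q (t- a₀ * t- a)
        split-Q {Q} π Q∣c Qa≢0 same = go (other-sign π Q∣c)
          where
          Qa₀≢0 : ¬ (eval a₀ Q ≡ K.0#)
          Qa₀≢0 = ∣-eval≢0 a₀ Q∣c ca₀≢0
          not≢ : ∀ b → ¬ (b ≡ not b)
          not≢ true ()
          not≢ false ()
          cop : Coprime Q (t- a₀)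
          cop = Coprime-sym (∤⇒Coprime (Prime-t- a₀) (λ d → Qa₀≢0 (∣⇒root d)))
          go : (∃ λ b → ¬ (eval b Q ≡ K.0#) × sq? (eval b Q) ≡ not (sq? (eval a₀ Q))) → SquareMod Q (t- a₀ * t- a)
          go (b , Qb≢0 , e) = [ (λ s → s) , (λ s → ⊥-elim (contra s)) ]′ (square-index π ¬split (t- a₀ * t- a))
            where
            a₀≢b : ¬ (a₀ ≡ b)
            a₀≢b z = not≢ (sq? (eval a₀ Q)) (≡.trans (cong (λ w → sq? (eval w Q)) z) e)
            a≢b : ¬ (a ≡ b)
            a≢b z = not≢ (sq? (eval a₀ Q)) (≡.trans (≡.sym same) (≡.trans (cong (λ w → sq? (eval w Q)) z) e))
            ¬split : ¬ SquareMod Q (t- a₀ * t- b)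
            ¬split s = not≢ (sq? (eval a₀ Q)) (≡.trans (norm₂-signs (nonconstant π) a₀≢b s Qa₀≢0 Qb≢0) e)
            contra : SquareMod Q (t- a₀ * t- b * (t- a₀ * t- a)) → ⊥
            contra (θ , d) = not≢ (sq? (eval a₀ Q)) (≡.trans (≡.sym same) (≡.trans (norm₂-signs (nonconstant π) a≢b (divided cop) Qa≢0 Qb≢0) e))
              where
              divided : Coprime Q (t- a₀) → SquareMod Q (t- a * t- b)
              divided (u , v , uv) = v * θ , ∣-cong eq (∣-+ (∣-*ˡ (v * v) d) (∣-*ʳ (- (u * (1# + v * t- a₀) * (t- a * t- b))) ∣-refl))
                where
                open import Relation.Binary.Reasoning.Setoid setoid
                eq : v * v * (θ * θ - t- a₀ * t- b * (t- a₀ * t- a)) + Q * - (u * (1# + v * t- a₀) * (t- a * t- b)) ≈ v * θ * (v * θ) - t- a * t- b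
                eq = begin
                  v * v * (θ * θ - t- a₀ * t- b * (t- a₀ * t- a)) + Q * - (u * (1# + v * t- a₀) * (t- a * t- b))
                    ≈⟨ solve 7 (λ v θ r b a q u → v :* v :* (θ :* θ :- r :* b :* (r :* a)) :+ q :* :- (u :* (:1 :+ v :* r) :* (a :* b)) := v :* θ :* (v :* θ) :- a :* b :* ((u :* q :+ v :* r) :* (:1 :+ v :* r) :- v :* r)) v θ (t- a₀) (t- b) (t- a) Q u ⟩
                  v * θ * (v * θ) - t- a * t- b * ((u * Q + v * t- a₀) * (1# + v * t- a₀) - v * t- a₀) ≈⟨ +-congˡ (-‿cong (*-congˡ (+-congʳ (*-congʳ uv)))) ⟩
                  v * θ * (v * θ) - t- a * t- b * (1# * (1# + v * t- a₀) - v * t- a₀)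
                    ≈⟨ solve 5 (λ v θ r b a → v :* θ :* (v :* θ) :- a :* b :* (:1 :* (:1 :+ v :* r) :- v :* r) := v :* θ :* (v :* θ) :- a :* b) v θ (t- a₀) (t- b) (t- a) ⟩
                  v * θ * (v * θ) - t- a * t- b ∎

      opaque
        all-split : ∀ {Rs} → SquareFree Rs → product Rs ∣ c → ¬ (eval a (product Rs) ≡ K.0#) → Matches a (List.zip (List.map signOf Rs) (List.map (λ Q → sq? (eval a₀ Q)) Rs)) →
          All (λ Q → ∃ λ θ → Q ∣ θ * θ + 0# * θ + - (t- a₀ * t- a)) Rs
        all-split [] _ _ _ = []
        all-split {Q ∷ Rs} (cons π _ sf′) d nz (e ∷ m) =
          (proj₁ s , ∣-cong (solve 2 (λ x y → x :* x :- y := x :* x :+ :0 :* x :+ :- y) (proj₁ s) (t- a₀ * t- a)) (proj₂ s))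
            ∷ all-split sf′ (∣-trans (∣-*ˡ Q ∣-refl) d) (∣-eval≢0 a (∣-*ˡ Q ∣-refl) nz) m
          where
          s : SquareMod Q (t- a₀ * t- a)
          s = split-Q π (∣-trans (∣-*ʳ (product Rs) ∣-refl) d) (∣-eval≢0 a (∣-*ʳ (product Rs) ∣-refl) nz) e

      opaque
        root : ∃ λ θ → Π ∣ θ * θ + 0# * θ + - (t- a₀ * t- a)
        root = quadratic-crt 0# (- (t- a₀ * t- a)) f.squareFree (all-split f.squareFree Π∣c (∣-eval≢0 a (∣-*ˡ P ∣-refl) (proj₁ (proj₂ signs))) (proj₂ (first-match (proj₂ (proj₂ signs)))))

      opaque
        dΠ : ∃ (Degree Π)
        dΠ = ≉0⇒Degree (λ z → Πa₀≢0 (eval-cong a₀ z))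

      m≤n : proj₁ dΠ ≤ n
      m≤n = ≤-pred (Degree-Deg< (proj₂ dΠ) f.Deg<-product)

      opaque
        NΠ : Norm₂ a₀ a Π (proj₁ dΠ)
        NΠ = norm₂ (proj₂ dΠ) a₀ a a₀≢a (proj₁ root) (∣-cong (solve 2 (λ x y → x :* x :+ :0 :* x :+ :- y := x :* x :- y) (proj₁ root) (t- a₀ * t- a)) (proj₂ root))
      module NΠ = Norm₂ NΠ

      opaque
        λΠ-sq : IsSq (λ₀ K.* eval a₀ Π)
        λΠ-sq = IsSq-cancel {eval a₀ ρ K.* eval a₀ ρ} {λ₀ K.* eval a₀ Π} (Kₗ.*≉0 ρa₀≢0 ρa₀≢0) (eval a₀ ρ , ≡.refl)
          (subst IsSq (≡.trans eval-c (solveᴷ 3 (λ l r p → l :* (r :* r :* p) := r :* r :* (l :* p)) λ₀ (eval a₀ ρ) (eval a₀ Π))) ca₀-sq)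

      opaque
        κΠ-sq : IsSq (NΠ.κ K.* eval a₀ Π)
        κΠ-sq = eval a₀ NΠ.z , eval-norm₂ NΠ a₀ (∣-*ʳ (t- a) ∣-refl)

      opaque
        -- Both constants have the class of Π(a₀): κ through the norm form at a₀, λ₀ because c is a
        -- square there. Hence the binary form represents c itself and not just a constant multiple.
        λκ-sq : IsSq (NΠ.κ K.* λ₀)
        λκ-sq = IsSq-cancel {eval a₀ Π K.* eval a₀ Π} (Kₗ.*≉0 Πa₀≢0 Πa₀≢0) (eval a₀ Π , ≡.refl)
          (subst IsSq (solveᴷ 3 (λ k l p → k :* p :* (l :* p) := p :* p :* (k :* l)) NΠ.κ λ₀ (eval a₀ Π)) (IsSq-* κΠ-sq λΠ-sq))

      opaque
        κ-inverse : ∃ λ i → NΠ.κ K.* i ≡ K.1#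
        κ-inverse = K.invert NΠ.κ NΠ.κ≉0

      μ : Fin q
      μ = proj₁ λκ-sq K.* proj₁ κ-inverse

      opaque
        μμκ : μ K.* μ K.* NΠ.κ ≡ λ₀
        μμκ = ≡.trans (solveᴷ 3 (λ s j k → s :* j :* (s :* j) :* k := s :* s :* j :* (k :* j)) (proj₁ λκ-sq) (proj₁ κ-inverse) NΠ.κ)
          (≡.trans (cong₂ K._*_ (cong (K._* proj₁ κ-inverse) (proj₂ λκ-sq)) (proj₂ κ-inverse))
          (≡.trans (K.*-identityʳ _) (≡.trans (solveᴷ 3 (λ k l j → k :* l :* j := k :* j :* l) NΠ.κ λ₀ (proj₁ κ-inverse)) (≡.trans (cong (K._* λ₀) (proj₂ κ-inverse)) (K.*-identityˡ λ₀)))))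

      μρ : Poly
      μρ = const μ * ρ

      dμρ : Deg< (suc n) μρ
      dμρ = Deg<-* (const μ) (Deg<-const μ) f.Deg<-root

      dyP : Deg< (suc (suc p)) yP
      dyP = Deg<-* i (Deg<-const _) (Deg<-mono (s≤s (ℕₚ.⌊n/2⌋≤n (suc p))) NP.Deg<-y)

      dwP : Deg< (suc (suc p)) wP
      dwP = Deg<-* i (Deg<-const _) (Deg<-mono (≤-trans (ℕₚ.⌈n/2⌉≤n (suc p)) (n≤1+n _)) NP.Deg<-w)

    -- The binary form that represents c contains the auxiliary point a. Multiplying by wP² and
    -- replacing (t - a) wP² by P - yP² trades a for P, so wP becomes the common denominator of the
    -- solution.
    oddSolution : OddSolution F P c a₀ (suc n ℕ.+ suc n ℕ.+ suc p)
    oddSolution = record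
      { z = μρ * NΠ.z * wP ; x = μρ * NΠ.w * yP ; y = μρ * NΠ.w ; w = wP
      ; equation = equation ; w≉0 = wP≉0
      ; Deg<-z = Deg<-* (μρ * NΠ.z) (Deg<-* μρ dμρ (Deg<-mono (s≤s (s≤s m≤n)) NΠ.Deg<-z)) dwP
      ; Deg<-x = Deg<-* (μρ * NΠ.w) dμρw dyP
      ; Deg<-y = Deg<-mono (m≤m+n _ (suc p)) dμρw
      ; Deg<-w = Deg<-mono (s≤s (m≤n+m (suc p) (n ℕ.+ suc n))) dwP }
      where
      open import Relation.Binary.Reasoning.Setoid setoid
      dμρw : Deg< (suc n ℕ.+ suc n) (μρ * NΠ.w)
      dμρw = Deg<-* μρ dμρ (Deg<-mono (s≤s (≤-trans m≤n (n≤1+n n))) NΠ.Deg<-w)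
      equation : μρ * NΠ.z * wP * (μρ * NΠ.z * wP) + t- a₀ * (μρ * NΠ.w * yP * (μρ * NΠ.w * yP) - P * (μρ * NΠ.w * (μρ * NΠ.w))) ≈ c * (wP * wP)
      equation = begin
        μρ * NΠ.z * wP * (μρ * NΠ.z * wP) + t- a₀ * (μρ * NΠ.w * yP * (μρ * NΠ.w * yP) - P * (μρ * NΠ.w * (μρ * NΠ.w)))
          ≈⟨ +-congˡ (*-congˡ (+-congˡ (-‿cong (*-congʳ P≈)))) ⟨
        μρ * NΠ.z * wP * (μρ * NΠ.z * wP) + t- a₀ * (μρ * NΠ.w * yP * (μρ * NΠ.w * yP) - (yP * yP + t- a * (wP * wP)) * (μρ * NΠ.w * (μρ * NΠ.w)))
          ≈⟨ solve 7 (λ m z u t w y s → m :* z :* u :* (m :* z :* u) :+ t :* (m :* w :* y :* (m :* w :* y) :- (y :* y :+ s :* (u :* u)) :* (m :* w :* (m :* w))) := m :* m :* (z :* z :- t :* s :* (w :* w)) :* (u :* u)) μρ NΠ.z wP (t- a₀) NΠ.w yP (t- a) ⟩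
        μρ * μρ * (NΠ.z * NΠ.z - t- a₀ * t- a * (NΠ.w * NΠ.w)) * (wP * wP) ≈⟨ *-congʳ (*-congˡ NΠ.norm) ⟩
        const μ * ρ * (const μ * ρ) * (const NΠ.κ * Π) * (wP * wP) ≈⟨ *-congʳ (solve 4 (λ m r k p → m :* r :* (m :* r) :* (k :* p) := m :* m :* k :* (r :* r :* p)) (const μ) ρ (const NΠ.κ) Π) ⟩
        const μ * const μ * const NΠ.κ * (ρ * ρ * Π) * (wP * wP) ≈⟨ *-congʳ (*-congʳ (trans (*-congʳ (sym (const-*-const μ μ))) (trans (sym (const-*-const (μ K.* μ) NΠ.κ)) (const-cong μμκ)))) ⟩
        const λ₀ * (ρ * ρ * Π) * (wP * wP) ≈⟨ *-congʳ f.factored ⟨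
        c * (wP * wP) ∎

-- The curves y² + y = e x³ in characteristic two.

private
  -- Applied to the degrees of c, w and c + w with m the degree of x: the three strict bounds add up
  -- to 6 m < 6 m.
  sum-of-degrees : ∀ m a b c → a ℕ.+ b ℕ.+ c ≡ m ℕ.+ m ℕ.+ m → m ℕ.+ m < a ℕ.+ b → m ℕ.+ m < a ℕ.+ c → m ℕ.+ m < b ℕ.+ c → ⊥
  sum-of-degrees m a b c e h k l = <-irrefl ≡.refl (<-≤-trans (ℕₚ.+-mono-< (ℕₚ.+-mono-< h k) l) (≤-reflexive
      (≡.trans (N.solve 3 (λ a b c → (a N.:+ b) N.:+ (a N.:+ c) N.:+ (b N.:+ c) N.:= (a N.:+ b N.:+ c) N.:+ (a N.:+ b N.:+ c)) ≡.refl a b c)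
      (≡.trans (cong₂ ℕ._+_ e e) (N.solve 1 (λ m → (m N.:+ m N.:+ m) N.:+ (m N.:+ m N.:+ m) N.:= (m N.:+ m) N.:+ (m N.:+ m) N.:+ (m N.:+ m)) ≡.refl m)))))

module PerfectCharTwo (F : DecField) (2≈0 : DecField._≈_ F (DecField._+_ F (DecField.1# F) (DecField.1# F)) (DecField.0# F))
                      (sqrt : ∀ x → ∃ λ s → DecField._≈_ F (DecField._*_ F s s) x) where
  open FieldPoly F
  open import Relation.Binary.Reasoning.Setoid setoid

  two : 1# + 1# ≈ 0#
  two = trans (+-cong (sym const-1) (sym const-1)) (trans (sym (const-+ _ _)) (trans (const-cong 2≈0) const-0))

  twice : ∀ p → (1# + 1#) * p ≈ 0#
  twice p = trans (*-congʳ two) (zeroˡ p)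

  Deg<-derivative : ∀ {n} p → Deg< (suc n) p → Deg< n (derivative p)
  Deg<-derivative {n} [] d = ≈0⇒Deg< derivative-[]
    where
    opaque
      unfolding derivative
      derivative-[] : derivative [] ≈ 0#
      derivative-[] = refl
  Deg<-derivative {n} (a ∷ p) d = Deg<-cong (sym (derivative-∷ a p)) (Deg<-+ (Deg<-tail d) (shifted n (Deg<-tail d)))
    where
    opaque
      unfolding derivative
      derivative-∷ : ∀ a p → derivative (a ∷ p) ≈ p + (K.0# ∷ derivative p)
      derivative-∷ a p = refl
    shifted : ∀ n → Deg< n p → Deg< n (K.0# ∷ derivative p)
    shifted zero z = ≈0⇒Deg< (0∷[] (trans (derivative-cong (Deg<0⇒≈0 z)) (Deg<0⇒≈0 (Deg<-derivative [] Deg<-0))))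
    shifted (suc n) z = Deg<-∷ (Deg<-derivative p z)

  square-injective : ∀ {p r} → p * p ≈ r * r → p ≈ r
  square-injective {p} {r} e = p-r≈0⇒p≈r ([ (λ z → z) , (λ z → z) ]′ (*≈0 (begin
    (p - r) * (p - r) ≈⟨ solve 2 (λ p r → (p :- r) :* (p :- r) := (p :* p :- r :* r) :+ (:1 :+ :1) :* (r :* r :- p :* r)) p r ⟩
    (p * p - r * r) + (1# + 1#) * (r * r - p * r) ≈⟨ +-cong (p≈r⇒p-r≈0 e) (twice _) ⟩
    0# + 0# ≈⟨ +-identityˡ 0# ⟩
    0# ∎)))

  -- A vanishing derivative kills the odd coefficients; the even ones have square roots in a perfect
  -- field, and squaring is additive. The list is therefore consumed two entries at a time.
  sqrtPoly : ∀ p → derivative p ≈ 0# → ∃ λ s → s * s ≈ p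
  sqrtPoly [] _ = 0# , zeroˡ 0#
  sqrtPoly (a ∷ []) _ = step (sqrt a)
    where
    step : (∃ λ s → s K.* s K.≈ a) → ∃ λ s → s * s ≈ (a ∷ [])
    step (s , e) = const s , trans (sym (const-*-const s s)) (trans (const-cong e) (const-∷ a))
  sqrtPoly (a ∷ b ∷ p) d = step (sqrt a) (sqrtPoly p ([]-tail shifted))
    where
    opaque
      unfolding derivative
      d′ : (b K.+ K.0#) ∷ (p + (p + (K.0# ∷ derivative p))) ≈ 0#
      d′ = d
    shifted : (K.0# ∷ derivative p) ≈ 0#
    shifted = begin
      K.0# ∷ derivative p ≈⟨ solve 2 (λ p y → y := (p :+ (p :+ y)) :- (:1 :+ :1) :* p) p (K.0# ∷ derivative p) ⟩
      (p + (p + (K.0# ∷ derivative p))) - (1# + 1#) * p ≈⟨ +-cong ([]-tail d′) (-‿cong (twice p)) ⟩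
      0# - 0# ≈⟨ -‿inverseʳ 0# ⟩
      0# ∎
    b≈0 : b K.≈ K.0#
    b≈0 = K.trans (K.sym (K.+-identityʳ b)) (at d′ 0)
    step : (∃ λ s → s K.* s K.≈ a) → (∃ λ s → s * s ≈ p) → ∃ λ s → s * s ≈ (a ∷ b ∷ p)
    step (s , e) (r , f) = const s + X * r , (begin
      (const s + X * r) * (const s + X * r) ≈⟨ solve 3 (λ s x r → (s :+ x :* r) :* (s :+ x :* r) := s :* s :+ x :* (x :* (r :* r)) :+ (:1 :+ :1) :* (s :* x :* r)) (const s) X r ⟩
      const s * const s + X * (X * (r * r)) + (1# + 1#) * (const s * X * r) ≈⟨ +-cong (+-cong (trans (sym (const-*-const s s)) (const-cong e)) (*-congˡ (*-congˡ f))) (twice _) ⟩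
      const a + X * (X * p) + 0# ≈⟨ trans (+-identityʳ _) (+-congˡ (*-congˡ (trans (X-* p) (∷-cong (K.sym b≈0) refl)))) ⟩
      const a + X * (b ∷ p) ≈⟨ ∷-split a (b ∷ p) ⟨
      a ∷ b ∷ p ∎)

  -- With vanishing derivative T would be a square, and a square divisible by π is divisible by π².
  exact⇒derivative≉0 : ∀ {T π u} → Prime π → T ≈ π * u → ¬ (π ∣ u) → ¬ (derivative T ≈ 0#)
  exact⇒derivative≉0 {T} {π} {u} pr e π∤u z = go (sqrtPoly T z)
    where
    go : (∃ λ s → s * s ≈ T) → ⊥
    go (s , f) = finish (Prime-∣² pr (∣-cong (trans (sym e) (sym f)) (∣-*ʳ u ∣-refl)))
      where
      finish : π ∣ s → ⊥
      finish (r , g) = π∤u (r * r , cancelˡ (Prime-≉0 pr) (begin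
        π * u ≈⟨ trans (sym e) (sym f) ⟩
        s * s ≈⟨ *-cong g g ⟩
        π * r * (π * r) ≈⟨ solve 2 (λ p r → p :* r :* (p :* r) := p :* (p :* (r :* r))) π r ⟩
        π * (π * (r * r)) ∎))

  ∣derivative⇒≈0 : ∀ {c} → c ∣ derivative c → derivative c ≈ 0#
  ∣derivative⇒≈0 {c} (r , e) with degree? c | degree? r
  ... | inj₁ z | _ = trans e (trans (*-congʳ z) (zeroˡ r))
  ... | inj₂ _ | inj₁ z = trans e (trans (*-congˡ z) (zeroʳ c))
  ... | inj₂ (n , dc) | inj₂ (k , dr) = ⊥-elim (<-irrefl ≡.refl (≤-<-trans (m≤m+n n k) (Degree-Deg< (Degree-cong (sym e) (Degree-* dc dr)) (Deg<-derivative c (bound dc)))))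

  private
    Wr : Poly → Poly → Poly
    Wr c w = c * derivative w - derivative c * w

    Deg<-Wr : ∀ {c w i j} → Degree c i → Degree w j → Deg< (i ℕ.+ j) (Wr c w)
    Deg<-Wr {c} {w} {i} {j} dc dw = Deg<-+ (Deg<-cong (*-comm (derivative w) c) (Deg<-mono (≤-reflexive (ℕₚ.+-comm j i)) (Deg<-* (derivative w) (Deg<-derivative w (bound dw)) (bound dc))))
      (Deg<-neg (Deg<-* (derivative c) (Deg<-derivative c (bound dc)) (bound dw)))

    derivative-const : ∀ c → derivative (const c) ≈ 0#
    derivative-const c = Deg<0⇒≈0 (Deg<-derivative (const c) (Deg<-const c))

    -- The invariant differential of y² + y = e x³ has no zeros and no poles, so it cannot be pulled back nontrivially to the line.
    module Curve (c w x : Poly) (e : K.Carrier) (e≉0 : ¬ (e K.≈ K.0#)) (cop : Coprime c w) (curve : c * w * (c + w) ≈ const e * (x * x * x)) where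
      private
        c′ w′ x′ H H′ : Poly
        c′ = derivative c
        w′ = derivative w
        x′ = derivative x
        H = c * w * (c + w)
        H′ = (c′ * w + c * w′) * (c + w) + c * w * (c′ + w′)

        H-derivative : derivative H ≈ H′
        H-derivative = trans (derivative-* (c * w) (c + w)) (+-cong (*-congʳ (derivative-* c w)) (*-congˡ (derivative-+ c w)))

        cube : H′ ≈ const e * ((x′ * x + x * x′) * x + x * x * x′)
        cube = trans (sym H-derivative) (trans (derivative-cong curve) (trans (derivative-* (const e) (x * x * x))
          (trans (+-cong (trans (*-congʳ (derivative-const e)) (zeroˡ _)) (*-congˡ (trans (derivative-* (x * x) x) (+-congʳ (*-congʳ (derivative-* x x)))))) (+-identityˡ _))))

        xx∣H : x * x ∣ H
        xx∣H = x * const e , trans curve (solve 2 (λ e x → e :* (x :* x :* x) := x :* x :* (x :* e)) (const e) x)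

        xx∣H′ : x * x ∣ H′
        xx∣H′ = const e * (x′ + x′ + x′) , trans cube (solve 3 (λ e x d → e :* ((d :* x :+ x :* d) :* x :+ x :* x :* d) := x :* x :* (e :* (d :+ d :+ d))) (const e) x x′)

        -- H is a constant times x³, so x² divides both H and H′, and c H′ - c′ H is c² times the
        -- Wronskian up to an even multiple. Together with the mirror statement for w, coprimality
        -- removes the squares in front.
        ccWr : x * x ∣ c * c * Wr c w
        ccWr = ∣-cong (begin
          (c * H′ - c′ * H) - (1# + 1#) * (c * c * (c′ * w + w * w′))
            ≈⟨ solve 4 (λ c w d v → (c :* ((d :* w :+ c :* v) :* (c :+ w) :+ c :* w :* (d :+ v)) :- d :* (c :* w :* (c :+ w))) :- (:1 :+ :1) :* (c :* c :* (d :* w :+ w :* v)) := c :* c :* (c :* v :- d :* w)) c w c′ w′ ⟩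
          c * c * Wr c w ∎) (∣-+ (∣-+ (∣-*ˡ c xx∣H′) (∣-neg (∣-*ˡ c′ xx∣H))) (∣-neg (0# , trans (twice _) (sym (zeroʳ _)))))

        wwWr : x * x ∣ w * w * Wr c w
        wwWr = ∣-cong (begin
          (w * H′ - w′ * H) - (1# + 1#) * (w * w * (c * c′ + c′ * w))
            ≈⟨ solve 4 (λ c w d v → (w :* ((d :* w :+ c :* v) :* (c :+ w) :+ c :* w :* (d :+ v)) :- v :* (c :* w :* (c :+ w))) :- (:1 :+ :1) :* (w :* w :* (c :* d :+ d :* w)) := w :* w :* (c :* v :- d :* w)) c w c′ w′ ⟩
          w * w * Wr c w ∎) (∣-+ (∣-+ (∣-*ˡ w xx∣H′) (∣-neg (∣-*ˡ w′ xx∣H))) (∣-neg (0# , trans (twice _) (sym (zeroʳ _)))))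

        xx∣Wr : x * x ∣ Wr c w
        xx∣Wr = go (Coprime-* (Coprime-sym (Coprime-* cop cop)) (Coprime-sym (Coprime-* cop cop)))
          where
          go : Coprime (w * w) (c * c) → x * x ∣ Wr c w
          go (u , v , f) = ∣-cong (begin
            u * (w * w * Wr c w) + v * (c * c * Wr c w) ≈⟨ solve 5 (λ u v c w r → u :* (w :* r) :+ v :* (c :* r) := (u :* w :+ v :* c) :* r) u v (c * c) (w * w) (Wr c w) ⟩
            (u * (w * w) + v * (c * c)) * Wr c w ≈⟨ trans (*-congʳ f) (*-identityˡ _) ⟩
            Wr c w ∎) (∣-+ (∣-*ˡ u wwWr) (∣-*ˡ v ccWr))

      -- Any two of c, w and c + w have the same Wronskian up to sign, so its degree is below each
      -- of the three pairwise sums. Their total is three times the degree of x, too small for a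
      -- nonzero multiple of x².
      Wr≈0 : ∀ {i j k} → Degree c i → Degree w j → Degree (c + w) k → Wr c w ≈ 0#
      Wr≈0 {i} {j} {k} dc dw ds with degree? x | degree? (Wr c w)
      ... | _ | inj₁ z = z
      ... | inj₁ z | inj₂ _ = ⊥-elim (*≉0 (*≉0 (Degree⇒≉0 dc) (Degree⇒≉0 dw)) (Degree⇒≉0 ds) (trans curve (trans (*-congˡ (trans (*-congˡ z) (zeroʳ _))) (zeroʳ _))))
      ... | inj₂ (m , dx) | inj₂ (r , dW) = ⊥-elim (sum-of-degrees m i j k
          (Degree-unique (Degree-* (Degree-* dc dw) ds) (Degree-cong (sym curve) (Degree-* {const e} (degree (λ z → e≉0 (K.trans (K.sym (coeff-const e)) z)) (Deg<-const e)) (Degree-* (Degree-* dx dx) dx))))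
          (lower xx∣Wr (Deg<-Wr dc dw)) (lower xx∣Wr (Deg<-cong cs≈ (Deg<-Wr dc ds))) (lower xx∣Wr (Deg<-cong ws≈ (Deg<-neg (Deg<-Wr dw ds)))))
        where
        cs≈ : Wr c (c + w) ≈ Wr c w
        cs≈ = trans (+-congʳ (*-congˡ (derivative-+ c w))) (solve 4 (λ c w d v → c :* (d :+ v) :- d :* (c :+ w) := c :* v :- d :* w) c w c′ w′)
        ws≈ : - Wr w (c + w) ≈ Wr c w
        ws≈ = trans (-‿cong (+-congʳ (*-congˡ (derivative-+ c w)))) (solve 4 (λ c w d v → :- (w :* (d :+ v) :- v :* (c :+ w)) := c :* v :- d :* w) c w c′ w′)
        lower : x * x ∣ Wr c w → ∀ {n} → Deg< n (Wr c w) → m ℕ.+ m < n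
        lower (s , f) d with degree? s
        ... | inj₁ z = ⊥-elim (Degree⇒≉0 dW (trans f (trans (*-congˡ z) (zeroʳ _))))
        ... | inj₂ (l , dl) = ≤-<-trans (m≤m+n (m ℕ.+ m) l) (Degree-Deg< (Degree-cong (sym f) (Degree-* (Degree-* dx dx) dl)) d)

      -- From c w′ = c′ w and coprimality c divides c′ and w divides w′, which the degrees exclude
      -- unless both vanish. The differentiated equation then reads e x² x′ = 0, because 3 = 1.
      derivatives≈0 : Wr c w ≈ 0# → ¬ (x ≈ 0#) → c′ ≈ 0# × w′ ≈ 0# × x′ ≈ 0#
      derivatives≈0 z x≉0 = c′≈0 , w′≈0 , x′≈0
        where
        cw′≈c′w : c * w′ ≈ c′ * w
        cw′≈c′w = p-r≈0⇒p≈r z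
        c′≈0 : c′ ≈ 0#
        c′≈0 = ∣derivative⇒≈0 (Coprime-∣ cop (∣-cong (trans cw′≈c′w (*-comm c′ w)) (∣-*ʳ w′ ∣-refl)))
        w′≈0 : w′ ≈ 0#
        w′≈0 = ∣derivative⇒≈0 (Coprime-∣ (Coprime-sym cop) (∣-cong (sym cw′≈c′w) (∣-*ˡ c′ ∣-refl)))
        H′≈0 : H′ ≈ 0#
        H′≈0 = begin
          (c′ * w + c * w′) * (c + w) + c * w * (c′ + w′) ≈⟨ +-cong (*-congʳ (+-cong (*-congʳ c′≈0) (*-congˡ w′≈0))) (*-congˡ (+-cong c′≈0 w′≈0)) ⟩
          (0# * w + c * 0#) * (c + w) + c * w * (0# + 0#) ≈⟨ solve 2 (λ c w → (:0 :* w :+ c :* :0) :* (c :+ w) :+ c :* w :* (:0 :+ :0) := :0) c w ⟩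
          0# ∎
        x′≈0 : x′ ≈ 0#
        x′≈0 = cancelˡ (*≉0 (const≉0 e≉0) (*≉0 x≉0 x≉0)) (begin
          const e * (x * x) * x′ ≈⟨ solve 3 (λ e x d → e :* (x :* x) :* d := e :* ((d :* x :+ x :* d) :* x :+ x :* x :* d) :- (:1 :+ :1) :* (e :* (x :* x) :* d)) (const e) x x′ ⟩
          const e * ((x′ * x + x * x′) * x + x * x * x′) - (1# + 1#) * (const e * (x * x) * x′) ≈⟨ +-cong (trans (sym cube) H′≈0) (-‿cong (twice _)) ⟩
          0# - 0# ≈⟨ trans (-‿inverseʳ 0#) (sym (zeroʳ _)) ⟩
          const e * (x * x) * 0# ∎)

    Coprime-unit : ∀ {w} → Coprime 0# w → Deg< 1 w
    Coprime-unit {w} (u , v , f) with degree? w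
    ... | inj₁ z = ≈0⇒Deg< z
    ... | inj₂ (j , dw) with degree? v
    ...   | inj₁ z = ⊥-elim (1≉0ₚ (trans (sym f) (trans (+-cong (zeroʳ u) (trans (*-congʳ z) (zeroˡ w))) (+-identityˡ 0#))))
    ...   | inj₂ (k , dv) = Deg<-mono (s≤s (≤-trans (m≤n+m j k) (≤-pred (Degree-Deg< (Degree-cong (trans (sym (trans (+-congʳ (zeroʳ u)) (+-identityˡ _))) f) (Degree-* dv dw)) (Deg<-cong const-1 (Deg<-const K.1#)))))) (bound dw)

    Deg<-sqrt : ∀ {n s} → Deg< (suc (suc n)) (s * s) → Deg< (suc n) s
    Deg<-sqrt {n} {s} d with degree? s
    ... | inj₁ z = ≈0⇒Deg< z
    ... | inj₂ (k , dk) = Deg<-mono (half k n (Degree-Deg< (Degree-* dk dk) d)) (bound dk)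
      where
      half : ∀ k n → k ℕ.+ k < suc (suc n) → suc k ≤ suc n
      half zero n _ = s≤s z≤n
      half (suc k) n (s≤s h) = ≤-trans (s≤s (m≤n+m (suc k) k)) h

    -- Descent: since the derivatives vanish, c, w and x are squares, and their roots satisfy the
    -- same equation with the root of e in place of e. Hence e varies in the induction. If c, w or c
    -- + w is zero, coprimality alone makes both constant.
    constants : ∀ n c w x e → ¬ (e K.≈ K.0#) → Coprime c w → c * w * (c + w) ≈ const e * (x * x * x) → Deg< (suc n) c → Deg< (suc n) w → Deg< 1 c × Deg< 1 w
    constants zero c w x e _ _ _ dc dw = dc , dw
    constants (suc n) c w x e e≉0 cop curve dc dw with degree? c | degree? w | degree? (c + w)
    ... | inj₁ z | _ | _ = ≈0⇒Deg< z , Coprime-unit (Coprime-sym (Coprime-cong z (Coprime-sym cop)))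
    ... | inj₂ _ | inj₁ z | _ = Coprime-unit (Coprime-sym (Coprime-cong z cop)) , ≈0⇒Deg< z
    ... | inj₂ _ | inj₂ _ | inj₁ z = Deg<-cong (solve 1 (λ c → :- (:- c) := c) c) (Deg<-neg dneg) , Deg<-cong w≈ dneg
      where
      w≈ : - c ≈ w
      w≈ = trans (solve 2 (λ c w → :- c := w :- (c :+ w)) c w) (trans (+-congˡ (-‿cong z)) (solve 1 (λ w → w :- :0 := w) w))
      dneg : Deg< 1 (- c)
      dneg = Deg<-neg (Coprime-unit (go cop))
        where
        go : Coprime c w → Coprime 0# c
        go (u , v , f) = 0# , u - v , (begin
          0# * 0# + (u - v) * c ≈⟨ solve 3 (λ u v c → :0 :* :0 :+ (u :- v) :* c := u :* c :+ v :* :- c) u v c ⟩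
          u * c + v * - c ≈⟨ trans (+-congˡ (*-congˡ w≈)) f ⟩
          1# ∎)
    ... | inj₂ (i , di) | inj₂ (j , dj) | inj₂ (k , dk) = step (sqrtPoly c (proj₁ zs)) (sqrtPoly w (proj₁ (proj₂ zs))) (sqrtPoly x (proj₂ (proj₂ zs))) (sqrt e)
      where
      x≉0 : ¬ (x ≈ 0#)
      x≉0 z = *≉0 (*≉0 (Degree⇒≉0 di) (Degree⇒≉0 dj)) (Degree⇒≉0 dk) (trans curve (trans (*-congˡ (trans (*-congˡ z) (zeroʳ _))) (zeroʳ _)))
      zs : derivative c ≈ 0# × derivative w ≈ 0# × derivative x ≈ 0#
      zs = Curve.derivatives≈0 c w x e e≉0 cop curve (Curve.Wr≈0 c w x e e≉0 cop curve di dj dk) x≉0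
      step : (∃ λ s → s * s ≈ c) → (∃ λ s → s * s ≈ w) → (∃ λ s → s * s ≈ x) → (∃ λ s → s K.* s K.≈ e) → Deg< 1 c × Deg< 1 w
      step (c₁ , ec) (w₁ , ew) (x₁ , ex) (e₁ , ee) = Deg<-cong ec (sq (proj₁ smaller)) , Deg<-cong ew (sq (proj₂ smaller))
        where
        sq : ∀ {s} → Deg< 1 s → Deg< 1 (s * s)
        sq {s} d = Deg<-* s d d
        e₁≉0 : ¬ (e₁ K.≈ K.0#)
        e₁≉0 z = e≉0 (K.trans (K.sym ee) (K.trans (K.*-congʳ z) (K.zeroˡ _)))
        cop₁ : Coprime c w → Coprime c₁ w₁
        cop₁ (u , v , f) = u * c₁ , v * w₁ , trans (+-cong (trans (*-assoc u c₁ c₁) (*-congˡ ec)) (trans (*-assoc v w₁ w₁) (*-congˡ ew))) f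
        curve₁ : c₁ * w₁ * (c₁ + w₁) ≈ const e₁ * (x₁ * x₁ * x₁)
        curve₁ = square-injective (begin
          c₁ * w₁ * (c₁ + w₁) * (c₁ * w₁ * (c₁ + w₁))
            ≈⟨ solve 2 (λ c w → c :* w :* (c :+ w) :* (c :* w :* (c :+ w)) := (c :* c) :* (w :* w) :* (c :* c :+ w :* w) :+ (:1 :+ :1) :* (c :* c :* c :* (w :* w :* w))) c₁ w₁ ⟩
          (c₁ * c₁) * (w₁ * w₁) * (c₁ * c₁ + w₁ * w₁) + (1# + 1#) * (c₁ * c₁ * c₁ * (w₁ * w₁ * w₁)) ≈⟨ trans (+-congˡ (twice _)) (+-identityʳ _) ⟩
          (c₁ * c₁) * (w₁ * w₁) * (c₁ * c₁ + w₁ * w₁) ≈⟨ *-cong (*-cong ec ew) (+-cong ec ew) ⟩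
          c * w * (c + w) ≈⟨ curve ⟩
          const e * (x * x * x) ≈⟨ *-cong (trans (const-cong (K.sym ee)) (const-*-const e₁ e₁)) (*-cong (*-cong (sym ex) (sym ex)) (sym ex)) ⟩
          const e₁ * const e₁ * (x₁ * x₁ * (x₁ * x₁) * (x₁ * x₁)) ≈⟨ solve 2 (λ e x → e :* e :* (x :* x :* (x :* x) :* (x :* x)) := e :* (x :* x :* x) :* (e :* (x :* x :* x))) (const e₁) x₁ ⟩
          const e₁ * (x₁ * x₁ * x₁) * (const e₁ * (x₁ * x₁ * x₁)) ∎)
        smaller : Deg< 1 c₁ × Deg< 1 w₁
        smaller = constants n c₁ w₁ x₁ e₁ e₁≉0 (cop₁ cop) curve₁ (Deg<-sqrt (Deg<-cong (sym ec) dc)) (Deg<-sqrt (Deg<-cong (sym ew) dw))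

    Deg<-cube : ∀ {x} → Deg< 1 (x * x * x) → Deg< 1 x
    Deg<-cube {x} d with degree? x
    ... | inj₁ z = ≈0⇒Deg< z
    ... | inj₂ (k , dk) = Deg<-mono (s≤s (≤-trans (m≤n+m k (k ℕ.+ k)) (≤-pred (Degree-Deg< (Degree-* (Degree-* dk dk) dk) d)))) (bound dk)

  -- With Y / W = c / w in lowest terms and common factor d, the equation reads c w (c + w) = e (Z /
  -- d)³. The cube of the reduced denominator of Z / d divides e times a cube coprime to it, so this
  -- denominator is a unit and `constants` applies.
  curve-constant : ∀ Y W Z e → ¬ (e K.≈ K.0#) → ¬ (W ≈ 0#) → Y * W * (Y + W) ≈ const e * (Z * Z * Z) → ∃ λ δ → Z ≈ const δ * W
  curve-constant Y W Z e e≉0 W≉0 curve = go (lowest-terms Y W W≉0)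
    where
    go : (∃ λ d → ∃₂ λ c w → Y ≈ d * c × W ≈ d * w × Coprime c w) → ∃ λ δ → Z ≈ const δ * W
    go (d , c , w , eY , eW , cop) = go₂ (lowest-terms Z d d≉0)
      where
      d≉0 : ¬ (d ≈ 0#)
      d≉0 z = W≉0 (trans eW (trans (*-congʳ z) (zeroˡ w)))
      go₂ : (∃ λ g → ∃₂ λ x₁ d₁ → Z ≈ g * x₁ × d ≈ g * d₁ × Coprime x₁ d₁) → ∃ λ δ → Z ≈ const δ * W
      go₂ (g , x₁ , d₁ , eZ , ed , cop₁) = finish (K.invert e e≉0)
        where
        g≉0 : ¬ (g ≈ 0#)
        g≉0 z = d≉0 (trans ed (trans (*-congʳ z) (zeroˡ d₁)))
        ggg≉0 : ¬ (g * g * g ≈ 0#)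
        ggg≉0 = *≉0 (*≉0 g≉0 g≉0) g≉0
        cubes : d₁ * d₁ * d₁ * (c * w * (c + w)) ≈ const e * (x₁ * x₁ * x₁)
        cubes = cancelˡ ggg≉0 (begin
          g * g * g * (d₁ * d₁ * d₁ * (c * w * (c + w))) ≈⟨ solve 4 (λ g d c w → g :* g :* g :* (d :* d :* d :* (c :* w :* (c :+ w))) := (g :* d :* c) :* (g :* d :* w) :* (g :* d :* c :+ g :* d :* w)) g d₁ c w ⟩
          (g * d₁ * c) * (g * d₁ * w) * (g * d₁ * c + g * d₁ * w) ≈⟨ *-cong (*-cong Y≈ W≈) (+-cong Y≈ W≈) ⟨
          Y * W * (Y + W) ≈⟨ curve ⟩
          const e * (Z * Z * Z) ≈⟨ *-congˡ (*-cong (*-cong eZ eZ) eZ) ⟩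
          const e * (g * x₁ * (g * x₁) * (g * x₁)) ≈⟨ solve 3 (λ e g x → e :* (g :* x :* (g :* x) :* (g :* x)) := g :* g :* g :* (e :* (x :* x :* x))) (const e) g x₁ ⟩
          g * g * g * (const e * (x₁ * x₁ * x₁)) ∎)
          where
          Y≈ : Y ≈ g * d₁ * c
          Y≈ = trans eY (*-congʳ ed)
          W≈ : W ≈ g * d₁ * w
          W≈ = trans eW (*-congʳ ed)
        finish : (∃ λ i → e K.* i K.≈ K.1#) → ∃ λ δ → Z ≈ const δ * W
        finish (i , ei) = last unit
          where
          unit : d₁ ∣ 1#
          unit = Coprime-∣ (Coprime-* (Coprime-* (Coprime-sym cop₁) (Coprime-sym cop₁)) (Coprime-sym cop₁))
            (∣-cong (trans (*-congˡ cubes) (trans (solve 3 (λ i e x → i :* (e :* x) := e :* i :* x) (const i) (const e) (x₁ * x₁ * x₁)) (trans (*-congʳ (const-inverse ei)) (trans (*-identityˡ _) (sym (*-identityʳ _))))))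
              (∣-*ˡ (const i) (∣-*ʳ (c * w * (c + w)) (∣-*ʳ d₁ (∣-*ʳ d₁ ∣-refl)))))
          last : d₁ ∣ 1# → ∃ λ δ → Z ≈ const δ * W
          last (j , dj) = result (Kₗ.divide (coeff x 0) (coeff w 0) w₀≉0)
            where
            x : Poly
            x = j * x₁
            curve′ : c * w * (c + w) ≈ const e * (x * x * x)
            curve′ = begin
              c * w * (c + w) ≈⟨ trans (sym (*-identityˡ _)) (*-congʳ (trans (sym (trans (*-identityʳ _) (*-identityʳ 1#))) (*-cong (*-cong dj dj) dj))) ⟩
              d₁ * j * (d₁ * j) * (d₁ * j) * (c * w * (c + w)) ≈⟨ solve 3 (λ d j r → d :* j :* (d :* j) :* (d :* j) :* r := j :* j :* j :* (d :* d :* d :* r)) d₁ j (c * w * (c + w)) ⟩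
              j * j * j * (d₁ * d₁ * d₁ * (c * w * (c + w))) ≈⟨ *-congˡ cubes ⟩
              j * j * j * (const e * (x₁ * x₁ * x₁)) ≈⟨ solve 3 (λ j e x → j :* j :* j :* (e :* (x :* x :* x)) := e :* (j :* x :* (j :* x) :* (j :* x))) j (const e) x₁ ⟩
              const e * (x * x * x) ∎
            cw : Deg< 1 c × Deg< 1 w
            cw = constants (length c ℕ.⊔ length w) c w x e e≉0 cop curve′ (Deg<-mono (≤-trans (ℕₚ.m≤m⊔n _ _) (n≤1+n _)) (Deg<-length c)) (Deg<-mono (≤-trans (ℕₚ.m≤n⊔m (length c) _) (n≤1+n _)) (Deg<-length w))
            w≉0 : ¬ (w ≈ 0#)
            w≉0 z = W≉0 (trans eW (trans (*-congˡ z) (zeroʳ d)))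
            w₀≉0 : ¬ (coeff w 0 K.≈ K.0#)
            w₀≉0 z = w≉0 (trans (Deg<1⇒const (proj₂ cw)) (trans (const-cong z) const-0))
            dx : Deg< 1 x
            dx = Deg<-cube (Deg<-cong (trans (*-congˡ curve′) (trans (solve 3 (λ i e x → i :* (e :* x) := e :* i :* x) (const i) (const e) (x * x * x)) (trans (*-congʳ (const-inverse ei)) (*-identityˡ _))))
              (Deg<-* (const i) (Deg<-const i) (Deg<-* (c * w) (Deg<-* c (proj₁ cw) (proj₂ cw)) (Deg<-+ (proj₁ cw) (proj₂ cw)))))
            Z≈dx : Z ≈ d * x
            Z≈dx = begin
              Z ≈⟨ trans eZ (trans (sym (*-identityʳ _)) (*-congˡ dj)) ⟩
              g * x₁ * (d₁ * j) ≈⟨ solve 4 (λ g x d j → g :* x :* (d :* j) := g :* d :* (j :* x)) g x₁ d₁ j ⟩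
              g * d₁ * (j * x₁) ≈⟨ *-congʳ ed ⟨
              d * x ∎
            result : (∃ λ δ → δ K.* coeff w 0 K.≈ coeff x 0) → ∃ λ δ → Z ≈ const δ * W
            result (δ , f) = δ , (begin
              Z ≈⟨ trans Z≈dx (*-congˡ (trans (Deg<1⇒const dx) (trans (const-cong (K.sym f)) (const-*-const δ (coeff w 0))))) ⟩
              d * (const δ * const (coeff w 0)) ≈⟨ *-congˡ (*-congˡ (Deg<1⇒const (proj₂ cw))) ⟨
              d * (const δ * w) ≈⟨ solve 3 (λ d c w → d :* (c :* w) := c :* (d :* w)) d (const δ) w ⟩
              const δ * (d * w) ≈⟨ *-congˡ eW ⟨
              const δ * W ∎)

-- Artin-Schreier classes and the binary form in characteristic two.

evenBound : ℕ → ℕ → ℕ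
evenBound n p = n ℕ.+ suc p ℕ.+ n ℕ.* n ℕ.+ 2 ℕ.^ n ℕ.* (suc p ℕ.+ n ℕ.* n)

module ArtinSchreier {q} (F : FiniteField q) (2≡0 : FiniteField._+_ F (FiniteField.1# F) (FiniteField.1# F) ≡ FiniteField.0# F) where
  open FiniteFieldPoly F public
  private module S = SolverOver K.commRing
  open S using () renaming (solve to solveᴷ)

  twiceᴷ : ∀ x → (K.1# K.+ K.1#) K.* x ≡ K.0#
  twiceᴷ x = ≡.trans (cong (K._* x) 2≡0) (K.zeroˡ x)

  -≡ : ∀ x → K.- x ≡ x
  -≡ x = ≡.trans (solveᴷ 1 (λ x → :- x := x :- (:1 :+ :1) :* x) x) (≡.trans (cong (λ y → x K.- y) (twiceᴷ x)) (solveᴷ 1 (λ x → x :- :0 := x) x))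

  AS : Fin q → Set
  AS x = ∃ λ r → r K.* r K.+ r ≡ x

  opaque
    AS? : ∀ x → Dec (AS x)
    AS? x = Finₚ.any? (λ r → (r K.* r K.+ r) K.≟ x)

    sqrtᶠ : ∀ x → ∃ λ s → s K.* s ≡ x
    sqrtᶠ x = injective⇒surjective (λ s → s K.* s) inj x
      where
      inj : ∀ s t → s K.* s ≡ t K.* t → s ≡ t
      inj s t e = Kₗ.x-y≈0⇒x≈y ([ (λ z → z) , (λ z → z) ]′ (Kₗ.*≈0 (≡.trans (solveᴷ 2 (λ s t → (s :- t) :* (s :- t) := (s :* s :- t :* t) :+ (:1 :+ :1) :* (t :* t :- s :* t)) s t)
        (≡.trans (cong₂ K._+_ (Kₗ.x≈y⇒x-y≈0 e) (twiceᴷ _)) (K.+-identityˡ _)))))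

    -- The map r ↦ r² + r sends both 0 and 1 to 0; on a finite set a surjection would have to be
    -- injective.
    not-surjective : ∃ λ u → ¬ AS u
    not-surjective = decide (Finₚ.any? (λ u → ¬? (AS? u)))
      where
      decide : Dec (∃ λ u → ¬ AS u) → ∃ λ u → ¬ AS u
      decide (yes found) = found
      decide (no none) = ⊥-elim (K.1≉0 (≡.trans (≡.sym (proj₂ one)) (≡.trans (cong g (≡.trans (code one) (≡.trans (℘1 ≡.refl) (≡.sym (≡.trans (code zero′) (℘0 ≡.refl)))))) (proj₂ zero′))))
        where
        all : ∀ u → AS u
        all u with AS? u
        ... | yes s = s
        ... | no n = ⊥-elim (none (u , n))
        g : Fin q → Fin q
        g u = proj₁ (all u)
        inj : ∀ u v → g u ≡ g v → u ≡ v
        inj u v e = ≡.trans (≡.sym (proj₂ (all u))) (≡.trans (cong (λ r → r K.* r K.+ r) e) (proj₂ (all v)))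
        zero′ : ∃ λ u → g u ≡ K.0#
        zero′ = injective⇒surjective g inj K.0#
        one : ∃ λ u → g u ≡ K.1#
        one = injective⇒surjective g inj K.1#
        code : ∀ {x} (y : ∃ λ u → g u ≡ x) → proj₁ y ≡ x K.* x K.+ x
        code (u , e) = ≡.trans (≡.sym (proj₂ (all u))) (cong (λ r → r K.* r K.+ r) e)
        ℘0 : ∀ {x} → x ≡ K.0# → x K.* x K.+ x ≡ K.0#
        ℘0 ≡.refl = ≡.trans (K.+-identityʳ _) (K.zeroˡ _)
        ℘1 : ∀ {x} → x ≡ K.1# → x K.* x K.+ x ≡ K.0#
        ℘1 ≡.refl = ≡.trans (cong (K._+ K.1#) (K.*-identityˡ _)) 2≡0

  as? : Fin q → Bool
  as? x = does (AS? x)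

  as?-true : ∀ {x} → AS x → as? x ≡ true
  as?-true {x} s with AS? x
  ... | yes _ = ≡.refl
  ... | no n = ⊥-elim (n s)

  as?-false : ∀ {x} → ¬ AS x → as? x ≡ false
  as?-false {x} n with AS? x
  ... | yes s = ⊥-elim (n s)
  ... | no _ = ≡.refl

  true-as : ∀ {x} → as? x ≡ true → AS x
  true-as {x} e with AS? x
  ... | yes s = s

  false-as : ∀ {x} → as? x ≡ false → ¬ AS x
  false-as {x} e with AS? x
  ... | no n = n

  AS-+ : ∀ {x y} → AS x → AS y → AS (x K.+ y)
  AS-+ (r , e) (s , f) = r K.+ s , ≡.trans (solveᴷ 2 (λ r s → (r :+ s) :* (r :+ s) :+ (r :+ s) := ((r :* r :+ r) :+ (s :* s :+ s)) :+ (:1 :+ :1) :* (r :* s)) r s)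
    (≡.trans (cong₂ K._+_ (cong₂ K._+_ e f) (twiceᴷ _)) (K.+-identityʳ _))

  opaque
    AS-index : ∀ {a} → ¬ AS a → ∀ b → AS b ⊎ AS (b K.- a)
    AS-index {a} ¬a b = conclude (TwoToOne.exhaust setoidF (λ x → x K.* x K.+ x) (a K.+_) (λ x → K.- K.1# K.- x) (cong (λ x → K.- K.1# K.- x))
        (λ x → solveᴷ 2 (λ o x → (:- o :- (:- o :- x)) := x) K.1# x) g-inj fibre separate b)
      where
      setoidF : FiniteSetoid
      setoidF = record { Carrier = Fin q ; _~_ = _≡_ ; ~-sym = ≡.sym ; ~-trans = ≡.trans ; size = q ; element = λ x → x ; code = λ x → x
        ; element-code = λ _ → ≡.refl ; element-injective = λ _ _ e → e }
      conclude : (∃ λ x → (b ≡ x K.* x K.+ x) ⊎ (b ≡ a K.+ (x K.* x K.+ x))) → AS b ⊎ AS (b K.- a)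
      conclude (x , inj₁ e) = inj₁ (x , ≡.sym e)
      conclude (x , inj₂ e) = inj₂ (x , ≡.trans (solveᴷ 2 (λ a y → y := (a :+ y) :- a) a (x K.* x K.+ x)) (cong (λ y → y K.- a) (≡.sym e)))
      g-inj : ∀ {x y} → a K.+ x ≡ a K.+ y → x ≡ y
      g-inj {x} {y} e = ≡.trans (solveᴷ 2 (λ a x → x := (a :+ x) :- a) a x) (≡.trans (cong (λ y → y K.- a) e) (solveᴷ 2 (λ a x → (a :+ x) :- a := x) a y))
      either : ∀ {x y} → x K.- y ≡ K.0# ⊎ x K.- (K.- K.1# K.- y) ≡ K.0# → (x ≡ y) ⊎ (x ≡ K.- K.1# K.- y)
      either (inj₁ z) = inj₁ (Kₗ.x-y≈0⇒x≈y z)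
      either (inj₂ z) = inj₂ (Kₗ.x-y≈0⇒x≈y z)
      fibre : ∀ x y → x K.* x K.+ x ≡ y K.* y K.+ y → (x ≡ y) ⊎ (x ≡ K.- K.1# K.- y)
      fibre x y e = either (Kₗ.*≈0 (≡.trans (solveᴷ 2 (λ x y → (x :- y) :* (x :- (:- :1 :- y)) := (x :* x :+ x) :- (y :* y :+ y)) x y) (Kₗ.x≈y⇒x-y≈0 e)))
      separate : ∀ x y → x K.* x K.+ x ≡ a K.+ (y K.* y K.+ y) → x ≡ y
      separate x y e = ⊥-elim (¬a (subst AS (≡.trans (cong (K._+ (y K.* y K.+ y)) e) (≡.trans (solveᴷ 2 (λ a z → (a :+ z) :+ z := a :+ (:1 :+ :1) :* z) a (y K.* y K.+ y)) (≡.trans (cong (a K.+_) (twiceᴷ _)) (K.+-identityʳ a))))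
        (AS-+ (x , ≡.refl) (y , ≡.refl))))

  as?-+ : ∀ x y → as? (x K.+ y) ≡ as? x ⇔ᵇ as? y
  as?-+ x y with AS? x | AS? y
  ... | yes s | yes t = as?-true (AS-+ s t)
  ... | yes s | no n = as?-false λ p → n (subst AS (cancel x y) (AS-+ s p))
    where
    cancel : ∀ x y → x K.+ (x K.+ y) ≡ y
    cancel x y = ≡.trans (solveᴷ 2 (λ x y → x :+ (x :+ y) := y :+ (:1 :+ :1) :* x) x y) (≡.trans (cong (y K.+_) (twiceᴷ x)) (K.+-identityʳ y))
  ... | no n | yes t = as?-false λ p → n (subst AS (cancel x y) (AS-+ p t))
    where
    cancel : ∀ x y → (x K.+ y) K.+ y ≡ x
    cancel x y = ≡.trans (solveᴷ 2 (λ x y → (x :+ y) :+ y := x :+ (:1 :+ :1) :* y) x y) (≡.trans (cong (x K.+_) (twiceᴷ y)) (K.+-identityʳ x))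
  ... | no n | no m = as?-true ([ (λ s → ⊥-elim (m s)) , (λ s → subst AS (≡.trans (cong (y K.+_) (-≡ x)) (K.+-comm y x)) s) ]′ (AS-index n y))

  -- `v₀` lies outside the F₂-span of the list, unfolded into the nonvanishing of `v₀` plus each
  -- subset sum.
  NotInSpan : Fin q → List (Fin q) → Set
  NotInSpan v₀ [] = ¬ (v₀ ≡ K.0#)
  NotInSpan v₀ (v ∷ vs) = NotInSpan v₀ vs × NotInSpan (v₀ K.+ v) vs

  -- Duality for the trace pairing: the class of β v modulo r² + r is additive in β and in v. Of the
  -- multipliers found for v₀ and for v₀ + v on the shorter list, one of them or their sum also
  -- trivializes v while staying nontrivial on v₀.
  separating : ∀ v₀ vs → NotInSpan v₀ vs → ∃ λ β → as? (β K.* v₀) ≡ false × All (λ v → as? (β K.* v) ≡ true) vs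
  separating v₀ [] v₀≢0 = go (Kₗ.divide (proj₁ not-surjective) v₀ v₀≢0)
    where
    go : (∃ λ β → β K.* v₀ ≡ proj₁ not-surjective) → ∃ λ β → as? (β K.* v₀) ≡ false × All (λ v → as? (β K.* v) ≡ true) []
    go (β , e) = β , ≡.trans (cong as? e) (as?-false (proj₂ not-surjective)) , []
  separating v₀ (v ∷ vs) (n₀ , n₁) = go (separating v₀ vs n₀) (separating (v₀ K.+ v) vs n₁)
    where
    Goal : Set
    Goal = ∃ λ β → as? (β K.* v₀) ≡ false × All (λ v → as? (β K.* v) ≡ true) (v ∷ vs)
    go : (∃ λ β → as? (β K.* v₀) ≡ false × All (λ v → as? (β K.* v) ≡ true) vs) → (∃ λ β → as? (β K.* (v₀ K.+ v)) ≡ false × All (λ v → as? (β K.* v) ≡ true) vs) → Goal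
    go (β₀ , z₀ , all₀) (β₁ , z₁ , all₁) = cases (as? (β₀ K.* v)) (as? (β₁ K.* v)) ≡.refl ≡.refl
      where
      sum : as? (β₁ K.* v₀) ⇔ᵇ as? (β₁ K.* v) ≡ false
      sum = ≡.trans (≡.sym (as?-+ (β₁ K.* v₀) (β₁ K.* v))) (≡.trans (cong as? (≡.sym (K.distribˡ β₁ v₀ v))) z₁)
      additive : ∀ x → as? ((β₀ K.+ β₁) K.* x) ≡ as? (β₀ K.* x) ⇔ᵇ as? (β₁ K.* x)
      additive x = ≡.trans (cong as? (K.distribʳ x β₀ β₁)) (as?-+ (β₀ K.* x) (β₁ K.* x))
      iff-true : ∀ b → b ⇔ᵇ true ≡ b
      iff-true true = ≡.refl
      iff-true false = ≡.refl
      iff-false : ∀ b → b ⇔ᵇ false ≡ false → b ≡ true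
      iff-false true _ = ≡.refl
      cases : ∀ s₀ s₁ → as? (β₀ K.* v) ≡ s₀ → as? (β₁ K.* v) ≡ s₁ → Goal
      cases true _ e₀ _ = β₀ , z₀ , e₀ ∷ all₀
      cases false true _ e₁ = β₁ , ≡.trans (≡.sym (iff-true _)) (≡.trans (cong (as? (β₁ K.* v₀) ⇔ᵇ_) (≡.sym e₁)) sum) , e₁ ∷ all₁
      cases false false e₀ e₁ = β₀ K.+ β₁
        , ≡.trans (additive v₀) (cong₂ _⇔ᵇ_ z₀ (iff-false _ (≡.trans (cong (as? (β₁ K.* v₀) ⇔ᵇ_) (≡.sym e₁)) sum)))
        , ≡.trans (additive v) (cong₂ _⇔ᵇ_ e₀ e₁) ∷ All.zipWith (λ {x} (h , k) → ≡.trans (additive x) (cong₂ _⇔ᵇ_ h k)) (all₀ , all₁)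

  OnCurve : Fin q → Fin q → Fin q → Set
  OnCurve e x y = (y K.* y K.+ y K.- x K.* x K.* x) K.* (y K.* y K.+ y K.- e K.* (x K.* x K.* x)) K.* (y K.* y K.+ y K.- (K.1# K.+ e) K.* (x K.* x K.* x)) ≡ K.0#

  -- The classes of x³, e x³ and (1 + e) x³ modulo ℘ add up to zero, so one of them vanishes.
  onCurve : ∀ e x → ∃ (OnCurve e x)
  onCurve e x = cases (AS? x³) (AS? (e K.* x³))
    where
    x³ : Fin q
    x³ = x K.* x K.* x
    zero₁ : ∀ {A B C} → A ≡ K.0# → A K.* B K.* C ≡ K.0#
    zero₁ {B = B} {C} ≡.refl = ≡.trans (cong (K._* C) (K.zeroˡ B)) (K.zeroˡ C)
    zero₂ : ∀ {A B C} → B ≡ K.0# → A K.* B K.* C ≡ K.0#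
    zero₂ {A} {C = C} ≡.refl = ≡.trans (cong (K._* C) (K.zeroʳ A)) (K.zeroˡ C)
    zero₃ : ∀ {A B C} → C ≡ K.0# → A K.* B K.* C ≡ K.0#
    zero₃ ≡.refl = K.zeroʳ _
    third : as? x³ ≡ false → as? (e K.* x³) ≡ false → AS ((K.1# K.+ e) K.* x³)
    third h k = true-as (≡.trans (cong as? (≡.trans (K.distribʳ x³ K.1# e) (cong (K._+ e K.* x³) (K.*-identityˡ x³)))) (≡.trans (as?-+ x³ (e K.* x³)) (cong₂ _⇔ᵇ_ h k)))
    cases : Dec (AS x³) → Dec (AS (e K.* x³)) → ∃ (OnCurve e x)
    cases (yes (r , f)) _ = r , zero₁ (Kₗ.x≈y⇒x-y≈0 f)
    cases (no _) (yes (r , f)) = r , zero₂ (Kₗ.x≈y⇒x-y≈0 f)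
    cases (no n) (no m) = finish (third (as?-false n) (as?-false m))
      where
      finish : AS ((K.1# K.+ e) K.* x³) → ∃ (OnCurve e x)
      finish (r , f) = r , zero₃ (Kₗ.x≈y⇒x-y≈0 f)

record EvenSolution {q} (F : FiniteField q) (P c : List (Fin q)) (u : Fin q) (b : ℕ) : Set where
  open FiniteFieldPoly F
  field
    a β i r : Fin q
    z w : Poly
    inverse : i K.* eval a P ≡ K.1#
    inert : r K.* r K.+ r K.+ u ≡ β K.* (i K.* eval a (derivative P))
    equation : t- a * (z * z + z * w) + const β * (w * w) ≈ t- a * c
    Deg<-z : Deg< b z
    Deg<-w : Deg< b w

module EvenSolvability {q} (F : FiniteField q) (2≡0 : FiniteField._+_ F (FiniteField.1# F) (FiniteField.1# F) ≡ FiniteField.0# F) where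
  open ArtinSchreier F 2≡0
  open FiniteFieldPowers F using (vanishing-everywhere)
  open PerfectCharTwo field′ 2≡0 sqrtᶠ
  open NormForms field′
  open LinearSymbols field′
  open ChineseRemainder F
  private module S = SolverOver K.commRing
  open S using () renaming (solve to solveᴷ)

  -- The product, over all sublists, of the derivative of T times the product of the sublist. At a
  -- point where T and the primes do not vanish, its nonvanishing says that the logarithmic
  -- derivative of T is outside the F₂-span of those of the primes.
  Δ : Poly → List Poly → Poly
  Δ T [] = derivative T
  Δ T (Q ∷ Qs) = Δ T Qs * Δ (T * Q) Qs

  -- Every factor is the derivative of a polynomial that π still divides exactly, because π divides
  -- none of the listed primes.
  Δ≉0 : ∀ {π T u} Qs → Prime π → T ≈ π * u → ¬ (π ∣ u) → ¬ (π ∣ product Qs) → ¬ (Δ T Qs ≈ 0#)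
  Δ≉0 [] pr e n _ = exact⇒derivative≉0 pr e n
  Δ≉0 {π} {T} {u} (Q ∷ Qs) pr e n m = *≉0 (Δ≉0 Qs pr e n (λ d → m (∣-*ˡ Q d)))
    (Δ≉0 Qs pr (trans (*-congʳ e) (*-assoc π u Q)) (Prime-∤* pr n (λ d → m (∣-*ʳ (product Qs) d))) (λ d → m (∣-*ˡ Q d)))

  Deg<-Δ : ∀ {n k T} Qs → Deg< (suc k) T → All (Deg< (suc n)) Qs → Deg< (suc (2 ℕ.^ length Qs ℕ.* (k ℕ.+ length Qs ℕ.* n))) (Δ T Qs)
  Deg<-Δ {n} {k} {T} [] d [] = Deg<-mono (≤-trans (n≤1+n k) (≤-reflexive (cong suc (≡.sym (≡.trans (ℕₚ.+-identityʳ (k ℕ.+ 0)) (ℕₚ.+-identityʳ k)))))) (Deg<-derivative T d)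
  Deg<-Δ {n} {k} {T} (Q ∷ Qs) d (dQ ∷ ds) = Deg<-mono (s≤s (subst (ℕ._≤ 2 ℕ.^ suc l ℕ.* (k ℕ.+ (n ℕ.+ l ℕ.* n))) ≡.refl bnd)) (Deg<-* (Δ T Qs) (Deg<-Δ Qs d ds) (Deg<-Δ Qs (Deg<-* T d dQ) ds))
    where
    l : ℕ
    l = length Qs
    bnd : 2 ℕ.^ l ℕ.* (k ℕ.+ l ℕ.* n) ℕ.+ 2 ℕ.^ l ℕ.* (k ℕ.+ n ℕ.+ l ℕ.* n) ≤ 2 ℕ.* 2 ℕ.^ l ℕ.* (k ℕ.+ (n ℕ.+ l ℕ.* n))
    bnd = ≤-trans (+-mono-≤ (*-monoʳ-≤ (2 ℕ.^ l) (+-monoʳ-≤ k (m≤n+m (l ℕ.* n) n))) (≤-reflexive (cong (2 ℕ.^ l ℕ.*_) (ℕₚ.+-assoc k n (l ℕ.* n)))))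
      (≤-reflexive (N.solve 2 (λ a b → a N.:* b N.:+ a N.:* b N.:= N.con 2 N.:* a N.:* b) ≡.refl (2 ℕ.^ l) (k ℕ.+ (n ℕ.+ l ℕ.* n))))

  ders : List Poly → Poly
  ders [] = 1#
  ders (Q ∷ Qs) = derivative Q * ders Qs

  ders≉0 : ∀ {Qs} → SquareFree Qs → ¬ (ders Qs ≈ 0#)
  ders≉0 [] = 1≉0ₚ
  ders≉0 (cons {Q} pr _ sf) = *≉0 (exact⇒derivative≉0 pr (sym (*-identityʳ Q)) (Prime-∤1 pr)) (ders≉0 sf)

  Deg<-ders : ∀ {n Qs} → All (Deg< (suc n)) Qs → Deg< (suc (length Qs ℕ.* n)) (ders Qs)
  Deg<-ders [] = Deg<-cong const-1 (Deg<-const _)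
  Deg<-ders {n} {Q ∷ Qs} (d ∷ ds) = Deg<-mono (≤-trans (n≤1+n _) ≤-refl) (Deg<-* (derivative Q) (Deg<-derivative Q d) (Deg<-ders ds))

  DLog : Fin q → Poly → Fin q → Set
  DLog a T v = v K.* eval a T ≡ eval a (derivative T)

  DLog-* : ∀ {a T Q v w} → DLog a T v → DLog a Q w → DLog a (T * Q) (v K.+ w)
  DLog-* {a} {T} {Q} {v} {w} e f = ≡.trans (cong ((v K.+ w) K.*_) (eval-* a T Q))
    (≡.trans (solveᴷ 4 (λ v w t s → (v :+ w) :* (t :* s) := v :* t :* s :+ t :* (w :* s)) v w (eval a T) (eval a Q))
    (≡.trans (cong₂ K._+_ (≡.trans (cong (K._* eval a Q) e) (≡.sym (eval-* a (derivative T) Q))) (≡.trans (cong (eval a T K.*_) f) (≡.sym (eval-* a T (derivative Q)))))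
    (≡.trans (≡.sym (eval-+ a (derivative T * Q) (T * derivative Q))) (≡.sym (eval-cong a (derivative-* T Q))))))

  data DLogs (a : Fin q) : List Poly → List (Fin q) → Set where
    [] : DLogs a [] []
    _∷_ : ∀ {Q Qs v vs} → DLog a Q v → DLogs a Qs vs → DLogs a (Q ∷ Qs) (v ∷ vs)

  eval-*≢0 : ∀ a p r → ¬ (eval a (p * r) ≡ K.0#) → ¬ (eval a p ≡ K.0#) × ¬ (eval a r ≡ K.0#)
  eval-*≢0 a p r n = (λ z → n (≡.trans (eval-* a p r) (≡.trans (cong (K._* eval a r) z) (K.zeroˡ _)))) , (λ z → n (≡.trans (eval-* a p r) (≡.trans (cong (eval a p K.*_) z) (K.zeroʳ _))))

  notInSpan : ∀ {a T v Qs vs} → ¬ (eval a (Δ T Qs) ≡ K.0#) → DLog a T v → DLogs a Qs vs → NotInSpan v vs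
  notInSpan {a} {T} n e [] v≡0 = n (≡.trans (≡.sym e) (≡.trans (cong (K._* eval a T) v≡0) (K.zeroˡ _)))
  notInSpan {a} {T} {Qs = Q ∷ Qs} n e (f ∷ fs) = notInSpan (proj₁ (eval-*≢0 a (Δ T Qs) (Δ (T * Q) Qs) n)) e fs , notInSpan (proj₂ (eval-*≢0 a (Δ T Qs) (Δ (T * Q) Qs) n)) (DLog-* e f) fs

  dlog : ∀ a Q → ¬ (eval a Q ≡ K.0#) → ∃ (DLog a Q)
  dlog a Q n = Kₗ.divide (eval a (derivative Q)) (eval a Q) n

  dlogs : ∀ a Qs → ¬ (eval a (product Qs) ≡ K.0#) → ∃ (DLogs a Qs)
  dlogs a [] n = [] , []
  dlogs a (Q ∷ Qs) n with eval-*≢0 a Q (product Qs) n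
  ... | nQ , nQs = proj₁ (dlog a Q nQ) ∷ proj₁ (dlogs a Qs nQs) , proj₂ (dlog a Q nQ) ∷ proj₂ (dlogs a Qs nQs)

  opaque
    non-root : ∀ {p} → ¬ (p ≈ 0#) → Deg< q p → ∃ λ a → ¬ (eval a p ≡ K.0#)
    non-root {p} p≉0 d = decide (Finₚ.any? (λ a → ¬? (eval a p K.≟ K.0#)))
      where
      decide : Dec (∃ λ a → ¬ (eval a p ≡ K.0#)) → ∃ λ a → ¬ (eval a p ≡ K.0#)
      decide (yes found) = found
      decide (no none) = ⊥-elim (p≉0 (vanishing-everywhere d zeros))
        where
        zeros : ∀ x → eval x p ≡ K.0#
        zeros x with eval x p K.≟ K.0#
        ... | yes e = e
        ... | no n = ⊥-elim (none (x , n))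

  opaque
    -- The converse of `artinSchreier-split`, by index two. A γ with nontrivial class of γ v exists
    -- because v is nonzero; by `artinSchreier-split` it gives a nonsplit congruence. If β gave a
    -- nonsplit one too, β - γ would split, although (β - γ) v has nontrivial class.
    split-Q : ∀ {Q a β v} → Prime Q → ¬ (eval a Q ≡ K.0#) → ¬ (eval a (derivative Q) ≡ K.0#) → DLog a Q v → as? (β K.* v) ≡ true →
      ∃ λ θ → Q ∣ θ * θ + t- a * θ + t- a * const β
    split-Q {Q} {a} {β} {v} π Qa≢0 Q′a≢0 e asβ = go (∤⇒Coprime (Prime-t- a) (λ d → Qa≢0 (∣⇒root d)))
      where
      v≢0 : ¬ (v ≡ K.0#)
      v≢0 z = Q′a≢0 (≡.trans (≡.sym e) (≡.trans (cong (K._* eval a Q) z) (K.zeroˡ _)))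
      go : Coprime (t- a) Q → ∃ λ θ → Q ∣ θ * θ + t- a * θ + t- a * const β
      go (i , j , ij) = pick (Kₗ.divide (proj₁ not-surjective) v v≢0)
        where
        open import Relation.Binary.Reasoning.Setoid setoid
        -- Here i is an inverse of t - a mod Q, so θ solves θ² + θ = γ / (t - a), and (t - a) θ
        -- solves the equation without denominator.
        lift : ∀ γ → ASMod Q (const γ * i) → ∃ λ θ → Q ∣ θ * θ + t- a * θ + t- a * const γ
        lift γ (θ , d) = t- a * θ , ∣-cong eq (∣-+ (∣-+ (∣-*ˡ (t- a * t- a) d) (∣-*ʳ (- (t- a * const γ * j)) ∣-refl)) (0# , trans (twice _) (sym (zeroʳ Q))))
          where
          eq : t- a * t- a * (θ * θ + θ - const γ * i) + Q * - (t- a * const γ * j) + (1# + 1#) * (t- a * const γ) ≈ t- a * θ * (t- a * θ) + t- a * (t- a * θ) + t- a * const γ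
          eq = begin
            t- a * t- a * (θ * θ + θ - const γ * i) + Q * - (t- a * const γ * j) + (1# + 1#) * (t- a * const γ)
              ≈⟨ solve 6 (λ t h g i q j → t :* t :* (h :* h :+ h :- g :* i) :+ q :* :- (t :* g :* j) :+ (:1 :+ :1) :* (t :* g) := t :* h :* (t :* h) :+ t :* (t :* h) :+ ((:1 :+ :1) :* (t :* g) :- t :* g :* (i :* t :+ j :* q))) (t- a) θ (const γ) i Q j ⟩
            t- a * θ * (t- a * θ) + t- a * (t- a * θ) + ((1# + 1#) * (t- a * const γ) - t- a * const γ * (i * t- a + j * Q)) ≈⟨ +-congˡ (+-congˡ (-‿cong (*-congˡ ij))) ⟩
            t- a * θ * (t- a * θ) + t- a * (t- a * θ) + ((1# + 1#) * (t- a * const γ) - t- a * const γ * 1#) ≈⟨ +-congˡ (solve 1 (λ g → (:1 :+ :1) :* g :- g :* :1 := g) (t- a * const γ)) ⟩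
            t- a * θ * (t- a * θ) + t- a * (t- a * θ) + t- a * const γ ∎
        split⇒as : ∀ γ → ¬ (γ ≡ K.0#) → ASMod Q (const γ * i) → as? (γ K.* v) ≡ true
        split⇒as γ γ≢0 s = from (lift γ s)
          where
          from : (∃ λ θ → Q ∣ θ * θ + t- a * θ + t- a * const γ) → as? (γ K.* v) ≡ true
          from (θ , d) = value (artinSchreier-split 2≡0 (nonconstant π) a γ γ≢0 Qa≢0 θ (∣-cong (solve 3 (λ h t g → h :* h :+ t :* h :+ t :* g := h :* h :+ t :* (h :+ g)) θ (t- a) (const γ)) d))
            where
            value : (∃ λ r → (r K.* r K.+ r) K.* eval a Q ≡ γ K.* eval a (derivative Q)) → as? (γ K.* v) ≡ true
            value (r , f) = as?-true (r , Kₗ.cancelˡ Qa≢0 (≡.trans (K.*-comm (eval a Q) _) (≡.trans f (≡.trans (cong (γ K.*_) (≡.sym e)) (solveᴷ 3 (λ g v q → g :* (v :* q) := q :* (g :* v)) γ v (eval a Q))))))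
        pick : (∃ λ γ → γ K.* v ≡ proj₁ not-surjective) → ∃ λ θ → Q ∣ θ * θ + t- a * θ + t- a * const β
        pick (γ , f) = lift β ([ (λ s → s) , (λ s → ⊥-elim (contra s)) ]′ (artinSchreier-index π 2≡0 ¬split (const β * i)))
          where
          γ-false : as? (γ K.* v) ≡ false
          γ-false = ≡.trans (cong as? f) (as?-false (proj₂ not-surjective))
          true≢false : ∀ {b} → b ≡ true → b ≡ false → ⊥
          true≢false ≡.refl ()
          γ≢0 : ¬ (γ ≡ K.0#)
          γ≢0 z = true≢false (as?-true (K.0# , ≡.trans (K.+-identityʳ _) (≡.trans (K.zeroˡ _) (≡.sym (≡.trans (cong (K._* v) z) (K.zeroˡ v)))))) γ-false
          ¬split : ¬ ASMod Q (const γ * i)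
          ¬split s = true≢false (split⇒as γ γ≢0 s) γ-false
          δ : Fin q
          δ = β K.- γ
          δ-false : as? (δ K.* v) ≡ false
          δ-false = ≡.trans (cong as? (≡.trans (cong (λ x → (β K.+ x) K.* v) (-≡ γ)) (K.distribʳ v β γ))) (≡.trans (as?-+ (β K.* v) (γ K.* v)) (cong₂ _⇔ᵇ_ asβ γ-false))
          δ≢0 : ¬ (δ ≡ K.0#)
          δ≢0 z = true≢false (as?-true (K.0# , ≡.trans (K.+-identityʳ _) (≡.trans (K.zeroˡ _) (≡.sym (≡.trans (cong (K._* v) z) (K.zeroˡ v)))))) δ-false
          contra : ASMod Q (const β * i - const γ * i) → ⊥
          contra (θ , d) = true≢false (split⇒as δ δ≢0 (θ , ∣-cong (+-congˡ (-‿cong (trans (solve 3 (λ b g i → b :* i :- g :* i := (b :- g) :* i) (const β) (const γ) i) (*-congʳ (trans (+-congˡ (sym (RingHomNeg γ))) (sym (const-+ β (K.- γ)))))))) d)) δ-false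
            where
            RingHomNeg : ∀ x → const (K.- x) ≈ - const x
            RingHomNeg x = RingHom.to-neg constHom x

  module _ (u : Fin q) (u-ns : ¬ AS u) {P p} (dP : Degree P (suc p)) (P-prime : Prime P) {c n} (dc : Degree c n) (P∤c : ¬ (P ∣ c)) (large : evenBound n p < q) where
    private
      opaque
        f : Factorization c n
        f = factorize (suc n) ≤-refl dc
      module f = Factorization f
      Qs : List Poly
      Qs = f.primes
      ρ Π : Poly
      ρ = f.root
      Π = product Qs

      Π∣c : Π ∣ c
      Π∣c = ∣-cong (sym f.factored) (∣-*ˡ (const f.unit) (∣-*ˡ (ρ * ρ) ∣-refl))

      P∤Π : ¬ (P ∣ Π)
      P∤Π d = P∤c (∣-trans d Π∣c)

      c≉0 : ¬ (c ≈ 0#)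
      c≉0 = Degree⇒≉0 dc

      Deg<-∣c : ∀ {Q} → Q ∣ c → Deg< (suc n) Q
      Deg<-∣c {Q} (r , e) with degree? Q | degree? r
      ... | inj₁ z | _ = ≈0⇒Deg< z
      ... | inj₂ _ | inj₁ z = ⊥-elim (c≉0 (trans e (trans (*-congˡ z) (zeroʳ Q))))
      ... | inj₂ (i , di) | inj₂ (j , dj) = Deg<-mono (s≤s (subst (i ≤_) (Degree-unique (Degree-cong (sym e) (Degree-* di dj)) dc) (m≤m+n i j))) (bound di)

      degrees : ∀ Rs → product Rs ∣ c → All (Deg< (suc n)) Rs
      degrees [] _ = []
      degrees (Q ∷ Rs) d = Deg<-∣c (∣-trans (∣-*ʳ (product Rs) ∣-refl) d) ∷ degrees Rs (∣-trans (∣-*ˡ Q ∣-refl) d)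

      product≉0 : ∀ {Rs} → SquareFree Rs → ¬ (product Rs ≈ 0#)
      product≉0 [] = 1≉0ₚ
      product≉0 (cons pr _ sf) = *≉0 (Prime-≉0 pr) (product≉0 sf)

      -- At a nonroot a, the factors Π and P make the logarithmic derivatives defined, `ders` makes
      -- those of the primes of Π nonzero, and `Δ` keeps that of P independent of them, so that a
      -- single β can keep P inert while all primes of Π split.
      Bad : Poly
      Bad = Π * P * ders Qs * Δ P Qs

      Bad≉0 : ¬ (Bad ≈ 0#)
      Bad≉0 = *≉0 (*≉0 (*≉0 (product≉0 f.squareFree) (Prime-≉0 P-prime)) (ders≉0 f.squareFree)) (Δ≉0 Qs P-prime (sym (*-identityʳ P)) (Prime-∤1 P-prime) P∤Π)

      -- The four factors account for the four summands of `evenBound`: there are at most n primes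
      -- of degree at most n, and `Δ` runs over at most 2^n sublists.
      Deg<-Bad : Deg< q Bad
      Deg<-Bad = Deg<-mono large (Deg<-* (Π * P * ders Qs) (Deg<-* (Π * P) (Deg<-* Π (Deg<-∣c Π∣c) (bound dP))
          (Deg<-mono (s≤s (*-monoˡ-≤ n f.length≤)) (Deg<-ders (degrees Qs Π∣c))))
        (Deg<-mono (s≤s (ℕₚ.*-mono-≤ (ℕₚ.^-monoʳ-≤ 2 f.length≤) (+-monoʳ-≤ (suc p) (*-monoˡ-≤ n f.length≤)))) (Deg<-Δ Qs (bound dP) (degrees Qs Π∣c))))

      opaque
        point : ∃ λ a → ¬ (eval a Bad ≡ K.0#)
        point = non-root Bad≉0 Deg<-Bad

      a : Fin q
      a = proj₁ point

      nonzeros : ¬ (eval a (Π * P * ders Qs) ≡ K.0#) × ¬ (eval a (Δ P Qs) ≡ K.0#)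
      nonzeros = eval-*≢0 a (Π * P * ders Qs) (Δ P Qs) (proj₂ point)

      nonzeros′ : ¬ (eval a (Π * P) ≡ K.0#) × ¬ (eval a (ders Qs) ≡ K.0#)
      nonzeros′ = eval-*≢0 a (Π * P) (ders Qs) (proj₁ nonzeros)

      Πa≢0 : ¬ (eval a Π ≡ K.0#)
      Πa≢0 = proj₁ (eval-*≢0 a Π P (proj₁ nonzeros′))

      Pa≢0 : ¬ (eval a P ≡ K.0#)
      Pa≢0 = proj₂ (eval-*≢0 a Π P (proj₁ nonzeros′))

      opaque
        vP : ∃ (DLog a P)
        vP = dlog a P Pa≢0

        vQs : ∃ (DLogs a Qs)
        vQs = dlogs a Qs Πa≢0

        chosen : ∃ λ β → as? (β K.* proj₁ vP) ≡ false × All (λ v → as? (β K.* v) ≡ true) (proj₁ vQs)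
        chosen = separating (proj₁ vP) (proj₁ vQs) (notInSpan (proj₂ nonzeros) (proj₂ vP) (proj₂ vQs))

      β : Fin q
      β = proj₁ chosen

      β≢0 : ¬ (β ≡ K.0#)
      β≢0 z = false-as (proj₁ (proj₂ chosen)) (K.0# , ≡.trans (K.+-identityʳ _) (≡.trans (K.zeroˡ _) (≡.sym (≡.trans (cong (K._* proj₁ vP) z) (K.zeroˡ _)))))

      splits : ∀ {Rs vs} → SquareFree Rs → ¬ (eval a (product Rs) ≡ K.0#) → ¬ (eval a (ders Rs) ≡ K.0#) → DLogs a Rs vs → All (λ v → as? (β K.* v) ≡ true) vs →
        All (λ Q → ∃ λ θ → Q ∣ θ * θ + t- a * θ + t- a * const β) Rs
      splits [] _ _ [] [] = []
      splits {Q ∷ Rs} (cons pr _ sf) nz nd (e ∷ es) (h ∷ hs) = split-Q pr (proj₁ (eval-*≢0 a Q (product Rs) nz)) (proj₁ (eval-*≢0 a (derivative Q) (ders Rs) nd)) e h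
        ∷ splits sf (proj₂ (eval-*≢0 a Q (product Rs) nz)) (proj₂ (eval-*≢0 a (derivative Q) (ders Rs) nd)) es hs

      opaque
        root : ∃ λ θ → Π ∣ θ * θ + t- a * θ + t- a * const β
        root = quadratic-crt (t- a) (t- a * const β) f.squareFree (splits f.squareFree Πa≢0 (proj₂ nonzeros′) (proj₂ vQs) (proj₂ (proj₂ chosen)))

        dΠ : ∃ (Degree Π)
        dΠ = ≉0⇒Degree (product≉0 f.squareFree)

        NΠ : Norm₁ a K.1# β Π (proj₁ dΠ)
        NΠ = norm₁ (proj₂ dΠ) a K.1# β β≢0 (proj₁ root) (∣-cong (trans (solve 3 (λ h t g → h :* h :+ t :* h :+ t :* g := h :* h :+ t :* (:1 :* h :+ g)) (proj₁ root) (t- a) (const β)) (+-congˡ (*-congˡ (+-congʳ (*-congʳ (sym const-1)))))) (proj₂ root))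
      module NΠ = Norm₁ NΠ

      m≤n : proj₁ dΠ ≤ n
      m≤n = ≤-pred (Degree-Deg< (proj₂ dΠ) f.Deg<-product)

      opaque
        μ′ : ∃ λ μ → μ K.* μ K.* NΠ.κ ≡ f.unit
        μ′ = go (Kₗ.divide f.unit NΠ.κ NΠ.κ≉0)
          where
          go : (∃ λ x → x K.* NΠ.κ ≡ f.unit) → ∃ λ μ → μ K.* μ K.* NΠ.κ ≡ f.unit
          go (x , e) = proj₁ (sqrtᶠ x) , ≡.trans (cong (K._* NΠ.κ) (proj₂ (sqrtᶠ x))) e

        i′ : ∃ λ i → i K.* eval a P ≡ K.1#
        i′ = Kₗ.divide K.1# (eval a P) Pa≢0

        vP≡ : proj₁ vP ≡ proj₁ i′ K.* eval a (derivative P)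
        vP≡ = ≡.trans (≡.sym (K.*-identityʳ _)) (≡.trans (cong (proj₁ vP K.*_) (≡.sym (proj₂ i′)))
          (≡.trans (solveᴷ 3 (λ v i x → v :* (i :* x) := i :* (v :* x)) (proj₁ vP) (proj₁ i′) (eval a P)) (cong (proj₁ i′ K.*_) (proj₂ vP))))

        -- The image of r² + r has index two, so the nontrivial class of β P′(a) / P(a) is the class
        -- of the fixed u.
        inert′ : ∃ λ r → r K.* r K.+ r K.+ u ≡ β K.* proj₁ vP
        inert′ = [ (λ s → ⊥-elim (false-as (proj₁ (proj₂ chosen)) s)) , shift ]′ (AS-index u-ns (β K.* proj₁ vP))
          where
          shift : AS (β K.* proj₁ vP K.- u) → ∃ λ r → r K.* r K.+ r K.+ u ≡ β K.* proj₁ vP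
          shift (r , e) = r , ≡.trans (cong (K._+ u) e) (solveᴷ 2 (λ x u → (x :- u) :+ u := x) (β K.* proj₁ vP) u)

      μ : Fin q
      μ = proj₁ μ′

      μρ z w : Poly
      μρ = const μ * ρ
      z = μρ * NΠ.y
      -- The extra factor t - a matches the two normalizations: (t - a)(z² + z w) + β w² with w = (t
      -- - a) w₁ is t - a times z² + (t - a)(z w₁ + β w₁²).
      w = μρ * NΠ.w * t- a

      dμρ : Deg< (suc n) μρ
      dμρ = Deg<-* (const μ) (Deg<-const μ) f.Deg<-root

    evenSolution : EvenSolution F P c u (suc n ℕ.+ n ℕ.+ 1)
    evenSolution = record
      { a = a ; β = β ; i = proj₁ i′ ; r = proj₁ inert′ ; z = z ; w = w
      ; inverse = proj₂ i′ ; inert = ≡.trans (proj₂ inert′) (cong (β K.*_) vP≡) ; equation = equation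
      ; Deg<-z = Deg<-mono (m≤m+n _ 1) (Deg<-* μρ dμρ (Deg<-mono (s≤s (≤-trans (ℕₚ.⌊n/2⌋≤n _) m≤n)) NΠ.Deg<-y))
      ; Deg<-w = Deg<-* (μρ * NΠ.w) (Deg<-* μρ dμρ (Deg<-mono (≤-trans (ℕₚ.⌈n/2⌉≤n _) (≤-trans m≤n (n≤1+n n))) NΠ.Deg<-w)) (bound (Degree-t- a)) }
      where
      open import Relation.Binary.Reasoning.Setoid setoid
      equation : t- a * (z * z + z * w) + const β * (w * w) ≈ t- a * c
      equation = begin
        t- a * (z * z + z * w) + const β * (w * w)
          ≈⟨ solve 5 (λ t m y w b → t :* (m :* y :* (m :* y) :+ m :* y :* (m :* w :* t)) :+ b :* (m :* w :* t :* (m :* w :* t)) := t :* (m :* m :* (y :* y :+ t :* (:1 :* (w :* y) :+ b :* (w :* w))))) (t- a) μρ NΠ.y NΠ.w (const β) ⟩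
        t- a * (μρ * μρ * (NΠ.y * NΠ.y + t- a * (1# * (NΠ.w * NΠ.y) + const β * (NΠ.w * NΠ.w)))) ≈⟨ *-congˡ (*-congˡ (trans (+-congˡ (*-congˡ (+-congʳ (*-congʳ (sym const-1))))) NΠ.norm)) ⟩
        t- a * (μρ * μρ * (const NΠ.κ * Π)) ≈⟨ *-congˡ (solve 4 (λ m r k p → m :* r :* (m :* r) :* (k :* p) := m :* m :* k :* (r :* r :* p)) (const μ) ρ (const NΠ.κ) Π) ⟩
        t- a * (const μ * const μ * const NΠ.κ * (ρ * ρ * Π)) ≈⟨ *-congˡ (*-congʳ (trans (*-congʳ (sym (const-*-const μ μ))) (trans (sym (const-*-const (μ K.* μ) NΠ.κ)) (const-cong (proj₂ μ′))))) ⟩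
        t- a * (const f.unit * (ρ * ρ * Π)) ≈⟨ *-congˡ f.factored ⟨
        t- a * c ∎

-- The field of fractions.

module Fractions (F : DecField) where
  open FieldPoly F
  open import Relation.Binary.Reasoning.Setoid setoid

  -- The proof is irrelevant so that fractions with the same numerator and denominator are equal.
  record Frac : Set where
    constructor frac
    field
      num den : Poly
      .nonzero : ¬ (den ≈ 0#)
  open Frac public using (num; den)

  den≉0 : ∀ x → ¬ (den x ≈ 0#)
  den≉0 (frac _ _ n) e = ⊥-elim-irr (n e)

  infix 4 _≈ᶠ_
  record _≈ᶠ_ (x y : Frac) : Set where
    constructor cross
    field crossed : num x * den y ≈ num y * den x
  open _≈ᶠ_ public

  opaque
    _+ᶠ_ _*ᶠ_ : Frac → Frac → Frac
    x +ᶠ y = frac (num x * den y + num y * den x) (den x * den y) (*≉0 (den≉0 x) (den≉0 y))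
    x *ᶠ y = frac (num x * num y) (den x * den y) (*≉0 (den≉0 x) (den≉0 y))

    -ᶠ_ : Frac → Frac
    -ᶠ x = frac (- num x) (den x) (den≉0 x)

    num-+ : ∀ x y → num (x +ᶠ y) ≡ num x * den y + num y * den x
    num-+ x y = ≡.refl

    den-+ : ∀ x y → den (x +ᶠ y) ≡ den x * den y
    den-+ x y = ≡.refl

    num-* : ∀ x y → num (x *ᶠ y) ≡ num x * num y
    num-* x y = ≡.refl

    den-* : ∀ x y → den (x *ᶠ y) ≡ den x * den y
    den-* x y = ≡.refl

    num-neg : ∀ x → num (-ᶠ x) ≡ - num x
    num-neg x = ≡.refl

    den-neg : ∀ x → den (-ᶠ x) ≡ den x
    den-neg x = ≡.refl

  ⌜_⌝ : Poly → Frac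
  ⌜ p ⌝ = frac p 1# 1≉0ₚ

  private
    opaque
      unfolding _+ᶠ_

      trans′ : ∀ {x y z} → x ≈ᶠ y → y ≈ᶠ z → x ≈ᶠ z
      trans′ {frac a b _} {y@(frac c d _)} {frac e f _} (cross p) (cross r) = cross (cancelˡ (den≉0 y) (begin
        d * (a * f) ≈⟨ solve 3 (λ d a f → d :* (a :* f) := a :* d :* f) d a f ⟩
        a * d * f ≈⟨ *-congʳ p ⟩
        c * b * f ≈⟨ solve 3 (λ c b f → c :* b :* f := c :* f :* b) c b f ⟩
        c * f * b ≈⟨ *-congʳ r ⟩
        e * d * b ≈⟨ solve 3 (λ e d b → e :* d :* b := d :* (e :* b)) e d b ⟩
        d * (e * b) ∎))

      +-cong′ : ∀ {x y u v} → x ≈ᶠ y → u ≈ᶠ v → x +ᶠ u ≈ᶠ y +ᶠ v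
      +-cong′ {frac a b _} {frac a′ b′ _} {frac c d _} {frac c′ d′ _} (cross p) (cross r) = cross (begin
        (a * d + c * b) * (b′ * d′) ≈⟨ solve 6 (λ a b c d b′ d′ → (a :* d :+ c :* b) :* (b′ :* d′) := a :* b′ :* (d :* d′) :+ c :* d′ :* (b :* b′)) a b c d b′ d′ ⟩
        a * b′ * (d * d′) + c * d′ * (b * b′) ≈⟨ +-cong (*-congʳ p) (*-congʳ r) ⟩
        a′ * b * (d * d′) + c′ * d * (b * b′) ≈⟨ solve 6 (λ a′ b c′ d b′ d′ → a′ :* b :* (d :* d′) :+ c′ :* d :* (b :* b′) := (a′ :* d′ :+ c′ :* b′) :* (b :* d)) a′ b c′ d b′ d′ ⟩
        (a′ * d′ + c′ * b′) * (b * d) ∎)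

      *-cong′ : ∀ {x y u v} → x ≈ᶠ y → u ≈ᶠ v → x *ᶠ u ≈ᶠ y *ᶠ v
      *-cong′ {frac a b _} {frac a′ b′ _} {frac c d _} {frac c′ d′ _} (cross p) (cross r) = cross (begin
        a * c * (b′ * d′) ≈⟨ solve 4 (λ a c b′ d′ → a :* c :* (b′ :* d′) := a :* b′ :* (c :* d′)) a c b′ d′ ⟩
        a * b′ * (c * d′) ≈⟨ *-cong p r ⟩
        a′ * b * (c′ * d) ≈⟨ solve 4 (λ a′ b c′ d → a′ :* b :* (c′ :* d) := a′ :* c′ :* (b :* d)) a′ b c′ d ⟩
        a′ * c′ * (b * d) ∎)

      neg-cong′ : ∀ {x y} → x ≈ᶠ y → -ᶠ x ≈ᶠ -ᶠ y
      neg-cong′ {frac a b _} {frac a′ b′ _} (cross p) = cross (begin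
        - a * b′ ≈⟨ solve 2 (λ a b → :- a :* b := :- (a :* b)) a b′ ⟩
        - (a * b′) ≈⟨ -‿cong p ⟩
        - (a′ * b) ≈⟨ solve 2 (λ a b → :- (a :* b) := :- a :* b) a′ b ⟩
        - a′ * b ∎)

      +-assoc′ : ∀ x y z → (x +ᶠ y) +ᶠ z ≈ᶠ x +ᶠ (y +ᶠ z)
      +-assoc′ (frac a b _) (frac c d _) (frac e f _) = cross (solve 6 (λ a b c d e f → ((a :* d :+ c :* b) :* f :+ e :* (b :* d)) :* (b :* (d :* f)) := (a :* (d :* f) :+ (c :* f :+ e :* d) :* b) :* (b :* d :* f)) a b c d e f)

      +-identityˡ′ : ∀ x → ⌜ 0# ⌝ +ᶠ x ≈ᶠ x
      +-identityˡ′ (frac a b _) = cross (solve 2 (λ a b → (:0 :* b :+ a :* :1) :* b := a :* (:1 :* b)) a b)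

      +-identityʳ′ : ∀ x → x +ᶠ ⌜ 0# ⌝ ≈ᶠ x
      +-identityʳ′ (frac a b _) = cross (solve 2 (λ a b → (a :* :1 :+ :0 :* b) :* b := a :* (b :* :1)) a b)

      inverseˡ′ : ∀ x → (-ᶠ x) +ᶠ x ≈ᶠ ⌜ 0# ⌝
      inverseˡ′ (frac a b _) = cross (solve 2 (λ a b → (:- a :* b :+ a :* b) :* :1 := :0 :* (b :* b)) a b)

      inverseʳ′ : ∀ x → x +ᶠ (-ᶠ x) ≈ᶠ ⌜ 0# ⌝
      inverseʳ′ (frac a b _) = cross (solve 2 (λ a b → (a :* b :+ :- a :* b) :* :1 := :0 :* (b :* b)) a b)

      +-comm′ : ∀ x y → x +ᶠ y ≈ᶠ y +ᶠ x
      +-comm′ (frac a b _) (frac c d _) = cross (solve 4 (λ a b c d → (a :* d :+ c :* b) :* (d :* b) := (c :* b :+ a :* d) :* (b :* d)) a b c d)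

      *-assoc′ : ∀ x y z → (x *ᶠ y) *ᶠ z ≈ᶠ x *ᶠ (y *ᶠ z)
      *-assoc′ (frac a b _) (frac c d _) (frac e f _) = cross (solve 6 (λ a b c d e f → a :* c :* e :* (b :* (d :* f)) := a :* (c :* e) :* (b :* d :* f)) a b c d e f)

      *-identityˡ′ : ∀ x → ⌜ 1# ⌝ *ᶠ x ≈ᶠ x
      *-identityˡ′ (frac a b _) = cross (solve 2 (λ a b → :1 :* a :* b := a :* (:1 :* b)) a b)

      *-identityʳ′ : ∀ x → x *ᶠ ⌜ 1# ⌝ ≈ᶠ x
      *-identityʳ′ (frac a b _) = cross (solve 2 (λ a b → a :* :1 :* b := a :* (b :* :1)) a b)

      distribˡ′ : ∀ x y z → x *ᶠ (y +ᶠ z) ≈ᶠ (x *ᶠ y) +ᶠ (x *ᶠ z)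
      distribˡ′ (frac a b _) (frac c d _) (frac e f _) = cross (solve 6 (λ a b c d e f → a :* (c :* f :+ e :* d) :* (b :* d :* (b :* f)) := (a :* c :* (b :* f) :+ a :* e :* (b :* d)) :* (b :* (d :* f))) a b c d e f)

      distribʳ′ : ∀ x y z → (y +ᶠ z) *ᶠ x ≈ᶠ (y *ᶠ x) +ᶠ (z *ᶠ x)
      distribʳ′ (frac a b _) (frac c d _) (frac e f _) = cross (solve 6 (λ a b c d e f → (c :* f :+ e :* d) :* a :* (d :* b :* (f :* b)) := (c :* a :* (f :* b) :+ e :* a :* (d :* b)) :* (d :* f :* b)) a b c d e f)

      *-comm′ : ∀ x y → x *ᶠ y ≈ᶠ y *ᶠ x
      *-comm′ (frac a b _) (frac c d _) = cross (solve 4 (λ a b c d → a :* c :* (d :* b) := c :* a :* (b :* d)) a b c d)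

  fracRing : CommutativeRing 0ℓ 0ℓ
  fracRing = record
    { Carrier = Frac ; _≈_ = _≈ᶠ_ ; _+_ = _+ᶠ_ ; _*_ = _*ᶠ_ ; -_ = -ᶠ_ ; 0# = ⌜ 0# ⌝ ; 1# = ⌜ 1# ⌝
    ; isCommutativeRing = record
      { isRing = record
        { +-isAbelianGroup = record
          { isGroup = record
            { isMonoid = record
              { isSemigroup = record
                { isMagma = record
                  { isEquivalence = record { refl = cross refl ; sym = λ (cross p) → cross (sym p) ; trans = trans′ }
                  ; ∙-cong = +-cong′ }
                ; assoc = +-assoc′ }
              ; identity = +-identityˡ′ , +-identityʳ′ }
            ; inverse = inverseˡ′ , inverseʳ′
            ; ⁻¹-cong = neg-cong′ }
          ; comm = +-comm′ }
        ; *-cong = *-cong′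
        ; *-assoc = *-assoc′
        ; *-identity = *-identityˡ′ , *-identityʳ′
        ; distrib = distribˡ′ , distribʳ′ }
      ; *-comm = *-comm′ } }

  ⌜⌝≈0 : ∀ {x} → x ≈ᶠ ⌜ 0# ⌝ → num x ≈ 0#
  ⌜⌝≈0 {x} (cross e) = trans (sym (*-identityʳ _)) (trans e (zeroˡ _))

  ≈0⇒≈ᶠ0 : ∀ {x} → num x ≈ 0# → x ≈ᶠ ⌜ 0# ⌝
  ≈0⇒≈ᶠ0 {x} e = cross (trans (*-identityʳ _) (trans e (sym (zeroˡ _))))

  ⌜⌝-injective : ∀ {p r} → ⌜ p ⌝ ≈ᶠ ⌜ r ⌝ → p ≈ r
  ⌜⌝-injective (cross e) = trans (sym (*-identityʳ _)) (trans e (*-identityʳ _))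

  opaque
    unfolding _+ᶠ_

    invertᶠ : ∀ x → ¬ (x ≈ᶠ ⌜ 0# ⌝) → ∃ λ y → x *ᶠ y ≈ᶠ ⌜ 1# ⌝
    invertᶠ x x≉0 = frac (den x) (num x) (λ e → x≉0 (≈0⇒≈ᶠ0 e)) , cross (solve 2 (λ a b → a :* b :* :1 := :1 :* (b :* a)) (num x) (den x))

    ⌜⌝-+ : ∀ p r → ⌜ p + r ⌝ ≈ᶠ ⌜ p ⌝ +ᶠ ⌜ r ⌝
    ⌜⌝-+ p r = cross (solve 2 (λ p r → (p :+ r) :* (:1 :* :1) := (p :* :1 :+ r :* :1) :* :1) p r)

    ⌜⌝-* : ∀ p r → ⌜ p * r ⌝ ≈ᶠ ⌜ p ⌝ *ᶠ ⌜ r ⌝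
    ⌜⌝-* p r = cross (solve 2 (λ p r → p :* r :* (:1 :* :1) := p :* r :* :1) p r)

    *⌜⌝-cross : ∀ x f g → num x * g ≈ f * den x → x *ᶠ ⌜ g ⌝ ≈ᶠ ⌜ f ⌝
    *⌜⌝-cross x f g e = cross (trans (*-identityʳ _) (trans e (*-congˡ (sym (*-identityʳ _)))))

    *⌜⌝-crossed : ∀ x f g → x *ᶠ ⌜ g ⌝ ≈ᶠ ⌜ f ⌝ → num x * g ≈ f * den x
    *⌜⌝-crossed x f g (cross e) = trans (sym (*-identityʳ _)) (trans e (*-congˡ (*-identityʳ _)))

  fracField : DecField
  fracField = record
    { commRing = fracRing
    ; _≟_ = decide
    ; 1≉0 = λ e → 1≉0ₚ (⌜⌝≈0 e)
    ; invert = invertᶠ }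
    where
    decide : ∀ x y → Dec (x ≈ᶠ y)
    decide x y with (num x * den y) ≟ₚ (num y * den x)
    ... | yes e = yes (cross e)
    ... | no n = no λ (cross e) → n e

  embed : RingHom polyRing fracRing
  embed = record
    { to = ⌜_⌝ ; to-cong = λ e → cross (*-congʳ e)
    ; to-+ = ⌜⌝-+ ; to-* = ⌜⌝-*
    ; to-1 = cross refl }

  clear : ∀ x → x *ᶠ ⌜ den x ⌝ ≈ᶠ ⌜ num x ⌝
  clear x = *⌜⌝-cross x (num x) (den x) refl

  constᶠ : RingHom K.commRing fracRing
  constᶠ = compHom constHom embed

-- Descent at an inert prime.

module InertDescent (F : DecField) where
  open FieldPoly F
  open import Relation.Binary.Reasoning.Setoid setoid

  module OddInert {P} (π : Prime P) (ϖ : Poly) (inert : ∀ θ → ¬ (P ∣ θ * θ + ϖ)) where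

    -- If y were invertible mod P with inverse v, then v x would be a square root of -ϖ.
    inert-∣ : ∀ x y → P ∣ x * x + ϖ * (y * y) → P ∣ x × P ∣ y
    inert-∣ x y d with dichotomy π y
    ... | inj₁ P∣y = Prime-∣² π (∣-cong (solve 3 (λ x t y → x :* x :+ t :* (y :* y) :- t :* y :* y := x :* x) x ϖ y) (∣-+ d (∣-neg (∣-*ˡ (ϖ * y) P∣y)))) , P∣y
    ... | inj₂ (u , v , e) = ⊥-elim (inert (v * x) (∣-cong (begin
      v * v * (x * x + ϖ * (y * y)) + P * (ϖ * (u * (1# + v * y)))
        ≈⟨ solve 6 (λ v x t y p u → v :* v :* (x :* x :+ t :* (y :* y)) :+ p :* (t :* (u :* (:1 :+ v :* y))) := v :* x :* (v :* x) :+ t :* ((u :* p :+ v :* y) :* (:1 :+ v :* y) :- v :* y)) v x ϖ y P u ⟩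
      v * x * (v * x) + ϖ * ((u * P + v * y) * (1# + v * y) - v * y) ≈⟨ +-congˡ (*-congˡ (+-congʳ (*-congʳ e))) ⟩
      v * x * (v * x) + ϖ * (1# * (1# + v * y) - v * y) ≈⟨ solve 4 (λ v x t y → v :* x :* (v :* x) :+ t :* (:1 :* (:1 :+ v :* y) :- v :* y) := v :* x :* (v :* x) :+ t) v x ϖ y ⟩
      v * x * (v * x) + ϖ ∎) (∣-+ (∣-*ˡ (v * v) d) (∣-*ʳ _ ∣-refl))))

    module _ (κ g f : Poly) (κ≡1 : P ∣ κ - 1#) (P∤f : ¬ (P ∣ f)) where
      private
        R : Poly
        R = P * (g * g) + f * f

        -- The cleared equation when α + j = f / (P g) with P not dividing f. Then 1 + P (α + j)² =
        -- P R / (P g)², with R prime to P, has odd valuation at P.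
        Solution : Poly → Poly → Poly → Poly → Set
        Solution Z X Y W = Z * Z + ϖ * (X * X - P * (Y * Y)) ≈ κ * (P * R) * (W * W)

        divide : ∀ Z X Y W → Solution Z X Y W → P ∣ Z × P ∣ X
        divide Z X Y W e = inert-∣ Z X (∣-cong (begin
          κ * (P * R) * (W * W) + ϖ * (P * (Y * Y)) ≈⟨ +-congʳ e ⟨
          Z * Z + ϖ * (X * X - P * (Y * Y)) + ϖ * (P * (Y * Y)) ≈⟨ solve 5 (λ z t x p y → z :* z :+ t :* (x :* x :- p :* (y :* y)) :+ t :* (p :* (y :* y)) := z :* z :+ t :* (x :* x)) Z ϖ X P Y ⟩
          Z * Z + ϖ * (X * X) ∎) (∣-+ (∣-*ʳ (W * W) (∣-*ˡ κ (∣-*ʳ R ∣-refl))) (∣-*ˡ ϖ (∣-*ʳ (Y * Y) ∣-refl))))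

        -- After the first division the two halves of the form exchange roles: as κ is 1 mod P, the
        -- right-hand side is (f W)² mod P, and f W and Y satisfy the anisotropic congruence.
        divide₂ : ∀ Z X Y W → P * (Z * Z) + ϖ * (P * (X * X) - Y * Y) ≈ κ * R * (W * W) → P ∣ W × P ∣ Y
        divide₂ Z X Y W e = fW→W (inert-∣ (f * W) Y (∣-cong (begin
          P * (Z * Z + ϖ * (X * X) - κ * (g * g) * (W * W)) - (κ - 1#) * (f * f) * (W * W)
            ≈⟨ solve 8 (λ p z t x k g w f → p :* (z :* z :+ t :* (x :* x) :- k :* (g :* g) :* (w :* w)) :- (k :- :1) :* (f :* f) :* (w :* w) := f :* w :* (f :* w) :+ (p :* (z :* z) :+ t :* (p :* (x :* x))) :- k :* (p :* (g :* g) :+ f :* f) :* (w :* w)) P Z ϖ X κ g W f ⟩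
          f * W * (f * W) + (P * (Z * Z) + ϖ * (P * (X * X))) - κ * R * (W * W) ≈⟨ +-congˡ (-‿cong e) ⟨
          f * W * (f * W) + (P * (Z * Z) + ϖ * (P * (X * X))) - (P * (Z * Z) + ϖ * (P * (X * X) - Y * Y))
            ≈⟨ solve 5 (λ a b t x y → a :+ (b :+ t :* x) :- (b :+ t :* (x :- y)) := a :+ t :* y) (f * W * (f * W)) (P * (Z * Z)) ϖ (P * (X * X)) (Y * Y) ⟩
          f * W * (f * W) + ϖ * (Y * Y) ∎) (∣-+ (∣-*ʳ _ ∣-refl) (∣-neg (∣-*ʳ (W * W) (∣-*ʳ (f * f) κ≡1))))))
          where
          fW→W : P ∣ f * W × P ∣ Y → P ∣ W × P ∣ Y
          fW→W (a , b) = Coprime-∣ (∤⇒Coprime π P∤f) a , b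

        go : ∀ n Z X Y W → Deg< n W → Solution Z X Y W → W ≈ 0#
        go zero Z X Y W d _ = Deg<0⇒≈0 d
        go (suc n) Z X Y W d e = step₁ (divide Z X Y W e)
          where
          step₁ : P ∣ Z × P ∣ X → W ≈ 0#
          step₁ ((Z₁ , eZ) , (X₁ , eX)) = step₂ (divide₂ Z₁ X₁ Y W e₁)
            where
            e₁ : P * (Z₁ * Z₁) + ϖ * (P * (X₁ * X₁) - Y * Y) ≈ κ * R * (W * W)
            e₁ = cancelˡ (Prime-≉0 π) (begin
              P * (P * (Z₁ * Z₁) + ϖ * (P * (X₁ * X₁) - Y * Y)) ≈⟨ solve 5 (λ p z t x y → p :* (p :* (z :* z) :+ t :* (p :* (x :* x) :- y)) := p :* z :* (p :* z) :+ t :* (p :* x :* (p :* x) :- p :* y)) P Z₁ ϖ X₁ (Y * Y) ⟩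
              P * Z₁ * (P * Z₁) + ϖ * (P * X₁ * (P * X₁) - P * (Y * Y)) ≈⟨ +-cong (*-cong eZ eZ) (*-congˡ (+-congʳ (*-cong eX eX))) ⟨
              Z * Z + ϖ * (X * X - P * (Y * Y)) ≈⟨ e ⟩
              κ * (P * R) * (W * W) ≈⟨ solve 4 (λ k p r w → k :* (p :* r) :* w := p :* (k :* r :* w)) κ P R (W * W) ⟩
              P * (κ * R * (W * W)) ∎)
            step₂ : P ∣ W × P ∣ Y → W ≈ 0#
            -- The quotients by P satisfy the original equation, and W has dropped in degree.
            step₂ ((W₁ , eW) , (Y₁ , eY)) = trans eW (trans (*-congˡ (go n Z₁ X₁ Y₁ W₁ (Deg<-quotient-prime π (Deg<-cong eW d)) e₂)) (zeroʳ P))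
              where
              e₂ : Solution Z₁ X₁ Y₁ W₁
              e₂ = cancelˡ (Prime-≉0 π) (begin
                P * (Z₁ * Z₁ + ϖ * (X₁ * X₁ - P * (Y₁ * Y₁))) ≈⟨ solve 5 (λ p z t x y → p :* (z :+ t :* (x :- p :* (y :* y))) := p :* z :+ t :* (p :* x :- p :* y :* (p :* y))) P (Z₁ * Z₁) ϖ (X₁ * X₁) Y₁ ⟩
                P * (Z₁ * Z₁) + ϖ * (P * (X₁ * X₁) - P * Y₁ * (P * Y₁)) ≈⟨ +-congˡ (*-congˡ (+-congˡ (-‿cong (*-cong eY eY)))) ⟨
                P * (Z₁ * Z₁) + ϖ * (P * (X₁ * X₁) - Y * Y) ≈⟨ e₁ ⟩
                κ * R * (W * W) ≈⟨ *-congˡ (*-cong eW eW) ⟩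
                κ * R * (P * W₁ * (P * W₁)) ≈⟨ solve 4 (λ k r p w → k :* r :* (p :* w :* (p :* w)) := p :* (k :* (p :* r) :* (w :* w))) κ R P W₁ ⟩
                P * (κ * (P * R) * (W₁ * W₁)) ∎)

      oddDescent : ∀ Z X Y W → Z * Z + ϖ * (X * X - P * (Y * Y)) ≈ κ * (P * (P * (g * g) + f * f)) * (W * W) → W ≈ 0#
      oddDescent Z X Y W = go (length W) Z X Y W (Deg<-length W)

  module EvenInert {P} (π : Prime P) (ϖ β : Poly) (P∤ϖ : ¬ (P ∣ ϖ)) (inert : ∀ θ → ¬ (P ∣ θ * θ + ϖ * (θ + β))) where

    inert-∣ : ∀ x y → P ∣ ϖ * (x * x + x * y) + β * (y * y) → P ∣ x × P ∣ y
    inert-∣ x y d with dichotomy π y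
    ... | inj₁ P∣y = Prime-∤∣² π P∤ϖ (∣-cong (solve 4 (λ t x y b → t :* (x :* x :+ x :* y) :+ b :* (y :* y) :- (t :* x :+ b :* y) :* y := t :* (x :* x)) ϖ x y β) (∣-+ d (∣-neg (∣-*ˡ (ϖ * x + β * y) P∣y)))) , P∣y
    ... | inj₂ (u , v , e) = ⊥-elim (inert (ϖ * (v * x)) (∣-cong (begin
      ϖ * (v * v) * (ϖ * (x * x + x * y) + β * (y * y)) + P * (u * (ϖ * (ϖ * (v * x)) + ϖ * β * (1# + v * y)))
        ≈⟨ solve 7 (λ t v x y b p u → t :* (v :* v) :* (t :* (x :* x :+ x :* y) :+ b :* (y :* y)) :+ p :* (u :* (t :* (t :* (v :* x)) :+ t :* b :* (:1 :+ v :* y))) := t :* (v :* x) :* (t :* (v :* x)) :+ t :* (t :* (v :* x) :* (u :* p :+ v :* y) :+ b :* ((u :* p :+ v :* y) :* (:1 :+ v :* y) :- v :* y))) ϖ v x y β P u ⟩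
      ϖ * (v * x) * (ϖ * (v * x)) + ϖ * (ϖ * (v * x) * (u * P + v * y) + β * ((u * P + v * y) * (1# + v * y) - v * y)) ≈⟨ +-congˡ (*-congˡ (+-cong (*-congˡ e) (*-congˡ (+-congʳ (*-congʳ e))))) ⟩
      ϖ * (v * x) * (ϖ * (v * x)) + ϖ * (ϖ * (v * x) * 1# + β * (1# * (1# + v * y) - v * y))
        ≈⟨ solve 4 (λ h t b z → h :* h :+ t :* (h :* :1 :+ b :* (:1 :* (:1 :+ z) :- z)) := h :* h :+ t :* (h :+ b)) (ϖ * (v * x)) ϖ β (v * y) ⟩
      ϖ * (v * x) * (ϖ * (v * x)) + ϖ * (ϖ * (v * x) + β) ∎) (∣-+ (∣-*ˡ (ϖ * (v * v)) d) (∣-*ʳ _ ∣-refl))))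

    module _ (g f : Poly) (P∤f : ¬ (P ∣ f)) where
      private
        R : Poly
        R = P * (g * g) + f * f

        -- Cleared as in the odd case, for α = f / (P g). The left-hand side is a form that is
        -- anisotropic mod P and has even valuation; the right-hand side has odd valuation.
        Solution : Poly → Poly → Poly → Set
        Solution Z W M = ϖ * (Z * Z + Z * W) + β * (W * W) ≈ ϖ * (P * R) * (M * M)

        go : ∀ n Z W M → Deg< n M → Solution Z W M → M ≈ 0#
        go zero Z W M d _ = Deg<0⇒≈0 d
        go (suc n) Z W M d e = step₁ (inert-∣ Z W (∣-cong (sym e) (∣-*ʳ (M * M) (∣-*ˡ ϖ (∣-*ʳ R ∣-refl)))))
          where
          step₁ : P ∣ Z × P ∣ W → M ≈ 0#
          step₁ ((Z₁ , eZ) , (W₁ , eW)) = step₂ (Prime-∤∣² π P∤R (∣-cong (sym R≈) (∣-*ʳ _ ∣-refl)))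
            where
            e₁ : P * (ϖ * (Z₁ * Z₁ + Z₁ * W₁) + β * (W₁ * W₁)) ≈ ϖ * R * (M * M)
            e₁ = cancelˡ (Prime-≉0 π) (begin
              P * (P * (ϖ * (Z₁ * Z₁ + Z₁ * W₁) + β * (W₁ * W₁))) ≈⟨ solve 5 (λ p t z w b → p :* (p :* (t :* (z :* z :+ z :* w) :+ b :* (w :* w))) := t :* (p :* z :* (p :* z) :+ p :* z :* (p :* w)) :+ b :* (p :* w :* (p :* w))) P ϖ Z₁ W₁ β ⟩
              ϖ * (P * Z₁ * (P * Z₁) + P * Z₁ * (P * W₁)) + β * (P * W₁ * (P * W₁)) ≈⟨ +-cong (*-congˡ (+-cong (*-cong eZ eZ) (*-cong eZ eW))) (*-congˡ (*-cong eW eW)) ⟨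
              ϖ * (Z * Z + Z * W) + β * (W * W) ≈⟨ e ⟩
              ϖ * (P * R) * (M * M) ≈⟨ solve 4 (λ t p r m → t :* (p :* r) :* m := p :* (t :* r :* m)) ϖ P R (M * M) ⟩
              P * (ϖ * R * (M * M)) ∎)
            R≈ : ϖ * R * (M * M) ≈ P * (ϖ * (Z₁ * Z₁ + Z₁ * W₁) + β * (W₁ * W₁))
            R≈ = sym e₁
            P∤R : ¬ (P ∣ ϖ * R)
            P∤R = Prime-∤* π P∤ϖ (λ r → P∤f (Prime-∣² π (∣-cong (solve 3 (λ p g f → p :* g :+ f :- p :* g := f) P (g * g) (f * f)) (∣-+ r (∣-neg (∣-*ʳ (g * g) ∣-refl))))))
            step₂ : P ∣ M → M ≈ 0#
            step₂ (M₁ , eM) = trans eM (trans (*-congˡ (go n Z₁ W₁ M₁ (Deg<-quotient-prime π (Deg<-cong eM d)) e₂)) (zeroʳ P))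
              where
              e₂ : Solution Z₁ W₁ M₁
              e₂ = cancelˡ (Prime-≉0 π) (begin
                P * (ϖ * (Z₁ * Z₁ + Z₁ * W₁) + β * (W₁ * W₁)) ≈⟨ e₁ ⟩
                ϖ * R * (M * M) ≈⟨ *-congˡ (*-cong eM eM) ⟩
                ϖ * R * (P * M₁ * (P * M₁)) ≈⟨ solve 4 (λ t r p m → t :* r :* (p :* m :* (p :* m)) := p :* (t :* (p :* r) :* (m :* m))) ϖ R P M₁ ⟩
                P * (ϖ * (P * R) * (M₁ * M₁)) ∎)

      evenDescent : ∀ Z W M → ϖ * (Z * Z + Z * W) + β * (W * W) ≈ ϖ * (P * (P * (g * g) + f * f)) * (M * M) → M ≈ 0#
      evenDescent Z W M = go (length M) Z W M (Deg<-length M)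

-- Local integrality and the clearing of denominators.

module LocalIntegrality (F : DecField) where
  open FieldPoly F
  open Fractions F
  open InertDescent F
  private
    module L = DecField fracField
    module LS = SolverOver L.commRing
    module ι = RingHom embed
  open LS using () renaming (solve to solveᶠ)

  Integral : Poly → Frac → Set
  Integral P α = ∃₂ λ f g → ¬ (P ∣ g) × α L.* ⌜ g ⌝ L.≈ ⌜ f ⌝

  lowestTerms : ∀ α → ∃₂ λ f g → Coprime f g × ¬ (g ≈ 0#) × α L.* ⌜ g ⌝ L.≈ ⌜ f ⌝
  lowestTerms α = go (lowest-terms (num α) (den α) (den≉0 α))
    where
    go : (∃ λ d → ∃₂ λ f g → num α ≈ d * f × den α ≈ d * g × Coprime f g) → ∃₂ λ f g → Coprime f g × ¬ (g ≈ 0#) × α L.* ⌜ g ⌝ L.≈ ⌜ f ⌝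
    go (d , f , g , ea , eb , cop) = f , g , cop , (λ z → den≉0 α (trans eb (trans (*-congˡ z) (zeroʳ d)))) , *⌜⌝-cross α f g
      (trans (*-congʳ ea) (trans (solve 3 (λ d f g → d :* f :* g := f :* (d :* g)) d f g) (*-congˡ (sym eb))))

  clear-by : ∀ x r → x L.* ⌜ den x * r ⌝ L.≈ ⌜ num x * r ⌝
  clear-by x r = L.trans (L.*-congˡ (ι.to-* (den x) r)) (L.trans (L.sym (L.*-assoc x ⌜ den x ⌝ ⌜ r ⌝)) (L.trans (L.*-congʳ (clear x)) (L.sym (ι.to-* (num x) r))))

  clear-as : ∀ x r {M} → den x * r ≈ M → x L.* ⌜ M ⌝ L.≈ ⌜ num x * r ⌝
  clear-as x r e = L.trans (L.*-congˡ (ι.to-cong (sym e))) (clear-by x r)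

  private
    -- In lowest terms either P does not divide the denominator, or it divides the denominator and
    -- not the numerator, the situation that the descent excludes.
    integral-or : ∀ {P} → Prime P → ∀ α → (∀ f g → ¬ (P ∣ f) → ¬ (P * g ≈ 0#) → α L.* ⌜ P * g ⌝ L.≈ ⌜ f ⌝ → ⊥) → Integral P α
    integral-or {P} π α absurd = go (lowestTerms α)
      where
      go : (∃₂ λ f g → Coprime f g × ¬ (g ≈ 0#) × α L.* ⌜ g ⌝ L.≈ ⌜ f ⌝) → Integral P α
      go (f , g , cop , g≉0 , e) with dichotomy π g
      ... | inj₂ c = f , g , Coprime⇒∤ π c , e
      ... | inj₁ (g₁ , eg) = ⊥-elim (absurd f g₁ (λ d → Prime-∤1 π (common d (g₁ , eg) cop)) (λ z → g≉0 (trans eg z)) (L.trans (L.*-congˡ (ι.to-cong (sym eg))) e))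
        where
        common : P ∣ f → P ∣ g → Coprime f g → P ∣ 1#
        common df dg (u , v , h) = ∣-cong h (∣-+ (∣-*ˡ u df) (∣-*ˡ v dg))

  open import Relation.Binary.Reasoning.Setoid L.setoid

  oddSound : ∀ {P} → Prime P → ∀ ϖ → (∀ θ → ¬ (P ∣ θ * θ + ϖ)) → ∀ κ → P ∣ κ - 1# → ∀ j α z x y →
    z L.* z L.+ ⌜ ϖ ⌝ L.* (x L.* x L.- ⌜ P ⌝ L.* (y L.* y)) L.≈ ⌜ κ ⌝ L.* (L.1# L.+ ⌜ P ⌝ L.* ((α L.+ ⌜ j ⌝) L.* (α L.+ ⌜ j ⌝))) → Integral P α
  oddSound {P} π ϖ inert κ κ≡1 j α z x y eq = integral-or π α absurd
    where
    absurd : ∀ f g → ¬ (P ∣ f) → ¬ (P * g ≈ 0#) → α L.* ⌜ P * g ⌝ L.≈ ⌜ f ⌝ → ⊥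
    absurd f g P∤f Pg≉0 e = *≉0 (*≉0 (den≉0 z) (den≉0 x)) (den≉0 y) (OddInert.oddDescent π ϖ inert κ g f′ κ≡1 P∤f′ Z X′ Y W (⌜⌝-injective poly))
      where
      G W Z X′ Y f′ : Poly
      -- G is the denominator of α and W the common denominator of z, x and y; the whole equation is
      -- multiplied by (W G)².
      G = P * g
      W = den z * den x * den y
      Z = num z * (den x * den y) * G
      X′ = num x * (den z * den y) * G
      Y = num y * (den z * den x) * G
      f′ = f + j * G
      P∤f′ : ¬ (P ∣ f′)
      P∤f′ d = P∤f (∣-cong (solve 3 (λ f j g → f :+ j :* g :- j :* g := f) f j G) (∣-+ d (∣-neg (∣-*ˡ j (∣-*ʳ g ∣-refl)))))
      w γ : Frac
      w = ⌜ W ⌝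
      γ = ⌜ G ⌝
      scaled : ∀ v r → v L.* w L.≈ ⌜ r ⌝ → ⌜ r * G ⌝ L.≈ v L.* (w L.* γ)
      scaled v r h = L.trans (ι.to-* r G) (L.trans (L.*-congʳ (L.sym h)) (L.*-assoc v w γ))
      z≈ : ⌜ Z ⌝ L.≈ z L.* (w L.* γ)
      z≈ = scaled z _ (clear-as z (den x * den y) (sym (*-assoc (den z) (den x) (den y))))
      x≈ : ⌜ X′ ⌝ L.≈ x L.* (w L.* γ)
      x≈ = scaled x _ (clear-as x (den z * den y) (solve 3 (λ a b c → a :* (b :* c) := b :* a :* c) (den x) (den z) (den y)))
      y≈ : ⌜ Y ⌝ L.≈ y L.* (w L.* γ)
      y≈ = scaled y _ (clear-as y (den z * den x) (*-comm (den y) (den z * den x)))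
      f≈ : ⌜ f′ ⌝ L.≈ (α L.+ ⌜ j ⌝) L.* γ
      f≈ = L.trans (ι.to-+ f (j * G)) (L.trans (L.+-cong (L.sym e) (ι.to-* j G)) (L.sym (L.distribʳ γ α ⌜ j ⌝)))
      poly : ⌜ Z * Z + ϖ * (X′ * X′ - P * (Y * Y)) ⌝ L.≈ ⌜ κ * (P * (P * (g * g) + f′ * f′)) * (W * W) ⌝
      poly = begin
        ⌜ Z * Z + ϖ * (X′ * X′ - P * (Y * Y)) ⌝
          ≈⟨ L.trans (ι.to-+ (Z * Z) _) (L.+-cong (ι.to-* Z Z) (L.trans (ι.to-* ϖ _) (L.*-congˡ (L.trans (ι.to-+ (X′ * X′) _) (L.+-cong (ι.to-* X′ X′) (L.trans (ι.to-neg (P * (Y * Y))) (L.-‿cong (L.trans (ι.to-* P (Y * Y)) (L.*-congˡ (ι.to-* Y Y)))))))))) ⟩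
        ⌜ Z ⌝ L.* ⌜ Z ⌝ L.+ ⌜ ϖ ⌝ L.* (⌜ X′ ⌝ L.* ⌜ X′ ⌝ L.- ⌜ P ⌝ L.* (⌜ Y ⌝ L.* ⌜ Y ⌝))
          ≈⟨ L.+-cong (L.*-cong z≈ z≈) (L.*-congˡ (L.+-cong (L.*-cong x≈ x≈) (L.-‿cong (L.*-congˡ (L.*-cong y≈ y≈))))) ⟩
        z L.* (w L.* γ) L.* (z L.* (w L.* γ)) L.+ ⌜ ϖ ⌝ L.* (x L.* (w L.* γ) L.* (x L.* (w L.* γ)) L.- ⌜ P ⌝ L.* (y L.* (w L.* γ) L.* (y L.* (w L.* γ))))
          ≈⟨ solveᶠ 6 (λ z x y t p v → z :* v :* (z :* v) :+ t :* (x :* v :* (x :* v) :- p :* (y :* v :* (y :* v))) := (z :* z :+ t :* (x :* x :- p :* (y :* y))) :* (v :* v)) z x y ⌜ ϖ ⌝ ⌜ P ⌝ (w L.* γ) ⟩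
        (z L.* z L.+ ⌜ ϖ ⌝ L.* (x L.* x L.- ⌜ P ⌝ L.* (y L.* y))) L.* (w L.* γ L.* (w L.* γ)) ≈⟨ L.*-congʳ eq ⟩
        ⌜ κ ⌝ L.* (L.1# L.+ ⌜ P ⌝ L.* ((α L.+ ⌜ j ⌝) L.* (α L.+ ⌜ j ⌝))) L.* (w L.* γ L.* (w L.* γ))
          ≈⟨ solveᶠ 5 (λ k p a w c → k :* (:1 :+ p :* (a :* a)) :* (w :* c :* (w :* c)) := k :* (c :* c :+ p :* (a :* c :* (a :* c))) :* (w :* w)) ⌜ κ ⌝ ⌜ P ⌝ (α L.+ ⌜ j ⌝) w γ ⟩
        ⌜ κ ⌝ L.* (γ L.* γ L.+ ⌜ P ⌝ L.* ((α L.+ ⌜ j ⌝) L.* γ L.* ((α L.+ ⌜ j ⌝) L.* γ))) L.* (w L.* w)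
          ≈⟨ L.*-cong (L.*-congˡ (L.+-cong (L.sym (ι.to-* G G)) (L.*-congˡ (L.*-cong (L.sym f≈) (L.sym f≈))))) (L.sym (ι.to-* W W)) ⟩
        ⌜ κ ⌝ L.* (⌜ G * G ⌝ L.+ ⌜ P ⌝ L.* (⌜ f′ ⌝ L.* ⌜ f′ ⌝)) L.* ⌜ W * W ⌝
          ≈⟨ L.sym (L.trans (ι.to-* (κ * (G * G + P * (f′ * f′))) (W * W)) (L.*-congʳ (L.trans (ι.to-* κ _) (L.*-congˡ (L.trans (ι.to-+ (G * G) _) (L.+-congˡ (L.trans (ι.to-* P _) (L.*-congˡ (ι.to-* f′ f′))))))))) ⟩
        ⌜ κ * (G * G + P * (f′ * f′)) * (W * W) ⌝
          ≈⟨ ι.to-cong (*-congʳ (*-congˡ (solve 3 (λ p g f → p :* g :* (p :* g) :+ p :* (f :* f) := p :* (p :* (g :* g) :+ f :* f)) P g f′))) ⟩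
        ⌜ κ * (P * (P * (g * g) + f′ * f′)) * (W * W) ⌝ ∎

  evenSound : ∀ {P} → Prime P → ∀ ϖ β → ¬ (P ∣ ϖ) → (∀ θ → ¬ (P ∣ θ * θ + ϖ * (θ + β))) → ∀ α z w →
    ⌜ ϖ ⌝ L.* (z L.* z L.+ z L.* w) L.+ ⌜ β ⌝ L.* (w L.* w) L.≈ ⌜ ϖ ⌝ L.* (L.1# L.+ ⌜ P ⌝ L.* (α L.* α)) → Integral P α
  evenSound {P} π ϖ β P∤ϖ inert α z w eq = integral-or π α absurd
    where
    absurd : ∀ f g → ¬ (P ∣ f) → ¬ (P * g ≈ 0#) → α L.* ⌜ P * g ⌝ L.≈ ⌜ f ⌝ → ⊥
    absurd f g P∤f Pg≉0 e = *≉0 (den≉0 z) (den≉0 w) (EvenInert.evenDescent π ϖ β P∤ϖ inert g f P∤f Z V M (⌜⌝-injective poly))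
      where
      G M Z V : Poly
      G = P * g
      M = den z * den w
      Z = num z * den w * G
      V = num w * den z * G
      m γ : Frac
      m = ⌜ M ⌝
      γ = ⌜ G ⌝
      scaled : ∀ v r → v L.* m L.≈ ⌜ r ⌝ → ⌜ r * G ⌝ L.≈ v L.* (m L.* γ)
      scaled v r h = L.trans (ι.to-* r G) (L.trans (L.*-congʳ (L.sym h)) (L.*-assoc v m γ))
      z≈ : ⌜ Z ⌝ L.≈ z L.* (m L.* γ)
      z≈ = scaled z _ (clear-as z (den w) refl)
      w≈ : ⌜ V ⌝ L.≈ w L.* (m L.* γ)
      w≈ = scaled w _ (clear-as w (den z) (*-comm (den w) (den z)))
      poly : ⌜ ϖ * (Z * Z + Z * V) + β * (V * V) ⌝ L.≈ ⌜ ϖ * (P * (P * (g * g) + f * f)) * (M * M) ⌝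
      poly = begin
        ⌜ ϖ * (Z * Z + Z * V) + β * (V * V) ⌝
          ≈⟨ L.trans (ι.to-+ (ϖ * (Z * Z + Z * V)) _) (L.+-cong (L.trans (ι.to-* ϖ _) (L.*-congˡ (L.trans (ι.to-+ (Z * Z) _) (L.+-cong (ι.to-* Z Z) (ι.to-* Z V))))) (L.trans (ι.to-* β _) (L.*-congˡ (ι.to-* V V)))) ⟩
        ⌜ ϖ ⌝ L.* (⌜ Z ⌝ L.* ⌜ Z ⌝ L.+ ⌜ Z ⌝ L.* ⌜ V ⌝) L.+ ⌜ β ⌝ L.* (⌜ V ⌝ L.* ⌜ V ⌝)
          ≈⟨ L.+-cong (L.*-congˡ (L.+-cong (L.*-cong z≈ z≈) (L.*-cong z≈ w≈))) (L.*-congˡ (L.*-cong w≈ w≈)) ⟩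
        ⌜ ϖ ⌝ L.* (z L.* (m L.* γ) L.* (z L.* (m L.* γ)) L.+ z L.* (m L.* γ) L.* (w L.* (m L.* γ))) L.+ ⌜ β ⌝ L.* (w L.* (m L.* γ) L.* (w L.* (m L.* γ)))
          ≈⟨ solveᶠ 5 (λ z w t b v → t :* (z :* v :* (z :* v) :+ z :* v :* (w :* v)) :+ b :* (w :* v :* (w :* v)) := (t :* (z :* z :+ z :* w) :+ b :* (w :* w)) :* (v :* v)) z w ⌜ ϖ ⌝ ⌜ β ⌝ (m L.* γ) ⟩
        (⌜ ϖ ⌝ L.* (z L.* z L.+ z L.* w) L.+ ⌜ β ⌝ L.* (w L.* w)) L.* (m L.* γ L.* (m L.* γ)) ≈⟨ L.*-congʳ eq ⟩
        ⌜ ϖ ⌝ L.* (L.1# L.+ ⌜ P ⌝ L.* (α L.* α)) L.* (m L.* γ L.* (m L.* γ))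
          ≈⟨ solveᶠ 5 (λ k p a w c → k :* (:1 :+ p :* (a :* a)) :* (w :* c :* (w :* c)) := k :* (c :* c :+ p :* (a :* c :* (a :* c))) :* (w :* w)) ⌜ ϖ ⌝ ⌜ P ⌝ α m γ ⟩
        ⌜ ϖ ⌝ L.* (γ L.* γ L.+ ⌜ P ⌝ L.* (α L.* γ L.* (α L.* γ))) L.* (m L.* m)
          ≈⟨ L.*-cong (L.*-congˡ (L.+-cong (L.sym (ι.to-* G G)) (L.*-congˡ (L.*-cong e e)))) (L.sym (ι.to-* M M)) ⟩
        ⌜ ϖ ⌝ L.* (⌜ G * G ⌝ L.+ ⌜ P ⌝ L.* (⌜ f ⌝ L.* ⌜ f ⌝)) L.* ⌜ M * M ⌝
          ≈⟨ L.sym (L.trans (ι.to-* (ϖ * (G * G + P * (f * f))) (M * M)) (L.*-congʳ (L.trans (ι.to-* ϖ _) (L.*-congˡ (L.trans (ι.to-+ (G * G) _) (L.+-congˡ (L.trans (ι.to-* P _) (L.*-congˡ (ι.to-* f f))))))))) ⟩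
        ⌜ ϖ * (G * G + P * (f * f)) * (M * M) ⌝
          ≈⟨ ι.to-cong (*-congʳ (*-congˡ (solve 3 (λ p g f → p :* g :* (p :* g) :+ p :* (f :* f) := p :* (p :* (g :* g) :+ f :* f)) P g f))) ⟩
        ⌜ ϖ * (P * (P * (g * g) + f * f)) * (M * M) ⌝ ∎

  -- `Integral` speaks of some denominator prime to P. The reduced one divides it up to units, and
  -- the coprimality of f and g is what the choice of the shift j relies on.
  integral-lowest : ∀ {P α} → Prime P → Integral P α → ∃₂ λ f g → Coprime f g × ¬ (g ≈ 0#) × ¬ (P ∣ g) × α L.* ⌜ g ⌝ L.≈ ⌜ f ⌝
  integral-lowest {P} {α} π (f , g , P∤g , e) = go (lowestTerms α)
    where
    go : (∃₂ λ f g → Coprime f g × ¬ (g ≈ 0#) × α L.* ⌜ g ⌝ L.≈ ⌜ f ⌝) → ∃₂ λ f g → Coprime f g × ¬ (g ≈ 0#) × ¬ (P ∣ g) × α L.* ⌜ g ⌝ L.≈ ⌜ f ⌝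
    go (f₁ , g₁ , cop , g₁≉0 , e₁) = f₁ , g₁ , cop , g₁≉0 , P∤g₁ , e₁
      where
      same : f * g₁ ≈ f₁ * g
      same = ⌜⌝-injective (begin
        ⌜ f * g₁ ⌝ ≈⟨ L.trans (ι.to-* f g₁) (L.*-congʳ (L.sym e)) ⟩
        α L.* ⌜ g ⌝ L.* ⌜ g₁ ⌝ ≈⟨ solveᶠ 3 (λ a g h → a :* g :* h := a :* h :* g) α ⌜ g ⌝ ⌜ g₁ ⌝ ⟩
        α L.* ⌜ g₁ ⌝ L.* ⌜ g ⌝ ≈⟨ L.trans (L.*-congʳ e₁) (L.sym (ι.to-* f₁ g)) ⟩
        ⌜ f₁ * g ⌝ ∎)
      P∤g₁ : ¬ (P ∣ g₁)
      P∤g₁ d = split (Prime-∣* π (∣-cong same (∣-*ˡ f d))) cop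
        where
        split : P ∣ f₁ ⊎ P ∣ g → Coprime f₁ g₁ → ⊥
        split (inj₂ r) _ = P∤g r
        split (inj₁ r) (u , v , h) = Prime-∤1 π (∣-cong h (∣-+ (∣-*ˡ u r) (∣-*ˡ v d)))

  private
    ⌜⌝≉0 : ∀ {p} → ¬ (p ≈ 0#) → ¬ (⌜ p ⌝ L.≈ L.0#)
    ⌜⌝≉0 p≉0 e = p≉0 (⌜⌝-injective e)

  -- Dividing the polynomial solution by w g: the right-hand side κ (g² + P (f + j g)²) w² is (w g)²
  -- times the wanted one.
  oddWitness : ∀ P ϖ κ j α f g → ¬ (g ≈ 0#) → α L.* ⌜ g ⌝ L.≈ ⌜ f ⌝ → ∀ z x y w → ¬ (w ≈ 0#) →
    z * z + ϖ * (x * x - P * (y * y)) ≈ κ * (g * g + P * ((f + j * g) * (f + j * g))) * (w * w) →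
    ∃ λ z′ → ∃₂ λ x′ y′ → z′ L.* z′ L.+ ⌜ ϖ ⌝ L.* (x′ L.* x′ L.- ⌜ P ⌝ L.* (y′ L.* y′)) L.≈ ⌜ κ ⌝ L.* (L.1# L.+ ⌜ P ⌝ L.* ((α L.+ ⌜ j ⌝) L.* (α L.+ ⌜ j ⌝)))
  oddWitness P ϖ κ j α f g g≉0 e z x y w w≉0 eq = go (L.invert ⌜ w * g ⌝ (⌜⌝≉0 (*≉0 w≉0 g≉0)))
    where
    G : Poly
    G = f + j * g
    G≈ : ⌜ G ⌝ L.≈ (α L.+ ⌜ j ⌝) L.* ⌜ g ⌝
    G≈ = L.trans (ι.to-+ f (j * g)) (L.trans (L.+-cong (L.sym e) (ι.to-* j g)) (L.sym (L.distribʳ ⌜ g ⌝ α ⌜ j ⌝)))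
    go : (∃ λ i → ⌜ w * g ⌝ L.* i L.≈ L.1#) → _
    go (i , wgi) = ⌜ z ⌝ L.* i , ⌜ x ⌝ L.* i , ⌜ y ⌝ L.* i , (begin
      ⌜ z ⌝ L.* i L.* (⌜ z ⌝ L.* i) L.+ ⌜ ϖ ⌝ L.* (⌜ x ⌝ L.* i L.* (⌜ x ⌝ L.* i) L.- ⌜ P ⌝ L.* (⌜ y ⌝ L.* i L.* (⌜ y ⌝ L.* i)))
        ≈⟨ solveᶠ 6 (λ z x y t p v → z :* v :* (z :* v) :+ t :* (x :* v :* (x :* v) :- p :* (y :* v :* (y :* v))) := (z :* z :+ t :* (x :* x :- p :* (y :* y))) :* (v :* v)) ⌜ z ⌝ ⌜ x ⌝ ⌜ y ⌝ ⌜ ϖ ⌝ ⌜ P ⌝ i ⟩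
      (⌜ z ⌝ L.* ⌜ z ⌝ L.+ ⌜ ϖ ⌝ L.* (⌜ x ⌝ L.* ⌜ x ⌝ L.- ⌜ P ⌝ L.* (⌜ y ⌝ L.* ⌜ y ⌝))) L.* (i L.* i)
        ≈⟨ L.*-congʳ (L.sym (L.trans (ι.to-+ (z * z) _) (L.+-cong (ι.to-* z z) (L.trans (ι.to-* ϖ _) (L.*-congˡ (L.trans (ι.to-+ (x * x) _) (L.+-cong (ι.to-* x x) (L.trans (ι.to-neg (P * (y * y))) (L.-‿cong (L.trans (ι.to-* P (y * y)) (L.*-congˡ (ι.to-* y y)))))))))))) ⟩
      ⌜ z * z + ϖ * (x * x - P * (y * y)) ⌝ L.* (i L.* i) ≈⟨ L.*-congʳ (ι.to-cong eq) ⟩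
      ⌜ κ * (g * g + P * (G * G)) * (w * w) ⌝ L.* (i L.* i)
        ≈⟨ L.*-congʳ (L.trans (ι.to-* (κ * (g * g + P * (G * G))) (w * w)) (L.*-cong (L.trans (ι.to-* κ _) (L.*-congˡ (L.trans (ι.to-+ (g * g) _) (L.+-cong (ι.to-* g g) (L.trans (ι.to-* P _) (L.*-congˡ (L.trans (ι.to-* G G) (L.*-cong G≈ G≈)))))))) (ι.to-* w w))) ⟩
      ⌜ κ ⌝ L.* (⌜ g ⌝ L.* ⌜ g ⌝ L.+ ⌜ P ⌝ L.* ((α L.+ ⌜ j ⌝) L.* ⌜ g ⌝ L.* ((α L.+ ⌜ j ⌝) L.* ⌜ g ⌝))) L.* (⌜ w ⌝ L.* ⌜ w ⌝) L.* (i L.* i)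
        ≈⟨ solveᶠ 6 (λ k p a g w i → k :* (g :* g :+ p :* (a :* g :* (a :* g))) :* (w :* w) :* (i :* i) := k :* (:1 :+ p :* (a :* a)) :* (w :* g :* i :* (w :* g :* i))) ⌜ κ ⌝ ⌜ P ⌝ (α L.+ ⌜ j ⌝) ⌜ g ⌝ ⌜ w ⌝ i ⟩
      ⌜ κ ⌝ L.* (L.1# L.+ ⌜ P ⌝ L.* ((α L.+ ⌜ j ⌝) L.* (α L.+ ⌜ j ⌝))) L.* (⌜ w ⌝ L.* ⌜ g ⌝ L.* i L.* (⌜ w ⌝ L.* ⌜ g ⌝ L.* i)) ≈⟨ L.*-congˡ (L.trans (L.*-cong one one) (L.*-identityˡ _)) ⟩
      ⌜ κ ⌝ L.* (L.1# L.+ ⌜ P ⌝ L.* ((α L.+ ⌜ j ⌝) L.* (α L.+ ⌜ j ⌝))) L.* L.1# ≈⟨ L.*-identityʳ _ ⟩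
      ⌜ κ ⌝ L.* (L.1# L.+ ⌜ P ⌝ L.* ((α L.+ ⌜ j ⌝) L.* (α L.+ ⌜ j ⌝))) ∎)
      where
      one : ⌜ w ⌝ L.* ⌜ g ⌝ L.* i L.≈ L.1#
      one = L.trans (L.*-congʳ (L.sym (ι.to-* w g))) wgi

  evenWitness : ∀ P ϖ β α f g → ¬ (g ≈ 0#) → α L.* ⌜ g ⌝ L.≈ ⌜ f ⌝ → ∀ z w →
    ϖ * (z * z + z * w) + β * (w * w) ≈ ϖ * (g * g + P * (f * f)) →
    ∃₂ λ z′ w′ → ⌜ ϖ ⌝ L.* (z′ L.* z′ L.+ z′ L.* w′) L.+ ⌜ β ⌝ L.* (w′ L.* w′) L.≈ ⌜ ϖ ⌝ L.* (L.1# L.+ ⌜ P ⌝ L.* (α L.* α))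
  evenWitness P ϖ β α f g g≉0 e z w eq = go (L.invert ⌜ g ⌝ (⌜⌝≉0 g≉0))
    where
    go : (∃ λ i → ⌜ g ⌝ L.* i L.≈ L.1#) → _
    go (i , gi) = ⌜ z ⌝ L.* i , ⌜ w ⌝ L.* i , (begin
      ⌜ ϖ ⌝ L.* (⌜ z ⌝ L.* i L.* (⌜ z ⌝ L.* i) L.+ ⌜ z ⌝ L.* i L.* (⌜ w ⌝ L.* i)) L.+ ⌜ β ⌝ L.* (⌜ w ⌝ L.* i L.* (⌜ w ⌝ L.* i))
        ≈⟨ solveᶠ 5 (λ z w t b v → t :* (z :* v :* (z :* v) :+ z :* v :* (w :* v)) :+ b :* (w :* v :* (w :* v)) := (t :* (z :* z :+ z :* w) :+ b :* (w :* w)) :* (v :* v)) ⌜ z ⌝ ⌜ w ⌝ ⌜ ϖ ⌝ ⌜ β ⌝ i ⟩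
      (⌜ ϖ ⌝ L.* (⌜ z ⌝ L.* ⌜ z ⌝ L.+ ⌜ z ⌝ L.* ⌜ w ⌝) L.+ ⌜ β ⌝ L.* (⌜ w ⌝ L.* ⌜ w ⌝)) L.* (i L.* i)
        ≈⟨ L.*-congʳ (L.sym (L.trans (ι.to-+ (ϖ * (z * z + z * w)) _) (L.+-cong (L.trans (ι.to-* ϖ _) (L.*-congˡ (L.trans (ι.to-+ (z * z) _) (L.+-cong (ι.to-* z z) (ι.to-* z w))))) (L.trans (ι.to-* β _) (L.*-congˡ (ι.to-* w w)))))) ⟩
      ⌜ ϖ * (z * z + z * w) + β * (w * w) ⌝ L.* (i L.* i) ≈⟨ L.*-congʳ (ι.to-cong eq) ⟩
      ⌜ ϖ * (g * g + P * (f * f)) ⌝ L.* (i L.* i)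
        ≈⟨ L.*-congʳ (L.trans (ι.to-* ϖ _) (L.*-congˡ (L.trans (ι.to-+ (g * g) _) (L.+-cong (ι.to-* g g) (L.trans (ι.to-* P _) (L.*-congˡ (L.trans (ι.to-* f f) (L.*-cong (L.sym e) (L.sym e))))))))) ⟩
      ⌜ ϖ ⌝ L.* (⌜ g ⌝ L.* ⌜ g ⌝ L.+ ⌜ P ⌝ L.* (α L.* ⌜ g ⌝ L.* (α L.* ⌜ g ⌝))) L.* (i L.* i)
        ≈⟨ solveᶠ 5 (λ k p a g i → k :* (g :* g :+ p :* (a :* g :* (a :* g))) :* (i :* i) := k :* (:1 :+ p :* (a :* a)) :* (g :* i :* (g :* i))) ⌜ ϖ ⌝ ⌜ P ⌝ α ⌜ g ⌝ i ⟩
      ⌜ ϖ ⌝ L.* (L.1# L.+ ⌜ P ⌝ L.* (α L.* α)) L.* (⌜ g ⌝ L.* i L.* (⌜ g ⌝ L.* i)) ≈⟨ L.*-congˡ (L.trans (L.*-cong gi gi) (L.*-identityˡ _)) ⟩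
      ⌜ ϖ ⌝ L.* (L.1# L.+ ⌜ P ⌝ L.* (α L.* α)) L.* L.1# ≈⟨ L.*-identityʳ _ ⟩
      ⌜ ϖ ⌝ L.* (L.1# L.+ ⌜ P ⌝ L.* (α L.* α)) ∎)

-- The ultraproduct field and the transfer of bounded statements.

module UltraField {S : Set} (D : Ultrafilter S) (q : S → ℕ) (F : ∀ s → FiniteField (q s)) where
  open Ultrafilter D public
  private
    module 𝒮 = Setting D q F
    module F s = FiniteField (F s)
    module R s = IsCommutativeRing (FiniteField.isCommutativeRing (F s))
  open 𝒮 using (GF; _≈_; _+ᴳ_; _*ᴳ_; -ᴳ_; 0ᴳ; 1ᴳ) public

  always : {A : S → Set} → (∀ s → A s) → U A
  always h = upward (λ s _ → h s) full

  U-map₂ : {A B C : S → Set} → (∀ s → A s → B s → C s) → U A → U B → U C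
  U-map₂ h a b = upward (λ s (x , y) → h s x y) (inter a b)

  U-contradiction : {A : S → Set} → U A → U (λ s → ¬ A s) → ⊥
  U-contradiction a b = empty (U-map₂ (λ s x n → n x) a b)

  U-¬ : {A : S → Set} → ¬ U A → U (λ s → ¬ A s)
  U-¬ {A} n with ultra A
  ... | inj₁ a = ⊥-elim (n a)
  ... | inj₂ b = b

  -- The existential case of the theorem of Łoś. Decidability at every index picks the witness, with
  -- the default `d` where none exists, so no choice principle enters.
  choose : (T : S → Set) → (∀ s → T s) → (P : ∀ s → T s → Set) → (∀ s → Dec (∃ (P s))) → U (λ s → ∃ (P s)) → Σ (∀ s → T s) λ f → U (λ s → P s (f s))
  choose T d P dec u = (λ s → pick s (dec s)) , upward (λ s e → correct s (dec s) e) u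
    where
    pick : ∀ s → Dec (∃ (P s)) → T s
    pick s (yes (t , _)) = t
    pick s (no _) = d s
    correct : ∀ s (x : Dec (∃ (P s))) → ∃ (P s) → P s (pick s x)
    correct s (yes (t , p)) _ = p
    correct s (no n) e = ⊥-elim (n e)

  GFring : CommutativeRing 0ℓ 0ℓ
  GFring = record
    { Carrier = GF ; _≈_ = _≈_ ; _+_ = _+ᴳ_ ; _*_ = _*ᴳ_ ; -_ = -ᴳ_ ; 0# = 0ᴳ ; 1# = 1ᴳ
    ; isCommutativeRing = record
      { isRing = record
        { +-isAbelianGroup = record
          { isGroup = record
            { isMonoid = record
              { isSemigroup = record
                { isMagma = record
                  { isEquivalence = record { refl = always (λ s → ≡.refl) ; sym = upward (λ s → ≡.sym) ; trans = U-map₂ (λ s → ≡.trans) }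
                  ; ∙-cong = λ {x} {y} {u} {v} → U-map₂ (λ s → cong₂ (F._+_ s)) }
                ; assoc = λ x y z → always (λ s → R.+-assoc s (x s) (y s) (z s)) }
              ; identity = (λ x → always (λ s → R.+-identityˡ s (x s))) , (λ x → always (λ s → R.+-identityʳ s (x s))) }
            ; inverse = (λ x → always (λ s → R.-‿inverseˡ s (x s))) , (λ x → always (λ s → R.-‿inverseʳ s (x s)))
            ; ⁻¹-cong = upward (λ s → cong (F.-_ s)) }
          ; comm = λ x y → always (λ s → R.+-comm s (x s) (y s)) }
        ; *-cong = λ {x} {y} {u} {v} → U-map₂ (λ s → cong₂ (F._*_ s))
        ; *-assoc = λ x y z → always (λ s → R.*-assoc s (x s) (y s) (z s))
        ; *-identity = (λ x → always (λ s → R.*-identityˡ s (x s))) , (λ x → always (λ s → R.*-identityʳ s (x s)))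
        ; distrib = (λ x y z → always (λ s → R.distribˡ s (x s) (y s) (z s))) , (λ x y z → always (λ s → R.distribʳ s (x s) (y s) (z s))) }
      ; *-comm = λ x y → always (λ s → R.*-comm s (x s) (y s)) } }

  -- The ultrafilter decides every equation between elements. Inverses are taken componentwise, with
  -- 0 at the components that vanish.
  kField : DecField
  kField = record { commRing = GFring ; _≟_ = decide ; 1≉0 = λ e → empty (upward (λ s h → F.1≢0 s h) e) ; invert = invertᴳ }
    where
    decide : ∀ x y → Dec (x ≈ y)
    decide x y with ultra (λ s → x s ≡ y s)
    ... | inj₁ e = yes e
    ... | inj₂ n = no λ e → U-contradiction e n
    invertᴳ : ∀ x → ¬ (x ≈ 0ᴳ) → ∃ λ y → x *ᴳ y ≈ 1ᴳ
    invertᴳ x x≉0 = (λ s → inv s (DecField._≟_ (finiteDecField (F s)) (x s) (F.0# s))) , upward (λ s n → correct s (DecField._≟_ (finiteDecField (F s)) (x s) (F.0# s)) n) (U-¬ x≉0)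
      where
      inv : ∀ s → Dec (x s ≡ F.0# s) → Fin (q s)
      inv s (yes _) = F.0# s
      inv s (no n) = proj₁ (F.inverse s (x s) n)
      correct : ∀ s (d : Dec (x s ≡ F.0# s)) → ¬ (x s ≡ F.0# s) → F._*_ s (x s) (inv s d) ≡ F.1# s
      correct s (yes e) n = ⊥-elim (n e)
      correct s (no n) _ = proj₂ (F.inverse s (x s) n)

  module k = FieldPoly kField
  module Fs (s : S) = FiniteFieldPoly (F s)

  proj : ∀ s → k.Poly → List (Fin (q s))
  proj s = List.map (λ x → x s)

  coeff-proj : ∀ s p n → Fs.coeff s (proj s p) n ≡ k.coeff p n s
  coeff-proj s [] n = ≡.refl
  coeff-proj s (a ∷ p) zero = ≡.refl
  coeff-proj s (a ∷ p) (suc n) = coeff-proj s p n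

  opaque
    unfolding k._+ₚ_ k.const

    proj-+ : ∀ s p r → proj s (p k.+ r) ≡ Fs._+_ s (proj s p) (proj s r)
    proj-+ s [] r = ≡.refl
    proj-+ s (a ∷ p) [] = ≡.refl
    proj-+ s (a ∷ p) (b ∷ r) = cong (_ ∷_) (proj-+ s p r)

    proj-neg : ∀ s p → proj s (k.- p) ≡ Fs.-_ s (proj s p)
    proj-neg s [] = ≡.refl
    proj-neg s (a ∷ p) = cong (_ ∷_) (proj-neg s p)

    proj-scale : ∀ s c p → proj s (k.scale c p) ≡ Fs.scale s (c s) (proj s p)
    proj-scale s c [] = ≡.refl
    proj-scale s c (a ∷ p) = cong (_ ∷_) (proj-scale s c p)

    proj-* : ∀ s p r → proj s (p k.* r) ≡ Fs._*_ s (proj s p) (proj s r)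
    proj-* s [] r = ≡.refl
    proj-* s (a ∷ p) r = ≡.trans (proj-+ s (k.scale a r) (0ᴳ ∷ (p k.* r))) (cong₂ (Fs._+_ s) (proj-scale s a r) (cong (_ ∷_) (proj-* s p r)))

    proj-const : ∀ s c → proj s (k.const c) ≡ Fs.const s (c s)
    proj-const s c = ≡.refl

    proj-t- : ∀ s a → proj s (k.t- a) ≡ Fs.t- s (a s)
    proj-t- s a = ≡.refl

    proj-derivative : ∀ s p → proj s (k.derivative p) ≡ Fs.derivative s (proj s p)
    proj-derivative s [] = ≡.refl
    proj-derivative s (a ∷ p) = ≡.trans (proj-+ s p (0ᴳ ∷ k.derivative p)) (cong (Fs._+_ s (proj s p)) (cong (_ ∷_) (proj-derivative s p)))

  proj-eval : ∀ s x p → k.eval x p s ≡ Fs.eval s (x s) (proj s p)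
  proj-eval s x [] = ≡.refl
  proj-eval s x (a ∷ p) = cong (λ z → F._+_ s (a s) (F._*_ s (x s) z)) (proj-eval s x p)

  -- The lists have finite length, so finitely many coefficient equations, hence finitely many
  -- intersections, imply all of them.
  down : ∀ {p r} → p k.≈ r → U (λ s → Fs._≈_ s (proj s p) (proj s r))
  down {[]} {[]} e = always (λ s → Fs.refl s)
  down {[]} {b ∷ r} e = U-map₂ (λ s h t → Fs.mk≈ λ { zero → h ; (suc n) → Fs.at t n }) (k.at e 0) (down {[]} {r} (k.mk≈ λ n → k.at e (suc n)))
  down {a ∷ p} {[]} e = U-map₂ (λ s h t → Fs.mk≈ λ { zero → h ; (suc n) → Fs.at t n }) (k.at e 0) (down {p} {[]} (k.mk≈ λ n → k.at e (suc n)))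
  down {a ∷ p} {b ∷ r} e = U-map₂ (λ s → Fs.∷-cong s) (k.at e 0) (down (k.∷-tail e))

  up : ∀ {p r} → U (λ s → Fs._≈_ s (proj s p) (proj s r)) → p k.≈ r
  up {p} {r} u = k.mk≈ λ n → upward (λ s e → ≡.trans (≡.sym (coeff-proj s p n)) (≡.trans (Fs.at e n) (coeff-proj s r n))) u

  down-Deg< : ∀ {n} p → k.Deg< n p → U (λ s → Fs.Deg< s n (proj s p))
  down-Deg< [] d = always (λ s → Fs.Deg<-0 s)
  down-Deg< {zero} (a ∷ p) d = upward (λ s e → Fs.≈0⇒Deg< s e) (down (k.Deg<0⇒≈0 d))
  down-Deg< {suc n} (a ∷ p) d = upward (λ s e → Fs.Deg<-∷ s e) (down-Deg< p (k.Deg<-tail d))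

  down-Degree : ∀ {p n} → k.Degree p n → U (λ s → Fs.Degree s (proj s p) n)
  down-Degree {p} {n} d = U-map₂ (λ s l b → Fs.degree (λ z → l (≡.trans (≡.sym (coeff-proj s p n)) z)) b) (U-¬ (k.lead≉0 d)) (down-Deg< p (k.bound d))

  down-Coprime : ∀ {p r} → k.Coprime p r → U (λ s → Fs.Coprime s (proj s p) (proj s r))
  down-Coprime {p} {r} (u , v , e) = upward (λ s h → proj s u , proj s v , Fs.trans s (Fs.reflexive s (≡.sym (≡.trans (proj-+ s (u k.* p) (v k.* r)) (cong₂ (Fs._+_ s) (proj-* s u p) (proj-* s v r))))) h) (down e)

  -- The common length N is essential: only families of uniformly bounded degree assemble into a
  -- polynomial over the ultraproduct.
  liftPoly : ∀ N → (∀ s → Vec (Fin (q s)) N) → k.Poly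
  liftPoly zero v = []
  liftPoly (suc N) v = (λ s → Vec.head (v s)) ∷ liftPoly N (λ s → Vec.tail (v s))

  proj-lift : ∀ s N v → proj s (liftPoly N v) ≡ toList (v s)
  proj-lift s zero v with v s
  ... | [] = ≡.refl
  proj-lift s (suc N) v = ≡.trans (cong (Vec.head (v s) ∷_) (proj-lift s N (λ s → Vec.tail (v s)))) (cons (v s))
    where
    cons : (x : Vec (Fin (q s)) (suc N)) → Vec.head x ∷ toList (Vec.tail x) ≡ toList x
    cons (a ∷ x) = ≡.refl

  Deg<-lift : ∀ N v → k.Deg< N (liftPoly N v)
  Deg<-lift zero v = k.Deg<-0
  Deg<-lift (suc N) v = k.Deg<-∷ (Deg<-lift N _)

  zeroVec : ∀ s N → Vec (Fin (q s)) N
  zeroVec s N = Vec.replicate N (F.0# s)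

  -- Factors of degree at most deg P - 1 are vectors of fixed length. If almost all projections of P
  -- were reducible, the factors would assemble into a factorization of P itself.
  down-Prime : ∀ {P p} → k.Prime P → k.Degree P (suc p) → U (λ s → Fs.Prime s (proj s P))
  down-Prime {P} {p} π dP = U-map₂ (λ s n d → Fs.NoFactor⇒Prime s d (Fs.¬factor⇒NoFactor s n)) irreducible (down-Degree dP)
    where
    Factor : ∀ s → Vec (Fin (q s)) (suc p) × Vec (Fin (q s)) (suc p) → Set
    Factor s (u , v) = Fs._≈_ s (proj s P) (Fs._*_ s (toList u) (toList v))
    ∃Factor : S → Set
    ∃Factor s = ∃₂ λ (u v : Vec (Fin (q s)) (suc p)) → Fs._≈_ s (proj s P) (Fs._*_ s (toList u) (toList v))
    dec : ∀ s → Dec (∃ (Factor s))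
    dec s with Fs.factor? s (proj s P) (suc p)
    ... | yes (u , v , e) = yes ((u , v) , e)
    ... | no n = no λ ((u , v) , e) → n (u , v , e)
    reducible : U ∃Factor → ⊥
    reducible u with choose (λ s → Vec (Fin (q s)) (suc p) × Vec (Fin (q s)) (suc p)) (λ s → zeroVec s (suc p) , zeroVec s (suc p)) Factor dec (upward (λ s (u , v , e) → (u , v) , e) u)
    ... | f , h = contra (k.Prime-∣* π (k.∣-cong P≈ k.∣-refl))
      where
      A B : k.Poly
      A = liftPoly (suc p) (λ s → proj₁ (f s))
      B = liftPoly (suc p) (λ s → proj₂ (f s))
      P≈ : P k.≈ A k.* B
      P≈ = up (upward (λ s e → Fs.trans s e (Fs.reflexive s (≡.sym (≡.trans (proj-* s A B) (cong₂ (Fs._*_ s) (proj-lift s (suc p) (λ s → proj₁ (f s))) (proj-lift s (suc p) (λ s → proj₂ (f s)))))))) h)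
      small : ∀ {C} → k.Deg< (suc p) C → P k.∣ C → C k.≈ k.0#
      small {C} d (r , e) = k.trans e (k.trans (k.*-congˡ (k.Deg<0⇒≈0 (k.Deg<-quotient dP (subst (λ n → k.Deg< n (P k.* r)) (≡.sym (ℕₚ.+-identityʳ (suc p))) (k.Deg<-cong e d))))) (k.zeroʳ P))
      contra : P k.∣ A ⊎ P k.∣ B → ⊥
      contra (inj₁ d) = k.Prime-≉0 π (k.trans P≈ (k.trans (k.*-congʳ (small (Deg<-lift (suc p) (λ s → proj₁ (f s))) d)) (k.zeroˡ B)))
      contra (inj₂ d) = k.Prime-≉0 π (k.trans P≈ (k.trans (k.*-congˡ (small (Deg<-lift (suc p) (λ s → proj₂ (f s))) d)) (k.zeroʳ A)))
    irreducible : U (λ s → ¬ ∃Factor s)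
    irreducible = U-¬ reducible

-- Solutions over the ultraproduct.

module OverUltraproduct {S : Set} (D : Ultrafilter S) (q : S → ℕ) (F : ∀ s → FiniteField (q s))
                        (unbounded : ∀ m → Ultrafilter.U D (λ s → m < q s)) where
  open UltraField D q F
  private
    module F s = FiniteField (F s)
    module Sq s = Squares (F s)

  Two≡0 : S → Set
  Two≡0 s = F._+_ s (F.1# s) (F.1# s) ≡ F.0# s

  module Odd (odd : U (λ s → ¬ Two≡0 s)) {P p} (dP : k.Degree P (suc p)) (monic : k.coeff P (suc p) ≈ 1ᴳ) (π : k.Prime P) where

    down-monic : U (λ s → Fs.coeff s (proj s P) (suc p) ≡ F.1# s)
    down-monic = upward (λ s e → ≡.trans (coeff-proj s P (suc p)) e) monic

    NonSquareAt : GF → Set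
    NonSquareAt a = U (λ s → ¬ Sq.IsSq s (k.eval a P s))

    -- Prescribes the sign `false` for the single prime P. The threshold depends only on the degree
    -- of P, so almost every field exceeds it.
    nonSquarePoint : ∃ NonSquareAt
    nonSquarePoint = finish (choose (λ s → Fin (q s)) F.0# (λ s a → ¬ Sq.IsSq s (Fs.eval s a (proj s P))) (λ s → Finₚ.any? (λ a → ¬? (Sq.isSq? s (Fs.eval s a (proj s P)))))
        (upward (λ s (o , d , pr , l) → exists s o d pr l) (inter odd (inter (down-Degree dP) (inter (down-Prime π dP) (unbounded (signBound (suc p) 1)))))))
      where
      exists : ∀ s → ¬ Two≡0 s → Fs.Degree s (proj s P) (suc p) → Fs.Prime s (proj s P) → signBound (suc p) 1 < q s → ∃ λ a → ¬ Sq.IsSq s (Fs.eval s a (proj s P))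
      exists s o d pr l = go (Sq.Odd.prescribed-signs s o (suc p) 1 l {proj s P ∷ []} (FiniteFieldPoly.cons pr (Fs.Prime-∤1 s pr) FiniteFieldPoly.[]) (s≤s z≤n) (Fs.Deg<-cong s (Fs.sym s (Fs.*-identityʳ s _)) (Fs.bound d)) (false ∷ []) ≡.refl)
        where
        go : (∃ λ a → ¬ (Fs.eval s a (Fs._*_ s (proj s P) (Fs.1# s)) ≡ F.0# s) × Counting.Matches a ((Sq.Odd.signOf s o (proj s P) , false) ∷ [])) → ∃ λ a → ¬ Sq.IsSq s (Fs.eval s a (proj s P))
        go (a , _ , e Counting.∷ Counting.[]) = a , Sq.false-sq s e
      finish : (Σ (∀ s → Fin (q s)) λ f → U (λ s → ¬ Sq.IsSq s (Fs.eval s (f s) (proj s P)))) → ∃ NonSquareAt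
      finish (a , h) = a , upward (λ s n sq → n (subst (Sq.IsSq s) (proj-eval s a P) sq)) h

    module _ (a₀ : GF) (ns : NonSquareAt a₀) where
      Soluble : k.Poly → Set
      Soluble c = ∃ λ z → ∃ λ x → ∃₂ λ y w → z k.* z k.+ k.t- a₀ k.* (x k.* x k.- P k.* (y k.* y)) k.≈ c k.* (w k.* w) × ¬ (w k.≈ k.0#)

      -- Both the degree bound N of the solution and the required field size depend only on deg c
      -- and deg P. The search over vectors of length N is decidable at each index, so `choose`
      -- applies.
      soluble : ∀ {c n} → k.Degree c n → k.Coprime P c → ¬ (k.eval a₀ c ≈ 0ᴳ) → U (λ s → Sq.IsSq s (k.eval a₀ c s)) → Soluble c
      soluble {c} {n} dc cop ca₀≉0 ca₀-sq = finish (choose Quad (λ s → zeroVec s N , zeroVec s N , zeroVec s N , zeroVec s N) Good dec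
          (upward (λ s (o , d , m , pr , n′ , d′ , c′ , z , sq , l) → at-s s o d m pr n′ d′ c′ z sq l)
            (inter odd (inter (down-Degree dP) (inter down-monic (inter (down-Prime π dP) (inter ns (inter (down-Degree dc) (inter (down-Coprime cop) (inter (U-¬ ca₀≉0) (inter ca₀-sq (unbounded (signBound (n ℕ.+ suc p) (suc n))))))))))))))
        where
        N : ℕ
        N = suc n ℕ.+ suc n ℕ.+ suc p
        Quad : S → Set
        Quad s = Vec (Fin (q s)) N × Vec (Fin (q s)) N × Vec (Fin (q s)) N × Vec (Fin (q s)) N
        Equation : ∀ s → (z x y w : List (Fin (q s))) → Set
        Equation s z x y w = Fs._≈_ s (Fs._+_ s (Fs._*_ s z z) (Fs._*_ s (Fs.t- s (a₀ s)) (Fs._-_ s (Fs._*_ s x x) (Fs._*_ s (proj s P) (Fs._*_ s y y))))) (Fs._*_ s (proj s c) (Fs._*_ s w w))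
        Good : ∀ s → Quad s → Set
        Good s (z , x , y , w) = Equation s (toList z) (toList x) (toList y) (toList w) × ¬ Fs._≈_ s (toList w) (Fs.0# s)
        dec : ∀ s → Dec (∃ (Good s))
        dec s = map′ (λ (z , x , y , w , g) → (z , x , y , w) , g) (λ ((z , x , y , w) , g) → z , x , y , w , g)
          (anyVec? N λ z → anyVec? N λ x → anyVec? N λ y → anyVec? N λ w → Fs._≟ₚ_ s _ _ ×-dec ¬? (Fs._≟ₚ_ s (toList w) (Fs.0# s)))
        at-s : ∀ s → ¬ Two≡0 s → Fs.Degree s (proj s P) (suc p) → Fs.coeff s (proj s P) (suc p) ≡ F.1# s → Fs.Prime s (proj s P) → ¬ Sq.IsSq s (k.eval a₀ P s) →
          Fs.Degree s (proj s c) n → Fs.Coprime s (proj s P) (proj s c) → ¬ (k.eval a₀ c s ≡ F.0# s) → Sq.IsSq s (k.eval a₀ c s) → signBound (n ℕ.+ suc p) (suc n) < q s → ∃ (Good s)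
        at-s s o d m pr n′ d′ c′ z sq l = go (OddSolvability.oddSolution (F s) o d m pr (a₀ s) (λ r → n′ (subst (Sq.IsSq s) (≡.sym (proj-eval s a₀ P)) r)) d′ (Fs.Coprime⇒∤ s pr c′)
            (λ e → z (≡.trans (proj-eval s a₀ c) e)) (subst (Sq.IsSq s) (proj-eval s a₀ c) sq) l)
          where
          go : OddSolution (F s) (proj s P) (proj s c) (a₀ s) N → ∃ (Good s)
          go r = (Fs.truncate s N z′ , Fs.truncate s N x′ , Fs.truncate s N y′ , Fs.truncate s N w′)
            , Fs.trans s (Fs.+-cong s (Fs.*-cong s tz tz) (Fs.*-congˡ s (Fs.+-cong s (Fs.*-cong s tx tx) (Fs.-‿cong s (Fs.*-congˡ s (Fs.*-cong s ty ty)))))) (Fs.trans s (OddSolution.equation r) (Fs.*-congˡ s (Fs.*-cong s (Fs.sym s tw) (Fs.sym s tw))))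
            , (λ e → OddSolution.w≉0 r (Fs.trans s (Fs.sym s tw) e))
            where
            z′ x′ y′ w′ : List (Fin (q s))
            z′ = OddSolution.z r
            x′ = OddSolution.x r
            y′ = OddSolution.y r
            w′ = OddSolution.w r
            tz : Fs._≈_ s (toList (Fs.truncate s N z′)) z′
            tz = Fs.truncate-≈ s N z′ (OddSolution.Deg<-z r)
            tx : Fs._≈_ s (toList (Fs.truncate s N x′)) x′
            tx = Fs.truncate-≈ s N x′ (OddSolution.Deg<-x r)
            ty : Fs._≈_ s (toList (Fs.truncate s N y′)) y′
            ty = Fs.truncate-≈ s N y′ (OddSolution.Deg<-y r)
            tw : Fs._≈_ s (toList (Fs.truncate s N w′)) w′
            tw = Fs.truncate-≈ s N w′ (OddSolution.Deg<-w r)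
        finish : (Σ (∀ s → Quad s) λ f → U (λ s → Good s (f s))) → Soluble c
        finish (f , h) = Z , X , Y , W , up (upward (λ s (e , _) → equation s e) h) , λ e → U-contradiction (U-map₂ (λ s (_ , n) z → n (subst (λ v → Fs._≈_ s v (Fs.0# s)) (proj-lift s N w) z)) h (down e)) (always (λ s ()))
          where
          z x y w : ∀ s → Vec (Fin (q s)) N
          z s = proj₁ (f s)
          x s = proj₁ (proj₂ (f s))
          y s = proj₁ (proj₂ (proj₂ (f s)))
          w s = proj₂ (proj₂ (proj₂ (f s)))
          Z X Y W : k.Poly
          Z = liftPoly N z
          X = liftPoly N x
          Y = liftPoly N y
          W = liftPoly N w
          sq : ∀ s v → proj s (liftPoly N v k.* liftPoly N v) ≡ Fs._*_ s (toList (v s)) (toList (v s))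
          sq s v = ≡.trans (proj-* s (liftPoly N v) (liftPoly N v)) (cong₂ (Fs._*_ s) (proj-lift s N v) (proj-lift s N v))
          equation : ∀ s → Equation s (toList (z s)) (toList (x s)) (toList (y s)) (toList (w s)) → Fs._≈_ s (proj s (Z k.* Z k.+ k.t- a₀ k.* (X k.* X k.- P k.* (Y k.* Y)))) (proj s (c k.* (W k.* W)))
          equation s e = subst₂ (Fs._≈_ s)
            (≡.sym (≡.trans (proj-+ s (Z k.* Z) _) (cong₂ (Fs._+_ s) (sq s z) (≡.trans (proj-* s (k.t- a₀) _) (cong₂ (Fs._*_ s) (proj-t- s a₀) (≡.trans (proj-+ s (X k.* X) _) (cong₂ (Fs._+_ s) (sq s x) (≡.trans (proj-neg s (P k.* (Y k.* Y))) (cong (Fs.-_ s) (≡.trans (proj-* s P (Y k.* Y)) (cong (Fs._*_ s (proj s P)) (sq s y))))))))))))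
            (≡.sym (≡.trans (proj-* s c (W k.* W)) (cong (Fs._*_ s (proj s c)) (sq s w)))) e

  module Even (even : U Two≡0) where

    AS : ∀ s → Fin (q s) → Set
    AS s x = ∃ λ r → F._+_ s (F._*_ s r r) r ≡ x

    AS? : ∀ s x → Dec (AS s x)
    AS? s x = Finₚ.any? (λ r → F._+_ s (F._*_ s r r) r Finₚ.≟ x)

    sqrtᵏ : ∀ x → ∃ λ r → r *ᴳ r ≈ x
    sqrtᵏ x = choose (λ s → Fin (q s)) F.0# (λ s r → F._*_ s r r ≡ x s) (λ s → Finₚ.any? (λ r → F._*_ s r r Finₚ.≟ x s))
      (upward (λ s e → ArtinSchreier.sqrtᶠ (F s) e (x s)) even)

    inertConstant : Σ GF λ u → U (λ s → ¬ AS s (u s))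
    inertConstant = choose (λ s → Fin (q s)) F.0# (λ s u → ¬ AS s u) (λ s → Finₚ.any? (λ u → ¬? (AS? s u))) (upward (λ s e → ArtinSchreier.not-surjective (F s) e) even)

    -- The curves with coefficients 1, e and 1 + e must all have nonzero coefficient. Such an e is a
    -- nonroot of t (t + 1), which exists once q > 2.
    thirdConstant : Σ GF λ e → ¬ (e ≈ 0ᴳ) × ¬ (1ᴳ +ᴳ e ≈ 0ᴳ)
    thirdConstant = finish (choose (λ s → Fin (q s)) F.0# (λ s e → ¬ (e ≡ F.0# s) × ¬ (F._+_ s (F.1# s) e ≡ F.0# s)) (λ s → Finₚ.any? (λ e → ¬? (e Finₚ.≟ F.0# s) ×-dec ¬? (F._+_ s (F.1# s) e Finₚ.≟ F.0# s)))
        (U-map₂ exists even (unbounded 2)))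
      where
      exists : ∀ s → Two≡0 s → 2 < q s → ∃ λ e → ¬ (e ≡ F.0# s) × ¬ (F._+_ s (F.1# s) e ≡ F.0# s)
      exists s t l = go (EvenSolvability.non-root (F s) t {Fs._*_ s (Fs.t- s (F.0# s)) (Fs.t- s (Fs.K.-_ s (F.1# s)))} (Fs.Degree⇒≉0 s two) (Fs.Deg<-mono s l (Fs.bound two)))
        where
        two : Fs.Degree s (Fs._*_ s (Fs.t- s (F.0# s)) (Fs.t- s (Fs.K.-_ s (F.1# s)))) 2
        two = Fs.Degree-* s (Fs.Degree-t- s _) (Fs.Degree-t- s _)
        go : (∃ λ a → ¬ (Fs.eval s a (Fs._*_ s (Fs.t- s (F.0# s)) (Fs.t- s (Fs.K.-_ s (F.1# s)))) ≡ F.0# s)) → ∃ λ e → ¬ (e ≡ F.0# s) × ¬ (F._+_ s (F.1# s) e ≡ F.0# s)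
        go (a , n) = a
          , (λ z → n (Fs.∣⇒root s (Fs.∣-cong s (Fs.*-comm s _ _) (Fs.∣-cong s (Fs.*-congˡ s (Fs.+-congˡ s (Fs.-‿cong s (Fs.const-cong s z)))) (Fs.∣-*ˡ s _ (Fs.∣-refl s))))))
          , (λ z → n (Fs.∣⇒root s (Fs.∣-cong s (Fs.*-congˡ s (Fs.+-congˡ s (Fs.-‿cong s (Fs.const-cong s (minus z))))) (Fs.∣-*ˡ s _ (Fs.∣-refl s)))))
          where
          minus : F._+_ s (F.1# s) a ≡ F.0# s → a ≡ Fs.K.-_ s (F.1# s)
          minus z = Fs.Kₗ.x-y≈0⇒x≈y s (≡.trans (cong (F._+_ s a) (-involutive s)) (≡.trans (Fs.K.+-comm s a (F.1# s)) z))
            where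
            -involutive : ∀ s → Fs.K.-_ s (Fs.K.-_ s (F.1# s)) ≡ F.1# s
            -involutive s = RP.-‿involutive (F.1# s)
              where
              import Algebra.Properties.Ring as APR
              module RP = APR (Fs.K.ring s)
      finish : (Σ GF λ e → U (λ s → ¬ (e s ≡ F.0# s) × ¬ (F._+_ s (F.1# s) (e s) ≡ F.0# s))) → Σ GF λ e → ¬ (e ≈ 0ᴳ) × ¬ (1ᴳ +ᴳ e ≈ 0ᴳ)
      finish (e , h) = e , (λ z → U-contradiction z (upward (λ s → proj₁) h)) , (λ z → U-contradiction z (upward (λ s → proj₂) h))

    OnCurve : GF → GF → GF → Set
    OnCurve e x y = (y *ᴳ y +ᴳ y +ᴳ -ᴳ (x *ᴳ x *ᴳ x)) *ᴳ (y *ᴳ y +ᴳ y +ᴳ -ᴳ (e *ᴳ (x *ᴳ x *ᴳ x))) *ᴳ (y *ᴳ y +ᴳ y +ᴳ -ᴳ ((1ᴳ +ᴳ e) *ᴳ (x *ᴳ x *ᴳ x))) ≈ 0ᴳ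

    onCurveᵏ : ∀ e x → ∃ (OnCurve e x)
    onCurveᵏ e x = choose (λ s → Fin (q s)) F.0# _ (λ s → Finₚ.any? (λ y → _ Finₚ.≟ F.0# s)) (upward (λ s t → ArtinSchreier.onCurve (F s) t (e s) (x s)) even)

    record Solution (P c : k.Poly) (u : GF) : Set where
      field
        a β i r : GF
        z w : k.Poly
        inverse : i *ᴳ k.eval a P ≈ 1ᴳ
        inert : r *ᴳ r +ᴳ r +ᴳ u ≈ β *ᴳ (i *ᴳ k.eval a (k.derivative P))
        equation : k.t- a k.* (z k.* z k.+ z k.* w) k.+ k.const β k.* (w k.* w) k.≈ k.t- a k.* c

    -- The constants a, β, i, r are part of the searched tuple, so they become elements of the
    -- ultraproduct together with z and w.
    soluble : ∀ {P p} → k.Degree P (suc p) → k.Prime P → ∀ u → U (λ s → ¬ AS s (u s)) → ∀ {c n} → k.Degree c n → k.Coprime P c → Solution P c u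
    soluble {P} {p} dP π u u-ns {c} {n} dc cop = finish (choose T (λ s → F.0# s , F.0# s , F.0# s , F.0# s , zeroVec s N , zeroVec s N) Good dec
        (upward (λ s (t , d , pr , n′ , d′ , c′ , l) → at-s s t d pr n′ d′ c′ l) (inter even (inter (down-Degree dP) (inter (down-Prime π dP) (inter u-ns (inter (down-Degree dc) (inter (down-Coprime cop) (unbounded (evenBound n p))))))))))
      where
      N : ℕ
      N = suc n ℕ.+ n ℕ.+ 1
      T : S → Set
      T s = Fin (q s) × Fin (q s) × Fin (q s) × Fin (q s) × Vec (Fin (q s)) N × Vec (Fin (q s)) N
      Equation : ∀ s → (a β : Fin (q s)) (z w : List (Fin (q s))) → Set
      Equation s a β z w = Fs._≈_ s (Fs._+_ s (Fs._*_ s (Fs.t- s a) (Fs._+_ s (Fs._*_ s z z) (Fs._*_ s z w))) (Fs._*_ s (Fs.const s β) (Fs._*_ s w w))) (Fs._*_ s (Fs.t- s a) (proj s c))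
      Inverse : ∀ s → (a i : Fin (q s)) → Set
      Inverse s a i = F._*_ s i (Fs.eval s a (proj s P)) ≡ F.1# s
      Inert : ∀ s → (a β i r : Fin (q s)) → Set
      Inert s a β i r = F._+_ s (F._+_ s (F._*_ s r r) r) (u s) ≡ F._*_ s β (F._*_ s i (Fs.eval s a (Fs.derivative s (proj s P))))
      Good : ∀ s → T s → Set
      Good s (a , β , i , r , z , w) = Inverse s a i × Inert s a β i r × Equation s a β (toList z) (toList w)
      dec : ∀ s → Dec (∃ (Good s))
      dec s = map′ (λ (a , β , i , r , z , w , g) → (a , β , i , r , z , w) , g) (λ ((a , β , i , r , z , w) , g) → a , β , i , r , z , w , g)
        (Finₚ.any? λ a → Finₚ.any? λ β → Finₚ.any? λ i → Finₚ.any? λ r → anyVec? N λ z → anyVec? N λ w → (_ Finₚ.≟ _) ×-dec ((_ Finₚ.≟ _) ×-dec Fs._≟ₚ_ s _ _))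
      at-s : ∀ s → Two≡0 s → Fs.Degree s (proj s P) (suc p) → Fs.Prime s (proj s P) → ¬ AS s (u s) → Fs.Degree s (proj s c) n → Fs.Coprime s (proj s P) (proj s c) → evenBound n p < q s → ∃ (Good s)
      at-s s t d pr n′ d′ c′ l = go (EvenSolvability.evenSolution (F s) t (u s) n′ d pr d′ (Fs.Coprime⇒∤ s pr c′) l)
        where
        go : EvenSolution (F s) (proj s P) (proj s c) (u s) N → ∃ (Good s)
        go r = (EvenSolution.a r , EvenSolution.β r , EvenSolution.i r , EvenSolution.r r , Fs.truncate s N z′ , Fs.truncate s N w′) , EvenSolution.inverse r , EvenSolution.inert r ,
          Fs.trans s (Fs.+-cong s (Fs.*-congˡ s (Fs.+-cong s (Fs.*-cong s tz tz) (Fs.*-cong s tz tw))) (Fs.*-congˡ s (Fs.*-cong s tw tw))) (EvenSolution.equation r)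
          where
          z′ w′ : List (Fin (q s))
          z′ = EvenSolution.z r
          w′ = EvenSolution.w r
          tz : Fs._≈_ s (toList (Fs.truncate s N z′)) z′
          tz = Fs.truncate-≈ s N z′ (EvenSolution.Deg<-z r)
          tw : Fs._≈_ s (toList (Fs.truncate s N w′)) w′
          tw = Fs.truncate-≈ s N w′ (EvenSolution.Deg<-w r)
      finish : (Σ (∀ s → T s) λ f → U (λ s → Good s (f s))) → Solution P c u
      finish (f , h) = record
        { a = a ; β = β ; i = i ; r = r ; z = Z ; w = W
        ; inverse = upward (λ s (e , _ , _) → ≡.trans (cong (F._*_ s (i s)) (proj-eval s a P)) e) h
        ; inert = upward (λ s (_ , e , _) → ≡.trans e (cong (λ x → F._*_ s (β s) (F._*_ s (i s) x)) (≡.sym (≡.trans (proj-eval s a (k.derivative P)) (cong (Fs.eval s (a s)) (proj-derivative s P)))))) h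
        ; equation = up (upward (λ s (_ , _ , e) → equation s e) h) }
        where
        a β i r : GF
        a s = proj₁ (f s)
        β s = proj₁ (proj₂ (f s))
        i s = proj₁ (proj₂ (proj₂ (f s)))
        r s = proj₁ (proj₂ (proj₂ (proj₂ (f s))))
        z w : ∀ s → Vec (Fin (q s)) N
        z s = proj₁ (proj₂ (proj₂ (proj₂ (proj₂ (f s)))))
        w s = proj₂ (proj₂ (proj₂ (proj₂ (proj₂ (f s)))))
        Z W : k.Poly
        Z = liftPoly N z
        W = liftPoly N w
        prod : ∀ s v v′ → proj s (liftPoly N v k.* liftPoly N v′) ≡ Fs._*_ s (toList (v s)) (toList (v′ s))
        prod s v v′ = ≡.trans (proj-* s (liftPoly N v) (liftPoly N v′)) (cong₂ (Fs._*_ s) (proj-lift s N v) (proj-lift s N v′))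
        equation : ∀ s → Equation s (a s) (β s) (toList (z s)) (toList (w s)) → Fs._≈_ s (proj s (k.t- a k.* (Z k.* Z k.+ Z k.* W) k.+ k.const β k.* (W k.* W))) (proj s (k.t- a k.* c))
        equation s e = subst₂ (Fs._≈_ s)
          (≡.sym (≡.trans (proj-+ s (k.t- a k.* (Z k.* Z k.+ Z k.* W)) _) (cong₂ (Fs._+_ s)
            (≡.trans (proj-* s (k.t- a) _) (cong₂ (Fs._*_ s) (proj-t- s a) (≡.trans (proj-+ s (Z k.* Z) (Z k.* W)) (cong₂ (Fs._+_ s) (prod s z z) (prod s z w)))))
            (≡.trans (proj-* s (k.const β) (W k.* W)) (cong₂ (Fs._*_ s) (proj-const s β) (prod s w w))))))
          (≡.sym (≡.trans (proj-* s (k.t- a) c) (cong (λ x → Fs._*_ s x (proj s c)) (proj-t- s a)))) e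

-- Recognizing constants in the rational function field.

module ConstantFractions (F : DecField) where
  open FieldPoly F
  open Fractions F
  open LocalIntegrality F
  module L = DecField fracField
  module Lₗ = FieldLemmas fracField
  module LS = SolverOver L.commRing
  module ι = RingHom embed
  open LS using () renaming (solve to solveᶠ) public
  module Ev = EvalOver constᶠ

  ⟨_⟩ : K.Carrier → Frac
  ⟨ a ⟩ = ⌜ const a ⌝

  module c = RingHom constᶠ

  ⟨⟩-1 : ⟨ K.1# ⟩ L.≈ L.1#
  ⟨⟩-1 = c.to-1

  ⟨⟩-0 : ⟨ K.0# ⟩ L.≈ L.0#
  ⟨⟩-0 = c.to-0

  ev-constant : ∀ a p → Ev.ev ⟨ a ⟩ p L.≈ ⟨ eval a p ⟩
  ev-constant a [] = L.sym ⟨⟩-0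
  ev-constant a (b ∷ p) = L.trans (L.+-congˡ (L.*-congˡ (ev-constant a p))) (L.sym (L.trans (c.to-+ b (a K.* eval a p)) (L.+-congˡ (c.to-* a (eval a p)))))

  -- Write r = A / B. If A had larger degree than B, nothing could cancel the leading term of A²;
  -- otherwise the coefficients of A and B at the degree of B have a constant solution as quotient.
  artinSchreier-constant : ∀ r u → r L.* r L.+ r L.≈ ⟨ u ⟩ → ∃ λ ρ → ρ K.* ρ K.+ ρ K.≈ u
  artinSchreier-constant r u eq = leading (≉0⇒Degree (den≉0 r))
    where
    A B : Poly
    A = num r
    B = den r
    poly : A * A + A * B ≈ const u * (B * B)
    poly = ⌜⌝-injective (begin
      ⌜ A * A + A * B ⌝ ≈⟨ L.trans (ι.to-+ (A * A) (A * B)) (L.+-cong (ι.to-* A A) (ι.to-* A B)) ⟩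
      ⌜ A ⌝ L.* ⌜ A ⌝ L.+ ⌜ A ⌝ L.* ⌜ B ⌝ ≈⟨ L.+-cong (L.*-cong (L.sym (clear r)) (L.sym (clear r))) (L.*-congʳ (L.sym (clear r))) ⟩
      r L.* ⌜ B ⌝ L.* (r L.* ⌜ B ⌝) L.+ r L.* ⌜ B ⌝ L.* ⌜ B ⌝ ≈⟨ solveᶠ 2 (λ r b → r :* b :* (r :* b) :+ r :* b :* b := (r :* r :+ r) :* (b :* b)) r ⌜ B ⌝ ⟩
      (r L.* r L.+ r) L.* (⌜ B ⌝ L.* ⌜ B ⌝) ≈⟨ L.*-cong eq (L.sym (ι.to-* B B)) ⟩
      ⟨ u ⟩ L.* ⌜ B * B ⌝ ≈⟨ L.sym (ι.to-* (const u) (B * B)) ⟩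
      ⌜ const u * (B * B) ⌝ ∎)
      where open import Relation.Binary.Reasoning.Setoid L.setoid
    module KS = SolverOver K.commRing
    leading : ∃ (Degree B) → ∃ λ ρ → ρ K.* ρ K.+ ρ K.≈ u
    leading (j , dB) = cases (degree? A)
      where
      b : K.Carrier
      b = coeff B j
      compare : Deg< (suc j) A → ∃ λ ρ → ρ K.* ρ K.+ ρ K.≈ u
      compare dA = go (Kₗ.divide (coeff A j) b (lead≉0 dB))
        where
        a : K.Carrier
        a = coeff A j
        top : a K.* a K.+ a K.* b K.≈ u K.* (b K.* b)
        top = K.trans (K.sym (K.trans (coeff-+ (A * A) (A * B) (j ℕ.+ j)) (K.+-cong (coeff-*-top j j A A dA dA) (coeff-*-top j j A B dA (bound dB)))))
          (K.trans (at poly (j ℕ.+ j)) (K.trans (at (const-* u (B * B)) (j ℕ.+ j)) (K.trans (coeff-scale u (B * B) (j ℕ.+ j)) (K.*-congˡ (coeff-*-top j j B B (bound dB) (bound dB))))))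
        go : (∃ λ ρ → ρ K.* b K.≈ a) → ∃ λ ρ → ρ K.* ρ K.+ ρ K.≈ u
        go (ρ , e) = ρ , Kₗ.cancelˡ (Kₗ.*≉0 (lead≉0 dB) (lead≉0 dB)) (K.trans (KS.solve 2 (λ r b → b :* b :* (r :* r :+ r) := r :* b :* (r :* b) :+ r :* b :* b) ρ b)
          (K.trans (K.+-cong (K.*-cong e e) (K.*-congʳ e)) (K.trans top (K.*-comm u (b K.* b)))))
      cases : A ≈ 0# ⊎ ∃ (Degree A) → ∃ λ ρ → ρ K.* ρ K.+ ρ K.≈ u
      cases (inj₁ z) = compare (≈0⇒Deg< z)
      cases (inj₂ (i , dA)) with i ℕₚ.≤? j
      ... | yes l = compare (Deg<-mono (s≤s l) (bound dA))
      ... | no l = ⊥-elim (Kₗ.*≉0 (lead≉0 dA) (lead≉0 dA) (K.trans (K.sym (coeff-*-top i i A A (bound dA) (bound dA)))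
          (K.trans (K.sym (K.+-identityʳ _)) (K.trans (K.+-congˡ (K.sym ab)) (K.trans (K.sym (coeff-+ (A * A) (A * B) (i ℕ.+ i))) (K.trans (at poly (i ℕ.+ i)) ubb))))))
        where
        j<i : j < i
        j<i = ≰⇒> l
        ab : coeff (A * B) (i ℕ.+ i) K.≈ K.0#
        ab = vanish (Deg<-* A (bound dA) (bound dB)) (i ℕ.+ i) (≤-trans (≤-reflexive (≡.sym (+-suc i j))) (+-monoʳ-≤ i j<i))
        ubb : coeff (const u * (B * B)) (i ℕ.+ i) K.≈ K.0#
        ubb = vanish (Deg<-* (const u) (Deg<-const u) (Deg<-* B (bound dB) (bound dB))) (i ℕ.+ i) (≤-trans (s≤s (+-monoʳ-≤ j (<⇒≤ j<i))) (ℕₚ.+-monoˡ-≤ i j<i))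

  module CharTwoConstants (2≈0 : K.1# K.+ K.1# K.≈ K.0#) (sqrt : ∀ x → ∃ λ s → s K.* s K.≈ x) where
    open PerfectCharTwo F 2≈0 sqrt
    open LinearSymbols F
    open import Relation.Binary.Reasoning.Setoid L.setoid

    twoᶠ : L.1# L.+ L.1# L.≈ L.0#
    twoᶠ = L.trans (L.sym (ι.to-+ 1# 1#)) (ι.to-cong two)

    twiceᶠ : ∀ x → (L.1# L.+ L.1#) L.* x L.≈ L.0#
    twiceᶠ x = L.trans (L.*-congʳ twoᶠ) (L.zeroˡ x)

    -- Over a common denominator M of x and y the equation becomes homogeneous of degree three, Y M
    -- (Y + M) = e X′³, the shape treated by `curve-constant`.
    curve⇒constant : ∀ e → ¬ (e K.≈ K.0#) → ∀ x y → y L.* y L.+ y L.- ⟨ e ⟩ L.* (x L.* x L.* x) L.≈ L.0# → ∃ λ δ → x L.≈ ⟨ δ ⟩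
    curve⇒constant e e≉0 x y eq = go (curve-constant Y M X′ e e≉0 M≉0 (⌜⌝-injective poly))
      where
      M X′ Y : Poly
      M = den y * den x
      X′ = num x * den y
      Y = num y * den x
      M≉0 : ¬ (M ≈ 0#)
      M≉0 = *≉0 (den≉0 y) (den≉0 x)
      m : Frac
      m = ⌜ M ⌝
      x≈ : x L.* m L.≈ ⌜ X′ ⌝
      x≈ = clear-as x (den y) (*-comm (den x) (den y))
      y≈ : y L.* m L.≈ ⌜ Y ⌝
      y≈ = clear-as y (den x) refl
      poly : ⌜ Y * M * (Y + M) ⌝ L.≈ ⌜ const e * (X′ * X′ * X′) ⌝
      poly = begin
        ⌜ Y * M * (Y + M) ⌝ ≈⟨ L.trans (ι.to-* (Y * M) (Y + M)) (L.*-cong (ι.to-* Y M) (ι.to-+ Y M)) ⟩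
        ⌜ Y ⌝ L.* m L.* (⌜ Y ⌝ L.+ m) ≈⟨ L.*-cong (L.*-congʳ (L.sym y≈)) (L.+-congʳ (L.sym y≈)) ⟩
        y L.* m L.* m L.* (y L.* m L.+ m) ≈⟨ solveᶠ 2 (λ y m → y :* m :* m :* (y :* m :+ m) := (y :* y :+ y) :* (m :* m :* m)) y m ⟩
        (y L.* y L.+ y) L.* (m L.* m L.* m) ≈⟨ L.*-congʳ (Lₗ.x-y≈0⇒x≈y eq) ⟩
        ⟨ e ⟩ L.* (x L.* x L.* x) L.* (m L.* m L.* m) ≈⟨ solveᶠ 3 (λ e x m → e :* (x :* x :* x) :* (m :* m :* m) := e :* (x :* m :* (x :* m) :* (x :* m))) ⟨ e ⟩ x m ⟩
        ⟨ e ⟩ L.* (x L.* m L.* (x L.* m) L.* (x L.* m)) ≈⟨ L.*-congˡ (L.*-cong (L.*-cong x≈ x≈) x≈) ⟩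
        ⟨ e ⟩ L.* (⌜ X′ ⌝ L.* ⌜ X′ ⌝ L.* ⌜ X′ ⌝) ≈⟨ L.sym (L.trans (ι.to-* (const e) _) (L.*-congˡ (L.trans (ι.to-* (X′ * X′) X′) (L.*-congʳ (ι.to-* X′ X′))))) ⟩
        ⌜ const e * (X′ * X′ * X′) ⌝ ∎
      go : (∃ λ δ → X′ ≈ const δ * M) → ∃ λ δ → x L.≈ ⟨ δ ⟩
      go (δ , h) = δ , Lₗ.cancelˡ {x = m} (λ z → M≉0 (⌜⌝-injective z)) (L.trans (L.*-comm m x) (L.trans x≈ (L.trans (ι.to-cong h) (L.trans (ι.to-* (const δ) M) (L.*-comm ⟨ δ ⟩ m)))))

    curves⇒constant : ∀ e → ¬ (e K.≈ K.0#) → ¬ (K.1# K.+ e K.≈ K.0#) → ∀ x y →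
      (y L.* y L.+ y L.- x L.* x L.* x) L.* (y L.* y L.+ y L.- ⟨ e ⟩ L.* (x L.* x L.* x)) L.* (y L.* y L.+ y L.- ⟨ K.1# K.+ e ⟩ L.* (x L.* x L.* x)) L.≈ L.0# →
      ∃ λ δ → x L.≈ ⟨ δ ⟩
    curves⇒constant e e≉0 1+e≉0 x y eq = [ (λ h → [ first , curve⇒constant e e≉0 x y ]′ (Lₗ.*≈0 h)) , curve⇒constant (K.1# K.+ e) 1+e≉0 x y ]′ (Lₗ.*≈0 eq)
      where
      first : y L.* y L.+ y L.- x L.* x L.* x L.≈ L.0# → ∃ λ δ → x L.≈ ⟨ δ ⟩
      first h = curve⇒constant K.1# K.1≉0 x y (L.trans (L.+-congˡ (L.-‿cong (L.trans (L.*-congʳ ⟨⟩-1) (L.*-identityˡ _)))) h)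

    negate : ∀ x → L.- x L.≈ x
    negate x = L.trans (solveᶠ 1 (λ x → :- x := x :- (:1 :+ :1) :* x) x) (L.trans (L.+-congˡ (L.-‿cong (twiceᶠ x))) (solveᶠ 1 (λ x → x :- :0 := x) x))

    module _ {P m} (dP : Degree P m) (π : Prime P) (u : K.Carrier) (u-ns : ¬ (∃ λ ρ → ρ K.* ρ K.+ ρ K.≈ u)) (a β : K.Carrier) (i r : Frac)
             (inverse : i L.* ⟨ eval a P ⟩ L.≈ L.1#) (inert : r L.* r L.+ r L.+ ⟨ u ⟩ L.≈ ⟨ β ⟩ L.* (i L.* ⟨ eval a (derivative P) ⟩)) where
      private
        Pa≉0 : ¬ (eval a P K.≈ K.0#)
        Pa≉0 z = L.1≉0 (L.trans (L.sym inverse) (L.trans (L.*-congˡ (L.trans (c.to-cong z) ⟨⟩-0)) (L.zeroʳ i)))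

        -- The map r ↦ r² + r is additive in characteristic two, so r - ρ would solve r² + r = u
        -- over the function field, hence over the constants.
        difference : ∀ ρ → r L.* r L.+ r L.+ ⟨ u ⟩ L.≈ ⟨ ρ ⟩ L.* ⟨ ρ ⟩ L.+ ⟨ ρ ⟩ → ⊥
        difference ρ e = u-ns (artinSchreier-constant (r L.- ⟨ ρ ⟩) u (begin
          (r L.- ⟨ ρ ⟩) L.* (r L.- ⟨ ρ ⟩) L.+ (r L.- ⟨ ρ ⟩)
            ≈⟨ solveᶠ 3 (λ r s u → (r :- s) :* (r :- s) :+ (r :- s) := ((r :* r :+ r :+ u) :- (s :* s :+ s)) :+ (:1 :+ :1) :* (s :* s :- r :* s) :+ :- u) r ⟨ ρ ⟩ ⟨ u ⟩ ⟩
          ((r L.* r L.+ r L.+ ⟨ u ⟩) L.- (⟨ ρ ⟩ L.* ⟨ ρ ⟩ L.+ ⟨ ρ ⟩)) L.+ (L.1# L.+ L.1#) L.* (⟨ ρ ⟩ L.* ⟨ ρ ⟩ L.- r L.* ⟨ ρ ⟩) L.+ L.- ⟨ u ⟩ ≈⟨ L.+-cong (L.+-cong (Lₗ.x≈y⇒x-y≈0 e) (twiceᶠ _)) (negate ⟨ u ⟩) ⟩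
          L.0# L.+ L.0# L.+ ⟨ u ⟩ ≈⟨ solveᶠ 1 (λ u → :0 :+ :0 :+ u := u) ⟨ u ⟩ ⟩
          ⟨ u ⟩ ∎))

        β≉0 : ¬ (β K.≈ K.0#)
        β≉0 z = difference K.0# (L.trans inert (L.trans (L.*-congʳ (L.trans (c.to-cong z) ⟨⟩-0)) (L.trans (L.zeroˡ _) (L.sym (L.trans (L.+-cong (L.trans (L.*-congʳ ⟨⟩-0) (L.zeroˡ _)) ⟨⟩-0) (L.+-identityˡ _))))))

      -- P(a) is invertible, so in t - a = P s the factor s would have to vanish at a, and P would
      -- be a unit.
      P∤t-a : ¬ (P ∣ t- a)
      P∤t-a (s , e) = finish (root⇒∣ s₀≈0)
        where
        s₀≈0 : eval a s K.≈ K.0#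
        s₀≈0 = [ (λ z → ⊥-elim (Pa≉0 z)) , (λ z → z) ]′ (Kₗ.*≈0 (K.trans (K.sym (eval-* a P s)) (K.trans (K.sym (eval-cong a e)) (eval-root a))))
        finish : t- a ∣ s → ⊥
        finish (d , f) = Prime-∤1 π (d , cancelˡ (Degree⇒≉0 (Degree-t- a)) (trans (*-identityʳ _) (trans e (trans (*-congˡ f) (solve 3 (λ p t d → p :* (t :* d) := t :* (p :* d)) P (t- a) d)))))

      -- A root modulo P yields, through the symbol at a, a constant ρ with ρ² + ρ = β P′(a) / P(a);
      -- the certificate r puts this value in the class of u.
      P-inert : ∀ θ → ¬ (P ∣ θ * θ + t- a * (θ + const β))
      P-inert θ d = go (artinSchreier-split 2≈0 dP a β β≉0 Pa≉0 θ d)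
        where
        go : (∃ λ ρ → (ρ K.* ρ K.+ ρ) K.* eval a P K.≈ β K.* eval a (derivative P)) → ⊥
        go (ρ , e) = difference ρ (begin
          r L.* r L.+ r L.+ ⟨ u ⟩ ≈⟨ inert ⟩
          ⟨ β ⟩ L.* (i L.* ⟨ eval a (derivative P) ⟩) ≈⟨ solveᶠ 3 (λ b i d → b :* (i :* d) := i :* (b :* d)) ⟨ β ⟩ i ⟨ eval a (derivative P) ⟩ ⟩
          i L.* (⟨ β ⟩ L.* ⟨ eval a (derivative P) ⟩) ≈⟨ L.*-congˡ (L.trans (L.sym (c.to-* β _)) (L.trans (c.to-cong (K.sym e)) (c.to-* (ρ K.* ρ K.+ ρ) (eval a P)))) ⟩
          i L.* (⟨ ρ K.* ρ K.+ ρ ⟩ L.* ⟨ eval a P ⟩) ≈⟨ solveᶠ 3 (λ i s p → i :* (s :* p) := s :* (i :* p)) i ⟨ ρ K.* ρ K.+ ρ ⟩ ⟨ eval a P ⟩ ⟩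
          ⟨ ρ K.* ρ K.+ ρ ⟩ L.* (i L.* ⟨ eval a P ⟩) ≈⟨ L.trans (L.*-congˡ inverse) (L.*-identityʳ _) ⟩
          ⟨ ρ K.* ρ K.+ ρ ⟩ ≈⟨ L.trans (c.to-+ (ρ K.* ρ) ρ) (L.+-congʳ (c.to-* ρ ρ)) ⟩
          ⟨ ρ ⟩ L.* ⟨ ρ ⟩ L.+ ⟨ ρ ⟩ ∎)

-- Semantics of formulas in the field of fractions.

module FormulaSemantics {S : Set} (D : Ultrafilter S) (q : S → ℕ) (F : ∀ s → FiniteField (q s)) where
  private module 𝒮 = Setting D q F
  open 𝒮 using (𝕂; _/_∶_; Term; QFFormula; var; par; _⊕_; _⊗_; ⊖_; _≐_; _∧ᶠ_; _∨ᶠ_; evalT; Sat; DiophantineWith)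
  open UltraField D q F
  open Fractions kField

  coeff≡ : ∀ p n → 𝒮.coeff p n ≡ k.coeff p n
  coeff≡ [] n = ≡.refl
  coeff≡ (a ∷ p) zero = ≡.refl
  coeff≡ (a ∷ p) (suc n) = coeff≡ p n

  ≈ₚ⇒≈ : ∀ {p r} → p 𝒮.≈ₚ r → p k.≈ r
  ≈ₚ⇒≈ {p} {r} e = k.mk≈ λ n → subst₂ _≈_ (coeff≡ p n) (coeff≡ r n) (e n)

  ≈⇒≈ₚ : ∀ {p r} → p k.≈ r → p 𝒮.≈ₚ r
  ≈⇒≈ₚ {p} {r} e n = subst₂ _≈_ (≡.sym (coeff≡ p n)) (≡.sym (coeff≡ r n)) (k.at e n)

  opaque
    unfolding k._+ₚ_ k.const

    +≡ : ∀ p r → p 𝒮.+ₚ r ≡ p k.+ r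
    +≡ [] r = ≡.refl
    +≡ (a ∷ p) [] = ≡.refl
    +≡ (a ∷ p) (b ∷ r) = cong (_ ∷_) (+≡ p r)

    neg≡ : ∀ p → 𝒮.-ₚ p ≡ k.- p
    neg≡ [] = ≡.refl
    neg≡ (a ∷ p) = cong (_ ∷_) (neg≡ p)

    scale≡ : ∀ c p → 𝒮.scale c p ≡ k.scale c p
    scale≡ c [] = ≡.refl
    scale≡ c (a ∷ p) = cong (_ ∷_) (scale≡ c p)

    *≡ : ∀ p r → p 𝒮.*ₚ r ≡ p k.* r
    *≡ [] r = ≡.refl
    *≡ (a ∷ p) r = ≡.trans (+≡ (𝒮.scale a r) _) (cong₂ k._+_ (scale≡ a r) (cong (_ ∷_) (*≡ p r)))

  toFrac : 𝕂 → Frac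
  toFrac (a / b ∶ b≢0) = frac a b (λ e → b≢0 (≈⇒≈ₚ e))

  fromFrac : Frac → 𝕂
  fromFrac x = num x / den x ∶ λ e → den≉0 x (≈ₚ⇒≈ e)

  ⟦_⟧ : ∀ {n} → Term n → Vec Frac n → Frac
  ⟦ var i ⟧ ρ = lookup ρ i
  ⟦ par c ⟧ ρ = toFrac c
  ⟦ t ⊕ u ⟧ ρ = ⟦ t ⟧ ρ +ᶠ ⟦ u ⟧ ρ
  ⟦ t ⊗ u ⟧ ρ = ⟦ t ⟧ ρ *ᶠ ⟦ u ⟧ ρ
  ⟦ ⊖ t ⟧ ρ = -ᶠ ⟦ t ⟧ ρ

  Holds : ∀ {n} → QFFormula n → Vec Frac n → Set
  Holds (t ≐ u) ρ = ⟦ t ⟧ ρ ≈ᶠ ⟦ u ⟧ ρ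
  Holds (φ ∧ᶠ ψ) ρ = Holds φ ρ × Holds ψ ρ
  Holds (φ ∨ᶠ ψ) ρ = Holds φ ρ ⊎ Holds ψ ρ

  private
    -- An equality on the nose: both sides build the same unreduced numerators and denominators by
    -- the same recursions.
    eval≡ : ∀ {n} (t : Term n) (ρ : Vec 𝕂 n) → evalT t ρ ≡ (num (⟦ t ⟧ (Vec.map toFrac ρ)) , den (⟦ t ⟧ (Vec.map toFrac ρ)))
    eval≡ (var i) ρ = cong (λ x → num x , den x) (≡.sym (Vecₚ.lookup-map i toFrac ρ))
    eval≡ (par c) ρ = ≡.refl
    eval≡ (t ⊕ u) ρ rewrite eval≡ t ρ | eval≡ u ρ = cong₂ _,_
      (≡.trans (≡.trans (+≡ _ _) (cong₂ k._+_ (*≡ _ _) (*≡ _ _))) (≡.sym (num-+ (⟦ t ⟧ (Vec.map toFrac ρ)) (⟦ u ⟧ (Vec.map toFrac ρ)))))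
      (≡.trans (*≡ _ _) (≡.sym (den-+ (⟦ t ⟧ (Vec.map toFrac ρ)) (⟦ u ⟧ (Vec.map toFrac ρ)))))
    eval≡ (t ⊗ u) ρ rewrite eval≡ t ρ | eval≡ u ρ = cong₂ _,_
      (≡.trans (*≡ _ _) (≡.sym (num-* (⟦ t ⟧ (Vec.map toFrac ρ)) (⟦ u ⟧ (Vec.map toFrac ρ)))))
      (≡.trans (*≡ _ _) (≡.sym (den-* (⟦ t ⟧ (Vec.map toFrac ρ)) (⟦ u ⟧ (Vec.map toFrac ρ)))))
    eval≡ (⊖ t) ρ rewrite eval≡ t ρ = cong₂ _,_ (≡.trans (neg≡ _) (≡.sym (num-neg (⟦ t ⟧ (Vec.map toFrac ρ))))) (≡.sym (den-neg (⟦ t ⟧ (Vec.map toFrac ρ))))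

    ≃⇔ : ∀ {x y} → ((num x , den x) 𝒮.≃ (num y , den y)) ⇔ (x ≈ᶠ y)
    ≃⇔ {x} {y} = mk⇔
      (λ e → cross (subst₂ k._≈_ (*≡ (num x) (den y)) (*≡ (num y) (den x)) (≈ₚ⇒≈ e)))
      (λ (cross e) → ≈⇒≈ₚ (subst₂ k._≈_ (≡.sym (*≡ (num x) (den y))) (≡.sym (*≡ (num y) (den x))) e))

  Sat⇒Holds : ∀ {n} (φ : QFFormula n) (ρ : Vec 𝕂 n) → Sat φ ρ → Holds φ (Vec.map toFrac ρ)
  Sat⇒Holds (t ≐ u) ρ s = Equivalence.to ≃⇔ (subst₂ 𝒮._≃_ (eval≡ t ρ) (eval≡ u ρ) s)
  Sat⇒Holds (φ ∧ᶠ ψ) ρ (s , r) = Sat⇒Holds φ ρ s , Sat⇒Holds ψ ρ r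
  Sat⇒Holds (φ ∨ᶠ ψ) ρ (inj₁ s) = inj₁ (Sat⇒Holds φ ρ s)
  Sat⇒Holds (φ ∨ᶠ ψ) ρ (inj₂ s) = inj₂ (Sat⇒Holds ψ ρ s)

  Holds⇒Sat : ∀ {n} (φ : QFFormula n) (ρ : Vec 𝕂 n) → Holds φ (Vec.map toFrac ρ) → Sat φ ρ
  Holds⇒Sat (t ≐ u) ρ h = subst₂ 𝒮._≃_ (≡.sym (eval≡ t ρ)) (≡.sym (eval≡ u ρ)) (Equivalence.from ≃⇔ h)
  Holds⇒Sat (φ ∧ᶠ ψ) ρ (s , r) = Holds⇒Sat φ ρ s , Holds⇒Sat ψ ρ r
  Holds⇒Sat (φ ∨ᶠ ψ) ρ (inj₁ s) = inj₁ (Holds⇒Sat φ ρ s)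
  Holds⇒Sat (φ ∨ᶠ ψ) ρ (inj₂ s) = inj₂ (Holds⇒Sat ψ ρ s)

  -- The counterpart of `DiophantineWith` inside `Frac`, where the field laws are available and
  -- where the substitution t ↦ 1/t can act on environments.
  record Definable (n : ℕ) (X : Frac → Set) : Set where
    field
      formula : QFFormula (suc n)
      sound : ∀ α ys → Holds formula (α ∷ ys) → X α
      complete : ∀ α → X α → Σ (Vec Frac n) λ ys → Holds formula (α ∷ ys)

  toFrac-fromFrac : ∀ {n} (ys : Vec Frac n) → Vec.map toFrac (Vec.map fromFrac ys) ≡ ys
  toFrac-fromFrac [] = ≡.refl
  toFrac-fromFrac (y ∷ ys) = cong (y ∷_) (toFrac-fromFrac ys)

  definable⇒diophantine : ∀ {n X} (Z : 𝕂 → Set) → Definable n X → (∀ α → Z α → X (toFrac α)) → (∀ α → X (toFrac α) → Z α) → DiophantineWith n Z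
  definable⇒diophantine {n} {X} Z d there back = formula , λ α → mk⇔
      (λ z → witness α (complete (toFrac α) (there α z)))
      (λ (ys , s) → back α (sound (toFrac α) (Vec.map toFrac ys) (Sat⇒Holds formula (α ∷ ys) s)))
    where
    open Definable d
    witness : ∀ α → (Σ (Vec Frac n) λ ys → Holds formula (toFrac α ∷ ys)) → Σ (Vec 𝕂 n) λ ys → Sat formula (α ∷ ys)
    witness α (ys , h) = Vec.map fromFrac ys , Holds⇒Sat formula (α ∷ Vec.map fromFrac ys) (subst (λ zs → Holds formula (toFrac α ∷ zs)) (≡.sym (toFrac-fromFrac ys)) h)

-- The two defining formulas.

module IntegralityFormulas {S : Set} (D : Ultrafilter S) (q : S → ℕ) (F : ∀ s → FiniteField (q s))
                           (unbounded : ∀ m → Ultrafilter.U D (λ s → m < q s)) where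
  open Setting D q F using (Term; QFFormula; var; par)
    renaming (_≐_ to infix 4 _≐_; _∧ᶠ_ to infixr 3 _∧ᶠ_; _⊕_ to infixl 6 _⊕_; _⊗_ to infixl 7 _⊗_; ⊖_ to infix 8 ⊖_)
  open UltraField D q F
  open OverUltraproduct D q F unbounded
  open FormulaSemantics D q F
  open Fractions kField
  open LocalIntegrality kField
  open ConstantFractions kField
  private
    module KS = SolverOver GFring
    module Kₗ = FieldLemmas kField

  ⟪_⟫ : ∀ {n} → k.Poly → Term n
  ⟪ p ⟫ = par (fromFrac ⌜ p ⌝)

  private
    c≉0 : ∀ {P f g} → k.Prime P → ¬ (P k.∣ g) → ¬ (P k.∣ g k.* g k.+ P k.* f)
    c≉0 {P} {f} {g} π P∤g d = P∤g (k.Prime-∣² π (k.∣-cong (k.solve 3 (λ g p f → g :+ p :* f :- p :* f := g) (g k.* g) P f) (k.∣-+ d (k.∣-neg (k.∣-*ʳ f k.∣-refl)))))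

  module OddFormula (odd : U (λ s → ¬ Two≡0 s)) {P p} (dP : k.Degree P (suc p)) (monic : k.coeff P (suc p) ≈ 1ᴳ) (π : k.Prime P) where
    open Odd odd dP monic π

    private
      opaque
        point : ∃ NonSquareAt
        point = nonSquarePoint

      a₀ p₀ : GF
      a₀ = proj₁ point
      p₀ = k.eval a₀ P

      ns : NonSquareAt a₀
      ns = proj₂ point

      ¬square : ∀ s → ¬ (s *ᴳ s ≈ p₀)
      ¬square s e = U-contradiction (upward (λ i h → s i , h) e) ns

      inert : ∀ θ → ¬ (P k.∣ θ k.* θ k.+ k.t- a₀)
      inert θ d = go (LinearSymbols.split⇒square kField dP monic a₀ θ d)
        where
        go : (∃ λ s → s *ᴳ s ≈ p₀) → ⊥
        go (s , e) = ¬square s e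

      p₀≉0 : ¬ (p₀ ≈ 0ᴳ)
      p₀≉0 e = ¬square 0ᴳ (k.K.trans (k.K.zeroˡ 0ᴳ) (k.K.sym e))

      opaque
        l′ : ∃ λ l → l *ᴳ p₀ ≈ p₀ +ᴳ -ᴳ 1ᴳ
        l′ = Kₗ.divide (p₀ +ᴳ -ᴳ 1ᴳ) p₀ p₀≉0

      -- The constant l solves 1 + p₀ l = p₀, so κ₀ is 1 modulo P and takes the non-square value p₀
      -- = P(a₀) at a₀.
      κ₀ : k.Poly
      κ₀ = k.1# k.+ P k.* k.const (proj₁ l′)

      κ₀≡1 : P k.∣ κ₀ k.- k.1#
      κ₀≡1 = k.const (proj₁ l′) , k.solve 2 (λ o x → (o :+ x) :- o := x) k.1# (P k.* k.const (proj₁ l′))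

      eval-κ₀ : k.eval a₀ κ₀ ≈ p₀
      eval-κ₀ = k.K.trans (k.eval-+ a₀ k.1# (P k.* k.const (proj₁ l′))) (k.K.trans (k.K.+-cong (k.eval-1 a₀) (k.K.trans (k.eval-* a₀ P (k.const (proj₁ l′))) (k.K.trans (k.K.*-congˡ (k.eval-const a₀ (proj₁ l′))) (k.K.trans (k.K.*-comm p₀ (proj₁ l′)) (proj₂ l′)))))
        (KS.solve 2 (λ o x → o :+ (x :- o) := x) 1ᴳ p₀))

      -- The two vanishing products confine κ to 1 and κ₀, and j to 0, 1 and -1. Both choices depend
      -- on α, so κ and j are quantified.
      formula : QFFormula 10
      formula = ((z ⊗ z) ⊕ (⟪ k.t- a₀ ⟫ ⊗ ((x ⊗ x) ⊕ (⊖ (⟪ P ⟫ ⊗ (y ⊗ y))))) ≐ κ ⊗ (⟪ k.1# ⟫ ⊕ (⟪ P ⟫ ⊗ ((α ⊕ j) ⊗ (α ⊕ j)))))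
        ∧ᶠ (((κ ⊕ (⊖ ⟪ k.1# ⟫)) ⊗ (κ ⊕ (⊖ ⟪ κ₀ ⟫)) ≐ ⟪ k.0# ⟫) ∧ᶠ (j ⊗ ((j ⊕ (⊖ ⟪ k.1# ⟫)) ⊗ (j ⊕ (⊖ ⟪ k.- k.1# ⟫))) ≐ ⟪ k.0# ⟫))
        where
        α z x y κ j : Term 10
        α = var zero
        z = var (suc zero)
        x = var (suc (suc zero))
        y = var (suc (suc (suc zero)))
        κ = var (suc (suc (suc (suc zero))))
        j = var (suc (suc (suc (suc (suc zero)))))

      sound : ∀ α ys → Holds formula (α ∷ ys) → Integral P α
      sound α (z ∷ x ∷ y ∷ κ ∷ j ∷ _ ∷ _ ∷ _ ∷ _ ∷ []) (e₁ , e₂ , e₃) = go (whichκ (Lₗ.*≈0 e₂)) (whichj (Lₗ.*≈0 e₃))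
        where
        whichκ : κ L.- ⌜ k.1# ⌝ L.≈ L.0# ⊎ κ L.- ⌜ κ₀ ⌝ L.≈ L.0# → ∃ λ κ′ → κ L.≈ ⌜ κ′ ⌝ × P k.∣ κ′ k.- k.1#
        whichκ (inj₁ h) = k.1# , Lₗ.x-y≈0⇒x≈y h , k.0# , k.trans (k.-‿inverseʳ k.1#) (k.sym (k.zeroʳ P))
        whichκ (inj₂ h) = κ₀ , Lₗ.x-y≈0⇒x≈y h , κ₀≡1
        whichj : j L.≈ L.0# ⊎ (j L.- ⌜ k.1# ⌝) L.* (j L.- ⌜ k.- k.1# ⌝) L.≈ L.0# → ∃ λ j′ → j L.≈ ⌜ j′ ⌝
        whichj (inj₁ h) = k.0# , h
        whichj (inj₂ h) = [ (λ r → k.1# , Lₗ.x-y≈0⇒x≈y r) , (λ r → k.- k.1# , Lₗ.x-y≈0⇒x≈y r) ]′ (Lₗ.*≈0 h)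
        go : (∃ λ κ′ → κ L.≈ ⌜ κ′ ⌝ × P k.∣ κ′ k.- k.1#) → (∃ λ j′ → j L.≈ ⌜ j′ ⌝) → Integral P α
        go (κ′ , hκ , κ≡1) (j′ , hj) = oddSound π (k.t- a₀) inert κ′ κ≡1 j′ α z x y
          (L.trans e₁ (L.*-cong hκ (L.+-congˡ (L.*-congˡ (L.*-cong (L.+-congˡ hj) (L.+-congˡ hj))))))

      2≉0 : ¬ (1ᴳ +ᴳ 1ᴳ ≈ 0ᴳ)
      2≉0 e = U-contradiction e odd

      C : k.Poly → k.Poly → k.Poly → k.Poly
      C f g j = g k.* g k.+ P k.* ((f k.+ j k.* g) k.* (f k.+ j k.* g))

      eval-C : ∀ f g j → k.eval a₀ (C f g j) ≈ k.eval a₀ g *ᴳ k.eval a₀ g +ᴳ p₀ *ᴳ ((k.eval a₀ f +ᴳ k.eval a₀ j *ᴳ k.eval a₀ g) *ᴳ (k.eval a₀ f +ᴳ k.eval a₀ j *ᴳ k.eval a₀ g))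
      eval-C f g j = k.K.trans (k.eval-+ a₀ (g k.* g) _) (k.K.+-cong (k.eval-* a₀ g g) (k.K.trans (k.eval-* a₀ P _) (k.K.*-congˡ (k.K.trans (k.eval-* a₀ _ _) (k.K.*-cong lin lin)))))
        where
        lin : k.eval a₀ (f k.+ j k.* g) ≈ k.eval a₀ f +ᴳ k.eval a₀ j *ᴳ k.eval a₀ g
        lin = k.K.trans (k.eval-+ a₀ f (j k.* g)) (k.K.+-congˡ (k.eval-* a₀ j g))

      record Shift (f g : k.Poly) : Set where
        field
          j : k.Poly
          j-root : ⌜ j ⌝ L.* ((⌜ j ⌝ L.- ⌜ k.1# ⌝) L.* (⌜ j ⌝ L.- ⌜ k.- k.1# ⌝)) L.≈ L.0#
          nonvanishing : ¬ (k.eval a₀ (C f g j) ≈ 0ᴳ)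

      -- If C vanished at a₀ for j = 1 and j = -1, the difference 4 p₀ f(a₀) g(a₀) would vanish;
      -- with the case j = 0 this forces f and g to vanish together at a₀, against coprimality.
      shift : ∀ f g → k.Coprime f g → Shift f g
      shift f g cop with k.eval a₀ (C f g k.0#) k.K.≟ 0ᴳ | k.eval a₀ (C f g k.1#) k.K.≟ 0ᴳ
      ... | no n | _ = record { j = k.0# ; j-root = L.zeroˡ _ ; nonvanishing = n }
      ... | yes _ | no n = record { j = k.1# ; j-root = L.trans (L.*-congˡ (L.trans (L.*-congʳ (L.-‿inverseʳ _)) (L.zeroˡ _))) (L.zeroʳ _) ; nonvanishing = n }
      ... | yes z₀ | yes z₁ = record { j = k.- k.1# ; j-root = L.trans (L.*-congˡ (L.trans (L.*-congˡ (L.-‿inverseʳ _)) (L.zeroʳ _))) (L.zeroʳ _) ; nonvanishing = λ z₂ → both cop (contra z₂) }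
        where
        f₀ g₀ : GF
        f₀ = k.eval a₀ f
        g₀ = k.eval a₀ g
        v₀ : g₀ *ᴳ g₀ +ᴳ p₀ *ᴳ (f₀ *ᴳ f₀) ≈ 0ᴳ
        v₀ = k.K.trans (KS.solve 3 (λ g p f → g :* g :+ p :* (f :* f) := g :* g :+ p :* ((f :+ :0 :* g) :* (f :+ :0 :* g))) g₀ p₀ f₀) (k.K.trans (k.K.sym (eval-C f g k.0#)) z₀)
        v₁ : g₀ *ᴳ g₀ +ᴳ p₀ *ᴳ ((f₀ +ᴳ g₀) *ᴳ (f₀ +ᴳ g₀)) ≈ 0ᴳ
        v₁ = k.K.trans (k.K.sym (k.K.trans (eval-C f g k.1#) (k.K.+-congˡ (k.K.*-congˡ (k.K.*-cong e e))))) z₁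
          where
          e : f₀ +ᴳ k.eval a₀ k.1# *ᴳ g₀ ≈ f₀ +ᴳ g₀
          e = k.K.+-congˡ (k.K.trans (k.K.*-congʳ (k.eval-1 a₀)) (k.K.*-identityˡ g₀))
        contra : k.eval a₀ (C f g (k.- k.1#)) ≈ 0ᴳ → f₀ ≈ 0ᴳ × g₀ ≈ 0ᴳ
        contra z₂ = finish (Kₗ.*≈0 fg)
          where
          v₂ : g₀ *ᴳ g₀ +ᴳ p₀ *ᴳ ((f₀ +ᴳ -ᴳ g₀) *ᴳ (f₀ +ᴳ -ᴳ g₀)) ≈ 0ᴳ
          v₂ = k.K.trans (k.K.sym (k.K.trans (eval-C f g (k.- k.1#)) (k.K.+-congˡ (k.K.*-congˡ (k.K.*-cong e e))))) z₂
            where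
            e : f₀ +ᴳ k.eval a₀ (k.- k.1#) *ᴳ g₀ ≈ f₀ +ᴳ -ᴳ g₀
            e = k.K.+-congˡ (k.K.trans (k.K.*-congʳ (k.K.trans (k.eval-neg a₀ k.1#) (k.K.-‿cong (k.eval-1 a₀)))) (KS.solve 1 (λ g → :- :1 :* g := :- g) g₀))
          fg : f₀ *ᴳ g₀ ≈ 0ᴳ
          fg = Kₗ.cancelˡ (Kₗ.*≉0 (Kₗ.*≉0 2≉0 2≉0) p₀≉0) (k.K.trans
            (KS.solve 3 (λ p f g → (:1 :+ :1) :* (:1 :+ :1) :* p :* (f :* g) := (g :* g :+ p :* ((f :+ g) :* (f :+ g))) :- (g :* g :+ p :* ((f :- g) :* (f :- g)))) p₀ f₀ g₀)
            (k.K.trans (k.K.+-cong v₁ (k.K.-‿cong v₂)) (k.K.trans (k.K.-‿inverseʳ 0ᴳ) (k.K.sym (k.K.zeroʳ _)))))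
          square-zero : ∀ {x} → x *ᴳ x ≈ 0ᴳ → x ≈ 0ᴳ
          square-zero h = [ (λ r → r) , (λ r → r) ]′ (Kₗ.*≈0 h)
          finish : f₀ ≈ 0ᴳ ⊎ g₀ ≈ 0ᴳ → f₀ ≈ 0ᴳ × g₀ ≈ 0ᴳ
          finish (inj₁ h) = h , square-zero (k.K.trans (k.K.sym (k.K.trans (k.K.+-congˡ (k.K.trans (k.K.*-congˡ (k.K.trans (k.K.*-congʳ h) (k.K.zeroˡ _))) (k.K.zeroʳ _))) (k.K.+-identityʳ _))) v₀)
          finish (inj₂ h) = square-zero (Kₗ.cancelˡ p₀≉0 (k.K.trans (k.K.sym (k.K.trans (k.K.+-congʳ (k.K.trans (k.K.*-congʳ h) (k.K.zeroˡ _))) (k.K.+-identityˡ _))) (k.K.trans v₀ (k.K.sym (k.K.zeroʳ _))))) , h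
        both : k.Coprime f g → f₀ ≈ 0ᴳ × g₀ ≈ 0ᴳ → ⊥
        both (u , v , h) (hf , hg) = k.K.1≉0 (k.K.trans (k.K.sym (k.eval-1 a₀)) (k.K.trans (k.K.sym (k.eval-cong a₀ h)) (k.K.trans (k.eval-+ a₀ (u k.* f) (v k.* g))
          (k.K.trans (k.K.+-cong (k.K.trans (k.eval-* a₀ u f) (k.K.trans (k.K.*-congˡ hf) (k.K.zeroʳ _))) (k.K.trans (k.eval-* a₀ v g) (k.K.trans (k.K.*-congˡ hg) (k.K.zeroʳ _)))) (k.K.+-identityʳ _)))))

      record Twist (c : k.Poly) : Set where
        field
          κ : k.Poly
          κ-root : (⌜ κ ⌝ L.- ⌜ k.1# ⌝) L.* (⌜ κ ⌝ L.- ⌜ κ₀ ⌝) L.≈ L.0#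
          κ≡1 : P k.∣ κ k.- k.1#
          square : U (λ s → Squares.IsSq (F s) (k.eval a₀ (κ k.* c) s))
          nonvanishing : ¬ (k.eval a₀ (κ k.* c) ≈ 0ᴳ)

      -- The ultrafilter decides whether c(a₀) is a square at almost every index. If not,
      -- multiplying by κ₀ contributes the non-square p₀, and squares have index two.
      twist : ∀ c → ¬ (k.eval a₀ c ≈ 0ᴳ) → Twist c
      twist c c₀≉0 with ultra (λ s → Squares.IsSq (F s) (k.eval a₀ c s))
      ... | inj₁ sq = record
        { κ = k.1# ; κ-root = L.trans (L.*-congʳ (L.-‿inverseʳ _)) (L.zeroˡ _) ; κ≡1 = k.0# , k.trans (k.-‿inverseʳ k.1#) (k.sym (k.zeroʳ P))
        ; square = U-map₂ (λ s h e → subst (Squares.IsSq (F s)) (≡.sym e) h) sq (k.eval-cong a₀ (k.*-identityˡ c))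
        ; nonvanishing = λ e → c₀≉0 (k.K.trans (k.K.sym (k.eval-cong a₀ (k.*-identityˡ c))) e) }
      ... | inj₂ nsq = record
        { κ = κ₀ ; κ-root = L.trans (L.*-congˡ (L.-‿inverseʳ _)) (L.zeroʳ _) ; κ≡1 = κ₀≡1
        ; square = U-map₂ (λ s (h , n) e → subst (Squares.IsSq (F s)) (≡.sym e) (index s n h)) (inter nsq ns) product
        ; nonvanishing = λ e → Kₗ.*≉0 p₀≉0 c₀≉0 (k.K.trans (k.K.sym product) e) }
        where
        product : k.eval a₀ (κ₀ k.* c) ≈ p₀ *ᴳ k.eval a₀ c
        product = k.K.trans (k.eval-* a₀ κ₀ c) (k.K.*-congʳ eval-κ₀)
        index : ∀ s → ¬ Squares.IsSq (F s) (p₀ s) → ¬ Squares.IsSq (F s) (k.eval a₀ c s) → Squares.IsSq (F s) ((p₀ *ᴳ k.eval a₀ c) s)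
        index s n h = [ (λ r → ⊥-elim (h r)) , (λ r → r) ]′ (Squares.IsSq-index (F s) n (k.eval a₀ c s))

      complete : ∀ α → Integral P α → Σ (Vec Frac 9) λ ys → Holds formula (α ∷ ys)
      complete α int = step (integral-lowest π int)
        where
        step : (∃₂ λ f g → k.Coprime f g × ¬ (g k.≈ k.0#) × ¬ (P k.∣ g) × α L.* ⌜ g ⌝ L.≈ ⌜ f ⌝) → Σ (Vec Frac 9) λ ys → Holds formula (α ∷ ys)
        step (f , g , cop , g≉0 , P∤g , e) = step₂ (shift f g cop)
          where
          step₂ : Shift f g → Σ (Vec Frac 9) λ ys → Holds formula (α ∷ ys)
          step₂ sh = step₃ (twist (C f g j) nonvanishing)
            where
            open Shift sh
            step₃ : Twist (C f g j) → Σ (Vec Frac 9) λ ys → Holds formula (α ∷ ys)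
            step₃ tw = step₄ (soluble a₀ ns (proj₂ (k.≉0⇒Degree {κ k.* C f g j} (λ z → T.nonvanishing (k.eval-cong a₀ z)))) (k.∤⇒Coprime π P∤κC) T.nonvanishing T.square)
              where
              module T = Twist tw
              κ : k.Poly
              κ = T.κ
              P∤κ : ¬ (P k.∣ κ)
              P∤κ d = k.Prime-∤1 π (k.∣-cong (k.solve 2 (λ x o → x :- (x :- o) := o) κ k.1#) (k.∣-+ d (k.∣-neg T.κ≡1)))
              P∤κC : ¬ (P k.∣ κ k.* C f g j)
              P∤κC = k.Prime-∤* π P∤κ (c≉0 π P∤g)
              step₄ : Soluble a₀ ns (κ k.* C f g j) → Σ (Vec Frac 9) λ ys → Holds formula (α ∷ ys)
              step₄ (z , x , y , w , eq , w≉0) = finish (oddWitness P (k.t- a₀) κ j α f g g≉0 e z x y w w≉0 eq)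
                where
                finish : (∃ λ z′ → ∃₂ λ x′ y′ → z′ L.* z′ L.+ ⌜ k.t- a₀ ⌝ L.* (x′ L.* x′ L.- ⌜ P ⌝ L.* (y′ L.* y′)) L.≈ ⌜ κ ⌝ L.* (L.1# L.+ ⌜ P ⌝ L.* ((α L.+ ⌜ j ⌝) L.* (α L.+ ⌜ j ⌝)))) → Σ (Vec Frac 9) λ ys → Holds formula (α ∷ ys)
                -- Five witnesses; the remaining slots of the nine are padded with zeros.
                finish (z′ , x′ , y′ , h) = (z′ ∷ x′ ∷ y′ ∷ ⌜ κ ⌝ ∷ ⌜ j ⌝ ∷ L.0# ∷ L.0# ∷ L.0# ∷ L.0# ∷ []) , h , T.κ-root , j-root

    oddDefinable : Definable 9 (Integral P)
    oddDefinable = record { formula = formula ; sound = sound ; complete = complete }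

  module EvenFormula (even : U Two≡0) {P p} (dP : k.Degree P (suc p)) (π : k.Prime P) where
    open Even even
    open CharTwoConstants even sqrtᵏ

    private
      opaque
        u′ : Σ GF λ u → U (λ s → ¬ AS s (u s))
        u′ = inertConstant

        e′ : Σ GF λ e → ¬ (e ≈ 0ᴳ) × ¬ (1ᴳ +ᴳ e ≈ 0ᴳ)
        e′ = thirdConstant

      u ε : GF
      u = proj₁ u′
      ε = proj₁ e′

      u-ns : ¬ (∃ λ ρ → ρ *ᴳ ρ +ᴳ ρ ≈ u)
      u-ns (ρ , h) = U-contradiction (upward (λ s r → ρ s , r) h) (proj₂ u′)

      -- Horner's scheme as a term: the point a is a quantified variable, so P(a) and P′(a) have to
      -- be expressed inside the formula.
      evTerm : k.Poly → Term 10 → Term 10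
      evTerm [] a = ⟪ k.0# ⟫
      evTerm (c ∷ p) a = ⟪ k.const c ⟫ ⊕ (a ⊗ evTerm p a)

      evTerm-ev : ∀ p t ρ → ⟦ evTerm p t ⟧ ρ ≡ Ev.ev (⟦ t ⟧ ρ) p
      evTerm-ev [] t ρ = ≡.refl
      evTerm-ev (c ∷ p) t ρ = cong (λ x → ⟨ c ⟩ L.+ (⟦ t ⟧ ρ L.* x)) (evTerm-ev p t ρ)

      curve : Term 10 → Term 10 → QFFormula 10
      curve x y = (((((y ⊗ y) ⊕ y) ⊕ (⊖ ((x ⊗ x) ⊗ x))) ⊗ (((y ⊗ y) ⊕ y) ⊕ (⊖ (⟪ k.const ε ⟫ ⊗ ((x ⊗ x) ⊗ x))))) ⊗ (((y ⊗ y) ⊕ y) ⊕ (⊖ (⟪ k.const (1ᴳ +ᴳ ε) ⟫ ⊗ ((x ⊗ x) ⊗ x))))) ≐ ⟪ k.0# ⟫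

      -- The points b₁ and b₂ on the curves certify that a and β are constants, i is the inverse of
      -- P(a), and r certifies that P is inert. Only then does the last equation, the norm equation
      -- for α, force integrality.
      formula : QFFormula 10
      formula = curve a b₁ ∧ᶠ (curve β b₂ ∧ᶠ ((i ⊗ evTerm P a ≐ ⟪ k.1# ⟫) ∧ᶠ ((((r ⊗ r) ⊕ r) ⊕ ⟪ k.const u ⟫ ≐ β ⊗ (i ⊗ evTerm (k.derivative P) a))
        ∧ᶠ ((t-a ⊗ ((z ⊗ z) ⊕ (z ⊗ w))) ⊕ (β ⊗ (w ⊗ w)) ≐ t-a ⊗ (⟪ k.1# ⟫ ⊕ (⟪ P ⟫ ⊗ (α ⊗ α)))))))
        where
        α a b₁ β b₂ i r z w t-a : Term 10
        α = var zero
        a = var (suc zero)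
        b₁ = var (suc (suc zero))
        β = var (suc (suc (suc zero)))
        b₂ = var (suc (suc (suc (suc zero))))
        i = var (suc (suc (suc (suc (suc zero)))))
        r = var (suc (suc (suc (suc (suc (suc zero))))))
        z = var (suc (suc (suc (suc (suc (suc (suc zero)))))))
        w = var (suc (suc (suc (suc (suc (suc (suc (suc zero))))))))
        t-a = ⟪ k.X ⟫ ⊕ (⊖ a)

      t-≈ : ∀ a → ⌜ k.t- a ⌝ L.≈ ⌜ k.X ⌝ L.- ⟨ a ⟩
      t-≈ a = L.trans (ι.to-+ k.X (k.- k.const a)) (L.+-congˡ (ι.to-neg (k.const a)))

      sound : ∀ α ys → Holds formula (α ∷ ys) → Integral P α
      sound α ys@(a ∷ b₁ ∷ β ∷ b₂ ∷ i ∷ r ∷ z ∷ w ∷ _ ∷ []) (h₁ , h₂ , h₃ , h₄ , h₅) =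
          go (curves⇒constant ε (proj₁ (proj₂ e′)) (proj₂ (proj₂ e′)) a b₁ h₁) (curves⇒constant ε (proj₁ (proj₂ e′)) (proj₂ (proj₂ e′)) β b₂ h₂)
        where
        go : (∃ λ δ → a L.≈ ⟨ δ ⟩) → (∃ λ δ → β L.≈ ⟨ δ ⟩) → Integral P α
        go (a′ , ea) (β′ , eβ) = evenSound π (k.t- a′) (k.const β′) (P∤t-a dP π u u-ns a′ β′ i r inverse inert) (P-inert dP π u u-ns a′ β′ i r inverse inert) α z w equation
          where
          value : ∀ p → ⟦ evTerm p (var (suc zero)) ⟧ (α ∷ ys) L.≈ ⟨ k.eval a′ p ⟩
          value p = L.trans (L.reflexive (evTerm-ev p (var (suc zero)) (α ∷ ys))) (L.trans (Ev.ev-congˣ p ea) (ev-constant a′ p))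
          inverse : i L.* ⟨ k.eval a′ P ⟩ L.≈ L.1#
          inverse = L.trans (L.*-congˡ (L.sym (value P))) h₃
          inert : r L.* r L.+ r L.+ ⟨ u ⟩ L.≈ ⟨ β′ ⟩ L.* (i L.* ⟨ k.eval a′ (k.derivative P) ⟩)
          inert = L.trans h₄ (L.*-cong eβ (L.*-congˡ (value (k.derivative P))))
          t≈ : ⌜ k.t- a′ ⌝ L.≈ ⌜ k.X ⌝ L.- a
          t≈ = L.trans (t-≈ a′) (L.+-congˡ (L.-‿cong (L.sym ea)))
          equation : ⌜ k.t- a′ ⌝ L.* (z L.* z L.+ z L.* w) L.+ ⟨ β′ ⟩ L.* (w L.* w) L.≈ ⌜ k.t- a′ ⌝ L.* (L.1# L.+ ⌜ P ⌝ L.* (α L.* α))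
          equation = L.trans (L.+-cong (L.*-congʳ t≈) (L.*-congʳ (L.sym eβ))) (L.trans h₅ (L.*-congʳ (L.sym t≈)))

      factor : ∀ x y e → ⟨ y *ᴳ y +ᴳ y +ᴳ -ᴳ (e *ᴳ (x *ᴳ x *ᴳ x)) ⟩ L.≈ ⟨ y ⟩ L.* ⟨ y ⟩ L.+ ⟨ y ⟩ L.- ⟨ e ⟩ L.* (⟨ x ⟩ L.* ⟨ x ⟩ L.* ⟨ x ⟩)
      factor x y e = L.trans (c.to-+ (y *ᴳ y +ᴳ y) (-ᴳ (e *ᴳ (x *ᴳ x *ᴳ x)))) (L.+-cong (L.trans (c.to-+ (y *ᴳ y) y) (L.+-congʳ (c.to-* y y)))
        (L.trans (c.to-neg (e *ᴳ (x *ᴳ x *ᴳ x))) (L.-‿cong (L.trans (c.to-* e (x *ᴳ x *ᴳ x)) (L.*-congˡ (L.trans (c.to-* (x *ᴳ x) x) (L.*-congʳ (c.to-* x x))))))))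

      factor₁ : ∀ x y → ⟨ y *ᴳ y +ᴳ y +ᴳ -ᴳ (x *ᴳ x *ᴳ x) ⟩ L.≈ ⟨ y ⟩ L.* ⟨ y ⟩ L.+ ⟨ y ⟩ L.- ⟨ x ⟩ L.* ⟨ x ⟩ L.* ⟨ x ⟩
      factor₁ x y = L.trans (c.to-+ (y *ᴳ y +ᴳ y) (-ᴳ (x *ᴳ x *ᴳ x))) (L.+-cong (L.trans (c.to-+ (y *ᴳ y) y) (L.+-congʳ (c.to-* y y)))
        (L.trans (c.to-neg (x *ᴳ x *ᴳ x)) (L.-‿cong (L.trans (c.to-* (x *ᴳ x) x) (L.*-congʳ (c.to-* x x))))))

      onCurveᶠ : ∀ x y → OnCurve ε x y →
        (⟨ y ⟩ L.* ⟨ y ⟩ L.+ ⟨ y ⟩ L.- ⟨ x ⟩ L.* ⟨ x ⟩ L.* ⟨ x ⟩) L.* (⟨ y ⟩ L.* ⟨ y ⟩ L.+ ⟨ y ⟩ L.- ⟨ ε ⟩ L.* (⟨ x ⟩ L.* ⟨ x ⟩ L.* ⟨ x ⟩)) L.* (⟨ y ⟩ L.* ⟨ y ⟩ L.+ ⟨ y ⟩ L.- ⟨ 1ᴳ +ᴳ ε ⟩ L.* (⟨ x ⟩ L.* ⟨ x ⟩ L.* ⟨ x ⟩)) L.≈ L.0#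
      onCurveᶠ x y h = L.trans (L.*-cong (L.*-cong (L.sym (factor₁ x y)) (L.sym (factor x y ε))) (L.sym (factor x y (1ᴳ +ᴳ ε))))
        (L.trans (L.*-congʳ (L.sym (c.to-* _ _))) (L.trans (L.sym (c.to-* _ _)) (L.trans (c.to-cong h) ⟨⟩-0)))

      complete : ∀ α → Integral P α → Σ (Vec Frac 9) λ ys → Holds formula (α ∷ ys)
      complete α int = step (integral-lowest π int)
        where
        step : (∃₂ λ f g → k.Coprime f g × ¬ (g k.≈ k.0#) × ¬ (P k.∣ g) × α L.* ⌜ g ⌝ L.≈ ⌜ f ⌝) → Σ (Vec Frac 9) λ ys → Holds formula (α ∷ ys)
        step (f , g , cop , g≉0 , P∤g , e) = step₂ (soluble dP π u (proj₂ u′) (proj₂ (k.≉0⇒Degree {c₀} (λ h → P∤c (k.0# , k.trans h (k.sym (k.zeroʳ P)))))) (k.∤⇒Coprime π P∤c))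
          where
          c₀ : k.Poly
          c₀ = g k.* g k.+ P k.* (f k.* f)
          P∤c : ¬ (P k.∣ c₀)
          P∤c = c≉0 π P∤g
          step₂ : Solution P c₀ u → Σ (Vec Frac 9) λ ys → Holds formula (α ∷ ys)
          step₂ sol = step₃ (onCurveᵏ ε a′) (onCurveᵏ ε β′) (evenWitness P (k.t- a′) (k.const β′) α f g g≉0 e (Solution.z sol) (Solution.w sol) (Solution.equation sol))
            where
            a′ β′ i′ r′ : GF
            a′ = Solution.a sol
            β′ = Solution.β sol
            i′ = Solution.i sol
            r′ = Solution.r sol
            step₃ : ∃ (OnCurve ε a′) → ∃ (OnCurve ε β′) → (∃₂ λ z′ w′ → ⌜ k.t- a′ ⌝ L.* (z′ L.* z′ L.+ z′ L.* w′) L.+ ⟨ β′ ⟩ L.* (w′ L.* w′) L.≈ ⌜ k.t- a′ ⌝ L.* (L.1# L.+ ⌜ P ⌝ L.* (α L.* α))) → Σ (Vec Frac 9) λ ys → Holds formula (α ∷ ys)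
            step₃ (y₁ , c₁) (y₂ , c₂) (z′ , w′ , h) = ys , onCurveᶠ a′ y₁ c₁ , onCurveᶠ β′ y₂ c₂
                , L.trans (L.*-congˡ (value P)) (L.trans (L.sym (c.to-* i′ (k.eval a′ P))) (L.trans (c.to-cong (Solution.inverse sol)) ⟨⟩-1))
                , L.trans (L.sym (L.trans (c.to-+ (r′ *ᴳ r′ +ᴳ r′) u) (L.+-congʳ (L.trans (c.to-+ (r′ *ᴳ r′) r′) (L.+-congʳ (c.to-* r′ r′))))))
                    (L.trans (c.to-cong (Solution.inert sol)) (L.trans (c.to-* β′ _) (L.*-congˡ (L.trans (c.to-* i′ _) (L.*-congˡ (L.sym (value (k.derivative P))))))))
                , L.trans (L.+-congʳ (L.*-congʳ (L.sym (t-≈ a′)))) (L.trans h (L.*-congʳ (t-≈ a′)))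
              where
              ys : Vec Frac 9
              -- Eight witnesses and one padding zero.
              ys = ⟨ a′ ⟩ ∷ ⟨ y₁ ⟩ ∷ ⟨ β′ ⟩ ∷ ⟨ y₂ ⟩ ∷ ⟨ i′ ⟩ ∷ ⟨ r′ ⟩ ∷ z′ ∷ w′ ∷ L.0# ∷ []
              value : ∀ p → ⟦ evTerm p (var (suc zero)) ⟧ (α ∷ ys) L.≈ ⟨ k.eval a′ p ⟩
              value p = L.trans (L.reflexive (evTerm-ev p (var (suc zero)) (α ∷ ys))) (ev-constant a′ p)

    evenDefinable : Definable 9 (Integral P)
    evenDefinable = record { formula = formula ; sound = sound ; complete = complete }

  integralDefinable : ∀ {P p} → k.Degree P (suc p) → k.coeff P (suc p) ≈ 1ᴳ → k.Prime P → Definable 9 (Integral P)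
  -- The characteristics may vary with the index, but almost all are two or almost all are odd.
  integralDefinable dP monic π with ultra Two≡0
  ... | inj₁ even = EvenFormula.evenDefinable even dP π
  ... | inj₂ odd = OddFormula.oddDefinable odd dP monic π

-- Integrality and the P-adic valuation.

module FiniteValuation (F : DecField) where
  open FieldPoly F
  open Fractions F
  open LocalIntegrality F
  open ConstantFractions F
  open Powers polyRing
  open import Relation.Binary.Reasoning.Setoid setoid

  module _ {P} (π : Prime P) where

    ^≉0 : ∀ n → ¬ (P ^ n ≈ 0#)
    ^≉0 zero = 1≉0ₚ
    ^≉0 (suc n) = *≉0 (Prime-≉0 π) (^≉0 n)

    multiplicity : ∀ f → ¬ (f ≈ 0#) → ∃₂ λ i a → ¬ (P ∣ a) × f ≈ P ^ i * a
    multiplicity f = go (length f) f (Deg<-length f)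
      where
      go : ∀ n f → Deg< n f → ¬ (f ≈ 0#) → ∃₂ λ i a → ¬ (P ∣ a) × f ≈ P ^ i * a
      go zero f d f≉0 = ⊥-elim (f≉0 (Deg<0⇒≈0 d))
      go (suc n) f d f≉0 with dichotomy π f
      ... | inj₂ c = 0 , f , Coprime⇒∤ π c , sym (*-identityˡ f)
      ... | inj₁ (f₁ , e) with go n f₁ (Deg<-quotient-prime π (Deg<-cong e d)) (λ z → f≉0 (trans e (trans (*-congˡ z) (zeroʳ P))))
      ...   | i , a , P∤a , e₁ = suc i , a , P∤a , trans e (trans (*-congˡ e₁) (sym (*-assoc P (P ^ i) a)))

    nonNeg⇒integral : ∀ α a b i j → ¬ (P ∣ b) → j ≤ i → num α * (P ^ j * b) ≈ P ^ i * a * den α → Integral P α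
    nonNeg⇒integral α a b i j P∤b j≤i e = P ^ d * a , b , P∤b , *⌜⌝-cross α (P ^ d * a) b (cancelˡ (^≉0 j) (begin
      P ^ j * (num α * b) ≈⟨ solve 3 (λ p n b → p :* (n :* b) := n :* (p :* b)) (P ^ j) (num α) b ⟩
      num α * (P ^ j * b) ≈⟨ e ⟩
      P ^ i * a * den α ≈⟨ *-congʳ (*-congʳ (reflexive (cong (P ^_) (m+[n∸m]≡n j≤i)))) ⟨
      P ^ (j ℕ.+ d) * a * den α ≈⟨ *-congʳ (*-congʳ (^-homo-* P j d)) ⟩
      P ^ j * P ^ d * a * den α ≈⟨ solve 4 (λ p q a n → p :* q :* a :* n := p :* (q :* a :* n)) (P ^ j) (P ^ d) a (den α) ⟩
      P ^ j * (P ^ d * a * den α) ∎))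
      where
      d : ℕ
      d = i ℕ.∸ j

    integral⇒nonNeg : ∀ α → Integral P α → num α ≈ 0# ⊎ ∃ λ i → ∃₂ λ a b → ¬ (P ∣ a) × ¬ (P ∣ b) × num α * b ≈ P ^ i * a * den α
    integral⇒nonNeg α (f , g , P∤g , e) with ≈0? f
    ... | yes z = inj₁ (zero-numerator (*≈0 (trans (*⌜⌝-crossed α f g e) (trans (*-congʳ z) (zeroˡ _)))))
      where
      zero-numerator : num α ≈ 0# ⊎ g ≈ 0# → num α ≈ 0#
      zero-numerator (inj₁ h) = h
      zero-numerator (inj₂ h) = ⊥-elim (P∤g (0# , trans h (sym (zeroʳ P))))
    ... | no n with multiplicity f n
    ...   | i , a , P∤a , ef = inj₂ (i , a , g , P∤a , P∤g , trans (*⌜⌝-crossed α f g e) (*-congʳ ef))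

-- The infinite prime and the substitution t ↦ 1/t.

module InfiniteValuation (F : DecField) where
  open FieldPoly F
  open Fractions F
  open LocalIntegrality F
  open ConstantFractions F
  open Powers polyRing

  -- The prime t, written as t - 0 so that the results on linear primes apply.
  T : Poly
  T = t- K.0#

  T-prime : Prime T
  T-prime = Prime-t- K.0#

  T≈X : T ≈ X
  T≈X = trans (+-congˡ (trans (-‿cong const-0) (trans (sym (+-identityˡ _)) (-‿inverseʳ 0#)))) (+-identityʳ X)

  private
    τ : Frac
    τ = frac 1# T (Prime-≉0 T-prime)

    τT : τ L.* ⌜ T ⌝ L.≈ L.1#
    τT = clear τ

    module E = RingHom (Ev.evHom τ)

  -- The witness r is the reversed polynomial t^n p(1/t). Its constant term is the leading
  -- coefficient of p, so T does not divide it.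
  reverse : ∀ p n → Degree p n → ∃ λ r → ¬ (T ∣ r) × E.to p L.* ⌜ T ^ n ⌝ L.≈ ⌜ r ⌝
  reverse [] n d = ⊥-elim (lead≉0 d K.refl)
  reverse (a ∷ p) zero d = const a , unit , L.trans (L.*-identityʳ _) (L.trans (L.+-congˡ (L.trans (L.*-congˡ (L.trans (E.to-cong p≈0) L.refl)) (L.zeroʳ τ))) (L.+-identityʳ _))
    where
    p≈0 : p ≈ 0#
    p≈0 = Deg<0⇒≈0 (Deg<-tail (bound d))
    unit : ¬ (T ∣ const a)
    unit h = lead≉0 d (K.trans (K.sym (eval-const K.0# a)) (∣⇒root h))
  reverse (a ∷ p) (suc n) d with reverse p n (degree (lead≉0 d) (Deg<-tail (bound d)))
  ... | r , T∤r , e = const a * T ^ suc n + r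
      , (λ h → T∤r (∣-cong (solve 2 (λ x y → x :+ y :- x := y) (const a * T ^ suc n) r) (∣-+ h (∣-neg (∣-*ˡ (const a) (∣-*ʳ (T ^ n) ∣-refl))))))
      , (begin
        (⟨ a ⟩ L.+ τ L.* E.to p) L.* ⌜ T ^ suc n ⌝ ≈⟨ L.distribʳ _ _ _ ⟩
        ⟨ a ⟩ L.* ⌜ T ^ suc n ⌝ L.+ τ L.* E.to p L.* ⌜ T ^ suc n ⌝ ≈⟨ L.+-cong (L.sym (ι.to-* (const a) (T ^ suc n))) (L.*-congˡ (ι.to-* T (T ^ n))) ⟩
        ⌜ const a * T ^ suc n ⌝ L.+ τ L.* E.to p L.* (⌜ T ⌝ L.* ⌜ T ^ n ⌝) ≈⟨ L.+-congˡ (solveᶠ 4 (λ s e t u → s :* e :* (t :* u) := s :* t :* (e :* u)) τ (E.to p) ⌜ T ⌝ ⌜ T ^ n ⌝) ⟩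
        ⌜ const a * T ^ suc n ⌝ L.+ τ L.* ⌜ T ⌝ L.* (E.to p L.* ⌜ T ^ n ⌝) ≈⟨ L.+-congˡ (L.trans (L.*-cong τT e) (L.*-identityˡ _)) ⟩
        ⌜ const a * T ^ suc n ⌝ L.+ ⌜ r ⌝ ≈⟨ ι.to-+ (const a * T ^ suc n) r ⟨
        ⌜ const a * T ^ suc n + r ⌝ ∎)
    where open import Relation.Binary.Reasoning.Setoid L.setoid

  E≉0 : ∀ {p} → ¬ (p ≈ 0#) → ¬ (E.to p L.≈ L.0#)
  E≉0 {p} p≉0 z with ≉0⇒Degree p≉0
  ... | n , d with reverse p n d
  ...   | r , T∤r , e = T∤r (0# , trans (⌜⌝-injective (L.trans (L.sym e) (L.trans (L.*-congʳ z) (L.zeroˡ _)))) (sym (zeroʳ T)))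

  -- The automorphism t ↦ 1/t of the rational function field.
  opaque
    σ : Frac → Frac
    σ x = proj₁ (Lₗ.divide (E.to (num x)) (E.to (den x)) (E≉0 (den≉0 x)))

    σ-den : ∀ x → σ x L.* E.to (den x) L.≈ E.to (num x)
    σ-den x = proj₂ (Lₗ.divide (E.to (num x)) (E.to (den x)) (E≉0 (den≉0 x)))

  σ-unique : ∀ x y → y L.* E.to (den x) L.≈ E.to (num x) → σ x L.≈ y
  σ-unique x y e = Lₗ.cancelˡ (E≉0 (den≉0 x)) (L.trans (L.*-comm _ _) (L.trans (σ-den x) (L.trans (L.sym e) (L.*-comm _ _))))

  open import Relation.Binary.Reasoning.Setoid L.setoid

  σ-cong : ∀ {x y} → x L.≈ y → σ x L.≈ σ y
  σ-cong {x} {y} (cross e) = σ-unique x (σ y) (Lₗ.cancelˡ (E≉0 (den≉0 y)) (begin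
    E.to (den y) L.* (σ y L.* E.to (den x)) ≈⟨ solveᶠ 3 (λ d s e → d :* (s :* e) := s :* d :* e) (E.to (den y)) (σ y) (E.to (den x)) ⟩
    σ y L.* E.to (den y) L.* E.to (den x) ≈⟨ L.*-congʳ (σ-den y) ⟩
    E.to (num y) L.* E.to (den x) ≈⟨ E.to-* (num y) (den x) ⟨
    E.to (num y * den x) ≈⟨ E.to-cong e ⟨
    E.to (num x * den y) ≈⟨ L.trans (E.to-* (num x) (den y)) (L.*-comm _ _) ⟩
    E.to (den y) L.* E.to (num x) ∎))

  σ-+ : ∀ x y → σ (x L.+ y) L.≈ σ x L.+ σ y
  σ-+ x y = σ-unique (x L.+ y) (σ x L.+ σ y) (begin
    (σ x L.+ σ y) L.* E.to (den (x L.+ y)) ≈⟨ L.*-congˡ (L.trans (L.reflexive (cong E.to (den-+ x y))) (E.to-* (den x) (den y))) ⟩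
    (σ x L.+ σ y) L.* (E.to (den x) L.* E.to (den y)) ≈⟨ solveᶠ 4 (λ s t a b → (s :+ t) :* (a :* b) := s :* a :* b :+ t :* b :* a) (σ x) (σ y) (E.to (den x)) (E.to (den y)) ⟩
    σ x L.* E.to (den x) L.* E.to (den y) L.+ σ y L.* E.to (den y) L.* E.to (den x) ≈⟨ L.+-cong (L.*-congʳ (σ-den x)) (L.*-congʳ (σ-den y)) ⟩
    E.to (num x) L.* E.to (den y) L.+ E.to (num y) L.* E.to (den x) ≈⟨ L.trans (E.to-+ (num x * den y) (num y * den x)) (L.+-cong (E.to-* (num x) (den y)) (E.to-* (num y) (den x))) ⟨
    E.to (num x * den y + num y * den x) ≡⟨ cong E.to (num-+ x y) ⟨
    E.to (num (x L.+ y)) ∎)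

  σ-* : ∀ x y → σ (x L.* y) L.≈ σ x L.* σ y
  σ-* x y = σ-unique (x L.* y) (σ x L.* σ y) (begin
    σ x L.* σ y L.* E.to (den (x L.* y)) ≈⟨ L.*-congˡ (L.trans (L.reflexive (cong E.to (den-* x y))) (E.to-* (den x) (den y))) ⟩
    σ x L.* σ y L.* (E.to (den x) L.* E.to (den y)) ≈⟨ solveᶠ 4 (λ s t a b → s :* t :* (a :* b) := s :* a :* (t :* b)) (σ x) (σ y) (E.to (den x)) (E.to (den y)) ⟩
    σ x L.* E.to (den x) L.* (σ y L.* E.to (den y)) ≈⟨ L.*-cong (σ-den x) (σ-den y) ⟩
    E.to (num x) L.* E.to (num y) ≈⟨ E.to-* (num x) (num y) ⟨
    E.to (num x * num y) ≡⟨ cong E.to (num-* x y) ⟨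
    E.to (num (x L.* y)) ∎)

  σ-⌜⌝ : ∀ p → σ ⌜ p ⌝ L.≈ E.to p
  σ-⌜⌝ p = σ-unique ⌜ p ⌝ (E.to p) (L.trans (L.*-congˡ E.to-1) (L.*-identityʳ _))

  σHom : RingHom L.commRing L.commRing
  σHom = record { to = σ ; to-cong = σ-cong ; to-+ = σ-+ ; to-* = σ-* ; to-1 = L.trans (σ-⌜⌝ 1#) E.to-1 }

  private
    σ-τ : σ τ L.≈ ⌜ X ⌝
    σ-τ = σ-unique τ ⌜ X ⌝ (begin
      ⌜ X ⌝ L.* E.to T ≈⟨ L.*-cong (ι.to-cong (sym T≈X)) (L.trans (E.to-cong T≈X) (Ev.ev-X τ)) ⟩
      ⌜ T ⌝ L.* τ ≈⟨ L.trans (L.*-comm _ _) τT ⟩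
      L.1# ≈⟨ E.to-1 ⟨
      E.to 1# ∎)

    σ-E : ∀ p → σ (E.to p) L.≈ ⌜ p ⌝
    σ-E [] = RingHom.to-0 σHom
    σ-E (a ∷ p) = begin
      σ (⟨ a ⟩ L.+ τ L.* E.to p) ≈⟨ L.trans (σ-+ _ _) (L.+-congˡ (σ-* _ _)) ⟩
      σ ⟨ a ⟩ L.+ σ τ L.* σ (E.to p) ≈⟨ L.+-cong (L.trans (σ-⌜⌝ (const a)) (Ev.ev-const τ a)) (L.*-cong σ-τ (σ-E p)) ⟩
      ⟨ a ⟩ L.+ ⌜ X ⌝ L.* ⌜ p ⌝ ≈⟨ L.trans (ι.to-+ (const a) (X * p)) (L.+-congˡ (ι.to-* X p)) ⟨
      ⌜ const a + X * p ⌝ ≈⟨ ι.to-cong (∷-split a p) ⟨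
      ⌜ a ∷ p ⌝ ∎

  -- Substituting twice exchanges 1/t and t and fixes constants, so it is the identity on
  -- polynomials, hence on fractions.
  σ-involutive : ∀ x → σ (σ x) L.≈ x
  σ-involutive x = Lₗ.cancelˡ {⌜ den x ⌝} (λ z → den≉0 x (⌜⌝-injective z)) (begin
    ⌜ den x ⌝ L.* σ (σ x) ≈⟨ L.trans (L.*-comm _ _) (L.*-congˡ (L.sym (σ-E (den x)))) ⟩
    σ (σ x) L.* σ (E.to (den x)) ≈⟨ σ-* _ _ ⟨
    σ (σ x L.* E.to (den x)) ≈⟨ L.trans (σ-cong (σ-den x)) (σ-E (num x)) ⟩
    ⌜ num x ⌝ ≈⟨ L.trans (L.*-comm _ _) (clear x) ⟨
    ⌜ den x ⌝ L.* x ∎)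

  σ-injective : ∀ {x y} → σ x L.≈ σ y → x L.≈ y
  σ-injective {x} {y} e = L.trans (L.sym (σ-involutive x)) (L.trans (σ-cong e) (σ-involutive y))

  private
    σ-reversed : ∀ α {a b} → num α * b ≈ a * den α → σ α L.* E.to b L.≈ E.to a
    σ-reversed α {a} {b} e = begin
      σ α L.* E.to b ≈⟨ L.*-congˡ (σ-⌜⌝ b) ⟨
      σ α L.* σ ⌜ b ⌝ ≈⟨ σ-* α ⌜ b ⌝ ⟨
      σ (α L.* ⌜ b ⌝) ≈⟨ L.trans (σ-cong (*⌜⌝-cross α a b e)) (σ-⌜⌝ a) ⟩
      E.to a ∎

    T^+ : ∀ m n → ⌜ T ^ (m ℕ.+ n) ⌝ L.≈ ⌜ T ^ m ⌝ L.* ⌜ T ^ n ⌝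
    T^+ m n = L.trans (ι.to-cong (^-homo-* T m n)) (ι.to-* (T ^ m) (T ^ n))

  -- By `reverse`, a(1/t) / b(1/t) is t^(j - i) times a quotient of polynomials prime to t, so the
  -- degree valuation of α becomes the T-adic valuation of σ α.
  nonNeg⇒integral∞ : ∀ α {a b i j} → Degree a i → Degree b j → num α * b ≈ a * den α → i ≤ j → Integral T (σ α)
  nonNeg⇒integral∞ α {a} {b} {i} {j} da db e i≤j = go (reverse a i da) (reverse b j db)
    where
    d : ℕ
    d = j ℕ.∸ i
    go : (∃ λ r → ¬ (T ∣ r) × E.to a L.* ⌜ T ^ i ⌝ L.≈ ⌜ r ⌝) → (∃ λ r → ¬ (T ∣ r) × E.to b L.* ⌜ T ^ j ⌝ L.≈ ⌜ r ⌝) → Integral T (σ α)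
    go (r , _ , er) (s , T∤s , es) = r * T ^ d , s , T∤s , (begin
      σ α L.* ⌜ s ⌝ ≈⟨ L.*-congˡ es ⟨
      σ α L.* (E.to b L.* ⌜ T ^ j ⌝) ≈⟨ L.trans (L.sym (L.*-assoc _ _ _)) (L.*-cong (σ-reversed α e) (L.trans (L.reflexive (cong (λ n → ⌜ T ^ n ⌝) (≡.sym (m+[n∸m]≡n i≤j)))) (T^+ i d))) ⟩
      E.to a L.* (⌜ T ^ i ⌝ L.* ⌜ T ^ d ⌝) ≈⟨ L.trans (L.sym (L.*-assoc _ _ _)) (L.*-congʳ er) ⟩
      ⌜ r ⌝ L.* ⌜ T ^ d ⌝ ≈⟨ ι.to-* r (T ^ d) ⟨
      ⌜ r * T ^ d ⌝ ∎)

  -- If the numerator had degree larger by d + 1, then T^(d + 1) would divide the product r g,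
  -- although T divides neither the reversed numerator r nor the denominator g.
  integral∞⇒nonNeg : ∀ α → Integral T (σ α) → num α ≈ 0# ⊎ ∃₂ λ i j → Degree (num α) i × Degree (den α) j × i ≤ j
  integral∞⇒nonNeg α (f , g , T∤g , e) = go (degree? (num α)) (≉0⇒Degree (den≉0 α))
    where
    go : num α ≈ 0# ⊎ ∃ (Degree (num α)) → ∃ (Degree (den α)) → num α ≈ 0# ⊎ ∃₂ λ i j → Degree (num α) i × Degree (den α) j × i ≤ j
    go (inj₁ z) _ = inj₁ z
    go (inj₂ (i , da)) (j , db) with i ℕₚ.≤? j
    ... | yes l = inj₂ (i , j , da , db , l)
    ... | no l = ⊥-elim (contradiction (reverse (num α) i da) (reverse (den α) j db))
      where
      d : ℕ
      d = i ℕ.∸ suc j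
      i≡ : i ≡ j ℕ.+ suc d
      i≡ = ≡.trans (≡.sym (m+[n∸m]≡n (≰⇒> l))) (≡.sym (+-suc j d))
      contradiction : (∃ λ r → ¬ (T ∣ r) × E.to (num α) L.* ⌜ T ^ i ⌝ L.≈ ⌜ r ⌝) → (∃ λ r → ¬ (T ∣ r) × E.to (den α) L.* ⌜ T ^ j ⌝ L.≈ ⌜ r ⌝) → ⊥
      contradiction (r , T∤r , er) (s , _ , es) = Prime-∤* T-prime T∤r T∤g (∣-cong (⌜⌝-injective (begin
        ⌜ T ^ suc d * (f * s) ⌝ ≈⟨ L.trans (ι.to-* _ _) (L.*-congˡ (L.trans (ι.to-* f s) (L.*-cong (L.sym e) (L.sym es)))) ⟩
        ⌜ T ^ suc d ⌝ L.* (σ α L.* ⌜ g ⌝ L.* (E.to (den α) L.* ⌜ T ^ j ⌝)) ≈⟨ solveᶠ 5 (λ u s g b v → u :* (s :* g :* (b :* v)) := s :* b :* (v :* u) :* g) ⌜ T ^ suc d ⌝ (σ α) ⌜ g ⌝ (E.to (den α)) ⌜ T ^ j ⌝ ⟩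
        σ α L.* E.to (den α) L.* (⌜ T ^ j ⌝ L.* ⌜ T ^ suc d ⌝) L.* ⌜ g ⌝ ≈⟨ L.*-congʳ (L.*-cong (σ-den α) (L.trans (L.sym (T^+ j (suc d))) (L.reflexive (cong (λ n → ⌜ T ^ n ⌝) (≡.sym i≡))))) ⟩
        E.to (num α) L.* ⌜ T ^ i ⌝ L.* ⌜ g ⌝ ≈⟨ L.trans (L.*-congʳ er) (L.sym (ι.to-* r g)) ⟩
        ⌜ r * g ⌝ ∎)) (∣-*ʳ (f * s) (∣-*ʳ (T ^ d) ∣-refl)))

-- From integrality to the stated valuations.

module NonNegativity {S : Set} (D : Ultrafilter S) (q : S → ℕ) (F : ∀ s → FiniteField (q s))
                     (unbounded : ∀ m → Ultrafilter.U D (λ s → m < q s)) where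
  open ℤ using (+_)
  private module 𝒮 = Setting D q F
  open 𝒮 using (𝕂; Term; QFFormula; var; par; _⊕_; _⊗_; ⊖_; _≐_; _∧ᶠ_; _∨ᶠ_; fin; ∞; NonNegVal; DiophantineWith)
  open UltraField D q F
  open FormulaSemantics D q F
  open IntegralityFormulas D q F unbounded
  open Fractions kField
  open LocalIntegrality kField
  open ConstantFractions kField
  open Powers k.polyRing
  open FiniteValuation kField
  open InfiniteValuation kField

  private
    *≈ : ∀ {a b c d} → a 𝒮.*ₚ b 𝒮.≈ₚ c 𝒮.*ₚ d → a k.* b k.≈ c k.* d
    *≈ {a} {b} {c} {d} e = subst₂ k._≈_ (*≡ a b) (*≡ c d) (≈ₚ⇒≈ e)

    ≈* : ∀ {a b c d} → a k.* b k.≈ c k.* d → a 𝒮.*ₚ b 𝒮.≈ₚ c 𝒮.*ₚ d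
    ≈* {a} {b} {c} {d} e = ≈⇒≈ₚ (subst₂ k._≈_ (≡.sym (*≡ a b)) (≡.sym (*≡ c d)) e)

    ^≡ : ∀ p n → p 𝒮.^ₚ n ≡ p ^ n
    ^≡ p zero = ≡.refl
    ^≡ p (suc n) = ≡.trans (*≡ p (p 𝒮.^ₚ n)) (cong (p k.*_) (^≡ p n))

    ^*≡ : ∀ p n a → (p 𝒮.^ₚ n) 𝒮.*ₚ a ≡ p ^ n k.* a
    ^*≡ p n a = ≡.trans (*≡ (p 𝒮.^ₚ n) a) (cong (k._* a) (^≡ p n))

    ∣⇒∣ₚ : ∀ {p a} → p k.∣ a → p 𝒮.∣ₚ a
    ∣⇒∣ₚ {p} {a} (c , e) = c , ≈⇒≈ₚ (k.trans (k.reflexive (*≡ p c)) (k.sym e))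

    ∣ₚ⇒∣ : ∀ {p a} → p 𝒮.∣ₚ a → p k.∣ a
    ∣ₚ⇒∣ {p} {a} (c , e) = c , k.trans (k.sym (≈ₚ⇒≈ e)) (k.reflexive (*≡ p c))

    degree⇒ : ∀ {p n} → 𝒮.HasDegree p n → k.Degree p n
    degree⇒ {p} {n} (l , b) = k.degree (λ e → l (subst (_≈ 0ᴳ) (≡.sym (coeff≡ p n)) e)) (k.deg< λ i h → subst (_≈ 0ᴳ) (coeff≡ p i) (b i h))

    degree⇐ : ∀ {p n} → k.Degree p n → 𝒮.HasDegree p n
    degree⇐ {p} {n} d = (λ e → k.lead≉0 d (subst (_≈ 0ᴳ) (coeff≡ p n) e)) , λ i h → subst (_≈ 0ᴳ) (≡.sym (coeff≡ p i)) (k.vanish (k.bound d) i h)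

    nonzeroDegree : ∀ {P n} → ¬ 𝒮.HasDegree P 0 → 𝒮.HasDegree P n → ∃ λ m → n ≡ suc m
    nonzeroDegree {n = zero} h d = ⊥-elim (h d)
    nonzeroDegree {n = suc m} h d = m , ≡.refl

    -- Units have degree zero, so the other factor b would carry the full degree of P.
    unit-degree : ∀ {a b P n} → k.Degree P n → k.Deg< n b → P k.≈ a k.* b → 𝒮.IsUnit a → ⊥
    unit-degree {a} {b} {P} {n} dP db e (r , h) = go (k.≉0⇒Degree {b} b≉0) (k.≉0⇒Degree {a} a≉0) (k.≉0⇒Degree {r} r≉0)
      where
      ar : a k.* r k.≈ k.1#
      ar = k.trans (k.reflexive (≡.sym (*≡ a r))) (≈ₚ⇒≈ h)
      b≉0 : ¬ (b k.≈ k.0#)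
      b≉0 z = k.Degree⇒≉0 dP (k.trans e (k.trans (k.*-congˡ z) (k.zeroʳ a)))
      a≉0 : ¬ (a k.≈ k.0#)
      a≉0 z = k.Degree⇒≉0 dP (k.trans e (k.trans (k.*-congʳ z) (k.zeroˡ b)))
      r≉0 : ¬ (r k.≈ k.0#)
      r≉0 z = k.1≉0ₚ (k.trans (k.sym ar) (k.trans (k.*-congˡ z) (k.zeroʳ a)))
      go : ∃ (k.Degree b) → ∃ (k.Degree a) → ∃ (k.Degree r) → ⊥
      go (i , di) (j , dj) (l , dl) with k.Degree-Deg< (k.Degree-cong ar (k.Degree-* dj dl)) (k.Deg<-cong k.const-1 (k.Deg<-const 1ᴳ))
      go (i , di) (zero , dj) (l , dl) | _ = <-irrefl (k.Degree-unique (k.Degree-cong (k.sym e) (k.Degree-* dj di)) dP) (k.Degree-Deg< di db)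
      go (i , di) (suc j , dj) (l , dl) | s≤s ()

    irreducible⇒prime : ∀ {P n} → k.Degree P (suc n) → 𝒮.Irreducible P → k.Prime P
    irreducible⇒prime {P} {n} dP (_ , _ , irr) = k.NoFactor⇒Prime dP λ a b da db e → factor a b da db e (irr a b (≈⇒≈ₚ (k.trans e (k.reflexive (≡.sym (*≡ a b))))))
      where
      factor : ∀ a b → k.Deg< (suc n) a → k.Deg< (suc n) b → P k.≈ a k.* b → 𝒮.IsUnit a ⊎ 𝒮.IsUnit b → ⊥
      factor a b da db e (inj₁ u) = unit-degree dP db e u
      factor a b da db e (inj₂ u) = unit-degree dP da (k.trans e (k.*-comm a b)) u

    zero⇒ : ∀ α → (𝕂.num α 𝒮.*ₚ 𝒮.1ₚ) 𝒮.≈ₚ (𝒮.0ₚ 𝒮.*ₚ 𝕂.den α) → 𝕂.num α k.≈ k.0#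
    zero⇒ α e = k.trans (k.sym (k.*-identityʳ _)) (k.trans (*≈ {𝕂.num α} {𝒮.1ₚ} {𝒮.0ₚ} e) (k.zeroˡ (𝕂.den α)))

    zero⇐ : ∀ α → 𝕂.num α k.≈ k.0# → (𝕂.num α 𝒮.*ₚ 𝒮.1ₚ) 𝒮.≈ₚ (𝒮.0ₚ 𝒮.*ₚ 𝕂.den α)
    zero⇐ α e = ≈* {𝕂.num α} {𝒮.1ₚ} {𝒮.0ₚ} (k.trans (k.*-identityʳ _) (k.trans e (k.sym (k.zeroˡ (𝕂.den α)))))

    0≤+i-+j⇒j≤i : ∀ {n i j} → n ≡ + i ℤ.- + j → + 0 ℤ.≤ n → j ≤ i
    0≤+i-+j⇒j≤i e h = ℤₚ.drop‿+≤+ (ℤₚ.0≤i-j⇒j≤i (subst (+ 0 ℤ.≤_) e h))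

  finDiophantine : ∀ P P∈ℙ → DiophantineWith 9 (NonNegVal (fin P P∈ℙ))
  finDiophantine P P∈ℙ@((n , dP , monic) , irr , nonconst) = go (nonzeroDegree {P} nonconst dP)
    where
    go : (∃ λ m → n ≡ suc m) → DiophantineWith 9 (NonNegVal (fin P P∈ℙ))
    go (m , ≡.refl) = definable⇒diophantine (NonNegVal (fin P P∈ℙ)) (integralDefinable (degree⇒ dP) (subst (_≈ 1ᴳ) (coeff≡ P n) monic) π) there back
      where
      π : k.Prime P
      π = irreducible⇒prime (degree⇒ dP) irr
      there : ∀ α → NonNegVal (fin P P∈ℙ) α → Integral P (toFrac α)
      there α (inj₁ z) = k.0# , k.1# , k.Prime-∤1 π , *⌜⌝-cross (toFrac α) k.0# k.1# (k.trans (k.*-identityʳ _) (k.trans (zero⇒ α z) (k.sym (k.zeroˡ _))))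
      there α (inj₂ (v , (a , b , i , j , P∤a , P∤b , e , v≡) , 0≤v)) = nonNeg⇒integral π (toFrac α) a b i j (λ d → P∤b (∣⇒∣ₚ d)) (0≤+i-+j⇒j≤i v≡ 0≤v)
        (subst₂ (λ x y → 𝕂.num α k.* x k.≈ y k.* 𝕂.den α) (^*≡ P j b) (^*≡ P i a) (*≈ {𝕂.num α} {_} {_} e))
      back : ∀ α → Integral P (toFrac α) → NonNegVal (fin P P∈ℙ) α
      back α int with integral⇒nonNeg π (toFrac α) int
      ... | inj₁ z = inj₁ (zero⇐ α z)
      ... | inj₂ (i , a , b , P∤a , P∤b , e) = inj₂ (+ i ℤ.- + 0 , (a , b , i , 0 , (λ d → P∤a (∣ₚ⇒∣ d)) , (λ d → P∤b (∣ₚ⇒∣ d))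
            , ≈* {𝕂.num α} (subst₂ (λ x y → 𝕂.num α k.* x k.≈ y k.* 𝕂.den α) (≡.sym (^*≡ P 0 b)) (≡.sym (^*≡ P i a)) (k.trans (k.*-congˡ (k.*-identityˡ b)) e)) , ≡.refl)
            , ℤₚ.i≤j⇒0≤j-i (ℤ.+≤+ z≤n))

  private
    -- Only the parameters are moved; the variables are moved by applying σ to the environment.
    twistTerm : ∀ {n} → Term n → Term n
    twistTerm (var i) = var i
    twistTerm (par c) = par (fromFrac (σ (toFrac c)))
    twistTerm (t ⊕ u) = twistTerm t ⊕ twistTerm u
    twistTerm (t ⊗ u) = twistTerm t ⊗ twistTerm u
    twistTerm (⊖ t) = ⊖ twistTerm t

    twist : ∀ {n} → QFFormula n → QFFormula n
    twist (t ≐ u) = twistTerm t ≐ twistTerm u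
    twist (φ ∧ᶠ ψ) = twist φ ∧ᶠ twist ψ
    twist (φ ∨ᶠ ψ) = twist φ ∨ᶠ twist ψ

    module _ {n} (ρ ρ′ : Vec Frac n) (related : ∀ i → σ (lookup ρ i) L.≈ lookup ρ′ i) where

      σ-term : ∀ t → σ (⟦ twistTerm t ⟧ ρ) L.≈ ⟦ t ⟧ ρ′
      σ-term (var i) = related i
      σ-term (par c) = σ-involutive (toFrac c)
      σ-term (t ⊕ u) = L.trans (σ-+ _ _) (L.+-cong (σ-term t) (σ-term u))
      σ-term (t ⊗ u) = L.trans (σ-* _ _) (L.*-cong (σ-term t) (σ-term u))
      σ-term (⊖ t) = L.trans (RingHom.to-neg σHom _) (L.-‿cong (σ-term t))

      untwist : ∀ φ → Holds (twist φ) ρ → Holds φ ρ′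
      untwist (t ≐ u) h = L.trans (L.sym (σ-term t)) (L.trans (σ-cong h) (σ-term u))
      untwist (φ ∧ᶠ ψ) (h , l) = untwist φ h , untwist ψ l
      untwist (φ ∨ᶠ ψ) (inj₁ h) = inj₁ (untwist φ h)
      untwist (φ ∨ᶠ ψ) (inj₂ h) = inj₂ (untwist ψ h)

      retwist : ∀ φ → Holds φ ρ′ → Holds (twist φ) ρ
      retwist (t ≐ u) h = σ-injective (L.trans (σ-term t) (L.trans h (L.sym (σ-term u))))
      retwist (φ ∧ᶠ ψ) (h , l) = retwist φ h , retwist ψ l
      retwist (φ ∨ᶠ ψ) (inj₁ h) = inj₁ (retwist φ h)
      retwist (φ ∨ᶠ ψ) (inj₂ h) = inj₂ (retwist ψ h)

  -- A field automorphism preserves truth if parameters and values move together. As σ is its own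
  -- inverse, the same twist serves both directions and the number of quantifiers stays the same.
  σ-definable : ∀ {n X} → Definable n X → Definable n (λ α → X (σ α))
  σ-definable {n} {X} d = record
    { formula = twist formula
    ; sound = λ α ys h → sound (σ α) (Vec.map σ ys) (untwist (α ∷ ys) (σ α ∷ Vec.map σ ys) (λ { zero → L.refl ; (suc i) → L.reflexive (≡.sym (Vecₚ.lookup-map i σ ys)) }) formula h)
    ; complete = λ α x → witness α (complete (σ α) x) }
    where
    open Definable d
    witness : ∀ α → (Σ (Vec Frac n) λ ys → Holds formula (σ α ∷ ys)) → Σ (Vec Frac n) λ ys → Holds (twist formula) (α ∷ ys)
    witness α (ys , h) = Vec.map σ ys , retwist (α ∷ Vec.map σ ys) (σ α ∷ ys) (λ { zero → L.refl ; (suc i) → L.trans (σ-cong (L.reflexive (Vecₚ.lookup-map i σ ys))) (σ-involutive _) }) formula h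

  ∞Diophantine : DiophantineWith 9 (NonNegVal ∞)
  ∞Diophantine = definable⇒diophantine (NonNegVal ∞) (σ-definable (integralDefinable (k.Degree-t- 0ᴳ) (k.K.trans (k.at T≈X 1) (k.at k.X-∷ 1)) T-prime)) there back
    where
    there : ∀ α → NonNegVal ∞ α → Integral T (σ (toFrac α))
    there α (inj₁ z) = k.0# , k.1# , k.Prime-∤1 T-prime , L.trans (L.*-identityʳ _) (L.trans (σ-cong (≈0⇒≈ᶠ0 (zero⇒ α z))) (RingHom.to-0 σHom))
    there α (inj₂ (v , (a , b , i , j , da , db , e , v≡) , 0≤v)) = nonNeg⇒integral∞ (toFrac α) {a} {b} (degree⇒ da) (degree⇒ db) (*≈ {𝕂.num α} {b} {a} e) (0≤+i-+j⇒j≤i v≡ 0≤v)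
    back : ∀ α → Integral T (σ (toFrac α)) → NonNegVal ∞ α
    back α int with integral∞⇒nonNeg (toFrac α) int
    ... | inj₁ z = inj₁ (zero⇐ α z)
    ... | inj₂ (i , j , da , db , l) = inj₂ (+ j ℤ.- + i , (𝕂.num α , 𝕂.den α , i , j , degree⇐ da , degree⇐ db , ≈* {𝕂.num α} {𝕂.den α} k.refl , ≡.refl) , ℤₚ.i≤j⇒0≤j-i (ℤ.+≤+ l))

theorem4p27 : {S : Set} → Infinite S → (D : Ultrafilter S) → NonPrincipal D
    → (q : S → ℕ) → (∀ s → IsPrimePower (q s))
    → (∀ (m : ℕ) → Ultrafilter.U D (λ s → m < q s))
    → (F : ∀ s → FiniteField (q s))
    → (P : Setting.Place D q F)
    → Setting.DiophantineWith D q F 9 (Setting.NonNegVal D q F P)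
theorem4p27 _ D _ q _ unbounded F (Setting.fin P P∈ℙ) = NonNegativity.finDiophantine D q F unbounded P P∈ℙ
theorem4p27 _ D _ q _ unbounded F Setting.∞ = NonNegativity.∞Diophantine D q F unbounded
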